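{- Let $q\in\mathbb{N}$ be odd and square-free, and let $\varepsilon>0$ be given. Then \[B_3^*(q)\ll_{\varepsilon} q^{5/8+\varepsilon},\] where the implied constant depends only on $\varepsilon$.
   Context: For an integral quadratic form $Q$ in $n$ variables and $q\in\mathbb{N}$, let $m(Q;q):=\min\{\|\mathbf{x}\|:\mathbf{x}\in\mathbb{Z}^n\setminus\{\mathbf{0}\},\ Q(\mathbf{x})\equiv 0 \pmod q\}$, where $\|\cdot\|$ is the Euclidean norm. For odd square-free $q$, $B_3^*(q):=\max_Q m(Q;q)$, the maximum taken over all integral ternary quadratic forms $Q$ with $(\det(Q),q)=1$. Here $\det(Q)$ is the determinant of the symmetric matrix $M$ of $Q$ (entries in $\tfrac12\mathbb{Z}$); since $q$ is odd, $(\det(Q),q)=1$ means $\gcd(\det(2M),q)=1$. -}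

module Defs where

open import Data.Nat as ℕ using (ℕ; _≤_)
open import Data.Nat.Divisibility using (_∣_)
open import Data.Nat.GCD using (gcd)
open import Data.Integer as ℤ using (ℤ; +_; ∣_∣)
open import Data.Product using (_×_; Σ)
open import Relation.Binary.PropositionalEquality using (_≡_)
open import Relation.Nullary using (¬_)

SquareFree : ℕ → Set
SquareFree q = ∀ p → p ℕ.* p ∣ q → p ≡ 1

Odd : ℕ → Set
Odd q = ¬ (2 ∣ q)

-- Integral ternary quadratic form
--   Q(x,y,z) = a x² + b y² + c z² + d xy + e xz + f yz ,  a..f ∈ ℤ
-- (symmetric matrix M has diagonal a,b,c and off-diagonal d/2, e/2, f/2).
record TernaryForm : Set where
  constructor form
  field
    a b c d e f : ℤ

open TernaryForm public

record Pt : Set where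
  constructor pt
  field
    x y z : ℤ

open Pt public

eval : TernaryForm → Pt → ℤ
eval Q v =
  a Q ℤ.* x v ℤ.* x v ℤ.+ b Q ℤ.* y v ℤ.* y v ℤ.+ c Q ℤ.* z v ℤ.* z v
  ℤ.+ d Q ℤ.* x v ℤ.* y v ℤ.+ e Q ℤ.* x v ℤ.* z v ℤ.+ f Q ℤ.* y v ℤ.* z v

-- det(2M) for 2M = [[2a,d,e],[d,2b,f],[e,f,2c]]
det2M : TernaryForm → ℤ
det2M Q =
  (+ 8) ℤ.* a Q ℤ.* b Q ℤ.* c Q ℤ.+ (+ 2) ℤ.* d Q ℤ.* e Q ℤ.* f Q
  ℤ.- (+ 2) ℤ.* a Q ℤ.* f Q ℤ.* f Q
  ℤ.- (+ 2) ℤ.* b Q ℤ.* e Q ℤ.* e Q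
  ℤ.- (+ 2) ℤ.* c Q ℤ.* d Q ℤ.* d Q

normSq : Pt → ℕ
normSq v = ∣ x v ∣ ℕ.* ∣ x v ∣ ℕ.+ ∣ y v ∣ ℕ.* ∣ y v ∣ ℕ.+ ∣ z v ∣ ℕ.* ∣ z v ∣

NonZeroPt : Pt → Set
NonZeroPt v = ¬ (x v ≡ + 0 × y v ≡ + 0 × z v ≡ + 0)

ZeroMod : TernaryForm → ℕ → Pt → Set
ZeroMod Q q v = q ∣ ∣ eval Q v ∣

-- "‖v‖ ≤ C · q^(5/8 + a/b)" with a, b ≥ 1, C ∈ ℕ, written without roots:
-- raising both sides to the power 8b gives
--   (‖v‖²)^(4b) ≤ C^(8b) · q^(5b + 8a).
NormBound : ℕ → ℕ → ℕ → ℕ → Pt → Set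
NormBound εn εd C q v =
  normSq v ℕ.^ (4 ℕ.* εd) ≤ C ℕ.^ (8 ℕ.* εd) ℕ.* q ℕ.^ (5 ℕ.* εd ℕ.+ 8 ℕ.* εn)

-- m(Q;q) ≤ C q^(5/8+ε)  (ε = εn/εd): some nonzero solution of Q(v) ≡ 0 mod q
-- has norm at most the bound (equivalent to the minimum being ≤ the bound).
MinBound : TernaryForm → ℕ → ℕ → ℕ → ℕ → Set
MinBound Q q εn εd C =
  Σ Pt (λ v → NonZeroPt v × ZeroMod Q q v × NormBound εn εd C q v)

-- For a nonzero integral vector (x , y) the form Q restricted to the plane spanned by (y , − x , 0) and (0 , 0 , 1) has
-- discriminant D(x , y), a binary form which is nondegenerate modulo the primes of q not dividing c. If D(x , y) is a square modulo
-- every prime of q, the restriction splits modulo q, and the pigeonhole principle gives a zero of norm about √(q L), L bounding x and y.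
-- A suitable (x , y) with L = q^(1/4 + o(1)) exists by Burgess's method for the characters χ_d(D(x , y)), d ∣ q: shift by u + t b with b
-- primitive, note that χ_d(D(l + t b)) depends on t only through the class of (l , b) modulo d, and apply Hölder's inequality. Pairs in
-- one class are counted by a lattice-point argument; the moments over classes are bounded by Stepanov's method over 𝔽_p and 𝔽_p².
module Submission where

open import Defs hiding (a; b; c; d; e; f; x; y; z)
open import Algebra.Structures using (IsCommutativeMonoid; IsCommutativeSemiring; IsCommutativeRing)
open import Algebra.Bundles using (CommutativeRing)
open import Data.Bool.Base using (Bool; true; false)
open import Data.Empty using (⊥; ⊥-elim)
open import Data.Unit.Base using (⊤; tt)
open import Data.Fin.Base as Fin using (Fin; toℕ; fromℕ<)
import Data.Fin.Properties as Finₚ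
open import Data.Integer as ℤ using (ℤ; +_; -[1+_]; ∣_∣; 0ℤ; 1ℤ)
import Data.Integer.Properties as ℤₚ
import Data.Integer.DivMod as ℤDM
import Data.Integer.Tactic.RingSolver as ℤR
open import Data.List.Base using (List; []; _∷_; _++_; map; length; filter; upTo; allFin; replicate) renaming (cartesianProduct to cart; cartesianProductWith to cartWith)
open import Data.Nat.ListAction using (product)
import Data.List.Properties as Listₚ
open import Data.List.Membership.Propositional using (_∈_; _∉_; find; lose)
import Data.List.Membership.Propositional.Properties as ∈ₚ
open import Data.List.Relation.Unary.All as All using (All; []; _∷_)
import Data.List.Relation.Unary.All.Properties as Allₚ
open import Data.List.Relation.Unary.Any as Any using (Any; here; there)
open import Data.List.Relation.Unary.AllPairs using ([]; _∷_)
open import Data.List.Relation.Unary.Unique.Propositional using (Unique)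
import Data.List.Relation.Unary.Unique.Propositional.Properties as Uniqueₚ
open import Data.List.Relation.Binary.Permutation.Propositional as ↭ using (_↭_)
import Data.List.Relation.Binary.Permutation.Propositional.Properties as ↭ₚ
open import Data.List.Membership.Propositional.Properties.WithK using (unique∧set⇒bag)
open import Data.List.Relation.Binary.BagAndSetEquality using (∼bag⇒↭)
open import Data.Maybe.Base using (Maybe; just; nothing)
import Data.Maybe.Properties as Maybeₚ
open import Data.Nat.Base
open import Data.Nat.Properties as ℕₚ hiding (_≟_; _<?_; _≤?_) renaming (≤-reflexive to ≡⇒≤)
open import Data.Nat using (_≟_; _<?_; _≤?_)
open import Data.Nat.Divisibility using (_∣_; divides; _∣?_)
import Data.Nat.Divisibility as ∣ₚ
open import Data.Nat.DivMod using (_/_; _%_)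
import Data.Nat.DivMod as DM
open import Data.Nat.GCD using (gcd; gcd[m,n]∣m; gcd[m,n]∣n; gcd-greatest)
import Data.Nat.GCD as GCD
open import Data.Nat.Coprimality using (Coprime)
import Data.Nat.Coprimality as Coprime
open import Data.Nat.Primality using (Prime; prime⇒nonZero; prime⇒nonTrivial; euclidsLemma)
import Data.Nat.Primality as Primality
open import Data.Nat.Primality.Factorisation using (PrimeFactorisation; factorise)
import Data.Nat.Tactic.RingSolver as ℕR
open import Data.Product using (Σ; _×_; _,_; proj₁; proj₂; ∃)
import Data.Product.Properties as ×ₚ
open import Data.Sum.Base using (_⊎_; inj₁; inj₂; [_,_]′)
open import Function.Base using (_∘_; id)
open import Function.Bundles using (mk⇔)
open import Level using (0ℓ)
open import Relation.Binary using (DecidableEquality; tri<; tri≈; tri>)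
open import Relation.Binary.PropositionalEquality
open import Relation.Nullary using (¬_; Dec; yes; no; ¬?)
import Algebra.Solver.Ring as RingSolver
open import Algebra.Solver.Ring.AlmostCommutativeRing using (AlmostCommutativeRing; fromCommutativeRing; _-Raw-AlmostCommutative⟶_)

-- Finite sums

-- The lengths are forced by the slice (s y , - s x , r): pigeonhole wants S R above q, while the
-- norm is about max (S L , R), so L = q^(1/4) gives S = q^(3/8) and R = q^(5/8). No real power of q
-- is ever taken: q lies between y^M and (y + 1)^M with M = 8 κ + 4, and every length is a power of
-- an integer root. Losses of the form C^ω are harmless because ω(q) = o(log q). Modulo p the form D
-- is a product of two linear forms or a norm from 𝔽_p², up to a constant, so a line t ↦ l + t b is
-- recorded by two points of P¹(𝔽_p) or by one of P¹(𝔽_p²); both kinds give about p² classes and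
-- square-root cancellation. The obstacle is to show that few lines share a class modulo a composite
-- d. If two do, the coefficients of a certain wedge product are parallel to a fixed vector modulo
-- each p ∣ d, so they lie in a lattice of ℤ³ whose cross products are all divisible by d. Such a
-- lattice has few short points, and each of them arises from few pairs of lines by the divisor
-- bound. Divisors d far below q escape this argument and are served by complete sums.

module Folds {M : Set} {_∙_ : M → M → M} {ε : M} (isCM : IsCommutativeMonoid _≡_ _∙_ ε) where
  open IsCommutativeMonoid isCM using (assoc; identityˡ; identityʳ) renaming (comm to ∙-comm)

  fold : {A : Set} → List A → (A → M) → M
  fold []       f = ε
  fold (x ∷ xs) f = f x ∙ fold xs f

  fold-cong : {A : Set} (xs : List A) {f g : A → M} → (∀ x → x ∈ xs → f x ≡ g x) → fold xs f ≡ fold xs g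
  fold-cong []       eq = refl
  fold-cong (x ∷ xs) eq = cong₂ _∙_ (eq x (here refl)) (fold-cong xs (λ y y∈ → eq y (there y∈)))

  fold-ext : {A : Set} (xs : List A) {f g : A → M} → (∀ x → f x ≡ g x) → fold xs f ≡ fold xs g
  fold-ext xs eq = fold-cong xs (λ x _ → eq x)

  fold-ε : {A : Set} (xs : List A) → fold xs (λ _ → ε) ≡ ε
  fold-ε []       = refl
  fold-ε (x ∷ xs) = trans (identityˡ _) (fold-ε xs)

  fold-++ : {A : Set} (xs ys : List A) (f : A → M) → fold (xs ++ ys) f ≡ fold xs f ∙ fold ys f
  fold-++ []       ys f = sym (identityˡ _)
  fold-++ (x ∷ xs) ys f = trans (cong (f x ∙_) (fold-++ xs ys f)) (sym (assoc _ _ _))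

  fold-map : {A B : Set} (h : A → B) (xs : List A) (f : B → M) → fold (map h xs) f ≡ fold xs (f ∘ h)
  fold-map h []       f = refl
  fold-map h (x ∷ xs) f = cong (f (h x) ∙_) (fold-map h xs f)

  interchange : ∀ a b c d → (a ∙ b) ∙ (c ∙ d) ≡ (a ∙ c) ∙ (b ∙ d)
  interchange a b c d = begin
    (a ∙ b) ∙ (c ∙ d) ≡⟨ assoc a b _ ⟩
    a ∙ (b ∙ (c ∙ d)) ≡⟨ cong (a ∙_) (sym (assoc b c d)) ⟩
    a ∙ ((b ∙ c) ∙ d) ≡⟨ cong (λ t → a ∙ (t ∙ d)) (∙-comm b c) ⟩
    a ∙ ((c ∙ b) ∙ d) ≡⟨ cong (a ∙_) (assoc c b d) ⟩
    a ∙ (c ∙ (b ∙ d)) ≡⟨ sym (assoc a c _) ⟩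
    (a ∙ c) ∙ (b ∙ d) ∎
    where open ≡-Reasoning

  fold-∙ : {A : Set} (xs : List A) (f g : A → M) → fold xs (λ x → f x ∙ g x) ≡ fold xs f ∙ fold xs g
  fold-∙ []       f g = sym (identityˡ ε)
  fold-∙ (x ∷ xs) f g = trans (cong ((f x ∙ g x) ∙_) (fold-∙ xs f g)) (interchange _ _ _ _)

  fold-swap : {A B : Set} (xs : List A) (ys : List B) (f : A → B → M) →
              fold xs (λ x → fold ys (f x)) ≡ fold ys (λ y → fold xs (λ x → f x y))
  fold-swap []       ys f = sym (fold-ε ys)
  fold-swap (x ∷ xs) ys f = trans (cong (fold ys (f x) ∙_) (fold-swap xs ys f)) (sym (fold-∙ ys _ _))

  fold-cartWith : {A B C : Set} (h : A → B → C) (xs : List A) (ys : List B) (f : C → M) →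
                  fold (cartWith h xs ys) f ≡ fold xs (λ x → fold ys (λ y → f (h x y)))
  fold-cartWith h []       ys f = refl
  fold-cartWith h (x ∷ xs) ys f =
    trans (fold-++ (map (h x) ys) _ f) (cong₂ _∙_ (fold-map (h x) ys f) (fold-cartWith h xs ys f))

  fold-↭ : {A : Set} {xs ys : List A} (f : A → M) → xs ↭ ys → fold xs f ≡ fold ys f
  fold-↭ f ↭.refl         = refl
  fold-↭ f (↭.prep x p)   = cong (f x ∙_) (fold-↭ f p)
  fold-↭ f (↭.swap x y p) = trans (sym (assoc _ _ _))
    (trans (cong₂ _∙_ (∙-comm (f x) (f y)) (fold-↭ f p)) (assoc _ _ _))
  fold-↭ f (↭.trans p q)  = trans (fold-↭ f p) (fold-↭ f q)

words : {A : Set} → ℕ → List A → List (List A)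
words zero    xs = [] ∷ []
words (suc n) xs = cartWith _∷_ xs (words n xs)

module Semi {M : Set} {_+M_ _*M_ : M → M → M} {0M 1M : M}
            (isCSR : IsCommutativeSemiring _≡_ _+M_ _*M_ 0M 1M) where
  open IsCommutativeSemiring isCSR using (+-isCommutativeMonoid; *-isCommutativeMonoid; distribˡ; distribʳ; zeroˡ; zeroʳ)
  open Folds +-isCommutativeMonoid public renaming
    ( fold to ∑; fold-cong to ∑-cong; fold-ext to ∑-ext; fold-ε to ∑-0; fold-++ to ∑-++; fold-map to ∑-map
    ; fold-∙ to ∑-+; fold-swap to ∑-swap; fold-cartWith to ∑-cartWith; fold-↭ to ∑-↭; interchange to +-interchange)
  open Folds *-isCommutativeMonoid public renaming
    ( fold to ∏; fold-cong to ∏-cong; fold-ext to ∏-ext; fold-ε to ∏-1; fold-++ to ∏-++; fold-map to ∏-map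
    ; fold-∙ to ∏-*; fold-swap to ∏-swap; fold-cartWith to ∏-cartWith; fold-↭ to ∏-↭; interchange to *-interchange)

  pow : M → ℕ → M
  pow x zero    = 1M
  pow x (suc n) = x *M pow x n

  ∑-*ˡ : {A : Set} (c : M) (xs : List A) (f : A → M) → ∑ xs (λ x → c *M f x) ≡ c *M ∑ xs f
  ∑-*ˡ c []       f = sym (zeroʳ c)
  ∑-*ˡ c (x ∷ xs) f = trans (cong ((c *M f x) +M_) (∑-*ˡ c xs f)) (sym (distribˡ c _ _))

  ∑-*ʳ : {A : Set} (c : M) (xs : List A) (f : A → M) → ∑ xs (λ x → f x *M c) ≡ ∑ xs f *M c
  ∑-*ʳ c []       f = sym (zeroˡ c)
  ∑-*ʳ c (x ∷ xs) f = trans (cong ((f x *M c) +M_) (∑-*ʳ c xs f)) (sym (distribʳ c _ _))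

  ∑-cart : {A B : Set} (xs : List A) (ys : List B) (f : A × B → M) →
           ∑ (cart xs ys) f ≡ ∑ xs (λ x → ∑ ys (λ y → f (x , y)))
  ∑-cart xs ys f = ∑-cartWith _,_ xs ys f

  ∑-*-∑ : {A B : Set} (xs : List A) (ys : List B) (f : A → M) (g : B → M) →
          ∑ xs f *M ∑ ys g ≡ ∑ xs (λ x → ∑ ys (λ y → f x *M g y))
  ∑-*-∑ xs ys f g = trans (sym (∑-*ʳ (∑ ys g) xs f)) (∑-ext xs (λ x → sym (∑-*ˡ (f x) ys g)))

  ∑-pow : {A : Set} (xs : List A) (f : A → M) (n : ℕ) → pow (∑ xs f) n ≡ ∑ (words n xs) (λ τ → ∏ τ f)
  ∑-pow xs f zero    = sym (IsCommutativeMonoid.identityʳ +-isCommutativeMonoid 1M)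
  ∑-pow xs f (suc n) = begin
    ∑ xs f *M pow (∑ xs f) n ≡⟨ cong (∑ xs f *M_) (∑-pow xs f n) ⟩
    ∑ xs f *M ∑ (words n xs) (λ τ → ∏ τ f) ≡⟨ ∑-*-∑ xs (words n xs) f _ ⟩
    ∑ xs (λ x → ∑ (words n xs) (λ τ → f x *M ∏ τ f)) ≡⟨ ∑-cartWith _∷_ xs (words n xs) (λ τ → ∏ τ f) ⟨
    ∑ (words (suc n) xs) (λ τ → ∏ τ f) ∎
    where open ≡-Reasoning

  pow-+ : ∀ x m n → pow x (m + n) ≡ pow x m *M pow x n
  pow-+ x zero    n = sym (IsCommutativeMonoid.identityˡ *-isCommutativeMonoid _)
  pow-+ x (suc m) n = trans (cong (x *M_) (pow-+ x m n)) (sym (IsCommutativeMonoid.assoc *-isCommutativeMonoid _ _ _))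

  pow-* : ∀ x y n → pow (x *M y) n ≡ pow x n *M pow y n
  pow-* x y zero    = sym (IsCommutativeMonoid.identityˡ *-isCommutativeMonoid _)
  pow-* x y (suc n) = trans (cong ((x *M y) *M_) (pow-* x y n)) (*-interchange x y _ _)

  pow-1 : ∀ n → pow 1M n ≡ 1M
  pow-1 zero    = refl
  pow-1 (suc n) = trans (IsCommutativeMonoid.identityˡ *-isCommutativeMonoid _) (pow-1 n)

  pow-∘ : ∀ x m n → pow (pow x m) n ≡ pow x (m * n)
  pow-∘ x m zero    = cong (pow x) (sym (*-zeroʳ m))
  pow-∘ x m (suc n) = trans (cong (pow x m *M_) (pow-∘ x m n))
    (trans (sym (pow-+ x m (m * n))) (cong (pow x) (sym (*-suc m n))))

  ∏-const : {A : Set} (xs : List A) (c : M) → ∏ xs (λ _ → c) ≡ pow c (length xs)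
  ∏-const []       c = refl
  ∏-const (x ∷ xs) c = cong (c *M_) (∏-const xs c)

module ℕΣ = Semi ℕₚ.+-*-isCommutativeSemiring
module ℤΣ = Semi ℤₚ.+-*-isCommutativeSemiring
open ℕΣ public using (∑; ∏)

𝟙 : {P : Set} → Dec P → ℕ
𝟙 (yes _) = 1
𝟙 (no  _) = 0

𝟙-yes : {P : Set} (d : Dec P) → P → 𝟙 d ≡ 1
𝟙-yes (yes _) p = refl
𝟙-yes (no ¬p) p = ⊥-elim (¬p p)

𝟙-no : {P : Set} (d : Dec P) → ¬ P → 𝟙 d ≡ 0
𝟙-no (yes p) ¬p = ⊥-elim (¬p p)
𝟙-no (no _)  ¬p = refl

∑-mono : {A : Set} (xs : List A) {f g : A → ℕ} → (∀ x → x ∈ xs → f x ≤ g x) → ∑ xs f ≤ ∑ xs g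
∑-mono []       le = z≤n
∑-mono (x ∷ xs) le = +-mono-≤ (le x (here refl)) (∑-mono xs (λ y y∈ → le y (there y∈)))

∑-const : {A : Set} (xs : List A) (c : ℕ) → ∑ xs (λ _ → c) ≡ length xs * c
∑-const []       c = refl
∑-const (x ∷ xs) c = cong (_+_ c) (∑-const xs c)

∑-≤const : {A : Set} (xs : List A) {f : A → ℕ} (c : ℕ) → (∀ x → x ∈ xs → f x ≤ c) → ∑ xs f ≤ length xs * c
∑-≤const xs c le = ≤-trans (∑-mono xs le) (≡⇒≤ (∑-const xs c))

∈⇒≤∑ : {A : Set} {x : A} {xs : List A} (f : A → ℕ) → x ∈ xs → f x ≤ ∑ xs f
∈⇒≤∑ f (here refl) = m≤m+n _ _
∈⇒≤∑ f (there x∈)  = ≤-trans (∈⇒≤∑ f x∈) (m≤n+m _ _)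

∏-mono : {A : Set} (xs : List A) {f g : A → ℕ} → (∀ x → x ∈ xs → f x ≤ g x) → ∏ xs f ≤ ∏ xs g
∏-mono []       le = ≤-refl
∏-mono (x ∷ xs) le = *-mono-≤ (le x (here refl)) (∏-mono xs (λ y y∈ → le y (there y∈)))

pow≡^ : ∀ x n → ℕΣ.pow x n ≡ x ^ n
pow≡^ x zero    = refl
pow≡^ x (suc n) = cong (x *_) (pow≡^ x n)

∣∑∣≤∑∣∣ : {A : Set} (xs : List A) (f : A → ℤ) → ∣ ℤΣ.∑ xs f ∣ ≤ ∑ xs (λ x → ∣ f x ∣)
∣∑∣≤∑∣∣ []       f = z≤n
∣∑∣≤∑∣∣ (x ∷ xs) f = ≤-trans (ℤₚ.∣i+j∣≤∣i∣+∣j∣ (f x) _) (+-monoʳ-≤ _ (∣∑∣≤∑∣∣ xs f))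

∣∏∣≡∏∣∣ : {A : Set} (xs : List A) (f : A → ℤ) → ∣ ℤΣ.∏ xs f ∣ ≡ ∏ xs (λ x → ∣ f x ∣)
∣∏∣≡∏∣∣ []       f = refl
∣∏∣≡∏∣∣ (x ∷ xs) f = trans (ℤₚ.abs-* (f x) _) (cong (∣ f x ∣ *_) (∣∏∣≡∏∣∣ xs f))

∣pow∣ : ∀ x n → ∣ ℤΣ.pow x n ∣ ≡ ∣ x ∣ ^ n
∣pow∣ x zero    = refl
∣pow∣ x (suc n) = trans (ℤₚ.abs-* x _) (cong (∣ x ∣ *_) (∣pow∣ x n))

length-filter : {A : Set} {P : A → Set} (P? : ∀ x → Dec (P x)) (xs : List A) → length (filter P? xs) ≡ ∑ xs (λ x → 𝟙 (P? x))
length-filter P? [] = refl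
length-filter P? (x ∷ xs) with P? x
... | yes _ = cong suc (length-filter P? xs)
... | no _  = length-filter P? xs

remove : {A : Set} {x : A} {ys : List A} → x ∈ ys → List A
remove {ys = y ∷ ys} (here _)   = ys
remove {ys = y ∷ ys} (there x∈) = y ∷ remove x∈

length-remove : {A : Set} {x : A} {ys : List A} (x∈ : x ∈ ys) → length ys ≡ suc (length (remove x∈))
length-remove (here _)   = refl
length-remove (there x∈) = cong suc (length-remove x∈)

∈-remove : {A : Set} {x y : A} {ys : List A} (x∈ : x ∈ ys) → y ∈ ys → y ≢ x → y ∈ remove x∈
∈-remove (here refl) (here refl) y≢x = ⊥-elim (y≢x refl)
∈-remove (here refl) (there y∈)  y≢x = y∈
∈-remove (there x∈)  (here refl) y≢x = here refl
∈-remove (there x∈)  (there y∈)  y≢x = there (∈-remove x∈ y∈ y≢x)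

-- The counting principle of the whole proof: a list is bounded by coding its members injectively in
-- an explicit list. Injectivity is asked on members only, since most codes fail to be injective
-- elsewhere.
injective⇒length≤ : {A B : Set} {xs : List A} {ys : List B} (f : A → B) → Unique xs →
                    (∀ {x x′} → x ∈ xs → x′ ∈ xs → f x ≡ f x′ → x ≡ x′) →
                    (∀ {x} → x ∈ xs → f x ∈ ys) → length xs ≤ length ys
injective⇒length≤ {xs = []} f u inj into = z≤n
injective⇒length≤ {xs = x ∷ xs} f (x≢ ∷ u) inj into =
  ≤-trans (s≤s (injective⇒length≤ f u (λ p q → inj (there p) (there q))
                 (λ p → ∈-remove fx∈ (into (there p))
                   (λ eq → All.lookup x≢ p (sym (inj (there p) (here refl) eq))))))
          (≡⇒≤ (sym (length-remove fx∈)))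
  where fx∈ = into (here refl)

unique-↭ : {A : Set} {xs ys : List A} → Unique xs → Unique ys → (∀ {x} → x ∈ xs → x ∈ ys) → (∀ {x} → x ∈ ys → x ∈ xs) → xs ↭ ys
unique-↭ ux uy f g = ∼bag⇒↭ (unique∧set⇒bag ux uy (mk⇔ f g))

length-cart : {A B C : Set} (h : A → B → C) (xs : List A) (ys : List B) →
              length (cartWith h xs ys) ≡ length xs * length ys
length-cart h []       ys = refl
length-cart h (x ∷ xs) ys = trans (Listₚ.length-++ (map (h x) ys))
  (cong₂ _+_ (Listₚ.length-map (h x) ys) (length-cart h xs ys))

∑-pick : {A : Set} (_≟A_ : DecidableEquality A) {xs : List A} (f : A → ℕ) (a : A) → Unique xs → a ∈ xs →
         ∑ xs (λ x → 𝟙 (a ≟A x) * f x) ≡ f a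
∑-pick _≟A_ {x ∷ xs} f a (x∉ ∷ u) (here refl) = begin
  𝟙 (a ≟A a) * f a + ∑ xs (λ x → 𝟙 (a ≟A x) * f x) ≡⟨ cong₂ _+_ (cong (_* f a) (𝟙-yes (a ≟A a) refl)) (ℕΣ.∑-cong xs (λ y y∈ → cong (_* f y) (𝟙-no (a ≟A y) (All.lookup x∉ y∈)))) ⟩
  1 * f a + ∑ xs (λ _ → 0) ≡⟨ cong₂ _+_ (*-identityˡ (f a)) (ℕΣ.∑-0 xs) ⟩
  f a + 0 ≡⟨ +-identityʳ _ ⟩
  f a ∎
  where open ≡-Reasoning
∑-pick _≟A_ {x ∷ xs} f a (x∉ ∷ u) (there a∈) =
  cong₂ _+_ (cong (_* f x) (𝟙-no (a ≟A x) (λ { refl → All.lookup x∉ a∈ refl }))) (∑-pick _≟A_ f a u a∈)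

-- Finite fields and power series

-- Elements are listed, so that sums over the field are list sums. The field has odd order and
-- `half` is (q - 1)/2, the exponent of the quadratic character. `ι` is the reduction of integers
-- and also provides the coefficients for ring identities.
record FiniteField : Set₁ where
  infixl 6 _⊞_
  infixl 7 _⊠_
  infix  8 ⊟_
  infix  4 _≟K_
  field
    K      : Set
    _⊞_    : K → K → K
    _⊠_    : K → K → K
    ⊟_     : K → K
    𝟘 𝟏    : K
    isCR   : IsCommutativeRing _≡_ _⊞_ _⊠_ ⊟_ 𝟘 𝟏
    ι      : ℤ → K
    ι-+    : ∀ i j → ι (i ℤ.+ j) ≡ ι i ⊞ ι j
    ι-*    : ∀ i j → ι (i ℤ.* j) ≡ ι i ⊠ ι j
    ι-neg  : ∀ i → ι (ℤ.- i) ≡ ⊟ ι i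
    ι-0    : ι 0ℤ ≡ 𝟘
    ι-1    : ι 1ℤ ≡ 𝟏
    _≟K_   : DecidableEquality K
    𝟏≢𝟘    : 𝟏 ≢ 𝟘
    inv    : ∀ x → x ≢ 𝟘 → Σ K (λ y → x ⊠ y ≡ 𝟏)
    elems  : List K
    unique : Unique elems
    all∈   : ∀ x → x ∈ elems
    half   : ℕ
    size   : length elems ≡ 1 + 2 * half

  open IsCommutativeRing isCR public using ()
    renaming ( isCommutativeSemiring to isCSR; +-identityˡ to ⊞-identityˡ; +-identityʳ to ⊞-identityʳ; +-comm to ⊞-comm
             ; *-comm to ⊠-comm; *-assoc to ⊠-assoc; *-identityˡ to ⊠-identityˡ; *-identityʳ to ⊠-identityʳ
             ; zeroˡ to ⊠-zeroˡ; zeroʳ to ⊠-zeroʳ; distribˡ to ⊠-distribˡ; -‿inverseʳ to ⊟-inverseʳ)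

  commutativeRing : CommutativeRing 0ℓ 0ℓ
  commutativeRing = record { isCommutativeRing = isCR }

  almostRing : AlmostCommutativeRing 0ℓ 0ℓ
  almostRing = fromCommutativeRing commutativeRing

  morphism : CommutativeRing.rawRing ℤₚ.+-*-commutativeRing -Raw-AlmostCommutative⟶ almostRing
  morphism = record { ⟦_⟧ = ι ; +-homo = ι-+ ; *-homo = ι-* ; -‿homo = ι-neg ; 0-homo = ι-0 ; 1-homo = ι-1 }

  coeff≟ : (i j : ℤ) → Maybe (ι i ≡ ι j)
  coeff≟ i j with i ℤ.≟ j
  ... | yes eq = just (cong ι eq)
  ... | no _   = nothing

  q : ℕ
  q = length elems

module FieldTheory (𝔽 : FiniteField) where
  open FiniteField 𝔽
  open RingSolver _ almostRing morphism coeff≟ public using (solve; _:+_; _:*_; :-_; _:-_; _:=_; con)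
  open Semi isCSR public using () renaming
    ( ∑ to ∑K; ∏ to ∏K; pow to powK; pow-+ to powK-+; pow-* to powK-*; pow-1 to powK-1; pow-∘ to powK-∘; ∏-const to ∏K-const
    ; ∑-cong to ∑K-cong; ∑-ext to ∑K-ext; ∑-0 to ∑K-0; ∑-+ to ∑K-+; ∑-*ˡ to ∑K-*ˡ; ∑-*ʳ to ∑K-*ʳ
    ; ∏-* to ∏K-*; ∏-↭ to ∏K-↭; ∏-map to ∏K-map; ∑-swap to ∑K-swap)
  open ≡-Reasoning

  integral : ∀ {x y} → x ⊠ y ≡ 𝟘 → x ≢ 𝟘 → y ≡ 𝟘
  integral {x} {y} xy≡0 x≢0 with inv x x≢0
  ... | x⁻¹ , xx⁻¹≡1 = begin
    y ≡⟨ ⊠-identityˡ y ⟨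
    𝟏 ⊠ y ≡⟨ cong (_⊠ y) xx⁻¹≡1 ⟨
    (x ⊠ x⁻¹) ⊠ y ≡⟨ solve 3 (λ x i y → (x :* i) :* y := i :* (x :* y)) refl x x⁻¹ y ⟩
    x⁻¹ ⊠ (x ⊠ y) ≡⟨ cong (x⁻¹ ⊠_) xy≡0 ⟩
    x⁻¹ ⊠ 𝟘 ≡⟨ ⊠-zeroʳ x⁻¹ ⟩
    𝟘 ∎

  ⊠-≢𝟘 : ∀ {x y} → x ≢ 𝟘 → y ≢ 𝟘 → x ⊠ y ≢ 𝟘
  ⊠-≢𝟘 x≢0 y≢0 xy≡0 = y≢0 (integral xy≡0 x≢0)

  ⊟-≡⇒≡ : ∀ {x y} → x ⊞ ⊟ y ≡ 𝟘 → x ≡ y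
  ⊟-≡⇒≡ {x} {y} eq = begin
    x ≡⟨ solve 2 (λ x y → x := (x :+ :- y) :+ y) refl x y ⟩
    (x ⊞ ⊟ y) ⊞ y ≡⟨ cong (_⊞ y) eq ⟩
    𝟘 ⊞ y ≡⟨ ⊞-identityˡ y ⟩
    y ∎

  ⊠-cancelˡ : ∀ {x y w} → x ≢ 𝟘 → x ⊠ y ≡ x ⊠ w → y ≡ w
  ⊠-cancelˡ {x} {y} {w} x≢0 eq = ⊟-≡⇒≡ (integral (begin
    x ⊠ (y ⊞ ⊟ w) ≡⟨ solve 3 (λ x y w → x :* (y :+ :- w) := x :* y :+ :- (x :* w)) refl x y w ⟩
    x ⊠ y ⊞ ⊟ (x ⊠ w) ≡⟨ cong (λ t → t ⊞ ⊟ (x ⊠ w)) eq ⟩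
    x ⊠ w ⊞ ⊟ (x ⊠ w) ≡⟨ ⊟-inverseʳ _ ⟩
    𝟘 ∎) x≢0)

  powK-≢𝟘 : ∀ {x} n → x ≢ 𝟘 → powK x n ≢ 𝟘
  powK-≢𝟘 zero    x≢0 = 𝟏≢𝟘
  powK-≢𝟘 (suc n) x≢0 = ⊠-≢𝟘 x≢0 (powK-≢𝟘 n x≢0)

  ∏K-≢𝟘 : {A : Set} (xs : List A) (h : A → K) → (∀ x → x ∈ xs → h x ≢ 𝟘) → ∏K xs h ≢ 𝟘
  ∏K-≢𝟘 []       h ne = 𝟏≢𝟘
  ∏K-≢𝟘 (x ∷ xs) h ne = ⊠-≢𝟘 (ne x (here refl)) (∏K-≢𝟘 xs h (λ y y∈ → ne y (there y∈)))

  nonzero? : ∀ x → Dec (x ≢ 𝟘)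
  nonzero? x = ¬? (x ≟K 𝟘)

  units : List K
  units = filter nonzero? elems

  units-unique : Unique units
  units-unique = Uniqueₚ.filter⁺ nonzero? unique

  elems↭ : elems ↭ 𝟘 ∷ units
  elems↭ = unique-↭ unique (All.tabulate (λ {x} x∈ eq → proj₂ (∈ₚ.∈-filter⁻ nonzero? {xs = elems} x∈) (sym eq)) ∷ units-unique)
    (λ {x} _ → into x) (λ {x} _ → all∈ x)
    where
    into : ∀ x → x ∈ 𝟘 ∷ units
    into x with x ≟K 𝟘
    ... | yes refl = here refl
    ... | no x≢0   = there (∈ₚ.∈-filter⁺ nonzero? (all∈ x) x≢0)

  length-units : length units ≡ 2 * half
  length-units = suc-injective (trans (sym (↭ₚ.↭-length elems↭)) size)

  units-↭ : ∀ {x} → x ≢ 𝟘 → map (x ⊠_) units ↭ units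
  units-↭ {x} x≢0 = unique-↭ (Uniqueₚ.map⁺ (⊠-cancelˡ x≢0) units-unique) units-unique into back
    where
    into : ∀ {y} → y ∈ map (x ⊠_) units → y ∈ units
    into y∈ with ∈ₚ.∈-map⁻ (x ⊠_) y∈
    ... | w , w∈ , refl = ∈ₚ.∈-filter⁺ nonzero? (all∈ _) (⊠-≢𝟘 x≢0 (proj₂ (∈ₚ.∈-filter⁻ nonzero? {xs = elems} w∈)))
    back : ∀ {y} → y ∈ units → y ∈ map (x ⊠_) units
    back {y} y∈ with inv x x≢0
    ... | i , eq = subst (_∈ map (x ⊠_) units) y≡ (∈ₚ.∈-map⁺ (x ⊠_) (∈ₚ.∈-filter⁺ nonzero? (all∈ (i ⊠ y)) ne))
      where
      y≡ : x ⊠ (i ⊠ y) ≡ y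
      y≡ = trans (sym (⊠-assoc x i y)) (trans (cong (_⊠ y) eq) (⊠-identityˡ y))
      ne : i ⊠ y ≢ 𝟘
      ne iy≡0 = proj₂ (∈ₚ.∈-filter⁻ nonzero? {xs = elems} y∈) (trans (sym y≡) (trans (cong (x ⊠_) iy≡0) (⊠-zeroʳ x)))

  unit^ : ∀ {x} → x ≢ 𝟘 → powK x (2 * half) ≡ 𝟏
  unit^ {x} x≢0 = ⊠-cancelˡ {∏K units id} (∏K-≢𝟘 units id (λ y y∈ → proj₂ (∈ₚ.∈-filter⁻ nonzero? {xs = elems} y∈))) (begin
    ∏K units id ⊠ powK x (2 * half) ≡⟨ cong (λ n → ∏K units id ⊠ powK x n) length-units ⟨
    ∏K units id ⊠ powK x (length units) ≡⟨ ⊠-comm _ _ ⟩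
    powK x (length units) ⊠ ∏K units id ≡⟨ cong (_⊠ ∏K units id) (∏K-const units x) ⟨
    ∏K units (λ _ → x) ⊠ ∏K units id ≡⟨ ∏K-* units (λ _ → x) id ⟨
    ∏K units (x ⊠_) ≡⟨ ∏K-map (x ⊠_) units id ⟨
    ∏K (map (x ⊠_) units) id ≡⟨ ∏K-↭ id (units-↭ x≢0) ⟩
    ∏K units id ≡⟨ ⊠-identityʳ _ ⟨
    ∏K units id ⊠ 𝟏 ∎)

  -- Multiplication by x permutes the nonzero elements.
  fermat : ∀ x → powK x q ≡ x
  fermat x with x ≟K 𝟘
  ... | yes refl = trans (cong (powK 𝟘) size) (⊠-zeroˡ _)
  ... | no x≢0   = trans (cong (powK x) size) (trans (cong (x ⊠_) (unit^ x≢0)) (⊠-identityʳ x))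

  -- Formal power series in h, and multiplication by y + h.

  Series : Set
  Series = ℕ → K

  one : Series
  one zero    = 𝟏
  one (suc _) = 𝟘

  lin : K → Series → Series
  lin y Ψ zero    = y ⊠ Ψ zero
  lin y Ψ (suc l) = y ⊠ Ψ (suc l) ⊞ Ψ l

  lins : List K → Series → Series
  lins []       Ψ = Ψ
  lins (y ∷ ys) Ψ = lin y (lins ys Ψ)

  lins-++ : ∀ ys zs Ψ → lins (ys ++ zs) Ψ ≡ lins ys (lins zs Ψ)
  lins-++ []       zs Ψ = refl
  lins-++ (y ∷ ys) zs Ψ = cong (lin y) (lins-++ ys zs Ψ)

  -- The scalars c and d let a series inside a longer product be exchanged for another one up to a
  -- factor, without dividing. In `lins-halves` they are powers of f(w).
  lin-cong : ∀ {M c d Ψ Φ} y → (∀ l → l < M → c ⊠ Ψ l ≡ d ⊠ Φ l) → ∀ l → l < M → c ⊠ lin y Ψ l ≡ d ⊠ lin y Φ l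
  lin-cong {M} {c} {d} {Ψ} {Φ} y eq zero l<M = begin
    c ⊠ (y ⊠ Ψ 0) ≡⟨ solve 3 (λ c y p → c :* (y :* p) := y :* (c :* p)) refl c y (Ψ 0) ⟩
    y ⊠ (c ⊠ Ψ 0) ≡⟨ cong (y ⊠_) (eq 0 l<M) ⟩
    y ⊠ (d ⊠ Φ 0) ≡⟨ solve 3 (λ c y p → y :* (c :* p) := c :* (y :* p)) refl d y (Φ 0) ⟩
    d ⊠ (y ⊠ Φ 0) ∎
  lin-cong {M} {c} {d} {Ψ} {Φ} y eq (suc l) l<M = begin
    c ⊠ (y ⊠ Ψ (suc l) ⊞ Ψ l) ≡⟨ solve 4 (λ c y p r → c :* (y :* p :+ r) := y :* (c :* p) :+ c :* r) refl c y (Ψ (suc l)) (Ψ l) ⟩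
    y ⊠ (c ⊠ Ψ (suc l)) ⊞ c ⊠ Ψ l ≡⟨ cong₂ (λ u v → y ⊠ u ⊞ v) (eq (suc l) l<M) (eq l (<-trans (n<1+n l) l<M)) ⟩
    y ⊠ (d ⊠ Φ (suc l)) ⊞ d ⊠ Φ l ≡⟨ solve 4 (λ c y p r → y :* (c :* p) :+ c :* r := c :* (y :* p :+ r)) refl d y (Φ (suc l)) (Φ l) ⟩
    d ⊠ (y ⊠ Φ (suc l) ⊞ Φ l) ∎

  lins-cong : ∀ {M c d Ψ Φ} ys → (∀ l → l < M → c ⊠ Ψ l ≡ d ⊠ Φ l) → ∀ l → l < M → c ⊠ lins ys Ψ l ≡ d ⊠ lins ys Φ l
  lins-cong []       eq = eq
  lins-cong (y ∷ ys) eq = lin-cong y (lins-cong ys eq)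

  ser : List K → Series
  ser ys = lins ys one

  ser-above : ∀ ys {l} → length ys < l → ser ys l ≡ 𝟘
  ser-above []       {suc l} _ = refl
  ser-above (y ∷ ys) {suc l} (s≤s lt) =
    trans (cong₂ (λ u v → y ⊠ u ⊞ v) (ser-above ys (m<n⇒m<1+n lt)) (ser-above ys lt))
          (solve 1 (λ y → y :* con 0ℤ :+ con 0ℤ := con 0ℤ) refl y ▹ y)
    where
    _▹_ : ∀ {y} → y ⊠ ι 0ℤ ⊞ ι 0ℤ ≡ ι 0ℤ → ∀ w → y ⊠ 𝟘 ⊞ 𝟘 ≡ 𝟘
    _▹_ {y} eq _ = trans (cong₂ (λ u v → y ⊠ u ⊞ v) (sym ι-0) (sym ι-0)) (trans eq ι-0)

  ser-lead : ∀ ys → ser ys (length ys) ≡ 𝟏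
  ser-lead []       = refl
  ser-lead (y ∷ ys) = trans (cong₂ (λ u v → y ⊠ u ⊞ v) (ser-above ys (n<1+n _)) (ser-lead ys))
    (trans (cong (_⊞ 𝟏) (⊠-zeroʳ y)) (⊞-identityˡ 𝟏))

  -- A polynomial is the list of its coefficients; taylor w F is the expansion of F(w + h).

  Poly : Set
  Poly = List K

  taylor : K → Poly → Series
  taylor w []      l       = 𝟘
  taylor w (a ∷ F) zero    = a ⊞ w ⊠ taylor w F zero
  taylor w (a ∷ F) (suc l) = w ⊠ taylor w F (suc l) ⊞ taylor w F l

  -- Synthetic division: `quo v F` is the quotient of a + X F by X - v for every constant a, because
  -- a only enters the remainder.
  quo : K → Poly → Poly
  quo w []      = []
  quo w (b ∷ G) = taylor w (b ∷ G) 0 ∷ quo w G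

  length-quo : ∀ w F → length (quo w F) ≡ length F
  length-quo w []      = refl
  length-quo w (b ∷ G) = cong suc (length-quo w G)

  quo-zero : ∀ v w a F → taylor w (a ∷ F) 0 ≡ taylor v (a ∷ F) 0 ⊞ lin (w ⊞ ⊟ v) (taylor w (quo v F)) 0
  quo-zero v w a [] = solve 4 (λ v w a o → a :+ w :* o := (a :+ v :* o) :+ ((w :+ :- v) :* o :+ (v :* o :- v :* o))) refl v w a 𝟘 ▹ₒ
    where
    _▹ₒ : a ⊞ w ⊠ 𝟘 ≡ (a ⊞ v ⊠ 𝟘) ⊞ ((w ⊞ ⊟ v) ⊠ 𝟘 ⊞ (v ⊠ 𝟘 ⊞ ⊟ (v ⊠ 𝟘))) → a ⊞ w ⊠ 𝟘 ≡ (a ⊞ v ⊠ 𝟘) ⊞ (w ⊞ ⊟ v) ⊠ 𝟘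
    _▹ₒ eq = trans eq (cong ((a ⊞ v ⊠ 𝟘) ⊞_) (trans (cong ((w ⊞ ⊟ v) ⊠ 𝟘 ⊞_) (⊟-inverseʳ _)) (⊞-identityʳ _)))
  quo-zero v w a (b ∷ G) = begin
    a ⊞ w ⊠ taylor w (b ∷ G) 0 ≡⟨ cong (λ t → a ⊞ w ⊠ t) (quo-zero v w b G) ⟩
    a ⊞ w ⊠ (r ⊞ (w ⊞ ⊟ v) ⊠ Q 0) ≡⟨ solve 5 (λ v w a r s → a :+ w :* (r :+ (w :+ :- v) :* s) := (a :+ v :* r) :+ (w :+ :- v) :* (r :+ w :* s)) refl v w a r (Q 0) ⟩
    (a ⊞ v ⊠ r) ⊞ (w ⊞ ⊟ v) ⊠ (r ⊞ w ⊠ Q 0) ∎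
    where
    r = taylor v (b ∷ G) 0
    Q = taylor w (quo v G)

  quo-suc : ∀ v w a F l → taylor w (a ∷ F) (suc l) ≡ lin (w ⊞ ⊟ v) (taylor w (quo v F)) (suc l)
  quo-suc v w a [] l = cong (_⊞ 𝟘) (trans (⊠-zeroʳ w) (sym (⊠-zeroʳ _)))
  quo-suc v w a (b ∷ G) zero = begin
    w ⊠ taylor w (b ∷ G) 1 ⊞ taylor w (b ∷ G) 0 ≡⟨ cong₂ (λ s t → w ⊠ s ⊞ t) (quo-suc v w b G 0) (quo-zero v w b G) ⟩
    w ⊠ ((w ⊞ ⊟ v) ⊠ Q 1 ⊞ Q 0) ⊞ (r ⊞ (w ⊞ ⊟ v) ⊠ Q 0) ≡⟨ solve 5 (λ v w r s t → w :* ((w :+ :- v) :* t :+ s) :+ (r :+ (w :+ :- v) :* s) := (w :+ :- v) :* (w :* t :+ s) :+ (r :+ w :* s)) refl v w r (Q 0) (Q 1) ⟩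
    (w ⊞ ⊟ v) ⊠ (w ⊠ Q 1 ⊞ Q 0) ⊞ (r ⊞ w ⊠ Q 0) ∎
    where
    r = taylor v (b ∷ G) 0
    Q = taylor w (quo v G)
  quo-suc v w a (b ∷ G) (suc l) = begin
    w ⊠ taylor w (b ∷ G) (2 + l) ⊞ taylor w (b ∷ G) (1 + l)
      ≡⟨ cong₂ (λ s t → w ⊠ s ⊞ t) (quo-suc v w b G (suc l)) (quo-suc v w b G l) ⟩
    w ⊠ ((w ⊞ ⊟ v) ⊠ Q (2 + l) ⊞ Q (1 + l)) ⊞ ((w ⊞ ⊟ v) ⊠ Q (1 + l) ⊞ Q l)
      ≡⟨ solve 5 (λ v w r s t → w :* ((w :+ :- v) :* t :+ s) :+ ((w :+ :- v) :* s :+ r) := (w :+ :- v) :* (w :* t :+ s) :+ (w :* s :+ r)) refl v w (Q l) (Q (1 + l)) (Q (2 + l)) ⟩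
    (w ⊞ ⊟ v) ⊠ (w ⊠ Q (2 + l) ⊞ Q (1 + l)) ⊞ (w ⊠ Q (1 + l) ⊞ Q l) ∎
    where
    Q = taylor w (quo v G)

  -- Each root is divided out as often as its multiplicity demands, and every division shortens the
  -- list by one; m is what is left of the multiplicity at the current root v. Multiplicity is read
  -- off the expansion in h (Hasse derivatives), so no factorial has to be invertible.
  hermite : ∀ M m v rest F → Unique (v ∷ rest) → (∀ l → l < m → taylor v F l ≡ 𝟘) →
            (∀ u → u ∈ rest → ∀ l → l < M → taylor u F l ≡ 𝟘) →
            length F ≤ m + length rest * M → ∀ w l → taylor w F l ≡ 𝟘
  hermite M m v rest [] u ov or le w l = refl
  hermite M zero v [] (a ∷ F) u ov or () w l
  hermite M zero v (v′ ∷ rest) F@(_ ∷ _) (_ ∷ u) ov or le w l =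
    hermite M M v′ rest F u (or v′ (here refl)) (λ x x∈ → or x (there x∈)) le w l
  hermite M (suc m) v rest (a ∷ F) u@(v∉ ∷ _) ov or (s≤s le) w l = result l
    where
    Q : Poly
    Q = quo v F

    root : taylor v (a ∷ F) 0 ≡ 𝟘
    root = ov 0 (s≤s z≤n)

    factor : ∀ x k → taylor x (a ∷ F) k ≡ lin (x ⊞ ⊟ v) (taylor x Q) k
    factor x zero    = trans (quo-zero v x a F) (trans (cong (_⊞ lin (x ⊞ ⊟ v) (taylor x Q) 0) root) (⊞-identityˡ _))
    factor x (suc k) = quo-suc v x a F k

    order-v : ∀ k → k < m → taylor v Q k ≡ 𝟘
    order-v k k<m = begin
      taylor v Q k ≡⟨ ⊞-identityˡ _ ⟨
      𝟘 ⊞ taylor v Q k ≡⟨ cong (_⊞ taylor v Q k) (trans (cong (_⊠ taylor v Q (suc k)) (⊟-inverseʳ v)) (⊠-zeroˡ _)) ⟨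
      (v ⊞ ⊟ v) ⊠ taylor v Q (suc k) ⊞ taylor v Q k ≡⟨ factor v (suc k) ⟨
      taylor v (a ∷ F) (suc k) ≡⟨ ov (suc k) (s≤s k<m) ⟩
      𝟘 ∎

    -- At v the factor (w - v) + h is h itself and the order drops by one; at any other root x its
    -- constant term x - v is a unit and the order is kept.
    order-rest : ∀ x → x ∈ rest → ∀ k → k < M → taylor x Q k ≡ 𝟘
    order-rest x x∈ = go
      where
      x-v≢0 : x ⊞ ⊟ v ≢ 𝟘
      x-v≢0 eq = All.lookup v∉ x∈ (sym (⊟-≡⇒≡ eq))
      go : ∀ k → k < M → taylor x Q k ≡ 𝟘
      go zero    k<M = integral (trans (sym (factor x 0)) (or x x∈ 0 k<M)) x-v≢0
      go (suc k) k<M = integral (begin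
        (x ⊞ ⊟ v) ⊠ taylor x Q (suc k) ≡⟨ ⊞-identityʳ _ ⟨
        (x ⊞ ⊟ v) ⊠ taylor x Q (suc k) ⊞ 𝟘 ≡⟨ cong ((x ⊞ ⊟ v) ⊠ taylor x Q (suc k) ⊞_) (go k (<-trans (n<1+n k) k<M)) ⟨
        (x ⊞ ⊟ v) ⊠ taylor x Q (suc k) ⊞ taylor x Q k ≡⟨ factor x (suc k) ⟨
        taylor x (a ∷ F) (suc k) ≡⟨ or x x∈ (suc k) k<M ⟩
        𝟘 ∎) x-v≢0

    Q≡0 : ∀ x k → taylor x Q k ≡ 𝟘
    Q≡0 = hermite M m v rest Q u order-v order-rest (≤-trans (≡⇒≤ (length-quo v F)) le)

    result : ∀ k → taylor w (a ∷ F) k ≡ 𝟘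
    result zero    = trans (factor w 0) (trans (cong ((w ⊞ ⊟ v) ⊠_) (Q≡0 w 0)) (⊠-zeroʳ _))
    result (suc k) = trans (factor w (suc k)) (trans (cong₂ (λ s t → (w ⊞ ⊟ v) ⊠ s ⊞ t) (Q≡0 w (suc k)) (Q≡0 w k))
      (trans (⊞-identityʳ _) (⊠-zeroʳ _)))

  addP : Poly → Poly → Poly
  addP []      G       = G
  addP (a ∷ F) []      = a ∷ F
  addP (a ∷ F) (b ∷ G) = (a ⊞ b) ∷ addP F G

  scaleP : K → Poly → Poly
  scaleP c = map (c ⊠_)

  linP : K → Poly → Poly
  linP t F = addP (scaleP t F) (𝟘 ∷ F)

  prodP : List K → Poly
  prodP []       = 𝟏 ∷ []
  prodP (t ∷ ts) = linP t (prodP ts)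

  length-addP : ∀ {n} F G → length F ≤ n → length G ≤ n → length (addP F G) ≤ n
  length-addP []      G       p q       = q
  length-addP (a ∷ F) []      p q       = p
  length-addP (a ∷ F) (b ∷ G) (s≤s p) (s≤s q) = s≤s (length-addP F G p q)

  length-linP : ∀ {n} t F → length F ≤ n → length (linP t F) ≤ suc n
  length-linP t F p = length-addP (scaleP t F) (𝟘 ∷ F) (m≤n⇒m≤1+n (≤-trans (≡⇒≤ (Listₚ.length-map (t ⊠_) F)) p)) (s≤s p)

  length-prodP : ∀ ts → length (prodP ts) ≤ suc (length ts)
  length-prodP []       = ≤-refl
  length-prodP (t ∷ ts) = length-linP t (prodP ts) (length-prodP ts)

  taylor-addP : ∀ w F G l → taylor w (addP F G) l ≡ taylor w F l ⊞ taylor w G l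
  taylor-addP w []      G       l       = sym (⊞-identityˡ _)
  taylor-addP w (a ∷ F) []      l       = sym (⊞-identityʳ _)
  taylor-addP w (a ∷ F) (b ∷ G) zero    = trans (cong (λ t → (a ⊞ b) ⊞ w ⊠ t) (taylor-addP w F G 0))
    (solve 5 (λ a b w f g → (a :+ b) :+ w :* (f :+ g) := (a :+ w :* f) :+ (b :+ w :* g)) refl a b w (taylor w F 0) (taylor w G 0))
  taylor-addP w (a ∷ F) (b ∷ G) (suc l) = trans (cong₂ (λ s t → w ⊠ s ⊞ t) (taylor-addP w F G (suc l)) (taylor-addP w F G l))
    (solve 5 (λ w f g f′ g′ → w :* (f :+ g) :+ (f′ :+ g′) := (w :* f :+ f′) :+ (w :* g :+ g′)) refl w (taylor w F (suc l)) (taylor w G (suc l)) (taylor w F l) (taylor w G l))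

  taylor-scaleP : ∀ w c F l → taylor w (scaleP c F) l ≡ c ⊠ taylor w F l
  taylor-scaleP w c []      l       = sym (⊠-zeroʳ c)
  taylor-scaleP w c (a ∷ F) zero    = trans (cong (λ t → c ⊠ a ⊞ w ⊠ t) (taylor-scaleP w c F 0))
    (solve 4 (λ c a w f → c :* a :+ w :* (c :* f) := c :* (a :+ w :* f)) refl c a w (taylor w F 0))
  taylor-scaleP w c (a ∷ F) (suc l) = trans (cong₂ (λ s t → w ⊠ s ⊞ t) (taylor-scaleP w c F (suc l)) (taylor-scaleP w c F l))
    (solve 4 (λ c w f g → w :* (c :* f) :+ c :* g := c :* (w :* f :+ g)) refl c w (taylor w F (suc l)) (taylor w F l))

  taylor-linP : ∀ w t F l → taylor w (linP t F) l ≡ lin (w ⊞ t) (taylor w F) l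
  taylor-linP w t F zero = begin
    taylor w (linP t F) 0 ≡⟨ taylor-addP w (scaleP t F) (𝟘 ∷ F) 0 ⟩
    taylor w (scaleP t F) 0 ⊞ (𝟘 ⊞ w ⊠ taylor w F 0) ≡⟨ cong₂ _⊞_ (taylor-scaleP w t F 0) (⊞-identityˡ _) ⟩
    t ⊠ taylor w F 0 ⊞ w ⊠ taylor w F 0 ≡⟨ solve 3 (λ t w f → t :* f :+ w :* f := (w :+ t) :* f) refl t w (taylor w F 0) ⟩
    (w ⊞ t) ⊠ taylor w F 0 ∎
  taylor-linP w t F (suc l) = begin
    taylor w (linP t F) (suc l) ≡⟨ taylor-addP w (scaleP t F) (𝟘 ∷ F) (suc l) ⟩
    taylor w (scaleP t F) (suc l) ⊞ (w ⊠ taylor w F (suc l) ⊞ taylor w F l) ≡⟨ cong (_⊞ _) (taylor-scaleP w t F (suc l)) ⟩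
    t ⊠ taylor w F (suc l) ⊞ (w ⊠ taylor w F (suc l) ⊞ taylor w F l) ≡⟨ solve 4 (λ t w f g → t :* f :+ (w :* f :+ g) := (w :+ t) :* f :+ g) refl t w (taylor w F (suc l)) (taylor w F l) ⟩
    (w ⊞ t) ⊠ taylor w F (suc l) ⊞ taylor w F l ∎

  ⊠-cong-𝟏 : ∀ {x y} → x ≡ y → 𝟏 ⊠ x ≡ 𝟏 ⊠ y
  ⊠-cong-𝟏 = cong (𝟏 ⊠_)

  𝟏⊠-injective : ∀ {x y} → 𝟏 ⊠ x ≡ 𝟏 ⊠ y → x ≡ y
  𝟏⊠-injective eq = trans (sym (⊠-identityˡ _)) (trans eq (⊠-identityˡ _))

  taylor-prodP : ∀ w ts l → taylor w (prodP ts) l ≡ ser (map (w ⊞_) ts) l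
  taylor-prodP w [] zero    = trans (cong (𝟏 ⊞_) (⊠-zeroʳ w)) (⊞-identityʳ 𝟏)
  taylor-prodP w [] (suc l) = trans (⊞-identityʳ _) (⊠-zeroʳ w)
  taylor-prodP w (t ∷ ts) l = trans (taylor-linP w t (prodP ts) l)
    (𝟏⊠-injective (lin-cong {suc l} (w ⊞ t) (λ k _ → ⊠-cong-𝟏 (taylor-prodP w ts k)) l (n<1+n l)))

  -- (X + t)ⁿ − Xⁿ, written so that its degree is visibly less than n.
  diffP : K → ℕ → Poly
  diffP t zero    = []
  diffP t (suc n) = addP (linP t (diffP t n)) (scaleP t (prodP (replicate n 𝟘)))

  length-diffP : ∀ t n → length (diffP t n) ≤ n
  length-diffP t zero    = z≤n
  length-diffP t (suc n) = length-addP (linP t (diffP t n)) _ (length-linP t (diffP t n) (length-diffP t n))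
    (≤-trans (≡⇒≤ (Listₚ.length-map (t ⊠_) (prodP (replicate n 𝟘))))
      (≤-trans (length-prodP (replicate n 𝟘)) (≡⇒≤ (cong suc (Listₚ.length-replicate n)))))

  -- Rests on (X + t)ⁿ⁺¹ - Xⁿ⁺¹ = (X + t) ((X + t)ⁿ - Xⁿ) + t Xⁿ.
  taylor-diffP : ∀ w t n l → taylor w (diffP t n) l ⊞ ser (replicate n w) l ≡ ser (replicate n (w ⊞ t)) l
  taylor-diffP w t zero    l = ⊞-identityˡ _
  taylor-diffP w t (suc n) l = begin
    taylor w (diffP t (suc n)) l ⊞ lin w (ser ws) l
      ≡⟨ cong (_⊞ lin w (ser ws) l) (trans (taylor-addP w (linP t (diffP t n)) _ l)
           (cong₂ _⊞_ (taylor-linP w t (diffP t n) l) (trans (taylor-scaleP w t (prodP (replicate n 𝟘)) l)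
             (cong (t ⊠_) (trans (taylor-prodP w (replicate n 𝟘) l) (cong (λ ys → ser ys l)
               (trans (Listₚ.map-replicate (w ⊞_) n 𝟘) (cong (replicate n) (⊞-identityʳ w))))))))) ⟩
    (lin (w ⊞ t) D l ⊞ t ⊠ ser ws l) ⊞ lin w (ser ws) l ≡⟨ step l ⟩
    lin (w ⊞ t) (ser (replicate n (w ⊞ t))) l ∎
    where
    ws = replicate n w
    D = taylor w (diffP t n)
    step : ∀ l → (lin (w ⊞ t) D l ⊞ t ⊠ ser ws l) ⊞ lin w (ser ws) l ≡ lin (w ⊞ t) (ser (replicate n (w ⊞ t))) l
    step zero = trans (solve 4 (λ w t d e → ((w :+ t) :* d :+ t :* e) :+ w :* e := (w :+ t) :* (d :+ e)) refl w t (D 0) (ser ws 0))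
      (cong ((w ⊞ t) ⊠_) (taylor-diffP w t n 0))
    step (suc l) = trans (solve 6 (λ w t d e d′ e′ → (((w :+ t) :* d :+ d′) :+ t :* e) :+ (w :* e :+ e′) := (w :+ t) :* (d :+ e) :+ (d′ :+ e′)) refl w t (D (suc l)) (ser ws (suc l)) (D l) (ser ws l))
      (cong₂ (λ x y → (w ⊞ t) ⊠ x ⊞ y) (taylor-diffP w t n (suc l)) (taylor-diffP w t n l))

  ser-const : ∀ y n → ser (replicate n y) 0 ≡ powK y n
  ser-const y zero    = refl
  ser-const y (suc n) = cong (y ⊠_) (ser-const y n)

  ser-𝟘s : ∀ n {l} → l < n → ser (replicate n 𝟘) l ≡ 𝟘
  ser-𝟘s (suc n) {zero}  _        = ⊠-zeroˡ _
  ser-𝟘s (suc n) {suc l} (s≤s lt) = trans (cong₂ _⊞_ (⊠-zeroˡ _) (ser-𝟘s n lt)) (⊞-identityˡ 𝟘)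

  q>0 : 0 < q
  q>0 = ≤-trans (s≤s z≤n) (≡⇒≤ (sym size))

  roots⇒zero : ∀ M F vs → Unique vs → (∀ v → v ∈ vs → ∀ l → l < M → taylor v F l ≡ 𝟘) →
               length F ≤ length vs * M → ∀ w l → taylor w F l ≡ 𝟘
  roots⇒zero M []      vs       u r le w l = refl
  roots⇒zero M (_ ∷ _) []       u r () w l
  roots⇒zero M F       (v ∷ vs) u r le     = hermite M M v vs F u (r v (here refl)) (λ x x∈ → r x (there x∈)) le

  -- (h + z)^q = h^q + z: their difference has degree less than q and vanishes on K.
  frobenius : ∀ w l → l < q → 𝟏 ⊠ ser (replicate q w) l ≡ w ⊠ one l
  frobenius w l l<q = begin
    𝟏 ⊠ ser (replicate q w) l ≡⟨ ⊠-identityˡ _ ⟩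
    ser (replicate q w) l ≡⟨ cong (λ t → ser (replicate q t) l) (⊞-identityˡ w) ⟨
    ser (replicate q (𝟘 ⊞ w)) l ≡⟨ taylor-diffP 𝟘 w q l ⟨
    taylor 𝟘 (diffP w q) l ⊞ ser (replicate q 𝟘) l ≡⟨ cong (taylor 𝟘 (diffP w q) l ⊞_) (ser-𝟘s q l<q) ⟩
    taylor 𝟘 (diffP w q) l ⊞ 𝟘 ≡⟨ ⊞-identityʳ _ ⟩
    taylor 𝟘 (diffP w q) l ≡⟨ ⊟-≡⇒≡ (trans (sym (value l)) (F≡0 𝟘 l)) ⟩
    w ⊠ one l ∎
    where
    F : Poly
    F = addP (diffP w q) ((⊟ w) ∷ [])
    lenF : length F ≤ q
    lenF = length-addP (diffP w q) _ (length-diffP w q) q>0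
    const : ∀ x l → taylor x ((⊟ w) ∷ []) l ≡ ⊟ (w ⊠ one l)
    const x zero    = trans (cong (⊟ w ⊞_) (⊠-zeroʳ x)) (trans (⊞-identityʳ _) (cong ⊟_ (sym (⊠-identityʳ w))))
    const x (suc l) = trans (⊞-identityʳ _) (trans (⊠-zeroʳ x) (solve 1 (λ w → con 0ℤ := :- (w :* con 0ℤ)) refl w ▹0))
      where
      _▹0 : ι 0ℤ ≡ ⊟ (w ⊠ ι 0ℤ) → 𝟘 ≡ ⊟ (w ⊠ 𝟘)
      eq ▹0 = subst (λ o → o ≡ ⊟ (w ⊠ o)) ι-0 eq
    value : ∀ {x} l → taylor x F l ≡ taylor x (diffP w q) l ⊞ ⊟ (w ⊠ one l)
    value {x} l = trans (taylor-addP x (diffP w q) _ l) (cong (taylor x (diffP w q) l ⊞_) (const x l))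
    root : ∀ x → taylor x F 0 ≡ 𝟘
    root x = begin
      taylor x F 0 ≡⟨ value 0 ⟩
      taylor x (diffP w q) 0 ⊞ ⊟ (w ⊠ 𝟏) ≡⟨ cong₂ (λ s t → s ⊞ ⊟ t) (move (trans (taylor-diffP x w q 0) (trans (ser-const _ q) (fermat _))) (trans (ser-const x q) (fermat x))) (⊠-identityʳ w) ⟩
      w ⊞ ⊟ w ≡⟨ ⊟-inverseʳ w ⟩
      𝟘 ∎
      where
      move : ∀ {s t} → s ⊞ t ≡ x ⊞ w → t ≡ x → s ≡ w
      move {s} {t} eq refl = trans (solve 2 (λ s t → s := (s :+ t) :+ :- t) refl s t) (trans (cong (_⊞ ⊟ t) eq) (solve 2 (λ t w → (t :+ w) :+ :- t := w) refl t w))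
    F≡0 : ∀ x l → taylor x F l ≡ 𝟘
    F≡0 = roots⇒zero 1 F elems unique (λ { x _ zero _ → root x ; x _ (suc _) (s≤s ()) }) (≤-trans lenF (≡⇒≤ (sym (*-identityʳ q))))

-- Stepanov's method

∈-split : {A : Set} {x y : A} {ys : List A} (x∈ : x ∈ ys) → y ∈ ys → y ≡ x ⊎ y ∈ remove x∈
∈-split (here refl) (here refl) = inj₁ refl
∈-split (here refl) (there y∈)  = inj₂ y∈
∈-split (there x∈)  (here refl) = inj₂ (here refl)
∈-split (there x∈)  (there y∈) with ∈-split x∈ y∈
... | inj₁ eq  = inj₁ eq
... | inj₂ y∈′ = inj₂ (there y∈′)

remove-≢ : {A B : Set} (f : A → B) {x y : A} {xs : List A} → Unique (map f xs) → (x∈ : x ∈ xs) → y ∈ remove x∈ → f y ≢ f x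
remove-≢ f (x∉ ∷ u) (here refl) y∈          eq = All.lookup x∉ (∈ₚ.∈-map⁺ f y∈) (sym eq)
remove-≢ f (x∉ ∷ u) (there x∈)  (here refl) eq = All.lookup x∉ (∈ₚ.∈-map⁺ f x∈) eq
remove-≢ f (x∉ ∷ u) (there x∈)  (there y∈)  eq = remove-≢ f u x∈ y∈ eq

replicate-+ : {A : Set} (m n : ℕ) (x : A) → replicate (m + n) x ≡ replicate m x ++ replicate n x
replicate-+ zero    n x = refl
replicate-+ (suc m) n x = cong (x ∷_) (replicate-+ m n x)

divMod-unique : ∀ {n r r′ k k′} → r < n → r′ < n → r + k * n ≡ r′ + k′ * n → r ≡ r′ × k ≡ k′
divMod-unique {n@(suc _)} {r} {r′} {k} {k′} r<n r′<n eq = r≡r′ , *-cancelʳ-≡ k k′ n (+-cancelˡ-≡ r′ (k * n) (k′ * n) (trans (cong (_+ k * n) (sym r≡r′)) eq))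
  where
  mod : ∀ {s} k → s < n → (s + k * n) % n ≡ s
  mod {s} k s<n = trans (DM.[m+kn]%n≡m%n s k n) (DM.m<n⇒m%n≡m s<n)
  r≡r′ : r ≡ r′
  r≡r′ = trans (sym (mod k r<n)) (trans (cong (_% n) eq) (mod k′ r′<n))

module Stepanov (𝔽 : FiniteField) where
  open FiniteField 𝔽
  open FieldTheory 𝔽
  open ≡-Reasoning

  ∑K-single : {A : Set} {x : A} {xs : List A} (h : A → K) (x∈ : x ∈ xs) → (∀ y → y ∈ remove x∈ → h y ≡ 𝟘) → ∑K xs h ≡ h x
  ∑K-single {xs = x ∷ xs} h (here refl) z = trans (cong (h x ⊞_) (trans (∑K-cong xs z) (∑K-0 xs))) (⊞-identityʳ _)
  ∑K-single {xs = x ∷ xs} h (there x∈)  z = trans (cong₂ _⊞_ (z x (here refl)) (∑K-single h x∈ (λ y y∈ → z y (there y∈)))) (⊞-identityˡ _)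

  module LinearAlgebra {I : Set} where

    comb : List (K × I) → (I → K) → K
    comb cs E = ∑K cs (λ c → proj₁ c ⊠ E (proj₂ c))

    comb-zeros : ∀ Is E → comb (map (𝟘 ,_) Is) E ≡ 𝟘
    comb-zeros []       E = refl
    comb-zeros (i ∷ Is) E = trans (cong₂ _⊞_ (⊠-zeroˡ _) (comb-zeros Is E)) (⊞-identityˡ 𝟘)

    comb-reduce : ∀ cs E k E₀ → comb cs (λ j → E j ⊞ ⊟ (k ⊠ E₀ j)) ⊞ k ⊠ comb cs E₀ ≡ comb cs E
    comb-reduce []             E k E₀ = trans (⊞-identityˡ _) (⊠-zeroʳ k)
    comb-reduce ((x , i) ∷ cs) E k E₀ = trans
      (solve 6 (λ x u k w s t → (x :* (u :+ :- (k :* w)) :+ s) :+ k :* (x :* w :+ t) := x :* u :+ (s :+ k :* t)) refl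
        x (E i) k (E₀ i) (comb cs (λ j → E j ⊞ ⊟ (k ⊠ E₀ j))) (comb cs E₀))
      (cong (x ⊠ E i ⊞_) (comb-reduce cs E k E₀))

    -- Gaussian elimination on the first unknown: if no equation involves it, it may be 1 and all
    -- others 0; otherwise an equation E₀ that does is solved for it and subtracted from the rest,
    -- which removes one unknown and one equation.
    kernel : (Is : List I) (eqs : List (I → K)) → length eqs < length Is →
             Σ (List (K × I)) (λ cs → map proj₂ cs ≡ Is × Any (λ c → proj₁ c ≢ 𝟘) cs × (∀ E → E ∈ eqs → comb cs E ≡ 𝟘))
    kernel []       eqs ()
    kernel (i ∷ Is) eqs lt with Any.any? (λ E → ¬? (E i ≟K 𝟘)) eqs
    ... | no none = (𝟏 , i) ∷ map (𝟘 ,_) Is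
      , cong (i ∷_) (trans (sym (Listₚ.map-∘ Is)) (Listₚ.map-id Is))
      , here 𝟏≢𝟘
      , λ E E∈ → trans (cong₂ _⊞_ (trans (⊠-identityˡ _) (vanish E E∈)) (comb-zeros Is E)) (⊞-identityˡ 𝟘)
      where
      vanish : ∀ E → E ∈ eqs → E i ≡ 𝟘
      vanish E E∈ with E i ≟K 𝟘
      ... | yes eq = eq
      ... | no ne  = ⊥-elim (none (Any.map (λ { refl → ne }) E∈))
    ... | yes some with find some
    ...   | E₀ , E₀∈ , ne with inv (E₀ i) ne
    ...     | k , E₀k≡1 with kernel Is (map (λ E j → E j ⊞ ⊟ ((E i ⊠ k) ⊠ E₀ j)) (remove E₀∈))
                              (≤-trans (s≤s (≡⇒≤ (Listₚ.length-map _ (remove E₀∈)))) (≤-trans (≡⇒≤ (sym (length-remove E₀∈))) (s≤s⁻¹ lt)))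
    ...       | cs , idx , nz , ker = (⊟ (k ⊠ S) , i) ∷ cs , cong (i ∷_) idx , there nz , vanish
      where
      S : K
      S = comb cs E₀
      E₀-vanish : (⊟ (k ⊠ S)) ⊠ E₀ i ⊞ S ≡ 𝟘
      E₀-vanish = begin
        (⊟ (k ⊠ S)) ⊠ E₀ i ⊞ S ≡⟨ solve 3 (λ k s e → (:- (k :* s)) :* e :+ s := :- ((e :* k) :* s) :+ s) refl k S (E₀ i) ⟩
        ⊟ ((E₀ i ⊠ k) ⊠ S) ⊞ S ≡⟨ cong (λ t → ⊟ (t ⊠ S) ⊞ S) E₀k≡1 ⟩
        ⊟ (𝟏 ⊠ S) ⊞ S ≡⟨ cong (λ t → ⊟ t ⊞ S) (⊠-identityˡ S) ⟩
        ⊟ S ⊞ S ≡⟨ trans (⊞-comm _ _) (⊟-inverseʳ S) ⟩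
        𝟘 ∎
      vanish : ∀ E → E ∈ eqs → (⊟ (k ⊠ S)) ⊠ E i ⊞ comb cs E ≡ 𝟘
      vanish E E∈ with ∈-split E₀∈ E∈
      ... | inj₁ refl = E₀-vanish
      ... | inj₂ E∈′  = begin
        (⊟ (k ⊠ S)) ⊠ E i ⊞ comb cs E ≡⟨ cong ((⊟ (k ⊠ S)) ⊠ E i ⊞_) (comb-reduce cs E (E i ⊠ k) E₀) ⟨
        (⊟ (k ⊠ S)) ⊠ E i ⊞ (comb cs _ ⊞ (E i ⊠ k) ⊠ S) ≡⟨ cong (λ t → (⊟ (k ⊠ S)) ⊠ E i ⊞ (t ⊞ (E i ⊠ k) ⊠ S)) (ker _ (∈ₚ.∈-map⁺ _ E∈′)) ⟩
        (⊟ (k ⊠ S)) ⊠ E i ⊞ (𝟘 ⊞ (E i ⊠ k) ⊠ S) ≡⟨ cong ((⊟ (k ⊠ S)) ⊠ E i ⊞_) (⊞-identityˡ _) ⟩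
        (⊟ (k ⊠ S)) ⊠ E i ⊞ (E i ⊠ k) ⊠ S ≡⟨ solve 3 (λ k s e → (:- (k :* s)) :* e :+ (e :* k) :* s := k :* s :- k :* s) refl k S (E i) ⟩
        k ⊠ S ⊞ ⊟ (k ⊠ S) ≡⟨ ⊟-inverseʳ _ ⟩
        𝟘 ∎

    -- The leading coefficients are 1 and the degrees are distinct, so the scalars vanish one after
    -- the other from the highest degree down. `go` descends from T, which exceeds every degree.
    independent : (L : I → List K) (cs : List (K × I)) → Unique (map (λ c → length (L (proj₂ c))) cs) →
                  (∀ l → comb cs (λ i → ser (L i) l) ≡ 𝟘) → ∀ c → c ∈ cs → proj₁ c ≡ 𝟘
    independent L cs u vanish c c∈ = go T c c∈ (m≤m+n T _)
      where
      deg : K × I → ℕ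
      deg c = length (L (proj₂ c))
      T : ℕ
      T = suc (∑ cs deg)
      go : ∀ n c → c ∈ cs → T ≤ n + deg c → proj₁ c ≡ 𝟘
      go zero    c c∈ le = ⊥-elim (<-irrefl refl (≤-trans le (∈⇒≤∑ deg c∈)))
      go (suc n) c c∈ le = begin
        proj₁ c ≡⟨ ⊠-identityʳ _ ⟨
        proj₁ c ⊠ 𝟏 ≡⟨ cong (proj₁ c ⊠_) (ser-lead (L (proj₂ c))) ⟨
        proj₁ c ⊠ ser (L (proj₂ c)) (deg c) ≡⟨ ∑K-single _ c∈ others ⟨
        comb cs (λ i → ser (L i) (deg c)) ≡⟨ vanish (deg c) ⟩
        𝟘 ∎
        where
        others : ∀ b → b ∈ remove c∈ → proj₁ b ⊠ ser (L (proj₂ b)) (deg c) ≡ 𝟘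
        others b b∈ with <-cmp (deg b) (deg c)
        ... | tri< lt _ _ = trans (cong (proj₁ b ⊠_) (ser-above (L (proj₂ b)) lt)) (⊠-zeroʳ _)
        ... | tri≈ _ eq _ = ⊥-elim (remove-≢ deg u c∈ b∈ eq)
        ... | tri> _ _ gt = trans (cong (_⊠ ser (L (proj₂ b)) (deg c)) (go n b (∈-remove⁻ c∈ b∈) (≤-trans le (≤-trans (≡⇒≤ (sym (+-suc n (deg c)))) (+-monoʳ-≤ n gt))))) (⊠-zeroˡ _)
          where
          ∈-remove⁻ : {A : Set} {x y : A} {ys : List A} (x∈ : x ∈ ys) → y ∈ remove x∈ → y ∈ ys
          ∈-remove⁻ (here _)   y∈         = there y∈
          ∈-remove⁻ (there x∈) (here eq)  = here eq
          ∈-remove⁻ (there x∈) (there y∈) = there (∈-remove⁻ x∈ y∈)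

  open LinearAlgebra

  evalN : ℕ → (ℕ → K) → K → K
  evalN zero    κ w = 𝟘
  evalN (suc n) κ w = κ 0 ⊞ w ⊠ evalN n (κ ∘ suc) w

  -- A polynomial function with n coefficients. Only n matters: it is the number of linear
  -- conditions that make φ vanish at all points at once.
  record Tame (n : ℕ) (φ : K → K) : Set where
    constructor _,ₜ_
    field
      coeffs : ℕ → K
      evals  : ∀ w → φ w ≡ evalN n coeffs w

  evalN-𝟘 : ∀ n {κ} w → (∀ e → e < n → κ e ≡ 𝟘) → evalN n κ w ≡ 𝟘
  evalN-𝟘 zero    w z = refl
  evalN-𝟘 (suc n) w z = trans (cong₂ (λ s t → s ⊞ w ⊠ t) (z 0 (s≤s z≤n)) (evalN-𝟘 n w (λ e lt → z (suc e) (s≤s lt)))) (trans (⊞-identityˡ _) (⊠-zeroʳ w))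

  extend : ℕ → (ℕ → K) → ℕ → K
  extend zero    κ e       = 𝟘
  extend (suc n) κ zero    = κ 0
  extend (suc n) κ (suc e) = extend n (κ ∘ suc) e

  evalN-extend : ∀ {n n′} κ w → n ≤ n′ → evalN n′ (extend n κ) w ≡ evalN n κ w
  evalN-extend {zero} {n′} κ w z≤n = evalN-𝟘 n′ w (λ _ _ → refl)
  evalN-extend κ w (s≤s le) = cong (λ t → κ 0 ⊞ w ⊠ t) (evalN-extend (κ ∘ suc) w le)

  evalN-+ : ∀ n κ κ′ w → evalN n (λ e → κ e ⊞ κ′ e) w ≡ evalN n κ w ⊞ evalN n κ′ w
  evalN-+ zero    κ κ′ w = sym (⊞-identityˡ 𝟘)
  evalN-+ (suc n) κ κ′ w = trans (cong (λ t → (κ 0 ⊞ κ′ 0) ⊞ w ⊠ t) (evalN-+ n _ _ w))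
    (solve 5 (λ a b w f g → (a :+ b) :+ w :* (f :+ g) := (a :+ w :* f) :+ (b :+ w :* g)) refl (κ 0) (κ′ 0) w _ _)

  evalN-* : ∀ n c κ w → evalN n (λ e → c ⊠ κ e) w ≡ c ⊠ evalN n κ w
  evalN-* zero    c κ w = sym (⊠-zeroʳ c)
  evalN-* (suc n) c κ w = trans (cong (λ t → c ⊠ κ 0 ⊞ w ⊠ t) (evalN-* n c _ w))
    (solve 4 (λ c a w f → c :* a :+ w :* (c :* f) := c :* (a :+ w :* f)) refl c (κ 0) w _)

  tame-ext : ∀ {n φ ψ} → (∀ w → ψ w ≡ φ w) → Tame n φ → Tame n ψ
  tame-ext eq (κ ,ₜ p) = κ ,ₜ λ w → trans (eq w) (p w)

  tame-const : ∀ c → Tame 1 (λ _ → c)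
  tame-const c = (λ _ → c) ,ₜ λ w → sym (trans (cong (c ⊞_) (⊠-zeroʳ w)) (⊞-identityʳ c))

  tame-≤ : ∀ {n n′ φ} → n ≤ n′ → Tame n φ → Tame n′ φ
  tame-≤ {n} le (κ ,ₜ p) = extend n κ ,ₜ λ w → trans (p w) (sym (evalN-extend κ w le))

  tame-⊞ : ∀ {n φ ψ} → Tame n φ → Tame n ψ → Tame n (λ w → φ w ⊞ ψ w)
  tame-⊞ {n} (κ ,ₜ p) (κ′ ,ₜ p′) = (λ e → κ e ⊞ κ′ e) ,ₜ λ w → trans (cong₂ _⊞_ (p w) (p′ w)) (sym (evalN-+ n κ κ′ w))

  tame-⊠ : ∀ {n φ} c → Tame n φ → Tame n (λ w → c ⊠ φ w)
  tame-⊠ {n} c (κ ,ₜ p) = (λ e → c ⊠ κ e) ,ₜ λ w → trans (cong (c ⊠_) (p w)) (sym (evalN-* n c κ w))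

  tame-var : ∀ {n φ} → Tame n φ → Tame (suc n) (λ w → w ⊠ φ w)
  tame-var (κ ,ₜ p) = (λ { zero → 𝟘 ; (suc e) → κ e }) ,ₜ λ w → trans (cong (w ⊠_) (p w)) (sym (⊞-identityˡ _))

  tame-lin : ∀ {n φ} t → Tame n φ → Tame (suc n) (λ w → (w ⊞ t) ⊠ φ w)
  tame-lin {n} {φ} t p = tame-ext (λ w → solve 3 (λ w t f → (w :+ t) :* f := w :* f :+ t :* f) refl w t (φ w))
    (tame-⊞ (tame-var p) (tame-≤ (n≤1+n n) (tame-⊠ t p)))

  tame-pow : ∀ {n φ} t k → Tame n φ → Tame (k + n) (λ w → powK (w ⊞ t) k ⊠ φ w)
  tame-pow t zero    p = tame-ext (λ w → ⊠-identityˡ _) p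
  tame-pow t (suc k) p = tame-ext (λ w → ⊠-assoc _ _ _) (tame-lin t (tame-pow t k p))

  value : List K → K → K
  value ts w = ∏K ts (w ⊞_)

  tame-value^ : ∀ {n φ} ts M → Tame n φ → Tame (length ts * M + n) (λ w → powK (value ts w) M ⊠ φ w)
  tame-value^ [] M p = tame-ext (λ w → trans (cong (_⊠ _) (powK-1 M)) (⊠-identityˡ _)) p
  tame-value^ {n} {φ} (t ∷ ts) M p = tame-≤ (≡⇒≤ (sym (+-assoc M (length ts * M) n)))
    (tame-ext (λ w → trans (cong (_⊠ φ w) (powK-* (w ⊞ t) (value ts w) M)) (⊠-assoc _ _ _)) (tame-pow t M (tame-value^ ts M p)))

  -- For l ≤ M, conv y M a Ψ l is the sum of the terms a i · y^(M − i) · Ψ (l − i).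
  conv : K → ℕ → (ℕ → K) → Series → Series
  conv y M       a Ψ zero    = a 0 ⊠ (powK y M ⊠ Ψ 0)
  conv y zero    a Ψ (suc l) = 𝟘
  conv y (suc M) a Ψ (suc l) = a 0 ⊠ (powK y (suc M) ⊠ Ψ (suc l)) ⊞ conv y M (a ∘ suc) Ψ l

  conv-𝟘 : ∀ y M Ψ l → conv y M (λ _ → 𝟘) Ψ l ≡ 𝟘
  conv-𝟘 y M       Ψ zero    = ⊠-zeroˡ _
  conv-𝟘 y zero    Ψ (suc l) = refl
  conv-𝟘 y (suc M) Ψ (suc l) = trans (cong₂ _⊞_ (⊠-zeroˡ _) (conv-𝟘 y M Ψ l)) (⊞-identityˡ 𝟘)

  conv-one : ∀ y M Ψ l → l ≤ M → conv y M one Ψ l ≡ powK y M ⊠ Ψ l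
  conv-one y M       Ψ zero    le       = ⊠-identityˡ _
  conv-one y (suc M) Ψ (suc l) (s≤s le) = trans (cong₂ _⊞_ (⊠-identityˡ _) (conv-𝟘 y M Ψ l)) (⊞-identityʳ _)

  conv-+ : ∀ y M a b Ψ l → conv y M (λ i → a i ⊞ b i) Ψ l ≡ conv y M a Ψ l ⊞ conv y M b Ψ l
  conv-+ y M       a b Ψ zero    = solve 3 (λ a b p → (a :+ b) :* p := a :* p :+ b :* p) refl (a 0) (b 0) (powK y M ⊠ Ψ 0)
  conv-+ y zero    a b Ψ (suc l) = sym (⊞-identityˡ 𝟘)
  conv-+ y (suc M) a b Ψ (suc l) = trans (cong ((a 0 ⊞ b 0) ⊠ _ ⊞_) (conv-+ y M _ _ Ψ l))
    (solve 5 (λ a b p f g → (a :+ b) :* p :+ (f :+ g) := (a :* p :+ f) :+ (b :* p :+ g)) refl (a 0) (b 0) (powK y (suc M) ⊠ Ψ (suc l)) _ _)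

  -- Binomial coefficients in K by their recurrence, which makes sense in every characteristic.
  pascal : ℕ → ℕ → K
  pascal zero    i       = one i
  pascal (suc n) zero    = pascal n zero
  pascal (suc n) (suc i) = pascal n (suc i) ⊞ pascal n i

  -- (y + h)ⁿ = yⁿ (1 + h/y)ⁿ, and the factor yᴹ clears the denominators up to hᴹ. This isolates the
  -- high power yⁿ; what remains has degree at most M in y.
  lins-replicate : ∀ y M n Ψ l → l ≤ M → powK y M ⊠ lins (replicate n y) Ψ l ≡ powK y n ⊠ conv y M (pascal n) Ψ l
  lins-replicate y M zero Ψ l le = sym (trans (⊠-identityˡ _) (conv-one y M Ψ l le))
  lins-replicate y M (suc n) Ψ zero le = begin
    powK y M ⊠ (y ⊠ E 0) ≡⟨ solve 3 (λ p y f → p :* (y :* f) := y :* (p :* f)) refl (powK y M) y (E 0) ⟩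
    y ⊠ (powK y M ⊠ E 0) ≡⟨ cong (y ⊠_) (lins-replicate y M n Ψ zero le) ⟩
    y ⊠ (powK y n ⊠ conv y M (pascal n) Ψ zero) ≡⟨ ⊠-assoc _ _ _ ⟨
    powK y (suc n) ⊠ conv y M (pascal n) Ψ zero ∎
    where E = lins (replicate n y) Ψ
  lins-replicate y (suc M) (suc n) Ψ (suc l) (s≤s le) = begin
    powK y (suc M) ⊠ (y ⊠ E (suc l) ⊞ E l)
      ≡⟨ solve 4 (λ y p f g → (y :* p) :* (y :* f :+ g) := y :* ((y :* p) :* f) :+ y :* (p :* g)) refl y (powK y M) (E (suc l)) (E l) ⟩
    y ⊠ (powK y (suc M) ⊠ E (suc l)) ⊞ y ⊠ (powK y M ⊠ E l)
      ≡⟨ cong₂ (λ s t → y ⊠ s ⊞ y ⊠ t) (lins-replicate y (suc M) n Ψ (suc l) (s≤s le)) (lins-replicate y M n Ψ l le) ⟩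
    y ⊠ (powK y n ⊠ (A ⊞ conv y M (pascal n ∘ suc) Ψ l)) ⊞ y ⊠ (powK y n ⊠ conv y M (pascal n) Ψ l)
      ≡⟨ solve 5 (λ y p a f g → y :* (p :* (a :+ f)) :+ y :* (p :* g) := (y :* p) :* (a :+ (f :+ g))) refl y (powK y n) A _ _ ⟩
    powK y (suc n) ⊠ (A ⊞ (conv y M (pascal n ∘ suc) Ψ l ⊞ conv y M (pascal n) Ψ l))
      ≡⟨ cong (λ t → powK y (suc n) ⊠ (A ⊞ t)) (conv-+ y M _ _ Ψ l) ⟨
    powK y (suc n) ⊠ conv y (suc M) (pascal (suc n)) Ψ (suc l) ∎
    where
    E = lins (replicate n y) Ψ
    A = pascal n 0 ⊠ (powK y (suc M) ⊠ Ψ (suc l))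

  tame-conv : ∀ {n} t {Ψ : K → Series} → (∀ l → Tame n (λ w → Ψ w l)) → ∀ M a l → Tame (M + n) (λ w → conv (w ⊞ t) M a (Ψ w) l)
  tame-conv t p M       a zero    = tame-⊠ (a 0) (tame-pow t M (p 0))
  tame-conv {n} t p zero    a (suc l) = (λ _ → 𝟘) ,ₜ λ w → sym (evalN-𝟘 n w (λ _ _ → refl))
  tame-conv t p (suc M) a (suc l) = tame-⊞ (tame-⊠ (a 0) (tame-pow t (suc M) (p (suc l)))) (tame-≤ (n≤1+n _) (tame-conv t p M (a ∘ suc) l))

  convs : List K → K → ℕ → Series → Series
  convs []       w M Ψ = Ψ
  convs (t ∷ ts) w M Ψ = conv (w ⊞ t) M (pascal half) (convs ts w M Ψ)

  tame-convs : ∀ {n} ts {Ψ : K → Series} M → (∀ l → Tame n (λ w → Ψ w l)) → ∀ l → Tame (length ts * M + n) (λ w → convs ts w M (Ψ w) l)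
  tame-convs []       M p = p
  tame-convs {n} (t ∷ ts) M p l = tame-≤ (≡⇒≤ (sym (+-assoc M (length ts * M) n))) (tame-conv t (tame-convs ts M p) M (pascal half) l)

  tame-lins : ∀ {n} s {Ψ : K → Series} → (∀ l → Tame n (λ w → Ψ w l)) → ∀ l → Tame (s + n) (λ w → lins (replicate s (w ⊞ 𝟘)) (Ψ w) l)
  tame-lins zero    p l       = p l
  tame-lins (suc s) p zero    = tame-lin 𝟘 (tame-lins s p 0)
  tame-lins (suc s) p (suc l) = tame-⊞ (tame-lin 𝟘 (tame-lins s p (suc l))) (tame-≤ (n≤1+n _) (tame-lins s p l))

  -- The linear factors of f^((q−1)/2), where f = ∏ (X + t).
  halves : List K → List K
  halves []       = []
  halves (t ∷ ts) = replicate half t ++ halves ts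

  -- The core of Stepanov's method: around w, f^((q - 1)/2) is its value at w times a series whose
  -- coefficients become polynomials in w of low degree after multiplication by f(w)ᴹ. On a level
  -- set that value is the constant ε, and the huge degree is gone.
  lins-halves : ∀ ts w M Ψ l → l < M →
                powK (value ts w) M ⊠ lins (map (w ⊞_) (halves ts)) Ψ l ≡ powK (value ts w) half ⊠ convs ts w M Ψ l
  lins-halves []       w M Ψ l lt = cong (_⊠ Ψ l) (trans (powK-1 M) (sym (powK-1 half)))
  lins-halves (t ∷ ts) w M Ψ l lt = begin
    powK (y ⊠ v) M ⊠ lins (map (w ⊞_) (replicate half t ++ halves ts)) Ψ l
      ≡⟨ cong₂ (λ a ys → a ⊠ lins ys Ψ l) (powK-* y v M) (trans (Listₚ.map-++ (w ⊞_) (replicate half t) _) (cong (_++ map (w ⊞_) (halves ts)) (Listₚ.map-replicate (w ⊞_) half t))) ⟩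
    (powK y M ⊠ powK v M) ⊠ lins (replicate half y ++ map (w ⊞_) (halves ts)) Ψ l
      ≡⟨ trans (⊠-assoc _ _ _) (cong (λ Φ → powK y M ⊠ (powK v M ⊠ Φ l)) (lins-++ (replicate half y) _ Ψ)) ⟩
    powK y M ⊠ (powK v M ⊠ lins (replicate half y) (lins (map (w ⊞_) (halves ts)) Ψ) l)
      ≡⟨ cong (powK y M ⊠_) (lins-cong (replicate half y) (lins-halves ts w M Ψ) l lt) ⟩
    powK y M ⊠ (powK v half ⊠ lins (replicate half y) B l)
      ≡⟨ solve 3 (λ a b c → a :* (b :* c) := b :* (a :* c)) refl (powK y M) (powK v half) _ ⟩
    powK v half ⊠ (powK y M ⊠ lins (replicate half y) B l)
      ≡⟨ cong (powK v half ⊠_) (lins-replicate y M half B l (<⇒≤ lt)) ⟩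
    powK v half ⊠ (powK y half ⊠ conv y M (pascal half) B l)
      ≡⟨ solve 3 (λ a b c → a :* (b :* c) := (b :* a) :* c) refl (powK v half) (powK y half) _ ⟩
    (powK y half ⊠ powK v half) ⊠ conv y M (pascal half) B l
      ≡⟨ cong (_⊠ conv y M (pascal half) B l) (powK-* y v half) ⟨
    powK (y ⊠ v) half ⊠ conv y M (pascal half) B l ∎
    where
    y = w ⊞ t
    v = value ts w
    B = convs ts w M Ψ

  -- Modulo h^q the power (w + h)^(j q) is the constant wʲ: a factor X^(j q) makes the auxiliary
  -- polynomials numerous but adds only j to the degree of the conditions.
  frobenius^ : ∀ w j l → l < q → 𝟏 ⊠ ser (replicate (j * q) w) l ≡ powK w j ⊠ one l
  frobenius^ w zero    l lt = refl
  frobenius^ w (suc j) l lt = begin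
    𝟏 ⊠ ser (replicate (q + j * q) w) l ≡⟨ cong (λ ys → 𝟏 ⊠ ser ys l) (replicate-+ q (j * q) w) ⟩
    𝟏 ⊠ ser (replicate q w ++ replicate (j * q) w) l ≡⟨ cong (λ Φ → 𝟏 ⊠ Φ l) (lins-++ (replicate q w) _ one) ⟩
    𝟏 ⊠ lins (replicate q w) (ser (replicate (j * q) w)) l ≡⟨ lins-cong (replicate q w) (frobenius^ w j) l lt ⟩
    powK w j ⊠ lins (replicate q w) one l ≡⟨ cong (powK w j ⊠_) (trans (sym (⊠-identityˡ _)) (frobenius w l lt)) ⟩
    powK w j ⊠ (w ⊠ one l) ≡⟨ solve 3 (λ a b c → a :* (b :* c) := (b :* a) :* c) refl (powK w j) w (one l) ⟩
    powK w (suc j) ⊠ one l ∎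

  -- The auxiliary polynomial combines the products Xˢ f^(i · half) X^(j q) with i ∈ {0 , 1}, s < D
  -- and j < J, and is to vanish to order M on the level set of ε. Each Taylor coefficient is a
  -- polynomial in w with N coefficients, which gives M N conditions on 2 J D unknowns.
  module Auxiliary (ts : List K) (m′ D M J : ℕ) (odd : length ts ≡ 1 + 2 * m′) (D+m′ : D + m′ ≡ half) (M≤q : M ≤ q)
                   (ε : K) where

    I : Set
    I = Bool × ℕ × Fin D

    N : ℕ
    N = length ts * M + (J + (D + 1))

    part : Bool → List K
    part false = []
    part true  = halves ts

    factors : I → List K
    factors (i , j , s) = replicate (toℕ s) 𝟘 ++ (part i ++ replicate (j * q) 𝟘)

    φ : I → ℕ → K → K
    φ (false , j , s) l w = powK (value ts w) M ⊠ (powK (w ⊞ 𝟘) j ⊠ lins (replicate (toℕ s) (w ⊞ 𝟘)) one l)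
    φ (true  , j , s) l w = ε ⊠ (powK (w ⊞ 𝟘) j ⊠ lins (replicate (toℕ s) (w ⊞ 𝟘)) (convs ts w M one) l)

    tame-one : ∀ l → Tame 1 (λ _ → one l)
    tame-one l = tame-const (one l)

    tame-φ : ∀ i j s l → j < J → Tame N (φ (i , j , s) l)
    tame-φ false j s l j<J = tame-≤ (+-monoʳ-≤ (length ts * M) (+-mono-≤ (<⇒≤ j<J) (+-monoˡ-≤ 1 (<⇒≤ (Finₚ.toℕ<n s)))))
      (tame-value^ ts M (tame-pow 𝟘 j (tame-lins (toℕ s) tame-one l)))
    tame-φ true j s l j<J = tame-≤ le
      (tame-⊠ ε (tame-pow 𝟘 j (tame-lins (toℕ s) (tame-convs ts M tame-one) l)))
      where
      le : j + (toℕ s + (length ts * M + 1)) ≤ N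
      le = ≤-trans (≡⇒≤ (rearrange j (toℕ s) (length ts * M))) (+-monoʳ-≤ (length ts * M) (+-mono-≤ (<⇒≤ j<J) (+-monoˡ-≤ 1 (<⇒≤ (Finₚ.toℕ<n s)))))
        where
        rearrange : ∀ a b c → a + (b + (c + 1)) ≡ c + (a + (b + 1))
        rearrange = ℕR.solve-∀

    local : ∀ w → powK (value ts w) half ≡ ε → ∀ i l → l < M →
            powK (value ts w) M ⊠ ser (map (w ⊞_) (factors i)) l ≡ φ i l w
    local w f≡ε (i , j , s) l l<M = begin
      P ⊠ ser (map (w ⊞_) (factors (i , j , s))) l
        ≡⟨ cong (λ ys → P ⊠ ser ys l) (trans (Listₚ.map-++ (w ⊞_) (replicate (toℕ s) 𝟘) _)
             (cong₂ _++_ (Listₚ.map-replicate (w ⊞_) (toℕ s) 𝟘) (trans (Listₚ.map-++ (w ⊞_) (part i) _)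
               (cong (map (w ⊞_) (part i) ++_) (Listₚ.map-replicate (w ⊞_) (j * q) 𝟘))))) ⟩
      P ⊠ ser (S ++ (A ++ Z)) l
        ≡⟨ cong (λ Φ → P ⊠ Φ l) (trans (lins-++ S (A ++ Z) one) (cong (lins S) (lins-++ A Z one))) ⟩
      P ⊠ lins S (lins A (ser Z)) l
        ≡⟨ cong (P ⊠_) (trans (sym (⊠-identityˡ _)) (lins-cong {M} S (lins-cong A (λ k k<M → frobenius^ (w ⊞ 𝟘) j k (≤-trans k<M M≤q))) l l<M)) ⟩
      P ⊠ (powK (w ⊞ 𝟘) j ⊠ lins S (lins A one) l)
        ≡⟨ finish i ⟩
      φ (i , j , s) l w ∎
      where
      P = powK (value ts w) M
      S = replicate (toℕ s) (w ⊞ 𝟘)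
      A = map (w ⊞_) (part i)
      Z = replicate (j * q) (w ⊞ 𝟘)
      finish : ∀ i → P ⊠ (powK (w ⊞ 𝟘) j ⊠ lins S (lins (map (w ⊞_) (part i)) one) l) ≡ φ (i , j , s) l w
      finish false = refl
      finish true  = begin
        P ⊠ (Y ⊠ lins S X l) ≡⟨ solve 3 (λ a b c → a :* (b :* c) := b :* (a :* c)) refl P Y _ ⟩
        Y ⊠ (P ⊠ lins S X l) ≡⟨ cong (Y ⊠_) (lins-cong S (lins-halves ts w M one) l l<M) ⟩
        Y ⊠ (powK (value ts w) half ⊠ lins S (convs ts w M one) l) ≡⟨ cong (λ t → Y ⊠ (t ⊠ lins S (convs ts w M one) l)) f≡ε ⟩
        Y ⊠ (ε ⊠ lins S (convs ts w M one) l) ≡⟨ solve 3 (λ a b c → a :* (b :* c) := b :* (a :* c)) refl Y ε _ ⟩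
        ε ⊠ (Y ⊠ lins S (convs ts w M one) l) ∎
        where
        Y = powK (w ⊞ 𝟘) j
        X = lins (map (w ⊞_) (halves ts)) one

    bit : Bool → ℕ
    bit false = 0
    bit true  = 1

    length-halves : ∀ us → length (halves us) ≡ length us * half
    length-halves []       = refl
    length-halves (u ∷ us) = trans (Listₚ.length-++ (replicate half u)) (cong₂ _+_ (Listₚ.length-replicate half) (length-halves us))

    residue : I → ℕ
    residue (i , j , s) = toℕ s + bit i * D

    level : I → ℕ
    level (i , j , s) = j + bit i * m′

    -- For m = 1 + 2 m′ linear factors, m · half = D + m′ q. A factor f^half thus moves the degree
    -- modulo q by D, clear of the residues s < D, and all degrees are distinct. An even m would
    -- move it by - m/2 and let degrees collide, hence the oddness.
    length-factors : ∀ i → length (factors i) ≡ residue i + level i * q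
    length-factors (i , j , s) = trans (trans (Listₚ.length-++ (replicate (toℕ s) 𝟘))
      (cong₂ _+_ (Listₚ.length-replicate (toℕ s)) (trans (Listₚ.length-++ (part i)) (cong (_+_ (length (part i))) (Listₚ.length-replicate (j * q))))))
      (by-part i)
      where
      by-part : ∀ i → toℕ s + (length (part i) + j * q) ≡ toℕ s + bit i * D + (j + bit i * m′) * q
      by-part false = cong₂ _+_ (sym (+-identityʳ _)) (cong (_* q) (sym (+-identityʳ j)))
      by-part true  = trans (cong (λ t → toℕ s + (t + j * q)) (trans (length-halves ts) (cong₂ _*_ odd (sym D+m′))))
        (trans (identity (toℕ s) m′ D j q) (trans (cong (λ t → toℕ s + (D + m′ * t + j * q)) (trans (cong (λ t → 1 + 2 * t) D+m′) (sym size)))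
          (identity′ (toℕ s) m′ D j q)))
        where
        identity : ∀ s m D j q → s + ((1 + 2 * m) * (D + m) + j * q) ≡ s + (D + m * (1 + 2 * (D + m)) + j * q)
        identity = ℕR.solve-∀
        identity′ : ∀ s m D j q → s + (D + m * q + j * q) ≡ s + 1 * D + (j + 1 * m) * q
        identity′ = ℕR.solve-∀

    residue<q : ∀ i → residue i < q
    residue<q (i , j , s) = bound
      where
      bit≤1 : ∀ i → bit i ≤ 1
      bit≤1 false = z≤n
      bit≤1 true  = ≤-refl
      bound : toℕ s + bit i * D < q
      bound = ≤-trans (+-mono-≤ (Finₚ.toℕ<n s) (*-monoˡ-≤ D (bit≤1 i)))
        (≤-trans (+-mono-≤ D≤half (*-monoʳ-≤ 1 D≤half)) (≤-trans (≡⇒≤ (double half)) (≤-trans (n≤1+n _) (≡⇒≤ (sym size)))))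
        where
        D≤half : D ≤ half
        D≤half = ≤-trans (m≤m+n D m′) (≡⇒≤ D+m′)
        double : ∀ h → h + 1 * h ≡ 2 * h
        double = ℕR.solve-∀

    factors-injective : ∀ {i i′} → length (factors i) ≡ length (factors i′) → i ≡ i′
    factors-injective {i} {i′} eq with divMod-unique {q} (residue<q i) (residue<q i′) (trans (sym (length-factors i)) (trans eq (length-factors i′)))
    ... | r≡ , l≡ = finish i i′ r≡ l≡
      where
      finish : ∀ i i′ → residue i ≡ residue i′ → level i ≡ level i′ → i ≡ i′
      finish (b , j , s) (b′ , j′ , s′) r≡ l≡ with divMod-unique {D} {k = bit b} {k′ = bit b′} (Finₚ.toℕ<n s) (Finₚ.toℕ<n s′) r≡
      finish (false , j , s) (false , j′ , s′) r≡ l≡ | s≡ , _ = cong₂ (λ j s → false , j , s) (+-cancelʳ-≡ 0 j j′ l≡) (Finₚ.toℕ-injective s≡)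
      finish (false , j , s) (true , j′ , s′) r≡ l≡ | _ , ()
      finish (true , j , s) (false , j′ , s′) r≡ l≡ | _ , ()
      finish (true , j , s) (true , j′ , s′) r≡ l≡ | s≡ , _ = cong₂ (λ j s → true , j , s) (+-cancelʳ-≡ (1 * m′) j j′ l≡) (Finₚ.toℕ-injective s≡)

    indices : List I
    indices = cart (false ∷ true ∷ []) (cart (upTo J) (allFin D))

    j<J : ∀ {i} → i ∈ indices → proj₁ (proj₂ i) < J
    j<J {i , j , s} i∈ = ∈ₚ.∈-upTo⁻ (proj₁ (∈ₚ.∈-cartesianProduct⁻ (upTo J) (allFin D) (proj₂ (∈ₚ.∈-cartesianProduct⁻ (false ∷ true ∷ []) _ i∈))))

    length-indices : length indices ≡ 2 * (J * D)
    length-indices = trans (length-cart _,_ (false ∷ true ∷ []) (cart (upTo J) (allFin D))) (cong (2 *_) (trans (length-cart _,_ (upTo J) (allFin D)) (cong₂ _*_ (Listₚ.length-upTo J) (Listₚ.length-tabulate {n = D} id))))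

    unique-indices : Unique indices
    unique-indices = Uniqueₚ.cartesianProduct⁺ (((λ ()) ∷ []) ∷ [] ∷ []) (Uniqueₚ.cartesianProduct⁺ (Uniqueₚ.upTo⁺ J) (Uniqueₚ.allFin⁺ D))

    combP : List (K × I) → Poly
    combP []             = []
    combP ((c , i) ∷ cs) = addP (scaleP c (prodP (factors i))) (combP cs)

    taylor-combP : ∀ w cs l → taylor w (combP cs) l ≡ comb cs (λ i → ser (map (w ⊞_) (factors i)) l)
    taylor-combP w []             l = refl
    taylor-combP w ((c , i) ∷ cs) l = trans (taylor-addP w (scaleP c (prodP (factors i))) (combP cs) l)
      (cong₂ _⊞_ (trans (taylor-scaleP w c (prodP (factors i)) l) (cong (c ⊠_) (taylor-prodP w (factors i) l))) (taylor-combP w cs l))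

    length-combP : ∀ cs n → (∀ c → c ∈ cs → suc (length (factors (proj₂ c))) ≤ n) → length (combP cs) ≤ n
    length-combP []             n le = z≤n
    length-combP ((c , i) ∷ cs) n le = length-addP (scaleP c (prodP (factors i))) (combP cs)
      (≤-trans (≡⇒≤ (Listₚ.length-map (c ⊠_) (prodP (factors i)))) (≤-trans (length-prodP (factors i)) (le _ (here refl))))
      (length-combP cs n (λ c c∈ → le c (there c∈)))

    κ : I → ℕ → ℕ → K
    κ (i , j , s) l e with j <? J
    ... | yes j<J = Tame.coeffs (tame-φ i j s l j<J) e
    ... | no _    = 𝟘

    κ-φ : ∀ i l → proj₁ (proj₂ i) < J → ∀ w → φ i l w ≡ evalN N (κ i l) w
    κ-φ (i , j , s) l lt w with j <? J
    ... | yes j<J = Tame.evals (tame-φ i j s l j<J) w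
    ... | no j≮J  = ⊥-elim (j≮J lt)

    equations : List (I → K)
    equations = cartWith (λ l e i → κ i l e) (upTo M) (upTo N)

    length-equations : length equations ≡ M * N
    length-equations = trans (length-cart (λ l e i → κ i l e) (upTo M) (upTo N)) (cong₂ _*_ (Listₚ.length-upTo M) (Listₚ.length-upTo N))

    comb-evalN : ∀ n cs (κ′ : I → ℕ → K) w → comb cs (λ i → evalN n (κ′ i) w) ≡ evalN n (λ e → comb cs (λ i → κ′ i e)) w
    comb-evalN n []             κ′ w = sym (evalN-𝟘 n w (λ _ _ → refl))
    comb-evalN n ((c , i) ∷ cs) κ′ w = trans (cong₂ _⊞_ (sym (evalN-* n c (κ′ i) w)) (comb-evalN n cs κ′ w)) (sym (evalN-+ n _ _ w))

    -- More unknowns than conditions give a nontrivial combination vanishing to order M on Z. Its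
    -- degree is below (J + m′) q, so it has too many zeros and vanishes identically, against
    -- `independent`.
    stepanov : M * N < 2 * (J * D) → ε ≢ 𝟘 → (Z : List K) → Unique Z → (∀ w → w ∈ Z → powK (value ts w) half ≡ ε) →
               (J + m′) * q ≤ length Z * M → ⊥
    stepanov lt ε≢0 Z uZ f≡ε le with kernel indices equations (≤-trans (s≤s (≡⇒≤ length-equations)) (≤-trans lt (≡⇒≤ (sym length-indices))))
    ... | cs , idx , nz , ker with find nz
    ...   | c₀ , c₀∈ , c₀≢0 = c₀≢0 (independent (λ i → map (𝟘 ⊞_) (factors i)) cs
              (subst Unique degrees (Uniqueₚ.map⁺ factors-injective unique-indices))
              (λ l → trans (sym (taylor-combP 𝟘 cs l)) (F≡0 𝟘 l)) c₀ c₀∈)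
      where
      degrees : map (λ i → length (factors i)) indices ≡ map (λ c → length (map (𝟘 ⊞_) (factors (proj₂ c)))) cs
      degrees = trans (cong (map _) (sym idx)) (trans (sym (Listₚ.map-∘ cs)) (Listₚ.map-cong (λ c → sym (Listₚ.length-map (𝟘 ⊞_) (factors (proj₂ c)))) cs))
      member : ∀ c → c ∈ cs → proj₂ c ∈ indices
      member c c∈ = subst (proj₂ c ∈_) idx (∈ₚ.∈-map⁺ proj₂ c∈)
      value≢0 : ∀ w → w ∈ Z → value ts w ≢ 𝟘
      value≢0 w w∈ eq = ε≢0 (trans (sym (f≡ε w w∈)) (trans (cong (λ t → powK t half) eq) (vanish half half≢0)))
        where
        vanish : ∀ n → n ≢ 0 → powK 𝟘 n ≡ 𝟘
        vanish zero    ne = ⊥-elim (ne refl)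
        vanish (suc n) _  = ⊠-zeroˡ _
        -- With half = 0 also D = 0, and `lt` would put a natural number below 0.
        half≢0 : half ≢ 0
        half≢0 eq = n≮0 (≤-trans lt (≡⇒≤ (trans (cong (λ t → 2 * (J * t)) (m+n≡0⇒m≡0 D (trans D+m′ eq))) (cong (2 *_) (*-zeroʳ J)))))
      F≡0 : ∀ w l → taylor w (combP cs) l ≡ 𝟘
      F≡0 = roots⇒zero M (combP cs) Z uZ order (≤-trans (length-combP cs ((J + m′) * q) short) le)
        where
        order : ∀ w → w ∈ Z → ∀ l → l < M → taylor w (combP cs) l ≡ 𝟘
        order w w∈ l l<M = integral (begin
          P ⊠ taylor w (combP cs) l ≡⟨ cong (P ⊠_) (taylor-combP w cs l) ⟩
          P ⊠ comb cs (λ i → ser (map (w ⊞_) (factors i)) l) ≡⟨ ∑K-*ˡ P cs _ ⟨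
          ∑K cs (λ c → P ⊠ (proj₁ c ⊠ ser (map (w ⊞_) (factors (proj₂ c))) l))
            ≡⟨ ∑K-cong cs (λ c c∈ → trans (solve 3 (λ p a b → p :* (a :* b) := a :* (p :* b)) refl P (proj₁ c) _)
                 (cong (proj₁ c ⊠_) (trans (local w (f≡ε w w∈) (proj₂ c) l l<M) (κ-φ (proj₂ c) l (j<J (member c c∈)) w)))) ⟩
          comb cs (λ i → evalN N (κ i l) w) ≡⟨ comb-evalN N cs (λ i → κ i l) w ⟩
          evalN N (λ e → comb cs (λ i → κ i l e)) w ≡⟨ evalN-𝟘 N w (λ e e<N → ker _ (∈ₚ.∈-cartesianProductWith⁺ (λ l e i → κ i l e) (∈ₚ.∈-upTo⁺ l<M) (∈ₚ.∈-upTo⁺ e<N))) ⟩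
          𝟘 ∎) (powK-≢𝟘 M (value≢0 w w∈))
          where P = powK (value ts w) M
        short : ∀ c → c ∈ cs → suc (length (factors (proj₂ c))) ≤ (J + m′) * q
        short c c∈ = ≤-trans (≡⇒≤ (cong suc (length-factors (proj₂ c)))) (≤-trans (+-monoˡ-≤ _ (residue<q (proj₂ c)))
          (*-monoˡ-≤ q {suc (level (proj₂ c))} (+-mono-≤ (j<J (member c c∈)) (≤-trans (*-monoˡ-≤ m′ (bit≤1 (proj₁ (proj₂ c)))) (≡⇒≤ (*-identityˡ m′))))))
          where
          bit≤1 : ∀ i → bit i ≤ 1
          bit≤1 false = z≤n
          bit≤1 true  = ≤-refl

-- Quadratic characters

-- μ is the integer part of √(n/8). The 8 leaves 2 D ≥ 7 μ² in `weil-odd`, enough room there for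
-- vanishing order 2 μ.
sqrt8 : ∀ n → Σ ℕ (λ μ → 8 * (μ * μ) ≤ n × n < 8 * (suc μ * suc μ))
sqrt8 zero = 0 , z≤n , s≤s z≤n
sqrt8 (suc n) with sqrt8 n
... | μ , lo , hi with suc n <? 8 * (suc μ * suc μ)
...   | yes lt = μ , m≤n⇒m≤1+n lo , lt
...   | no nlt = suc μ , ≮⇒≥ nlt , ≤-trans (s≤s hi) (*-monoʳ-< 8 {suc μ * suc μ} {suc (suc μ) * suc (suc μ)} (*-mono-< {suc μ} {suc (suc μ)} {suc μ} {suc (suc μ)} (n<1+n _) (n<1+n _)))

∣⊖∣≤ : ∀ m n k → m ≤ n + k → n ≤ m + k → ∣ m ℤ.⊖ n ∣ ≤ k
∣⊖∣≤ m n k m≤ n≤ with ≤-total m n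
... | inj₁ le = ≤-trans (≡⇒≤ (trans (cong ∣_∣ (ℤₚ.⊖-≤ le)) (ℤₚ.∣-i∣≡∣i∣ (+ (n ∸ m))))) (m≤n+o⇒m∸n≤o n m n≤)
... | inj₂ le = ≤-trans (≡⇒≤ (cong ∣_∣ (ℤₚ.⊖-≥ le))) (m≤n+o⇒m∸n≤o m n m≤)

module Character (𝔽 : FiniteField) where
  open FiniteField 𝔽
  open FieldTheory 𝔽
  open Stepanov 𝔽
  open ≡-Reasoning

  half>0 : 0 < half
  half>0 with half | size
  ... | suc _ | _  = s≤s z≤n
  ... | zero  | sz = ⊥-elim (n≮n 1 (≤-trans
    (injective⇒length≤ {xs = 𝟘 ∷ 𝟏 ∷ []} {ys = elems} id (((λ eq → 𝟏≢𝟘 (sym eq)) ∷ []) ∷ [] ∷ []) (λ _ _ eq → eq) (λ {x} _ → all∈ x))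
    (≡⇒≤ sz)))

  -- X^half - ε has leading coefficient 1, so it cannot vanish at more than `half` points.
  length-level≤ : ∀ ε Z → Unique Z → (∀ x → x ∈ Z → powK x half ≡ ε) → length Z ≤ half
  length-level≤ ε Z u r with length Z ≤? half
  ... | yes le = le
  ... | no nle = ⊥-elim (𝟏≢𝟘 (begin
    𝟏 ≡⟨ trans (cong₂ _⊞_ lead (low half half>0)) (⊞-identityʳ 𝟏) ⟨
    taylor 𝟘 G half ⊞ taylor 𝟘 (⊟ ε ∷ []) half ≡⟨ taylor-addP 𝟘 G (⊟ ε ∷ []) half ⟨
    taylor 𝟘 F half ≡⟨ roots⇒zero 1 F Z u (λ { x x∈ zero _ → root x (r x x∈) ; x x∈ (suc _) (s≤s ()) }) short 𝟘 half ⟩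
    𝟘 ∎))
    where
    G = prodP (replicate half 𝟘)
    F = addP G (⊟ ε ∷ [])
    short : length F ≤ length Z * 1
    short = ≤-trans (length-addP {suc half} G (⊟ ε ∷ []) (≤-trans (length-prodP (replicate half 𝟘)) (≡⇒≤ (cong suc (Listₚ.length-replicate half)))) (s≤s z≤n))
      (≤-trans (≰⇒> nle) (≡⇒≤ (sym (*-identityʳ _))))
    ser-G : ∀ x l → taylor x G l ≡ ser (replicate half x) l
    ser-G x l = trans (taylor-prodP x (replicate half 𝟘) l) (cong (λ ys → ser ys l) (trans (Listₚ.map-replicate (x ⊞_) half 𝟘) (cong (replicate half) (⊞-identityʳ x))))
    root : ∀ x → powK x half ≡ ε → taylor x F 0 ≡ 𝟘
    root x eq = begin
      taylor x F 0 ≡⟨ taylor-addP x G (⊟ ε ∷ []) 0 ⟩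
      taylor x G 0 ⊞ (⊟ ε ⊞ x ⊠ 𝟘) ≡⟨ cong₂ _⊞_ (trans (ser-G x 0) (trans (ser-const x half) eq)) (trans (cong (⊟ ε ⊞_) (⊠-zeroʳ x)) (⊞-identityʳ _)) ⟩
      ε ⊞ ⊟ ε ≡⟨ ⊟-inverseʳ ε ⟩
      𝟘 ∎
    lead : taylor 𝟘 G half ≡ 𝟏
    lead = trans (ser-G 𝟘 half) (trans (cong (ser (replicate half 𝟘)) (sym (Listₚ.length-replicate half))) (ser-lead (replicate half 𝟘)))
    low : ∀ l → 0 < l → taylor 𝟘 (⊟ ε ∷ []) l ≡ 𝟘
    low (suc l) _ = trans (⊞-identityʳ _) (⊠-zeroˡ 𝟘)

  square-𝟏 : ∀ {x} → x ⊠ x ≡ 𝟏 → x ≡ 𝟏 ⊎ x ≡ ⊟ 𝟏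
  square-𝟏 {x} eq with x ≟K 𝟏
  ... | yes x≡1 = inj₁ x≡1
  ... | no x≢1  = inj₂ (⊟-≡⇒≡ (integral (begin
    (x ⊞ ⊟ 𝟏) ⊠ (x ⊞ ⊟ ⊟ 𝟏) ≡⟨ solve 2 (λ x o → (x :+ :- o) :* (x :+ :- (:- o)) := x :* x :+ :- (o :* o)) refl x 𝟏 ⟩
    x ⊠ x ⊞ ⊟ (𝟏 ⊠ 𝟏) ≡⟨ cong₂ (λ s t → s ⊞ ⊟ t) eq (⊠-identityˡ 𝟏) ⟩
    𝟏 ⊞ ⊟ 𝟏 ≡⟨ ⊟-inverseʳ 𝟏 ⟩
    𝟘 ∎) (λ eq′ → x≢1 (⊟-≡⇒≡ eq′))))

  unit-half : ∀ {x} → x ≢ 𝟘 → powK x half ≡ 𝟏 ⊎ powK x half ≡ ⊟ 𝟏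
  unit-half {x} x≢0 = square-𝟏 (begin
    powK x half ⊠ powK x half ≡⟨ powK-+ x half half ⟨
    powK x (half + half) ≡⟨ cong (λ n → powK x (half + n)) (sym (+-identityʳ half)) ⟩
    powK x (2 * half) ≡⟨ unit^ x≢0 ⟩
    𝟏 ∎)

  ∈units⇒≢𝟘 : ∀ {x} → x ∈ units → x ≢ 𝟘
  ∈units⇒≢𝟘 x∈ = proj₂ (∈ₚ.∈-filter⁻ nonzero? {xs = elems} x∈)

  -- If all 2 · half units satisfied x^half = 1, that equation would have too many solutions for
  -- `length-level≤`.
  nonresidue : Σ K (λ ν → ν ≢ 𝟘 × powK ν half ≢ 𝟏)
  nonresidue with Any.any? (λ x → ¬? (powK x half ≟K 𝟏)) units
  ... | yes some with find some
  ...   | ν , ν∈ , ne = ν , ∈units⇒≢𝟘 ν∈ , ne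
  nonresidue | no none = ⊥-elim (<-irrefl refl (≤-trans (m<m+n half half>0)
    (≤-trans (≡⇒≤ (trans (cong (_+_ half) (sym (+-identityʳ half))) (sym length-units)))
      (length-level≤ 𝟏 units units-unique all-one))))
    where
    all-one : ∀ x → x ∈ units → powK x half ≡ 𝟏
    all-one x x∈ with powK x half ≟K 𝟏
    ... | yes eq = eq
    ... | no ne  = ⊥-elim (none (Any.map (λ { refl → ne }) x∈))

  ⊟𝟏≢𝟏 : ⊟ 𝟏 ≢ 𝟏
  ⊟𝟏≢𝟏 eq = proj₂ (proj₂ nonresidue) ([ id , (λ e → trans e eq) ]′ (unit-half (proj₁ (proj₂ nonresidue))))

  ⊟𝟏≢𝟘 : ⊟ 𝟏 ≢ 𝟘
  ⊟𝟏≢𝟘 eq = 𝟏≢𝟘 (trans (sym (⊞-identityˡ 𝟏)) (trans (cong (_⊞ 𝟏) (sym eq)) (trans (⊞-comm _ _) (⊟-inverseʳ 𝟏))))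

  χ : K → ℤ
  χ x with x ≟K 𝟘
  ... | yes _ = 0ℤ
  ... | no _ with powK x half ≟K 𝟏
  ...   | yes _ = 1ℤ
  ...   | no _  = ℤ.-1ℤ

  χ-𝟘 : ∀ {x} → x ≡ 𝟘 → χ x ≡ 0ℤ
  χ-𝟘 {x} eq with x ≟K 𝟘
  ... | yes _ = refl
  ... | no ne = ⊥-elim (ne eq)

  powK-half-𝟘 : powK 𝟘 half ≡ 𝟘
  powK-half-𝟘 with half | half>0
  ... | suc n | _ = ⊠-zeroˡ _

  χ-+ : ∀ {x} → powK x half ≡ 𝟏 → χ x ≡ 1ℤ
  χ-+ {x} eq with x ≟K 𝟘
  ... | yes refl = ⊥-elim (𝟏≢𝟘 (trans (sym eq) powK-half-𝟘))
  ... | no _ with powK x half ≟K 𝟏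
  ...   | yes _ = refl
  ...   | no ne = ⊥-elim (ne eq)

  χ-- : ∀ {x} → powK x half ≡ ⊟ 𝟏 → χ x ≡ ℤ.-1ℤ
  χ-- {x} eq with x ≟K 𝟘
  ... | yes refl = ⊥-elim (⊟𝟏≢𝟘 (trans (sym eq) powK-half-𝟘))
  ... | no _ with powK x half ≟K 𝟏
  ...   | yes e = ⊥-elim (⊟𝟏≢𝟏 (trans (sym eq) e))
  ...   | no _  = refl

  data Sign (x : K) : ℤ → Set where
    zer : x ≡ 𝟘 → Sign x 0ℤ
    pos : x ≢ 𝟘 → powK x half ≡ 𝟏 → Sign x 1ℤ
    neg : x ≢ 𝟘 → powK x half ≡ ⊟ 𝟏 → Sign x ℤ.-1ℤ

  sign : ∀ x → Sign x (χ x)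
  sign x with x ≟K 𝟘
  ... | yes eq = zer eq
  ... | no ne with powK x half ≟K 𝟏
  ...   | yes e = pos ne e
  ...   | no n  = neg ne ([ (λ e → ⊥-elim (n e)) , id ]′ (unit-half ne))

  χ-* : ∀ x y → χ (x ⊠ y) ≡ χ x ℤ.* χ y
  χ-* x y with χ x | sign x | χ y | sign y
  ... | _ | zer refl | s | _         = trans (χ-𝟘 (⊠-zeroˡ y)) (sym (ℤₚ.*-zeroˡ s))
  ... | _ | pos _ _  | _ | zer refl  = χ-𝟘 (⊠-zeroʳ x)
  ... | _ | neg _ _  | _ | zer refl  = χ-𝟘 (⊠-zeroʳ x)
  ... | _ | pos _ e  | _ | pos _ e′  = χ-+ (trans (powK-* x y half) (trans (cong₂ _⊠_ e e′) (⊠-identityˡ 𝟏)))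
  ... | _ | pos _ e  | _ | neg _ e′  = χ-- (trans (powK-* x y half) (trans (cong₂ _⊠_ e e′) (⊠-identityˡ (⊟ 𝟏))))
  ... | _ | neg _ e  | _ | pos _ e′  = χ-- (trans (powK-* x y half) (trans (cong₂ _⊠_ e e′) (⊠-identityʳ (⊟ 𝟏))))
  ... | _ | neg _ e  | _ | neg _ e′  = χ-+ (trans (powK-* x y half) (trans (cong₂ _⊠_ e e′)
    (trans (solve 1 (λ o → (:- o) :* (:- o) := o :* o) refl 𝟏) (⊠-identityˡ 𝟏))))

  powK-𝟏 : powK 𝟏 half ≡ 𝟏
  powK-𝟏 = powK-1 half

  χ-∏ : {A : Set} (xs : List A) (h : A → K) → χ (∏K xs h) ≡ ℤΣ.∏ xs (χ ∘ h)
  χ-∏ []       h = χ-+ powK-𝟏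
  χ-∏ (x ∷ xs) h = trans (χ-* (h x) _) (cong (χ (h x) ℤ.*_) (χ-∏ xs h))

  ∣χ∣≤1 : ∀ x → ∣ χ x ∣ ≤ 1
  ∣χ∣≤1 x with χ x | sign x
  ... | _ | zer _   = z≤n
  ... | _ | pos _ _ = ≤-refl
  ... | _ | neg _ _ = ≤-refl

  -- Euler's criterion: if x were not a square, the fibres of squaring over the at most half solutions of s^half = 1 would be too small.
  euler : ∀ {x} → powK x half ≡ 𝟏 → Σ K (λ y → y ⊠ y ≡ x)
  euler {x} x^≡1 with Any.any? (λ y → y ⊠ y ≟K x) elems
  ... | yes some = proj₁ (find some) , proj₂ (proj₂ (find some))
  ... | no none  = ⊥-elim (<-irrefl refl (≤-trans (≤-trans (s≤s count) (*-monoʳ-< 2 R′<R)) (≤-trans (*-monoʳ-≤ 2 (length-level≤ 𝟏 R R-unique R-level)) (≡⇒≤ (sym length-units)))))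
    where
    level? : ∀ s → Dec (powK s half ≡ 𝟏)
    level? s = powK s half ≟K 𝟏
    R : List K
    R = filter level? elems
    R-unique : Unique R
    R-unique = Uniqueₚ.filter⁺ level? unique
    R-level : ∀ s → s ∈ R → powK s half ≡ 𝟏
    R-level s s∈ = proj₂ (∈ₚ.∈-filter⁻ level? {xs = elems} s∈)
    x∈R : x ∈ R
    x∈R = ∈ₚ.∈-filter⁺ level? (all∈ x) x^≡1
    R′ : List K
    R′ = remove x∈R
    R′<R : length R′ < length R
    R′<R = ≡⇒≤ (sym (length-remove x∈R))
    fibre : K → List K
    fibre s = filter (λ y → y ⊠ y ≟K s) units
    fibre≤2 : ∀ s → length (fibre s) ≤ 2
    fibre≤2 s with fibre s in eq
    ... | []    = z≤n
    ... | y₀ ∷ ys = injective⇒length≤ {ys = y₀ ∷ ⊟ y₀ ∷ []} id (subst Unique eq (Uniqueₚ.filter⁺ (λ y → y ⊠ y ≟K s) units-unique)) (λ _ _ e → e) into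
      where
      sq : ∀ {y} → y ∈ y₀ ∷ ys → y ⊠ y ≡ s
      sq y∈ = proj₂ (∈ₚ.∈-filter⁻ (λ y → y ⊠ y ≟K s) {xs = units} (subst (_ ∈_) (sym eq) y∈))
      into : ∀ {y} → y ∈ y₀ ∷ ys → y ∈ y₀ ∷ ⊟ y₀ ∷ []
      into {y} y∈ with y ≟K y₀
      ... | yes e = here e
      ... | no ne = there (here (⊟-≡⇒≡ (integral (begin
        (y ⊞ ⊟ y₀) ⊠ (y ⊞ ⊟ ⊟ y₀) ≡⟨ solve 2 (λ y w → (y :+ :- w) :* (y :+ :- (:- w)) := y :* y :+ :- (w :* w)) refl y y₀ ⟩
        y ⊠ y ⊞ ⊟ (y₀ ⊠ y₀) ≡⟨ cong₂ (λ s t → s ⊞ ⊟ t) (sq y∈) (sq (here refl)) ⟩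
        s ⊞ ⊟ s ≡⟨ ⊟-inverseʳ s ⟩
        𝟘 ∎) (λ e → ne (⊟-≡⇒≡ e)))))
    in-R′ : ∀ y → y ∈ units → y ⊠ y ∈ R′
    in-R′ y y∈ = ∈-remove x∈R (∈ₚ.∈-filter⁺ level? (all∈ _) (trans (powK-* y y half) (trans (sym (powK-+ y half half))
      (trans (cong (λ n → powK y (half + n)) (sym (+-identityʳ half))) (unit^ (∈units⇒≢𝟘 y∈))))))
      (λ e → none (Any.map (λ { refl → e }) (all∈ y)))
    count : length units ≤ 2 * length R′
    count = ≤-trans (≡⇒≤ (sym (trans (∑-const units 1) (*-identityʳ (length units)))))
      (≤-trans (∑-mono units (λ y y∈ → ≤-trans (≡⇒≤ (sym (𝟙-yes (y ⊠ y ≟K y ⊠ y) refl))) (∈⇒≤∑ (λ s → 𝟙 (y ⊠ y ≟K s)) (in-R′ y y∈))))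
      (≤-trans (≡⇒≤ (ℕΣ.∑-swap units R′ (λ y s → 𝟙 (y ⊠ y ≟K s))))
      (≤-trans (∑-≤const R′ 2 (λ s _ → ≤-trans (≡⇒≤ (sym (length-filter (λ y → y ⊠ y ≟K s) units))) (fibre≤2 s)))
        (≡⇒≤ (*-comm (length R′) 2)))))

  χ≢-1⇒square : ∀ {x} → χ x ≢ ℤ.-1ℤ → Σ K (λ y → y ⊠ y ≡ x)
  χ≢-1⇒square {x} ne with χ x | sign x
  ... | _ | zer refl  = 𝟘 , ⊠-zeroˡ 𝟘
  ... | _ | pos _ e   = euler e
  ... | _ | neg _ _   = ⊥-elim (ne refl)

  χ-square : ∀ {x} → x ≢ 𝟘 → χ (x ⊠ x) ≡ 1ℤ
  χ-square {x} x≢0 = trans (χ-* x x) (lemma (χ x) (sign x))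
    where
    lemma : ∀ s → Sign x s → s ℤ.* s ≡ 1ℤ
    lemma _ (zer e)   = ⊥-elim (x≢0 e)
    lemma _ (pos _ _) = refl
    lemma _ (neg _ _) = refl

  level : (K → K) → K → List K
  level h ε = filter (λ w → powK (h w) half ≟K ε) elems

  -- Stepanov's method bounds level sets from above only. Since the two level sets and the zeros of
  -- h exhaust K, an upper bound for one is a lower bound for the other.
  count± : (h : K → K) → (n₀ : List K) → (∀ w → h w ≡ 𝟘 → w ∈ n₀) → ∀ E →
           2 * length (level h 𝟏) ≤ q + E → 2 * length (level h (⊟ 𝟏)) ≤ q + E →
           ∣ ℤΣ.∑ elems (χ ∘ h) ∣ ≤ length n₀ + E
  count± h n₀ zeros E le₊ le₋ = ≤-trans (≡⇒≤ (cong ∣_∣ (trans (sums elems) (cong₂ ℤ._⊖_ (sym (length-filter (pos? h) elems)) (sym (length-filter (neg? h) elems))))))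
    (∣⊖∣≤ P N (length n₀ + E) (cancel P N total (≤-trans le₊ (+-monoˡ-≤ E (total P N bound))))
                              (cancel N P total (≤-trans le₋ (+-monoˡ-≤ E (≤-trans (total P N bound) (+-monoˡ-≤ (length n₀) (≡⇒≤ (+-comm P N))))))))
    where
    pos? : (h : K → K) → ∀ w → Dec (powK (h w) half ≡ 𝟏)
    pos? h w = powK (h w) half ≟K 𝟏
    neg? : (h : K → K) → ∀ w → Dec (powK (h w) half ≡ ⊟ 𝟏)
    neg? h w = powK (h w) half ≟K ⊟ 𝟏
    zer? : ∀ w → Dec (h w ≡ 𝟘)
    zer? w = h w ≟K 𝟘
    P = length (level h 𝟏)
    N = length (level h (⊟ 𝟏))
    split : ∀ w → χ (h w) ≡ 𝟙 (pos? h w) ℤ.⊖ 𝟙 (neg? h w)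
    split w with χ (h w) | sign (h w)
    ... | _ | zer e = sym (cong₂ ℤ._⊖_ (𝟙-no (pos? h w) (λ p → 𝟏≢𝟘 (trans (sym p) vanish))) (𝟙-no (neg? h w) (λ p → ⊟𝟏≢𝟘 (trans (sym p) vanish))))
      where
      vanish : powK (h w) half ≡ 𝟘
      vanish = trans (cong (λ t → powK t half) e) powK-half-𝟘
    ... | _ | pos _ e = sym (cong₂ ℤ._⊖_ (𝟙-yes (pos? h w) e) (𝟙-no (neg? h w) (λ p → ⊟𝟏≢𝟏 (trans (sym p) e))))
    ... | _ | neg _ e = sym (cong₂ ℤ._⊖_ (𝟙-no (pos? h w) (λ p → ⊟𝟏≢𝟏 (trans (sym e) p))) (𝟙-yes (neg? h w) e))
    ⊖-+ : ∀ a b c d → (a ℤ.⊖ b) ℤ.+ (c ℤ.⊖ d) ≡ (a + c) ℤ.⊖ (b + d)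
    ⊖-+ a b c d = trans (cong₂ ℤ._+_ (sym (ℤₚ.m-n≡m⊖n a b)) (sym (ℤₚ.m-n≡m⊖n c d)))
      (trans (rearrange (+ a) (+ b) (+ c) (+ d)) (ℤₚ.m-n≡m⊖n (a + c) (b + d)))
      where
      rearrange : ∀ a b c d → (a ℤ.- b) ℤ.+ (c ℤ.- d) ≡ (a ℤ.+ c) ℤ.- (b ℤ.+ d)
      rearrange = ℤR.solve-∀
    sums : ∀ xs → ℤΣ.∑ xs (χ ∘ h) ≡ ∑ xs (λ w → 𝟙 (pos? h w)) ℤ.⊖ ∑ xs (λ w → 𝟙 (neg? h w))
    sums []       = refl
    sums (w ∷ xs) = trans (cong₂ ℤ._+_ (split w) (sums xs)) (⊖-+ (𝟙 (pos? h w)) (𝟙 (neg? h w)) (∑ xs (λ w → 𝟙 (pos? h w))) (∑ xs (λ w → 𝟙 (neg? h w))))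
    Z₀ : List K
    Z₀ = filter zer? elems
    Z₀≤ : length Z₀ ≤ length n₀
    Z₀≤ = injective⇒length≤ id (Uniqueₚ.filter⁺ zer? unique) (λ _ _ e → e) (λ w∈ → zeros _ (proj₂ (∈ₚ.∈-filter⁻ zer? {xs = elems} w∈)))
    cover : ∀ w → 1 ≤ 𝟙 (pos? h w) + 𝟙 (neg? h w) + 𝟙 (zer? w)
    cover w with χ (h w) | sign (h w)
    ... | _ | zer e   = ≤-trans (≡⇒≤ (sym (𝟙-yes (zer? w) e))) (m≤n+m (𝟙 (zer? w)) (𝟙 (pos? h w) + 𝟙 (neg? h w)))
    ... | _ | pos _ e = ≤-trans (≡⇒≤ (sym (𝟙-yes (pos? h w) e))) (≤-trans (m≤m+n (𝟙 (pos? h w)) (𝟙 (neg? h w))) (m≤m+n _ (𝟙 (zer? w))))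
    ... | _ | neg _ e = ≤-trans (≡⇒≤ (sym (𝟙-yes (neg? h w) e))) (≤-trans (m≤n+m (𝟙 (neg? h w)) (𝟙 (pos? h w))) (m≤m+n _ (𝟙 (zer? w))))
    bound : q ≤ P + N + length Z₀
    bound = ≤-trans (≡⇒≤ (sym (trans (∑-const elems 1) (*-identityʳ q)))) (≤-trans (∑-mono elems (λ w _ → cover w))
      (≡⇒≤ (trans (ℕΣ.∑-+ elems _ _) (cong₂ _+_ (trans (ℕΣ.∑-+ elems _ _) (cong₂ _+_ (sym (length-filter (pos? h) elems)) (sym (length-filter (neg? h) elems)))) (sym (length-filter zer? elems))))))
    total : ∀ a b → q ≤ a + b + length Z₀ → q ≤ a + b + length n₀
    total a b le = ≤-trans le (+-monoʳ-≤ (a + b) Z₀≤)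
    cancel : ∀ a b → (∀ a b → q ≤ a + b + length Z₀ → q ≤ a + b + length n₀) → 2 * a ≤ a + b + length n₀ + E → a ≤ b + (length n₀ + E)
    cancel a b _ le = +-cancelˡ-≤ a a _ (≤-trans (≡⇒≤ (cong (_+_ a) (sym (+-identityʳ a)))) (≤-trans le (≡⇒≤ (rearrange a b (length n₀) E))))
      where
      rearrange : ∀ a b n e → a + b + n + e ≡ a + (b + (n + e))
      rearrange = ℕR.solve-∀

  invK : K → K
  invK x with x ≟K 𝟘
  ... | yes _ = 𝟘
  ... | no ne = proj₁ (inv x ne)

  invK-inverse : ∀ {x} → x ≢ 𝟘 → x ⊠ invK x ≡ 𝟏
  invK-inverse {x} x≢0 with x ≟K 𝟘
  ... | yes eq = ⊥-elim (x≢0 eq)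
  ... | no ne  = proj₂ (inv x ne)

  invK-≢𝟘 : ∀ {x} → x ≢ 𝟘 → invK x ≢ 𝟘
  invK-≢𝟘 x≢0 eq = 𝟏≢𝟘 (trans (sym (invK-inverse x≢0)) (trans (cong (_ ⊠_) eq) (⊠-zeroʳ _)))

  invK-injective : ∀ {x y} → x ≢ 𝟘 → y ≢ 𝟘 → invK x ≡ invK y → x ≡ y
  invK-injective {x} {y} x≢0 y≢0 eq = ⊠-cancelˡ (invK-≢𝟘 x≢0) (begin
    invK x ⊠ x ≡⟨ ⊠-comm _ _ ⟩
    x ⊠ invK x ≡⟨ invK-inverse x≢0 ⟩
    𝟏 ≡⟨ invK-inverse y≢0 ⟨
    y ⊠ invK y ≡⟨ ⊠-comm _ _ ⟩
    invK y ⊠ y ≡⟨ cong (_⊠ y) eq ⟨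
    invK x ⊠ y ∎)

  -- Multiplication by a nonresidue permutes the units and changes the sign of χ.
  ∑χ≡0 : ℤΣ.∑ elems χ ≡ 0ℤ
  ∑χ≡0 = begin
    ℤΣ.∑ elems χ ≡⟨ ℤΣ.∑-↭ χ elems↭ ⟩
    χ 𝟘 ℤ.+ ℤΣ.∑ units χ ≡⟨ trans (cong (ℤ._+ ℤΣ.∑ units χ) (χ-𝟘 refl)) (ℤₚ.+-identityˡ _) ⟩
    S ≡⟨ zero-sum (trans (cong (ℤ._* S) (sym χν)) (trans (sym (ℤΣ.∑-*ˡ (χ ν) units χ)) (trans (ℤΣ.∑-ext units (λ x → sym (χ-* ν x)))
                                             (trans (sym (ℤΣ.∑-map (ν ⊠_) units χ)) (ℤΣ.∑-↭ χ (units-↭ (proj₁ (proj₂ nonresidue)))))))) ⟩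
    0ℤ ∎
    where
    S = ℤΣ.∑ units χ
    ν = proj₁ nonresidue
    χν : χ ν ≡ ℤ.-1ℤ
    χν = χ-- ([ (λ e → ⊥-elim (proj₂ (proj₂ nonresidue) e)) , id ]′ (unit-half (proj₁ (proj₂ nonresidue))))
    zero-sum : ∀ {s} → ℤ.-1ℤ ℤ.* s ≡ s → s ≡ 0ℤ
    zero-sum {+ zero}   _  = refl
    zero-sum {+ suc n}  ()
    zero-sum { -[1+ n ]} ()

-- Weil's bound for products of linear factors

weilConst : ℕ → ℕ
weilConst m = 32 * (3 * m + 2)

module Weil (𝔽 : FiniteField) where
  open FiniteField 𝔽
  open FieldTheory 𝔽
  open Stepanov 𝔽
  open Character 𝔽
  open ≡-Reasoning

  -- Stepanov's argument with order 2 μ and J = μ + c. In M N < 2 J D the terms 2 μ D cancel, and 2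
  -- c D ≥ 7 c μ² has to beat (4 m + 2) μ² + (2 c + 2) μ, for which c = 2 m + 2 suffices.
  weil-odd : ∀ ts m′ → length ts ≡ 1 + 2 * m′ → ∀ {ε} → ε ≢ 𝟘 → ∀ Z → Unique Z → (∀ w → w ∈ Z → powK (value ts w) half ≡ ε) →
             ∀ μ → 8 * (μ * μ) ≤ q → q < 8 * (suc μ * suc μ) → 2 * length Z ≤ q + weilConst (length ts) * suc μ
  weil-odd ts m′ odd {ε} ε≢0 Z uZ f≡ε μ lo hi with length ts ≤? μ
  -- Here μ + 1 ≤ m and the trivial 2 |Z| ≤ 2 q ≤ q + 8 (μ + 1)² is already good enough.
  ... | no m≰μ = ≤-trans (*-monoʳ-≤ 2 (injective⇒length≤ id uZ (λ _ _ e → e) (λ {x} _ → all∈ x)))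
    (≤-trans (≡⇒≤ (cong (_+_ q) (+-identityʳ q))) (+-monoʳ-≤ q (≤-trans (<⇒≤ hi)
      (≤-trans (≡⇒≤ (sym (*-assoc 8 (suc μ) (suc μ)))) (*-monoˡ-≤ (suc μ) (≤-trans (*-monoʳ-≤ 8 (≰⇒> m≰μ)) (bound (length ts))))))))
    where
    bound : ∀ m → 8 * m ≤ 32 * (3 * m + 2)
    bound m = ≤-trans (m≤m+n (8 * m) (88 * m + 64)) (≡⇒≤ (identity m))
      where
      identity : ∀ m → 8 * m + (88 * m + 64) ≡ 32 * (3 * m + 2)
      identity = ℕR.solve-∀
  ... | yes m≤μ with 2 * length Z ≤? q + weilConst (length ts) * suc μ
  ...   | yes le = le
  ...   | no nle = ⊥-elim (stepanov small ε≢0 Z uZ f≡ε large)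
    where
    m c D : ℕ
    m = length ts
    c = 2 * m + 2
    D = half ∸ m′
    m≥1 : 1 ≤ m
    m≥1 = ≤-trans (s≤s z≤n) (≡⇒≤ (sym odd))
    μ≥1 : 1 ≤ μ
    μ≥1 = ≤-trans m≥1 m≤μ
    μ≤μ² : μ ≤ μ * μ
    μ≤μ² = ≤-trans (≡⇒≤ (sym (*-identityʳ μ))) (*-monoʳ-≤ μ μ≥1)
    m≤q : m ≤ q
    m≤q = ≤-trans m≤μ (≤-trans μ≤μ² (≤-trans (m≤m+n _ _) lo))
    m′≤half : m′ ≤ half
    m′≤half = *-cancelˡ-≤ 2 (s≤s⁻¹ (≤-trans (≡⇒≤ (sym odd)) (≤-trans m≤q (≡⇒≤ size))))
    D+m′ : D + m′ ≡ half
    D+m′ = m∸n+n≡m m′≤half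
    2D+m≡q : 2 * D + m ≡ q
    2D+m≡q = trans (cong (λ t → 2 * D + t) odd) (trans (identity D m′) (trans (cong (λ h → 1 + 2 * h) D+m′) (sym size)))
      where
      identity : ∀ D m → 2 * D + (1 + 2 * m) ≡ 1 + 2 * (D + m)
      identity = ℕR.solve-∀
    7μ²≤2D : 7 * (μ * μ) ≤ 2 * D
    7μ²≤2D = +-cancelʳ-≤ m _ _ (≤-trans (+-monoʳ-≤ _ (≤-trans m≤μ μ≤μ²)) (≤-trans (≡⇒≤ (identity (μ * μ))) (≤-trans lo (≡⇒≤ (sym 2D+m≡q)))))
      where
      identity : ∀ s → 7 * s + s ≡ 8 * s
      identity = ℕR.solve-∀
    2μ≤q : 2 * μ ≤ q
    2μ≤q = ≤-trans (*-mono-≤ {2} {8} (s≤s (s≤s z≤n)) μ≤μ²) lo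
    open Auxiliary ts m′ D (2 * μ) (μ + c) odd D+m′ 2μ≤q ε
    small : 2 * μ * (m * (2 * μ) + ((μ + c) + (D + 1))) < 2 * ((μ + c) * D)
    small = *-cancelˡ-< 2 _ _ (≤-trans (s≤s (≡⇒≤ (expand μ m c D))) (≤-trans (s≤s (+-monoʳ-≤ (4 * (μ * D)) main)) (≤-trans (≡⇒≤ (+-suc _ _ ▹)) (≤-trans (+-monoʳ-≤ (4 * (μ * D)) (≤-trans strict (*-monoʳ-≤ (2 * c) 7μ²≤2D))) (≡⇒≤ (collect μ c D))))))
      where
      _▹ : ∀ {a b : ℕ} → a ≡ b → b ≡ a
      _▹ = sym
      expand : ∀ μ m c D → 2 * (2 * μ * (m * (2 * μ) + ((μ + c) + (D + 1)))) ≡ 4 * (μ * D) + ((8 * m + 4) * (μ * μ) + (4 * c + 4) * μ)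
      expand = ℕR.solve-∀
      main : (8 * m + 4) * (μ * μ) + (4 * c + 4) * μ ≤ (8 * m + 4) * (μ * μ) + (4 * c + 4) * (μ * μ)
      main = +-monoʳ-≤ _ (*-monoʳ-≤ (4 * c + 4) μ≤μ²)
      strict : suc ((8 * m + 4) * (μ * μ) + (4 * c + 4) * (μ * μ)) ≤ 2 * c * (7 * (μ * μ))
      strict = ≤-trans (+-monoˡ-≤ _ (≤-trans μ≥1 μ≤μ²)) (≤-trans (m≤m+n _ ((12 * m + 11) * (μ * μ))) (≡⇒≤ (identity m (μ * μ))))
        where
        identity : ∀ m s → s + ((8 * m + 4) * s + (4 * (2 * m + 2) + 4) * s) + (12 * m + 11) * s ≡ 2 * (2 * m + 2) * (7 * s)
        identity = ℕR.solve-∀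
      collect : ∀ μ c D → 4 * (μ * D) + 2 * c * (2 * D) ≡ 2 * (2 * ((μ + c) * D))
      collect = ℕR.solve-∀
    -- Origin of `weilConst`: J + m′ exceeds μ by at most 3 m + 2, and q/μ is at most 32 (μ + 1).
    large : (μ + c + m′) * q ≤ length Z * (2 * μ)
    large = ≤-trans (≤-trans (*-monoˡ-≤ q (+-monoʳ-≤ (μ + c) m′≤m)) (≤-trans (≡⇒≤ (split μ m q)) (+-monoʳ-≤ (μ * q) (*-monoʳ-≤ (3 * m + 2) q≤))))
      (≤-trans (≡⇒≤ (regroup μ m q)) (≤-trans (*-monoˡ-≤ μ (<⇒≤ (≰⇒> nle))) (≡⇒≤ (swap (length Z) μ))))
      where
      m′≤m : m′ ≤ m
      m′≤m = ≤-trans (m≤n*m m′ 2) (≤-trans (n≤1+n _) (≡⇒≤ (sym odd)))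
      q≤ : q ≤ 32 * (suc μ * μ)
      q≤ = ≤-trans (<⇒≤ hi) (≤-trans (*-monoʳ-≤ 8 (*-monoʳ-≤ (suc μ) (≤-trans (+-monoˡ-≤ μ μ≥1) (≤-trans (m≤m+n (μ + μ) (2 * μ)) (≡⇒≤ (quad μ)))))) (≡⇒≤ (assoc8 (suc μ) μ)))
        where
        quad : ∀ μ → μ + μ + 2 * μ ≡ 4 * μ
        quad = ℕR.solve-∀
        assoc8 : ∀ a b → 8 * (a * (4 * b)) ≡ 32 * (a * b)
        assoc8 = ℕR.solve-∀
      split : ∀ μ m q → (μ + (2 * m + 2) + m) * q ≡ μ * q + (3 * m + 2) * q
      split = ℕR.solve-∀
      regroup : ∀ μ m q → μ * q + (3 * m + 2) * (32 * (suc μ * μ)) ≡ (q + 32 * (3 * m + 2) * suc μ) * μ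
      regroup = ℕR.solve-∀
      swap : ∀ z μ → 2 * z * μ ≡ z * (2 * μ)
      swap = ℕR.solve-∀

  -- The substitution w = 1/y − t₁ turns an even number of factors into an odd number, as the isolated factor w + t₁ disappears.
  module Inversion (t₁ : K) (rest : List K) (isolated : ∀ t → t ∈ rest → t ≢ t₁) where

    shifted : List K
    shifted = map (λ t → invK (t ⊞ ⊟ t₁)) rest

    scale : K
    scale = ∏K rest (λ t → t ⊞ ⊟ t₁)

    diff≢𝟘 : ∀ t → t ∈ rest → t ⊞ ⊟ t₁ ≢ 𝟘
    diff≢𝟘 t t∈ eq = isolated t t∈ (⊟-≡⇒≡ eq)

    scale≢𝟘 : scale ≢ 𝟘
    scale≢𝟘 = ∏K-≢𝟘 rest _ diff≢𝟘

    substitute : ∀ w → w ⊞ t₁ ≢ 𝟘 → ∀ ts → (∀ t → t ∈ ts → t ⊞ ⊟ t₁ ≢ 𝟘) →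
                 value ts w ≡ powK (w ⊞ t₁) (length ts) ⊠ (∏K ts (λ t → t ⊞ ⊟ t₁) ⊠ value (map (λ t → invK (t ⊞ ⊟ t₁)) ts) (invK (w ⊞ t₁)))
    substitute w ne []       ok = sym (trans (⊠-identityˡ _) (⊠-identityˡ _))
    substitute w ne (t ∷ ts) ok = begin
      (w ⊞ t) ⊠ value ts w
        ≡⟨ cong₂ _⊠_ one-factor (substitute w ne ts (λ t t∈ → ok t (there t∈))) ⟩
      (u ⊠ (s ⊠ (i ⊞ invK s))) ⊠ (P ⊠ (Q ⊠ V))
        ≡⟨ solve 6 (λ u s k P Q V → (u :* (s :* k)) :* (P :* (Q :* V)) := (u :* P) :* ((s :* Q) :* (k :* V))) refl u s (i ⊞ invK s) P Q V ⟩
      (u ⊠ P) ⊠ ((s ⊠ Q) ⊠ ((i ⊞ invK s) ⊠ V)) ∎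
      where
      u = w ⊞ t₁
      s = t ⊞ ⊟ t₁
      i = invK u
      P = powK u (length ts)
      Q = ∏K ts (λ t → t ⊞ ⊟ t₁)
      V = value (map (λ t → invK (t ⊞ ⊟ t₁)) ts) i
      one-factor : w ⊞ t ≡ u ⊠ (s ⊠ (i ⊞ invK s))
      one-factor = begin
        w ⊞ t ≡⟨ solve 3 (λ w t r → w :+ t := (w :+ r) :+ (t :+ :- r)) refl w t t₁ ⟩
        u ⊞ s ≡⟨ trans (⊞-comm u s) (cong₂ _⊞_ (sym (⊠-identityʳ s)) (sym (⊠-identityʳ u))) ⟩
        s ⊠ 𝟏 ⊞ u ⊠ 𝟏 ≡⟨ cong₂ (λ a b → s ⊠ a ⊞ u ⊠ b) (invK-inverse ne) (invK-inverse (ok t (here refl))) ⟨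
        s ⊠ (u ⊠ i) ⊞ u ⊠ (s ⊠ invK s) ≡⟨ solve 4 (λ s u i j → s :* (u :* i) :+ u :* (s :* j) := u :* (s :* (i :+ j))) refl s u i (invK s) ⟩
        u ⊠ (s ⊠ (i ⊞ invK s)) ∎

    half² : ∀ {x} → x ≢ 𝟘 → powK x half ⊠ powK x half ≡ 𝟏
    half² {x} x≢0 = trans (sym (powK-+ x half half)) (trans (cong (λ n → powK x (half + n)) (sym (+-identityʳ half))) (unit^ x≢0))

    -- The substitution produces w + t₁ to the even power 2 + 2 m′, whose half-th power is 1, so
    -- only `scale` remains; its half-th power is a sign and merely exchanges the levels.
    inverted : ∀ w m′ → length rest ≡ 1 + 2 * m′ → ∀ {ε} → ε ≢ 𝟘 → powK (value (t₁ ∷ rest) w) half ≡ ε →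
               (w ⊞ t₁ ≢ 𝟘) × powK (value shifted (invK (w ⊞ t₁))) half ≡ ε ⊠ powK scale half
    inverted w m′ odd {ε} ε≢0 eq = u≢0 , (begin
      powK V half ≡⟨ trans (⊠-identityˡ _) (⊠-identityˡ _) ⟨
      𝟏 ⊠ (𝟏 ⊠ powK V half) ≡⟨ cong₂ (λ a b → a ⊠ (b ⊠ powK V half)) u-part (half² scale≢𝟘) ⟨
      powK (powK u (2 + 2 * m′)) half ⊠ ((σ ⊠ σ) ⊠ powK V half) ≡⟨ solve 3 (λ U s v → U :* ((s :* s) :* v) := (U :* (s :* v)) :* s) refl (powK (powK u (2 + 2 * m′)) half) σ (powK V half) ⟩
      (powK (powK u (2 + 2 * m′)) half ⊠ (σ ⊠ powK V half)) ⊠ σ ≡⟨ cong (_⊠ σ) whole ⟨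
      powK (value (t₁ ∷ rest) w) half ⊠ σ ≡⟨ cong (_⊠ σ) eq ⟩
      ε ⊠ σ ∎)
      where
      u = w ⊞ t₁
      σ = powK scale half
      V = value shifted (invK u)
      u≢0 : u ≢ 𝟘
      u≢0 u≡0 = ε≢0 (trans (sym eq) (trans (cong (λ t → powK (t ⊠ value rest w) half) u≡0) (trans (cong (λ t → powK t half) (⊠-zeroˡ _)) powK-half-𝟘)))
      whole : powK (value (t₁ ∷ rest) w) half ≡ powK (powK u (2 + 2 * m′)) half ⊠ (σ ⊠ powK V half)
      whole = trans (cong (λ t → powK t half) (trans (cong (u ⊠_) (substitute w u≢0 rest diff≢𝟘))
        (trans (sym (⊠-assoc u _ _)) (cong (λ n → powK u (suc n) ⊠ (scale ⊠ V)) odd))))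
        (trans (powK-* (powK u (2 + 2 * m′)) (scale ⊠ V) half) (cong (powK (powK u (2 + 2 * m′)) half ⊠_) (powK-* scale V half)))
      u-part : powK (powK u (2 + 2 * m′)) half ≡ 𝟏
      u-part = trans (powK-∘ u (2 + 2 * m′) half) (trans (cong (powK u) (reorder m′ half)) (trans (sym (powK-∘ u (2 * half) (1 + m′))) (trans (cong (λ t → powK t (1 + m′)) (unit^ u≢0)) (powK-1 (1 + m′)))))
        where
        reorder : ∀ m h → (2 + 2 * m) * h ≡ 2 * h * (1 + m)
        reorder = ℕR.solve-∀

    weil-even : ∀ m′ → length rest ≡ 1 + 2 * m′ → ∀ {ε} → ε ≢ 𝟘 → ∀ μ → 8 * (μ * μ) ≤ q → q < 8 * (suc μ * suc μ) →
                2 * length (level (value (t₁ ∷ rest)) ε) ≤ q + weilConst (length rest) * suc μ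
    weil-even m′ odd {ε} ε≢0 μ lo hi = subst₂ (λ a b → 2 * a ≤ q + weilConst b * suc μ) (Listₚ.length-map y-of Z) (Listₚ.length-map _ rest)
      (weil-odd shifted m′ (trans (Listₚ.length-map _ rest) odd) (⊠-≢𝟘 ε≢0 (powK-≢𝟘 half scale≢𝟘)) (map y-of Z) unique-map
        (λ y y∈ → image y (∈ₚ.∈-map⁻ y-of y∈)) μ lo hi)
      where
      Z = level (value (t₁ ∷ rest)) ε
      y-of : K → K
      y-of w = invK (w ⊞ t₁)
      facts : ∀ w → w ∈ Z → (w ⊞ t₁ ≢ 𝟘) × powK (value shifted (y-of w)) half ≡ ε ⊠ powK scale half
      facts w w∈ = inverted w m′ odd ε≢0 (proj₂ (∈ₚ.∈-filter⁻ (λ w → powK (value (t₁ ∷ rest) w) half ≟K ε) {xs = elems} w∈))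
      image : ∀ y → ∃ (λ w → w ∈ Z × y ≡ y-of w) → powK (value shifted y) half ≡ ε ⊠ powK scale half
      image y (w , w∈ , refl) = proj₂ (facts w w∈)
      unique-map : Unique (map y-of Z)
      unique-map = map-unique Z (Uniqueₚ.filter⁺ _ unique) (λ w w∈ → proj₁ (facts w w∈))
        where
        map-unique : ∀ xs → Unique xs → (∀ w → w ∈ xs → w ⊞ t₁ ≢ 𝟘) → Unique (map y-of xs)
        map-unique []       u           ok = []
        map-unique (x ∷ xs) (x∉ ∷ u)    ok = All.tabulate (λ y∈ eq → differs (∈ₚ.∈-map⁻ y-of y∈) eq) ∷ map-unique xs u (λ w w∈ → ok w (there w∈))
          where
          differs : ∀ {y} → ∃ (λ w → w ∈ xs × y ≡ y-of w) → y-of x ≡ y → ⊥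
          differs (w , w∈ , refl) eq = All.lookup x∉ w∈ (cancelʳ (invK-injective (ok x (here refl)) (ok w (there w∈)) eq))
            where
            cancelʳ : ∀ {a b} → a ⊞ t₁ ≡ b ⊞ t₁ → a ≡ b
            cancelʳ {a} {b} eq = trans (solve 2 (λ a t → a := (a :+ t) :+ :- t) refl a t₁) (trans (cong (_⊞ ⊟ t₁) eq) (solve 2 (λ a t → (a :+ t) :+ :- t := a) refl b t₁))

    weil : ∀ m′ → length rest ≡ 1 + 2 * m′ → ∀ μ → 8 * (μ * μ) ≤ q → q < 8 * (suc μ * suc μ) →
           ∣ ℤΣ.∑ elems (λ w → ℤΣ.∏ (t₁ ∷ rest) (λ t → χ (w ⊞ t))) ∣ ≤ (suc (length rest) + weilConst (length rest)) * suc μ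
    weil m′ odd μ lo hi = ≤-trans (≡⇒≤ (cong ∣_∣ (ℤΣ.∑-ext elems (λ w → sym (χ-∏ (t₁ ∷ rest) (w ⊞_))))))
      (≤-trans (count± (value (t₁ ∷ rest)) (map ⊟_ (t₁ ∷ rest)) zeros (weilConst (length rest) * suc μ)
        (weil-even m′ odd 𝟏≢𝟘 μ lo hi) (weil-even m′ odd ⊟𝟏≢𝟘 μ lo hi))
      (≤-trans (+-monoˡ-≤ _ (≤-trans (≡⇒≤ (cong suc (Listₚ.length-map ⊟_ rest))) (m≤m*n (suc (length rest)) (suc μ))))
        (≡⇒≤ (sym (*-distribʳ-+ (suc μ) (suc (length rest)) _)))))
      where
      zeros : ∀ w → value (t₁ ∷ rest) w ≡ 𝟘 → w ∈ map ⊟_ (t₁ ∷ rest)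
      zeros w eq = go (t₁ ∷ rest) eq
        where
        go : ∀ ts → value ts w ≡ 𝟘 → w ∈ map ⊟_ ts
        go []       eq = ⊥-elim (𝟏≢𝟘 eq)
        go (t ∷ ts) eq with w ≟K ⊟ t
        ... | yes e = here e
        ... | no ne = there (go ts (integral eq (λ e → ne (trans (solve 2 (λ w t → w := (w :+ t) :+ :- t) refl w t) (trans (cong (_⊞ ⊟ t) e) (⊞-identityˡ _))))))

-- Prime fields and their quadratic extensions

mkCommutativeRing : {A : Set} {_+A_ _*A_ : A → A → A} { -A_ : A → A} {0A 1A : A} →
  (∀ x y z → (x +A y) +A z ≡ x +A (y +A z)) → (∀ x y → x +A y ≡ y +A x) → (∀ x → 0A +A x ≡ x) → (∀ x → (-A x) +A x ≡ 0A) →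
  (∀ x y z → (x *A y) *A z ≡ x *A (y *A z)) → (∀ x y → x *A y ≡ y *A x) → (∀ x → 1A *A x ≡ x) →
  (∀ x y z → x *A (y +A z) ≡ (x *A y) +A (x *A z)) → IsCommutativeRing _≡_ _+A_ _*A_ -A_ 0A 1A
mkCommutativeRing {A} {_+A_} {_*A_} { -A_} {0A} {1A} +-a +-c +-i +-n *-a *-c *-i d = record
  { isRing = record
    { +-isAbelianGroup = record
      { isGroup = record
        { isMonoid = record
          { isSemigroup = record { isMagma = record { isEquivalence = isEquivalence ; ∙-cong = cong₂ _+A_ } ; assoc = +-a }
          ; identity = +-i , λ x → trans (+-c x 0A) (+-i x) }
        ; inverse = +-n , λ x → trans (+-c x (-A x)) (+-n x)
        ; ⁻¹-cong = cong -A_ }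
      ; comm = +-c }
    ; *-cong = cong₂ _*A_
    ; *-assoc = *-a
    ; *-identity = *-i , λ x → trans (*-c x 1A) (*-i x)
    ; distrib = d , λ x y z → trans (*-c (y +A z) x) (trans (d x y z) (cong₂ _+A_ (*-c x y) (*-c x z))) }
  ; *-comm = *-c }

∣∣≡⇒± : ∀ i {n} → ∣ i ∣ ≡ n → i ≡ + n ⊎ i ≡ ℤ.- + n
∣∣≡⇒± (+ _)    refl = inj₁ refl
∣∣≡⇒± -[1+ _ ] refl = inj₂ refl

module PrimeField (p : ℕ) (prime : Prime p) (odd : Odd p) where
  private instance
    p≢0 : NonZero p
    p≢0 = prime⇒nonZero prime

  _≈_ : ℤ → ℤ → Set
  i ≈ j = Σ ℤ (λ k → i ≡ j ℤ.+ k ℤ.* + p)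

  residue-unique : ∀ {r s} k → r < p → + r ≡ + s ℤ.+ k ℤ.* + p → s < p → r ≡ s
  residue-unique (+ zero)  r<p eq s<p = ℤₚ.+-injective (trans eq (ℤₚ.+-identityʳ _))
  residue-unique {r} {s} (+ suc k) r<p eq s<p = ⊥-elim (<⇒≱ r<p (≤-trans (≤-trans (m≤m+n p (k * p)) (m≤n+m (suc k * p) s))
    (≡⇒≤ (sym (ℤₚ.+-injective (trans eq (cong (λ t → + s ℤ.+ t) (sym (ℤₚ.pos-* (suc k) p)))))))))
  residue-unique {r} {s} -[1+ k ] r<p eq s<p = ⊥-elim (<⇒≱ s<p (≤-trans (≤-trans (m≤m+n p (k * p)) (m≤n+m (suc k * p) r))
    (≡⇒≤ (ℤₚ.+-injective (trans (cong (λ t → + r ℤ.+ t) (ℤₚ.pos-* (suc k) p)) (trans (cong (ℤ._+ (+ suc k ℤ.* + p)) eq) (cancel (+ s) (+ suc k) (+ p))))))))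
    where
    cancel : ∀ s k p → (s ℤ.+ (ℤ.- k) ℤ.* p) ℤ.+ k ℤ.* p ≡ s
    cancel = ℤR.solve-∀

  ι : ℤ → Fin p
  ι i = fromℕ< (ℤDM.n%ℕd<d i p)

  toℤ : Fin p → ℤ
  toℤ x = + toℕ x

  toℤ-ι : ∀ i → toℤ (ι i) ≡ + (i ℤDM.%ℕ p)
  toℤ-ι i = cong +_ (Finₚ.toℕ-fromℕ< _)

  ≈-toℤ-ι : ∀ i → i ≈ toℤ (ι i)
  ≈-toℤ-ι i = (i ℤDM./ℕ p) , trans (ℤDM.a≡a%ℕn+[a/ℕn]*n i p) (cong (ℤ._+ (i ℤDM./ℕ p) ℤ.* + p) (sym (toℤ-ι i)))

  ι-sound : ∀ {i j} → i ≈ j → ι i ≡ ι j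
  ι-sound {i} {j} (k , eq) with ≈-toℤ-ι i | ≈-toℤ-ι j
  ... | u , ei | v , ej = Finₚ.toℕ-injective (residue-unique (v ℤ.+ k ℤ.- u) (Finₚ.toℕ<n (ι i)) (begin
    toℤ (ι i) ≡⟨ add-sub (toℤ (ι i)) u (+ p) ⟩
    (toℤ (ι i) ℤ.+ u ℤ.* + p) ℤ.- u ℤ.* + p ≡⟨ cong (ℤ._- u ℤ.* + p) (trans (sym ei) (trans eq (cong (ℤ._+ k ℤ.* + p) ej))) ⟩
    ((toℤ (ι j) ℤ.+ v ℤ.* + p) ℤ.+ k ℤ.* + p) ℤ.- u ℤ.* + p ≡⟨ regroup (toℤ (ι j)) u v k (+ p) ⟩
    toℤ (ι j) ℤ.+ (v ℤ.+ k ℤ.- u) ℤ.* + p ∎) (Finₚ.toℕ<n (ι j)))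
    where
    open ≡-Reasoning
    add-sub : ∀ a u p → a ≡ (a ℤ.+ u ℤ.* p) ℤ.- u ℤ.* p
    add-sub = ℤR.solve-∀
    regroup : ∀ a u v k p → ((a ℤ.+ v ℤ.* p) ℤ.+ k ℤ.* p) ℤ.- u ℤ.* p ≡ a ℤ.+ (v ℤ.+ k ℤ.- u) ℤ.* p
    regroup = ℤR.solve-∀

  ι-toℤ : ∀ x → ι (toℤ x) ≡ x
  ι-toℤ x = Finₚ.toℕ-injective (trans (Finₚ.toℕ-fromℕ< _) (DM.m<n⇒m%n≡m (Finₚ.toℕ<n x)))

  _⊞_ _⊠_ : Fin p → Fin p → Fin p
  x ⊞ y = ι (toℤ x ℤ.+ toℤ y)
  x ⊠ y = ι (toℤ x ℤ.* toℤ y)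

  ⊟_ : Fin p → Fin p
  ⊟ x = ι (ℤ.- toℤ x)

  ι-+ : ∀ i j → ι (i ℤ.+ j) ≡ ι i ⊞ ι j
  ι-+ i j with ≈-toℤ-ι i | ≈-toℤ-ι j
  ... | u , ei | v , ej = ι-sound {i ℤ.+ j} {toℤ (ι i) ℤ.+ toℤ (ι j)} (u ℤ.+ v , trans (cong₂ ℤ._+_ ei ej) (regroup (toℤ (ι i)) (toℤ (ι j)) u v (+ p)))
    where
    regroup : ∀ a b u v p → (a ℤ.+ u ℤ.* p) ℤ.+ (b ℤ.+ v ℤ.* p) ≡ (a ℤ.+ b) ℤ.+ (u ℤ.+ v) ℤ.* p
    regroup = ℤR.solve-∀

  ι-* : ∀ i j → ι (i ℤ.* j) ≡ ι i ⊠ ι j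
  ι-* i j with ≈-toℤ-ι i | ≈-toℤ-ι j
  ... | u , ei | v , ej = ι-sound {i ℤ.* j} {toℤ (ι i) ℤ.* toℤ (ι j)} (toℤ (ι i) ℤ.* v ℤ.+ u ℤ.* toℤ (ι j) ℤ.+ u ℤ.* v ℤ.* + p , trans (cong₂ ℤ._*_ ei ej) (regroup (toℤ (ι i)) (toℤ (ι j)) u v (+ p)))
    where
    regroup : ∀ a b u v p → (a ℤ.+ u ℤ.* p) ℤ.* (b ℤ.+ v ℤ.* p) ≡ a ℤ.* b ℤ.+ (a ℤ.* v ℤ.+ u ℤ.* b ℤ.+ u ℤ.* v ℤ.* p) ℤ.* p
    regroup = ℤR.solve-∀

  ι-neg : ∀ i → ι (ℤ.- i) ≡ ⊟ ι i
  ι-neg i with ≈-toℤ-ι i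
  ... | u , ei = ι-sound {ℤ.- i} {ℤ.- toℤ (ι i)} (ℤ.- u , trans (cong ℤ.-_ ei) (regroup (toℤ (ι i)) u (+ p)))
    where
    regroup : ∀ a u p → ℤ.- (a ℤ.+ u ℤ.* p) ≡ ℤ.- a ℤ.+ (ℤ.- u) ℤ.* p
    regroup = ℤR.solve-∀

  -- Every residue is the reduction of an integer, so the ring laws are inherited from ℤ.
  lift₁ : (P : Fin p → Set) → (∀ i → P (ι i)) → ∀ x → P x
  lift₁ P h x = subst P (ι-toℤ x) (h (toℤ x))

  lift₂ : (P : Fin p → Fin p → Set) → (∀ i j → P (ι i) (ι j)) → ∀ x y → P x y
  lift₂ P h x y = lift₁ (λ x → P x y) (λ i → lift₁ (P (ι i)) (h i) y) x

  lift₃ : (P : Fin p → Fin p → Fin p → Set) → (∀ i j k → P (ι i) (ι j) (ι k)) → ∀ x y z → P x y z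
  lift₃ P h x y z = lift₁ (λ x → P x y z) (λ i → lift₂ (P (ι i)) (h i) y z) x

  isCR : IsCommutativeRing _≡_ _⊞_ _⊠_ ⊟_ (ι 0ℤ) (ι 1ℤ)
  isCR = mkCommutativeRing
    (lift₃ _ λ i j k → trans (cong (_⊞ ι k) (sym (ι-+ i j))) (trans (sym (ι-+ (i ℤ.+ j) k)) (trans (cong ι (ℤₚ.+-assoc i j k)) (trans (ι-+ i (j ℤ.+ k)) (cong (ι i ⊞_) (ι-+ j k))))))
    (λ x y → cong ι (ℤₚ.+-comm (toℤ x) (toℤ y)))
    (lift₁ _ λ i → trans (sym (ι-+ 0ℤ i)) (cong ι (ℤₚ.+-identityˡ i)))
    (lift₁ _ λ i → trans (cong (_⊞ ι i) (sym (ι-neg i))) (trans (sym (ι-+ (ℤ.- i) i)) (cong ι (ℤₚ.+-inverseˡ i))))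
    (lift₃ _ λ i j k → trans (cong (_⊠ ι k) (sym (ι-* i j))) (trans (sym (ι-* (i ℤ.* j) k)) (trans (cong ι (ℤₚ.*-assoc i j k)) (trans (ι-* i (j ℤ.* k)) (cong (ι i ⊠_) (ι-* j k))))))
    (λ x y → cong ι (ℤₚ.*-comm (toℤ x) (toℤ y)))
    (lift₁ _ λ i → trans (sym (ι-* 1ℤ i)) (cong ι (ℤₚ.*-identityˡ i)))
    (lift₃ _ λ i j k → trans (cong (ι i ⊠_) (sym (ι-+ j k))) (trans (sym (ι-* i (j ℤ.+ k))) (trans (cong ι (ℤₚ.*-distribˡ-+ i j k)) (trans (ι-+ (i ℤ.* j) (i ℤ.* k)) (cong₂ _⊞_ (ι-* i j) (ι-* i k))))))

  ι≡0⇒∣ : ∀ {i} → ι i ≡ ι 0ℤ → p ∣ ∣ i ∣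
  ι≡0⇒∣ {i} eq with ≈-toℤ-ι i | ≈-toℤ-ι 0ℤ
  ... | u , ei | v , e0 = divides ∣ u ℤ.- v ∣ (trans (cong ∣_∣ i≡) (ℤₚ.abs-* (u ℤ.- v) (+ p)))
    where
    i≡ : i ≡ (u ℤ.- v) ℤ.* + p
    i≡ = begin
      i ≡⟨ ei ⟩
      toℤ (ι i) ℤ.+ u ℤ.* + p ≡⟨ cong (λ x → toℤ x ℤ.+ u ℤ.* + p) eq ⟩
      toℤ (ι 0ℤ) ℤ.+ u ℤ.* + p ≡⟨ regroup (toℤ (ι 0ℤ)) u v (+ p) ⟩
      (toℤ (ι 0ℤ) ℤ.+ v ℤ.* + p) ℤ.+ (u ℤ.- v) ℤ.* + p ≡⟨ cong (ℤ._+ (u ℤ.- v) ℤ.* + p) e0 ⟨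
      0ℤ ℤ.+ (u ℤ.- v) ℤ.* + p ≡⟨ ℤₚ.+-identityˡ _ ⟩
      (u ℤ.- v) ℤ.* + p ∎
      where
      open ≡-Reasoning
      regroup : ∀ a u v p → a ℤ.+ u ℤ.* p ≡ (a ℤ.+ v ℤ.* p) ℤ.+ (u ℤ.- v) ℤ.* p
      regroup = ℤR.solve-∀

  ∣⇒ι≡0 : ∀ {i} → p ∣ ∣ i ∣ → ι i ≡ ι 0ℤ
  ∣⇒ι≡0 {i} (divides k eq) with ∣∣≡⇒± i eq
  ... | inj₁ e = ι-sound {i} {0ℤ} (+ k , trans e (trans (ℤₚ.pos-* k p) (sym (ℤₚ.+-identityˡ _))))
  ... | inj₂ e = ι-sound {i} {0ℤ} (ℤ.- (+ k) , trans e (trans (cong ℤ.-_ (ℤₚ.pos-* k p)) (trans (ℤₚ.neg-distribˡ-* (+ k) (+ p)) (sym (ℤₚ.+-identityˡ _)))))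

  toℕ-ι0 : toℕ (ι 0ℤ) ≡ 0
  toℕ-ι0 = trans (Finₚ.toℕ-fromℕ< _) (DM.m<n⇒m%n≡m (>-nonZero⁻¹ p))

  inverse : ∀ x → x ≢ ι 0ℤ → Σ (Fin p) (λ y → x ⊠ y ≡ ι 1ℤ)
  inverse x x≢0 with Coprime.coprime-Bézout (Coprime.prime⇒coprime prime {{x≢0′}} (Finₚ.toℕ<n x))
    where
    x≢0′ : NonZero (toℕ x)
    x≢0′ = ≢-nonZero (λ eq → x≢0 (Finₚ.toℕ-injective (trans eq (sym toℕ-ι0))))
  ... | GCD.Bézout.+- u v eq = ι (ℤ.- (+ v)) , trans (cong (_⊠ ι (ℤ.- (+ v))) (sym (ι-toℤ x))) (trans (sym (ι-* (toℤ x) (ℤ.- (+ v)))) (ι-sound {toℤ x ℤ.* ℤ.- (+ v)} {1ℤ} (ℤ.- (+ u) , (begin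
      toℤ x ℤ.* ℤ.- (+ v) ≡⟨ regroup (toℤ x) (+ v) ⟩
      1ℤ ℤ.- (1ℤ ℤ.+ + v ℤ.* toℤ x) ≡⟨ cong (λ t → 1ℤ ℤ.- (1ℤ ℤ.+ t)) (ℤₚ.pos-* v (toℕ x)) ⟨
      1ℤ ℤ.- + (1 + v * toℕ x) ≡⟨ cong (λ t → 1ℤ ℤ.- + t) eq ⟩
      1ℤ ℤ.- + (u * p) ≡⟨ cong (λ t → 1ℤ ℤ.- t) (ℤₚ.pos-* u p) ⟩
      1ℤ ℤ.- + u ℤ.* + p ≡⟨ cong (λ t → 1ℤ ℤ.+ t) (ℤₚ.neg-distribˡ-* (+ u) (+ p)) ⟩
      1ℤ ℤ.+ (ℤ.- (+ u)) ℤ.* + p ∎))))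
    where
    open ≡-Reasoning
    regroup : ∀ x v → x ℤ.* ℤ.- v ≡ 1ℤ ℤ.- (1ℤ ℤ.+ v ℤ.* x)
    regroup = ℤR.solve-∀
  ... | GCD.Bézout.-+ u v eq = ι (+ v) , trans (cong (_⊠ ι (+ v)) (sym (ι-toℤ x))) (trans (sym (ι-* (toℤ x) (+ v))) (ι-sound {toℤ x ℤ.* + v} {1ℤ} (+ u , (begin
      toℤ x ℤ.* + v ≡⟨ ℤₚ.*-comm (toℤ x) (+ v) ⟩
      + v ℤ.* toℤ x ≡⟨ ℤₚ.pos-* v (toℕ x) ⟨
      + (v * toℕ x) ≡⟨ cong +_ eq ⟨
      + (1 + u * p) ≡⟨ cong (λ t → 1ℤ ℤ.+ t) (ℤₚ.pos-* u p) ⟩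
      1ℤ ℤ.+ + u ℤ.* + p ∎))))
    where open ≡-Reasoning

  half : ℕ
  half = p / 2

  p≡1+2half : p ≡ 1 + 2 * half
  p≡1+2half with p % 2 in eq | DM.m%n<n p 2
  ... | 0             | _ = ⊥-elim (odd (∣ₚ.m%n≡0⇒n∣m p 2 eq))
  ... | 1             | _ = trans (DM.m≡m%n+[m/n]*n p 2) (cong₂ _+_ eq (*-comm (p / 2) 2))
  ... | suc (suc _)   | s≤s (s≤s ())

  field-p : FiniteField
  field-p = record
    { K = Fin p ; _⊞_ = _⊞_ ; _⊠_ = _⊠_ ; ⊟_ = ⊟_ ; 𝟘 = ι 0ℤ ; 𝟏 = ι 1ℤ ; isCR = isCR
    ; ι = ι ; ι-+ = ι-+ ; ι-* = ι-* ; ι-neg = ι-neg ; ι-0 = refl ; ι-1 = refl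
    ; _≟K_ = Finₚ._≟_ ; 𝟏≢𝟘 = one≢zero
    ; inv = inverse ; elems = allFin p ; unique = Uniqueₚ.allFin⁺ p ; all∈ = ∈ₚ.∈-allFin
    ; half = half ; size = trans (Listₚ.length-tabulate {n = p} id) p≡1+2half }
    where
    one≢zero : ι 1ℤ ≢ ι 0ℤ
    one≢zero eq = Primality.prime⇒nonTrivial prime ▹ ι≡0⇒∣ {1ℤ} eq
      where
      _▹_ : NonTrivial p → p ∣ 1 → ⊥
      nt ▹ p∣1 = nonTrivial⇒≢1 {{nt}} (∣ₚ.∣1⇒≡1 p∣1)

-- K(√Δ), the pair (a , b) standing for a + b √Δ.
module QuadraticExtension (𝔽 : FiniteField) (Δ : FiniteField.K 𝔽) (nonsquare : ∀ y → FiniteField._⊠_ 𝔽 y y ≢ Δ) where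
  open FiniteField 𝔽
  open FieldTheory 𝔽
  open Character 𝔽
  open ≡-Reasoning

  L : Set
  L = K × K

  infixl 6 _⊕_
  infixl 7 _⊗_
  infix  8 ⊖_

  _⊕_ _⊗_ : L → L → L
  (a , b) ⊕ (c , d) = a ⊞ c , b ⊞ d
  (a , b) ⊗ (c , d) = a ⊠ c ⊞ Δ ⊠ (b ⊠ d) , a ⊠ d ⊞ b ⊠ c

  ⊖_ : L → L
  ⊖ (a , b) = ⊟ a , ⊟ b

  norm : L → K
  norm (a , b) = a ⊠ a ⊞ ⊟ (Δ ⊠ (b ⊠ b))

  embed : K → L
  embed a = a , 𝟘

  isCR-L : IsCommutativeRing _≡_ _⊕_ _⊗_ ⊖_ (embed 𝟘) (embed 𝟏)
  isCR-L = mkCommutativeRing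
    (λ { (a , b) (c , d) (e , f) → cong₂ _,_ (solve 3 (λ a c e → (a :+ c) :+ e := a :+ (c :+ e)) refl a c e) (solve 3 (λ a c e → (a :+ c) :+ e := a :+ (c :+ e)) refl b d f) })
    (λ { (a , b) (c , d) → cong₂ _,_ (⊞-comm a c) (⊞-comm b d) })
    (λ { (a , b) → cong₂ _,_ (⊞-identityˡ a) (⊞-identityˡ b) })
    (λ { (a , b) → cong₂ _,_ (trans (⊞-comm _ _) (⊟-inverseʳ a)) (trans (⊞-comm _ _) (⊟-inverseʳ b)) })
    (λ { (a , b) (c , d) (e , f) → cong₂ _,_
      (solve 7 (λ D a b c d e f → (a :* c :+ D :* (b :* d)) :* e :+ D :* ((a :* d :+ b :* c) :* f) := a :* (c :* e :+ D :* (d :* f)) :+ D :* (b :* (c :* f :+ d :* e))) refl Δ a b c d e f)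
      (solve 7 (λ D a b c d e f → (a :* c :+ D :* (b :* d)) :* f :+ (a :* d :+ b :* c) :* e := a :* (c :* f :+ d :* e) :+ b :* (c :* e :+ D :* (d :* f))) refl Δ a b c d e f) })
    (λ { (a , b) (c , d) → cong₂ _,_
      (solve 5 (λ D a b c d → a :* c :+ D :* (b :* d) := c :* a :+ D :* (d :* b)) refl Δ a b c d)
      (solve 4 (λ a b c d → a :* d :+ b :* c := c :* b :+ d :* a) refl a b c d) })
    (λ { (a , b) → cong₂ _,_
      (trans (cong₂ (λ s t → s ⊞ Δ ⊠ t) (⊠-identityˡ a) (⊠-zeroˡ b)) (trans (cong (a ⊞_) (⊠-zeroʳ Δ)) (⊞-identityʳ a)))
      (trans (cong₂ _⊞_ (⊠-identityˡ b) (⊠-zeroˡ a)) (⊞-identityʳ b)) })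
    (λ { (a , b) (c , d) (e , f) → cong₂ _,_
      (solve 7 (λ D a b c d e f → a :* (c :+ e) :+ D :* (b :* (d :+ f)) := (a :* c :+ D :* (b :* d)) :+ (a :* e :+ D :* (b :* f))) refl Δ a b c d e f)
      (solve 6 (λ a b c d e f → a :* (d :+ f) :+ b :* (c :+ e) := (a :* d :+ b :* c) :+ (a :* f :+ b :* e)) refl a b c d e f) })

  norm-≢𝟘 : ∀ z → z ≢ embed 𝟘 → norm z ≢ 𝟘
  norm-≢𝟘 (a , b) z≢0 eq with b ≟K 𝟘
  ... | yes refl = z≢0 (cong embed a≡0)
    where
    a²≡0 : a ⊠ a ≡ 𝟘
    a²≡0 = trans (sym (trans (cong (λ t → a ⊠ a ⊞ ⊟ (Δ ⊠ t)) (⊠-zeroˡ 𝟘)) (trans (cong (λ t → a ⊠ a ⊞ ⊟ t) (⊠-zeroʳ Δ))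
      (trans (cong (a ⊠ a ⊞_) (trans (sym (⊞-identityˡ _)) (⊟-inverseʳ 𝟘))) (⊞-identityʳ _))))) eq
    a≡0 : a ≡ 𝟘
    a≡0 with a ≟K 𝟘
    ... | yes e = e
    ... | no ne = ⊥-elim (⊠-≢𝟘 ne ne a²≡0)
  ... | no b≢0 = nonsquare (a ⊠ invK b) (begin
    (a ⊠ i) ⊠ (a ⊠ i) ≡⟨ solve 2 (λ a i → (a :* i) :* (a :* i) := (a :* a) :* (i :* i)) refl a i ⟩
    (a ⊠ a) ⊠ (i ⊠ i) ≡⟨ cong (_⊠ (i ⊠ i)) (⊟-≡⇒≡ eq) ⟩
    Δ ⊠ (b ⊠ b) ⊠ (i ⊠ i) ≡⟨ solve 3 (λ D b i → D :* (b :* b) :* (i :* i) := D :* ((b :* i) :* (b :* i))) refl Δ b i ⟩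
    Δ ⊠ ((b ⊠ i) ⊠ (b ⊠ i)) ≡⟨ cong (λ t → Δ ⊠ (t ⊠ t)) (invK-inverse b≢0) ⟩
    Δ ⊠ (𝟏 ⊠ 𝟏) ≡⟨ trans (cong (Δ ⊠_) (⊠-identityˡ 𝟏)) (⊠-identityʳ Δ) ⟩
    Δ ∎)
    where i = invK b

  inv-L : ∀ z → z ≢ embed 𝟘 → Σ L (λ w → z ⊗ w ≡ embed 𝟏)
  inv-L (a , b) z≢0 = (a ⊠ n , ⊟ (b ⊠ n)) , cong₂ _,_
    (trans (solve 4 (λ D a b n → a :* (a :* n) :+ D :* (b :* (:- (b :* n))) := (a :* a :+ :- (D :* (b :* b))) :* n) refl Δ a b n) (invK-inverse (norm-≢𝟘 (a , b) z≢0)))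
    (trans (solve 3 (λ a b n → a :* (:- (b :* n)) :+ b :* (a :* n) := a :* b :* n :+ :- (a :* b :* n)) refl a b n) (⊟-inverseʳ _))
    where n = invK (norm (a , b))

  extension : FiniteField
  extension = record
    { K = L ; _⊞_ = _⊕_ ; _⊠_ = _⊗_ ; ⊟_ = ⊖_ ; 𝟘 = embed 𝟘 ; 𝟏 = embed 𝟏 ; isCR = isCR-L
    ; ι = λ i → embed (ι i)
    ; ι-+ = λ i j → cong₂ _,_ (ι-+ i j) (sym (⊞-identityˡ 𝟘))
    ; ι-* = λ i j → cong₂ _,_
        (trans (ι-* i j) (sym (trans (cong (λ t → ι i ⊠ ι j ⊞ Δ ⊠ t) (⊠-zeroˡ 𝟘)) (trans (cong (ι i ⊠ ι j ⊞_) (⊠-zeroʳ Δ)) (⊞-identityʳ _)))))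
        (sym (trans (cong₂ _⊞_ (⊠-zeroʳ _) (⊠-zeroˡ _)) (⊞-identityˡ 𝟘)))
    ; ι-neg = λ i → cong₂ _,_ (ι-neg i) (trans (sym (⊟-inverseʳ 𝟘)) (⊞-identityˡ _))
    ; ι-0 = cong embed ι-0 ; ι-1 = cong embed ι-1
    ; _≟K_ = ×ₚ.≡-dec _≟K_ _≟K_
    ; 𝟏≢𝟘 = λ eq → 𝟏≢𝟘 (cong proj₁ eq)
    ; inv = inv-L
    ; elems = cart elems elems
    ; unique = Uniqueₚ.cartesianProduct⁺ unique unique
    ; all∈ = λ { (a , b) → ∈ₚ.∈-cartesianProduct⁺ (all∈ a) (all∈ b) }
    -- (q² - 1)/2 = (q - 1)/2 · (q + 1); in this form the exponent passes through the norm z^(q +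
    -- 1), see `norm-^`.
    ; half = half * (1 + q)
    ; size = trans (length-cart _,_ elems elems) (trans (cong₂ _*_ size size) (trans (identity half) (cong (λ t → 1 + 2 * (half * (1 + t))) (sym size)))) }
    where
    identity : ∀ h → (1 + 2 * h) * (1 + 2 * h) ≡ 1 + 2 * (h * (1 + (1 + 2 * h)))
    identity = ℕR.solve-∀

  private
    module E = FiniteField extension
    module T = FieldTheory extension
    module C = Character extension

  embed-⊞ : ∀ a b → embed (a ⊞ b) ≡ embed a ⊕ embed b
  embed-⊞ a b = cong (a ⊞ b ,_) (sym (⊞-identityˡ 𝟘))

  embed-⊠ : ∀ a b → embed (a ⊠ b) ≡ embed a ⊗ embed b
  embed-⊠ a b = cong₂ _,_
    (sym (trans (cong (λ t → a ⊠ b ⊞ Δ ⊠ t) (⊠-zeroˡ 𝟘)) (trans (cong (a ⊠ b ⊞_) (⊠-zeroʳ Δ)) (⊞-identityʳ _))))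
    (sym (trans (cong₂ _⊞_ (⊠-zeroʳ _) (⊠-zeroˡ _)) (⊞-identityˡ 𝟘)))

  embed-pow : ∀ a n → embed (powK a n) ≡ T.powK (embed a) n
  embed-pow a zero    = refl
  embed-pow a (suc n) = trans (embed-⊠ a (powK a n)) (cong (embed a ⊗_) (embed-pow a n))

  -- Evaluates the first n coefficients of a series over K at an element of L, so that coefficient
  -- identities over K turn into identities in L.
  evalL : ℕ → Series → L → L
  evalL zero    Ψ h = embed 𝟘
  evalL (suc n) Ψ h = embed (Ψ 0) ⊕ h ⊗ evalL n (Ψ ∘ suc) h

  evalL-lin : ∀ n y Ψ h → evalL (suc n) (lin y Ψ) h ≡ embed y ⊗ evalL (suc n) Ψ h ⊕ h ⊗ evalL n Ψ h
  evalL-lin n y Ψ h = begin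
    embed (y ⊠ Ψ 0) ⊕ h ⊗ evalL n (λ l → y ⊠ Ψ (suc l) ⊞ Ψ l) h
      ≡⟨ cong₂ (λ s t → s ⊕ h ⊗ t) (embed-⊠ y (Ψ 0)) (additive n (Ψ ∘ suc) Ψ) ⟩
    embed y ⊗ embed (Ψ 0) ⊕ h ⊗ (embed y ⊗ evalL n (Ψ ∘ suc) h ⊕ evalL n Ψ h)
      ≡⟨ T.solve 5 (λ y a h s t → y T.:* a T.:+ h T.:* (y T.:* s T.:+ t) T.:= y T.:* (a T.:+ h T.:* s) T.:+ h T.:* t) refl (embed y) (embed (Ψ 0)) h (evalL n (Ψ ∘ suc) h) (evalL n Ψ h) ⟩
    embed y ⊗ (embed (Ψ 0) ⊕ h ⊗ evalL n (Ψ ∘ suc) h) ⊕ h ⊗ evalL n Ψ h ∎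
    where
    additive : ∀ n Φ Ψ → evalL n (λ l → y ⊠ Φ l ⊞ Ψ l) h ≡ embed y ⊗ evalL n Φ h ⊕ evalL n Ψ h
    additive zero    Φ Ψ = sym (trans (cong (_⊕ embed 𝟘) (E.⊠-zeroʳ (embed y))) (E.⊞-identityˡ (embed 𝟘)))
    additive (suc n) Φ Ψ = trans (cong₂ (λ s t → s ⊕ h ⊗ t) (trans (embed-⊞ _ _) (cong (_⊕ embed (Ψ 0)) (embed-⊠ y (Φ 0)))) (additive n (Φ ∘ suc) (Ψ ∘ suc)))
      (T.solve 6 (λ y a b h s t → (y T.:* a T.:+ b) T.:+ h T.:* (y T.:* s T.:+ t) T.:= y T.:* (a T.:+ h T.:* s) T.:+ (b T.:+ h T.:* t)) refl (embed y) (embed (Φ 0)) (embed (Ψ 0)) h (evalL n (Φ ∘ suc) h) (evalL n (Ψ ∘ suc) h))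

  evalL-𝟘 : ∀ n {Ψ} h → (∀ l → l < n → Ψ l ≡ 𝟘) → evalL n Ψ h ≡ embed 𝟘
  evalL-𝟘 zero    h z = refl
  evalL-𝟘 (suc n) h z = trans (cong₂ (λ s t → embed s ⊕ h ⊗ t) (z 0 (s≤s z≤n)) (evalL-𝟘 n h (λ l lt → z (suc l) (s≤s lt))))
    (trans (cong (embed 𝟘 ⊕_) (E.⊠-zeroʳ h)) (E.⊞-identityˡ (embed 𝟘)))

  evalL-suc : ∀ n {Ψ} h → Ψ n ≡ 𝟘 → evalL (suc n) Ψ h ≡ evalL n Ψ h
  evalL-suc zero    h z = trans (cong₂ (λ s t → embed s ⊕ t) z (E.⊠-zeroʳ h)) (E.⊞-identityˡ (embed 𝟘))
  evalL-suc (suc n) h z = cong (λ t → embed _ ⊕ h ⊗ t) (evalL-suc n h z)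

  evalL-top : ∀ n {Ψ} h → (∀ l → l < n → Ψ l ≡ 𝟘) → Ψ n ≡ 𝟏 → evalL (suc n) Ψ h ≡ T.powK h n
  evalL-top zero    h z o = trans (cong₂ (λ s t → embed s ⊕ t) o (E.⊠-zeroʳ h)) (E.⊞-identityʳ (embed 𝟏))
  evalL-top (suc n) h z o = trans (cong₂ (λ s t → embed s ⊕ h ⊗ t) (z 0 (s≤s z≤n)) (evalL-top n h (λ l lt → z (suc l) (s≤s lt)) o)) (E.⊞-identityˡ _)

  evalL-ser : ∀ ys h → evalL (suc (length ys)) (ser ys) h ≡ T.∏K ys (λ y → h ⊕ embed y)
  evalL-ser []       h = trans (cong (embed 𝟏 ⊕_) (E.⊠-zeroʳ h)) (E.⊞-identityʳ (embed 𝟏))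
  evalL-ser (y ∷ ys) h = begin
    evalL (suc (suc n)) (lin y (ser ys)) h ≡⟨ evalL-lin (suc n) y (ser ys) h ⟩
    embed y ⊗ evalL (suc (suc n)) (ser ys) h ⊕ h ⊗ evalL (suc n) (ser ys) h ≡⟨ cong₂ (λ s t → embed y ⊗ s ⊕ h ⊗ t) (trans (evalL-suc (suc n) {ser ys} h (ser-above ys (n<1+n n))) (evalL-ser ys h)) (evalL-ser ys h) ⟩
    embed y ⊗ P ⊕ h ⊗ P ≡⟨ T.solve 3 (λ y h p → y T.:* p T.:+ h T.:* p T.:= (h T.:+ y) T.:* p) refl (embed y) h P ⟩
    (h ⊕ embed y) ⊗ P ∎
    where
    n = length ys
    P = T.∏K ys (λ y → h ⊕ embed y)

  -- By `frobenius` over K, only the constant and the leading coefficient of (h + w)^q survive.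
  additive^q : ∀ w h → T.powK (h ⊕ embed w) q ≡ T.powK h q ⊕ embed w
  additive^q w h = begin
    T.powK (h ⊕ embed w) q ≡⟨ cong (T.powK (h ⊕ embed w)) (Listₚ.length-replicate q) ⟨
    T.powK (h ⊕ embed w) (length ws) ≡⟨ T.∏K-const ws (h ⊕ embed w) ⟨
    T.∏K ws (λ _ → h ⊕ embed w) ≡⟨ const q ⟩
    T.∏K ws (λ y → h ⊕ embed y) ≡⟨ evalL-ser ws h ⟨
    evalL (suc (length ws)) (ser ws) h ≡⟨ cong (λ n → evalL (suc n) (ser ws) h) (trans (Listₚ.length-replicate q) size) ⟩
    evalL (suc (1 + 2 * half)) (ser ws) h ≡⟨ cong₂ (λ s t → embed s ⊕ h ⊗ t) (trans (ser-const w q) (fermat w)) (evalL-top (2 * half) h middle lead) ⟩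
    embed w ⊕ h ⊗ T.powK h (2 * half) ≡⟨ E.⊞-comm (embed w) _ ⟩
    T.powK h (1 + 2 * half) ⊕ embed w ≡⟨ cong (λ n → T.powK h n ⊕ embed w) (sym size) ⟩
    T.powK h q ⊕ embed w ∎
    where
    ws = replicate q w
    const : ∀ n → T.∏K (replicate n w) (λ _ → h ⊕ embed w) ≡ T.∏K (replicate n w) (λ y → h ⊕ embed y)
    const zero    = refl
    const (suc n) = cong ((h ⊕ embed w) ⊗_) (const n)
    middle : ∀ l → l < 2 * half → ser ws (suc l) ≡ 𝟘
    middle l lt = trans (𝟏⊠-injective (trans (frobenius w (suc l) (≤-trans (s≤s lt) (≡⇒≤ (sym size)))) (trans (⊠-zeroʳ w) (sym (⊠-zeroʳ 𝟏))))) refl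
    lead : ser ws (suc (2 * half)) ≡ 𝟏
    lead = trans (cong (ser ws) (trans (sym size) (sym (Listₚ.length-replicate q)))) (ser-lead ws)

  root : L
  root = 𝟘 , 𝟏

  root² : root ⊗ root ≡ embed Δ
  root² = cong₂ _,_
    (trans (cong₂ _⊞_ (⊠-zeroˡ 𝟘) (trans (cong (Δ ⊠_) (⊠-identityˡ 𝟏)) (⊠-identityʳ Δ))) (⊞-identityˡ Δ))
    (trans (cong₂ _⊞_ (⊠-zeroˡ 𝟏) (⊠-zeroʳ 𝟏)) (⊞-identityˡ 𝟘))

  Δ≢𝟘 : Δ ≢ 𝟘
  Δ≢𝟘 eq = nonsquare 𝟘 (trans (⊠-zeroˡ 𝟘) (sym eq))

  Δ^half : powK Δ half ≡ ⊟ 𝟏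
  Δ^half = [ (λ e → ⊥-elim (nonsquare (proj₁ (euler e)) (proj₂ (euler e)))) , id ]′ (unit-half Δ≢𝟘)

  -- (√Δ)^q = √Δ · Δ^half, and Δ^half = - 1 because Δ is not a square.
  root^q : T.powK root q ≡ embed (⊟ 𝟏) ⊗ root
  root^q = begin
    T.powK root q ≡⟨ cong (T.powK root) size ⟩
    root ⊗ T.powK root (2 * half) ≡⟨ cong (root ⊗_) (T.powK-∘ root 2 half) ⟨
    root ⊗ T.powK (root ⊗ (root ⊗ embed 𝟏)) half ≡⟨ cong (λ t → root ⊗ T.powK t half) (trans (cong (root ⊗_) (E.⊠-identityʳ root)) root²) ⟩
    root ⊗ T.powK (embed Δ) half ≡⟨ cong (root ⊗_) (trans (sym (embed-pow Δ half)) (cong embed Δ^half)) ⟩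
    root ⊗ embed (⊟ 𝟏) ≡⟨ E.⊠-comm root (embed (⊟ 𝟏)) ⟩
    embed (⊟ 𝟏) ⊗ root ∎

  as-sum : ∀ a b → (a , b) ≡ embed b ⊗ root ⊕ embed a
  as-sum a b = cong₂ _,_
    (sym (trans (cong (_⊞ a) (trans (cong₂ (λ s t → s ⊞ Δ ⊠ t) (⊠-zeroʳ b) (⊠-zeroˡ 𝟏)) (trans (⊞-identityˡ _) (⊠-zeroʳ Δ)))) (⊞-identityˡ a)))
    (sym (trans (⊞-identityʳ _) (trans (cong₂ _⊞_ (⊠-identityʳ b) (⊠-zeroˡ 𝟘)) (⊞-identityʳ b))))

  conjugate : ∀ z → T.powK z q ≡ (proj₁ z , ⊟ proj₂ z)
  conjugate (a , b) = begin
    T.powK (a , b) q ≡⟨ cong (λ z → T.powK z q) (as-sum a b) ⟩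
    T.powK (embed b ⊗ root ⊕ embed a) q ≡⟨ additive^q a (embed b ⊗ root) ⟩
    T.powK (embed b ⊗ root) q ⊕ embed a ≡⟨ cong (_⊕ embed a) (trans (T.powK-* (embed b) root q) (cong₂ _⊗_ (trans (sym (embed-pow b q)) (cong embed (fermat b))) root^q)) ⟩
    embed b ⊗ (embed (⊟ 𝟏) ⊗ root) ⊕ embed a ≡⟨ cong (_⊕ embed a) (trans (sym (E.⊠-assoc (embed b) _ root)) (cong (_⊗ root) (trans (sym (embed-⊠ b (⊟ 𝟏))) (cong embed neg-b)))) ⟩
    embed (⊟ b) ⊗ root ⊕ embed a ≡⟨ as-sum a (⊟ b) ⟨
    (a , ⊟ b) ∎
    where
    neg-b : b ⊠ ⊟ 𝟏 ≡ ⊟ b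
    neg-b = trans (solve 2 (λ b o → b :* (:- o) := :- (b :* o)) refl b 𝟏) (cong ⊟_ (⊠-identityʳ b))

  -- z^((q² - 1)/2) = (z · z^q)^((q - 1)/2), and z^q is the conjugate of z.
  norm-^ : ∀ z → T.powK z E.half ≡ embed (powK (norm z) half)
  norm-^ z@(a , b) = begin
    T.powK z (half * (1 + q)) ≡⟨ cong (T.powK z) (*-comm half (1 + q)) ⟩
    T.powK z ((1 + q) * half) ≡⟨ T.powK-∘ z (1 + q) half ⟨
    T.powK (z ⊗ T.powK z q) half ≡⟨ cong (λ t → T.powK t half) (trans (cong (z ⊗_) (conjugate z)) z·z̄) ⟩
    T.powK (embed (norm z)) half ≡⟨ embed-pow (norm z) half ⟨
    embed (powK (norm z) half) ∎
    where
    z·z̄ : (a , b) ⊗ (a , ⊟ b) ≡ embed (norm (a , b))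
    z·z̄ = cong₂ _,_ (solve 3 (λ D a b → a :* a :+ D :* (b :* (:- b)) := a :* a :+ :- (D :* (b :* b))) refl Δ a b)
      (trans (solve 2 (λ a b → a :* (:- b) :+ b :* a := a :* b :+ :- (a :* b)) refl a b) (⊟-inverseʳ _))

  χ-norm : ∀ z → χ (norm z) ≡ C.χ z
  χ-norm z = lemma (C.χ z) (C.sign z)
    where
    lemma : ∀ s → C.Sign z s → χ (norm z) ≡ s
    lemma _ (C.zer refl) = χ-𝟘 (trans (cong₂ (λ s t → s ⊞ ⊟ (Δ ⊠ t)) (⊠-zeroˡ 𝟘) (⊠-zeroˡ 𝟘)) (trans (cong (λ t → 𝟘 ⊞ ⊟ t) (⊠-zeroʳ Δ)) (⊟-inverseʳ 𝟘)))
    lemma _ (C.pos _ e)  = χ-+ (cong proj₁ (trans (sym (norm-^ z)) e))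
    lemma _ (C.neg _ e)  = χ-- (cong proj₁ (trans (sym (norm-^ z)) e))

-- Classes of pairs modulo a prime

injective⇒↭ : {A : Set} (_≟A_ : DecidableEquality A) {xs : List A} (f : A → A) → Unique xs → (∀ x → x ∈ xs) →
              (∀ {x y} → f x ≡ f y → x ≡ y) → map f xs ↭ xs
injective⇒↭ _≟A_ {xs} f u all∈ inj = unique-↭ (Uniqueₚ.map⁺ inj u) u (λ {y} _ → all∈ y) onto
  where
  onto : ∀ {y} → y ∈ xs → y ∈ map f xs
  onto {y} _ with Any.any? (y ≟A_) (map f xs)
  ... | yes y∈ = y∈
  ... | no y∉  = ⊥-elim (<-irrefl refl (≤-trans (s≤s (≡⇒≤ (sym (Listₚ.length-map f xs))))
    (injective⇒length≤ {xs = y ∷ map f xs} id (All.tabulate (λ w∈ eq → y∉ (subst (_∈ map f xs) (sym eq) w∈)) ∷ Uniqueₚ.map⁺ inj u) (λ _ _ e → e) (λ {x} _ → all∈ x))))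

-- For 1 + m linear factors on the projective line: 1 from the point at infinity, 1 + m from the
-- zeros, and `weilConst m` from the level sets.
localConst : ℕ → ℕ
localConst m = 2 + m + weilConst m

module ProjectiveLine (𝔽 : FiniteField) where
  open FiniteField 𝔽
  open FieldTheory 𝔽
  open Character 𝔽
  open Weil 𝔽
  open ≡-Reasoning

  -- The ratio a/b on the projective line, with `nothing` for infinity. It fixes t ↦ χ(a + t b) up
  -- to a factor free of t, namely χ(b), or χ(a) at infinity.
  point : K → K → Maybe K
  point a b with b ≟K 𝟘
  ... | yes _ = nothing
  ... | no _  = just (a ⊠ invK b)

  points : List (Maybe K)
  points = nothing ∷ map just elems

  points-unique : Unique points
  points-unique = All.tabulate (λ x∈ eq → not-nothing (∈ₚ.∈-map⁻ just x∈) (sym eq)) ∷ Uniqueₚ.map⁺ Maybeₚ.just-injective unique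
    where
    not-nothing : ∀ {x} → ∃ (λ y → y ∈ elems × x ≡ just y) → x ≢ nothing
    not-nothing (y , _ , refl) ()

  points-all : ∀ ξ → ξ ∈ points
  points-all nothing  = here refl
  points-all (just x) = there (∈ₚ.∈-map⁺ just (all∈ x))

  length-points : length points ≡ 1 + q
  length-points = cong suc (Listₚ.length-map just elems)

  sgn : Maybe K → ℤ → ℤ
  sgn nothing  t = 1ℤ
  sgn (just x) t = χ (x ⊞ ι t)

  coefficient : K → K → ℤ
  coefficient a b with b ≟K 𝟘
  ... | yes _ = χ a
  ... | no _  = χ b

  χ-linear : ∀ a b t → χ (a ⊞ ι t ⊠ b) ≡ coefficient a b ℤ.* sgn (point a b) t
  χ-linear a b t with b ≟K 𝟘
  ... | yes refl = trans (cong χ (trans (cong (a ⊞_) (⊠-zeroʳ (ι t))) (⊞-identityʳ a))) (sym (ℤₚ.*-identityʳ (χ a)))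
  ... | no b≢0   = trans (cong χ (begin
    a ⊞ ι t ⊠ b ≡⟨ cong (_⊞ ι t ⊠ b) (trans (sym (⊠-identityʳ a)) (cong (a ⊠_) (sym (invK-inverse b≢0)))) ⟩
    a ⊠ (b ⊠ invK b) ⊞ ι t ⊠ b ≡⟨ solve 4 (λ a b i t → a :* (b :* i) :+ t :* b := b :* (a :* i :+ t)) refl a b (invK b) (ι t) ⟩
    b ⊠ (a ⊠ invK b ⊞ ι t) ∎)) (χ-* b _)

  point-≡ : ∀ {a b a′ b′} → point a b ≡ point a′ b′ → a ⊠ b′ ≡ a′ ⊠ b
  point-≡ {a} {b} {a′} {b′} eq with b ≟K 𝟘 | b′ ≟K 𝟘
  ... | yes refl | yes refl = trans (⊠-zeroʳ a) (sym (⊠-zeroʳ a′))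
  ... | no b≢0   | no b′≢0  = begin
    a ⊠ b′ ≡⟨ trans (cong (λ t → a ⊠ b′ ⊠ t) (invK-inverse b≢0)) (⊠-identityʳ _) ⟨
    a ⊠ b′ ⊠ (b ⊠ invK b) ≡⟨ solve 4 (λ a c b i → a :* c :* (b :* i) := (a :* i) :* (c :* b)) refl a b′ b (invK b) ⟩
    (a ⊠ invK b) ⊠ (b′ ⊠ b) ≡⟨ cong (_⊠ (b′ ⊠ b)) (Maybeₚ.just-injective eq) ⟩
    (a′ ⊠ invK b′) ⊠ (b′ ⊠ b) ≡⟨ solve 4 (λ a c b i → (a :* i) :* (c :* b) := a :* b :* (c :* i)) refl a′ b′ b (invK b′) ⟩
    a′ ⊠ b ⊠ (b′ ⊠ invK b′) ≡⟨ trans (cong (λ t → a′ ⊠ b ⊠ t) (invK-inverse b′≢0)) (⊠-identityʳ _) ⟩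
    a′ ⊠ b ∎

  ∣sgn∣≤1 : ∀ ξ t → ∣ sgn ξ t ∣ ≤ 1
  ∣sgn∣≤1 nothing  t = ≤-refl
  ∣sgn∣≤1 (just x) t = ∣χ∣≤1 (x ⊞ ι t)

  ∣coefficient∣≤1 : ∀ a b → ∣ coefficient a b ∣ ≤ 1
  ∣coefficient∣≤1 a b with b ≟K 𝟘
  ... | yes _ = ∣χ∣≤1 a
  ... | no _  = ∣χ∣≤1 b

  ∏-∞ : ∀ (ts : List ℤ) → ℤΣ.∏ ts (sgn nothing) ≡ 1ℤ
  ∏-∞ ts = ℤΣ.∏-1 ts

  moment : ∀ t₁ rest m′ → length rest ≡ 1 + 2 * m′ → (∀ t → t ∈ rest → ι t ≢ ι t₁) → ∀ μ → 8 * (μ * μ) ≤ q → q < 8 * (suc μ * suc μ) →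
           ∣ ℤΣ.∑ points (λ ξ → ℤΣ.∏ (t₁ ∷ rest) (sgn ξ)) ∣ ≤ localConst (length rest) * suc μ
  moment t₁ rest m′ odd iso μ lo hi = ≤-trans (ℤₚ.∣i+j∣≤∣i∣+∣j∣ (ℤΣ.∏ (t₁ ∷ rest) (sgn nothing)) _)
    (≤-trans (+-mono-≤ (≡⇒≤ (cong ∣_∣ (∏-∞ (t₁ ∷ rest)))) (≤-trans (≡⇒≤ (cong ∣_∣ sums)) finite)) bound)
    where
    finite : ∣ ℤΣ.∑ elems (λ w → ℤΣ.∏ (ι t₁ ∷ map ι rest) (λ t → χ (w ⊞ t))) ∣ ≤ (suc (length rest) + weilConst (length rest)) * suc μ
    finite = subst (λ n → ∣ ℤΣ.∑ elems (λ w → ℤΣ.∏ (ι t₁ ∷ map ι rest) (λ t → χ (w ⊞ t))) ∣ ≤ (suc n + weilConst n) * suc μ) (Listₚ.length-map ι rest)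
      (Inversion.weil (ι t₁) (map ι rest) isolated m′ (trans (Listₚ.length-map ι rest) odd) μ lo hi)
      where
      isolated : ∀ t → t ∈ map ι rest → t ≢ ι t₁
      isolated t t∈ with ∈ₚ.∈-map⁻ ι t∈
      ... | s , s∈ , refl = iso s s∈
    sums : ℤΣ.∑ (map just elems) (λ ξ → ℤΣ.∏ (t₁ ∷ rest) (sgn ξ)) ≡ ℤΣ.∑ elems (λ w → ℤΣ.∏ (ι t₁ ∷ map ι rest) (λ t → χ (w ⊞ t)))
    sums = trans (ℤΣ.∑-map just elems _) (ℤΣ.∑-ext elems (λ w → cong (χ (w ⊞ ι t₁) ℤ.*_) (sym (ℤΣ.∏-map ι rest (λ t → χ (w ⊞ t))))))
    bound : 1 + (suc (length rest) + weilConst (length rest)) * suc μ ≤ localConst (length rest) * suc μ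
    bound = +-monoˡ-≤ _ (s≤s z≤n)

Pair Triple : Set
Pair   = ℤ × ℤ
Triple = ℤ × ℤ × ℤ

-- The coefficients of the product of the linear polynomials l₁ + l₂ s and b₁′ + b₂′ s, minus that of l₁′ + l₂′ s and b₁ + b₂ s.
wedge : Pair → Pair → Pair → Pair → Triple
wedge (l₁ , l₂) (b₁ , b₂) (l₁′ , l₂′) (b₁′ , b₂′) =
  l₁ ℤ.* b₁′ ℤ.- l₁′ ℤ.* b₁ ,
  (l₁ ℤ.* b₂′ ℤ.+ l₂ ℤ.* b₁′) ℤ.- (l₁′ ℤ.* b₂ ℤ.+ l₂′ ℤ.* b₁) ,
  l₂ ℤ.* b₂′ ℤ.- l₂′ ℤ.* b₂

Form : Set
Form = ℤ × ℤ × ℤ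

evalForm : Form → Pair → ℤ
evalForm (α , β , γ) (x , y) = α ℤ.* (x ℤ.* x) ℤ.+ β ℤ.* (x ℤ.* y) ℤ.+ γ ℤ.* (y ℤ.* y)

disc : Form → ℤ
disc (α , β , γ) = β ℤ.* β ℤ.- + 4 ℤ.* (α ℤ.* γ)

infixl 6 _⊕₂_
infixr 7 _·₂_

_⊕₂_ : Pair → Pair → Pair
(x , y) ⊕₂ (x′ , y′) = x ℤ.+ x′ , y ℤ.+ y′

_·₂_ : ℤ → Pair → Pair
k ·₂ (x , y) = k ℤ.* x , k ℤ.* y

infix 4 _∣ᶻ_

_∣ᶻ_ : ℕ → ℤ → Set
d ∣ᶻ i = d ∣ ∣ i ∣

Crossed : ℕ → Triple → Triple → Set
Crossed d (h₁ , h₂ , h₃) (k₁ , k₂ , k₃) =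
  d ∣ᶻ h₁ ℤ.* k₂ ℤ.- h₂ ℤ.* k₁ × d ∣ᶻ h₁ ℤ.* k₃ ℤ.- h₃ ℤ.* k₁ × d ∣ᶻ h₂ ℤ.* k₃ ℤ.- h₃ ℤ.* k₂

-- For D = (α , β , γ): h is parallel to (γ , −β , α) modulo p.
Parallel : ℕ → Form → Triple → Set
Parallel p (α , β , γ) (h₁ , h₂ , h₃) =
  p ∣ᶻ α ℤ.* h₂ ℤ.+ β ℤ.* h₃ × p ∣ᶻ α ℤ.* h₁ ℤ.- γ ℤ.* h₃ × p ∣ᶻ β ℤ.* h₁ ℤ.+ γ ℤ.* h₂

record ResidueField (p : ℕ) : Set₁ where
  field
    field-p : FiniteField
  open FiniteField field-p
  field
    q≡p     : q ≡ p
    ι≡0⇒∣   : ∀ {i} → ι i ≡ 𝟘 → p ∣ᶻ i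
    ∣⇒ι≡0   : ∀ {i} → p ∣ᶻ i → ι i ≡ 𝟘
    toℤ     : K → ℤ
    ι-toℤ   : ∀ x → ι (toℤ x) ≡ x
    ∣toℤ∣≤p : ∀ x → ∣ toℤ x ∣ ≤ p
    p>0     : 1 ≤ p

residueField : ∀ p → Prime p → Odd p → ResidueField p
residueField p pp odd = record
  { field-p = field-p ; q≡p = Listₚ.length-tabulate {n = p} id
  ; ι≡0⇒∣ = λ {i} → ι≡0⇒∣ {i} ; ∣⇒ι≡0 = λ {i} → ∣⇒ι≡0 {i}
  ; toℤ = toℤ ; ι-toℤ = ι-toℤ ; ∣toℤ∣≤p = λ x → <⇒≤ (Finₚ.toℕ<n x)
  ; p>0 = >-nonZero⁻¹ p {{prime⇒nonZero pp}} }
  where open PrimeField p pp odd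

-- The classes of pairs (l , b) modulo p: on each class the character of D(l + t b) is, up to sign, a fixed function of t.
record Local (p : ℕ) (D : Form) : Set₁ where
  field
    Ξ         : Set
    _≟Ξ_      : DecidableEquality Ξ
    classes   : List Ξ
    uniqueΞ   : Unique classes
    allΞ      : ∀ ξ → ξ ∈ classes
    -- There are (p + 1)² classes if D splits modulo p, and p² + 1 otherwise.
    sizeΞ     : length classes ≤ 4 * (p * p)
    chr       : ℤ → ℤ
    ∣chr∣≤1   : ∀ i → ∣ chr i ∣ ≤ 1
    chr-root  : ∀ i → chr i ≢ ℤ.-1ℤ → Σ ℤ (λ r → p ∣ᶻ r ℤ.* r ℤ.- i)
    periodic  : ∀ l k u → p ∣ᶻ k → chr (evalForm D (l ⊕₂ k ·₂ u)) ≡ chr (evalForm D l)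
    s         : Ξ → ℤ → ℤ
    ∣s∣≤1     : ∀ ξ t → ∣ s ξ t ∣ ≤ 1
    cls       : Pair → Pair → Ξ
    coef      : Pair → Pair → ℤ
    ∣coef∣≤1  : ∀ l b → ∣ coef l b ∣ ≤ 1
    factor    : ∀ l b t → chr (evalForm D (l ⊕₂ t ·₂ b)) ≡ coef l b ℤ.* s (cls l b) t
    same      : ∀ l b l′ b′ → cls l b ≡ cls l′ b′ → Parallel p D (wedge l b l′ b′)
    cross     : ∀ h k → Parallel p D h → Parallel p D k → Crossed p h k
    -- Square-root cancellation over about p² classes, provided that one of the shifts is isolated
    -- modulo p.
    momentΞ   : ∀ t₁ rest m′ → length rest ≡ 1 + 2 * m′ → (∀ t → t ∈ rest → ¬ p ∣ᶻ t ℤ.- t₁) →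
                ∣ ℤΣ.∑ classes (λ ξ → ℤΣ.∏ (t₁ ∷ rest) (s ξ)) ∣ ≤ localConst (length rest) * localConst (length rest) * p
    residues  : List ℤ
    ∣residues∣ : length residues ≡ p
    residue≤  : ∀ u → u ∈ residues → ∣ u ∣ ≤ p
    -- Complete sums in both variables; they serve the moduli that are too small for Burgess's
    -- method.
    zero-sum  : ∀ l k → ¬ p ∣ᶻ k →
                ℤΣ.∑ residues (λ u → ℤΣ.∑ residues (λ w → chr (evalForm D (l ⊕₂ k ·₂ (u , w))))) ≡ 0ℤ

-- Split and nonsplit binary forms modulo a prime

module LocalClasses (p : ℕ) (R : ResidueField p) (α β γ : ℤ) (nondegenerate : ¬ p ∣ᶻ disc (α , β , γ)) where
  private module P = ResidueField R
  open P using (q≡p; p>0)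
  open FiniteField P.field-p
  open FieldTheory P.field-p
  open Character P.field-p
  open ≡-Reasoning

  private module Line = ProjectiveLine P.field-p

  a b c two four Δ : K
  a = ι α
  b = ι β
  c = ι γ
  two = ι (+ 2)
  four = ι (+ 4)
  Δ = b ⊠ b ⊞ ⊟ (four ⊠ (a ⊠ c))

  D : Form
  D = α , β , γ

  Q : K → K → K
  Q x y = a ⊠ (x ⊠ x) ⊞ b ⊠ (x ⊠ y) ⊞ c ⊠ (y ⊠ y)

  ι-minus : ∀ i j → ι (i ℤ.- j) ≡ ι i ⊞ ⊟ ι j
  ι-minus i j = trans (ι-+ i (ℤ.- j)) (cong (ι i ⊞_) (ι-neg j))

  ι-*-* : ∀ i j k → ι (i ℤ.* (j ℤ.* k)) ≡ ι i ⊠ (ι j ⊠ ι k)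
  ι-*-* i j k = trans (ι-* i (j ℤ.* k)) (cong (ι i ⊠_) (ι-* j k))

  ι-D : ∀ x y → ι (evalForm D (x , y)) ≡ Q (ι x) (ι y)
  ι-D x y = trans (ι-+ (α ℤ.* (x ℤ.* x) ℤ.+ β ℤ.* (x ℤ.* y)) (γ ℤ.* (y ℤ.* y)))
    (cong₂ _⊞_ (trans (ι-+ (α ℤ.* (x ℤ.* x)) (β ℤ.* (x ℤ.* y))) (cong₂ _⊞_ (ι-*-* α x x) (ι-*-* β x y))) (ι-*-* γ y y))

  ι-shift : ∀ x t w → ι (x ℤ.+ t ℤ.* w) ≡ ι x ⊞ ι t ⊠ ι w
  ι-shift x t w = trans (ι-+ x (t ℤ.* w)) (cong (ι x ⊞_) (ι-* t w))

  ι-disc : ι (disc D) ≡ Δ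
  ι-disc = trans (ι-minus (β ℤ.* β) (+ 4 ℤ.* (α ℤ.* γ))) (cong₂ (λ s t → s ⊞ ⊟ t) (ι-* β β) (ι-*-* (+ 4) α γ))

  Δ≢𝟘 : Δ ≢ 𝟘
  Δ≢𝟘 eq = nondegenerate (P.ι≡0⇒∣ {disc D} (trans ι-disc eq))

  two≡ : two ≡ 𝟏 ⊞ 𝟏
  two≡ = trans (ι-+ 1ℤ 1ℤ) (cong₂ _⊞_ ι-1 ι-1)

  two-fold : ∀ u → two ⊠ u ≡ u ⊞ u
  two-fold u = trans (cong (_⊠ u) two≡) (trans (solve 2 (λ o u → (o :+ o) :* u := o :* u :+ o :* u) refl 𝟏 u) (cong₂ _⊞_ (⊠-identityˡ u) (⊠-identityˡ u)))

  two≢𝟘 : two ≢ 𝟘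
  two≢𝟘 eq = ⊟𝟏≢𝟏 (sym (⊟-≡⇒≡ (trans (solve 1 (λ o → o :+ :- (:- o) := o :+ o) refl 𝟏) (trans (sym two≡) eq))))

  four≡ : four ≡ two ⊠ two
  four≡ = ι-* (+ 2) (+ 2)

  four≢𝟘 : four ≢ 𝟘
  four≢𝟘 eq = ⊠-≢𝟘 two≢𝟘 two≢𝟘 (trans (sym four≡) eq)

  Par : K → K → K → Set
  Par h₁ h₂ h₃ = a ⊠ h₂ ⊞ b ⊠ h₃ ≡ 𝟘 × a ⊠ h₁ ⊞ ⊟ (c ⊠ h₃) ≡ 𝟘 × b ⊠ h₁ ⊞ c ⊠ h₂ ≡ 𝟘

  ι-plus : ∀ i j k l → ι (i ℤ.* j ℤ.+ k ℤ.* l) ≡ ι i ⊠ ι j ⊞ ι k ⊠ ι l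
  ι-plus i j k l = trans (ι-+ (i ℤ.* j) (k ℤ.* l)) (cong₂ _⊞_ (ι-* i j) (ι-* k l))

  ι-det : ∀ i j k l → ι (i ℤ.* j ℤ.- k ℤ.* l) ≡ ι i ⊠ ι j ⊞ ⊟ (ι k ⊠ ι l)
  ι-det i j k l = trans (ι-minus (i ℤ.* j) (k ℤ.* l)) (cong₂ (λ s t → s ⊞ ⊟ t) (ι-* i j) (ι-* k l))

  Par⇒Parallel : ∀ h₁ h₂ h₃ → Par (ι h₁) (ι h₂) (ι h₃) → Parallel p D (h₁ , h₂ , h₃)
  Par⇒Parallel h₁ h₂ h₃ (e₁ , e₂ , e₃) =
    P.ι≡0⇒∣ {α ℤ.* h₂ ℤ.+ β ℤ.* h₃} (trans (ι-plus α h₂ β h₃) e₁) ,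
    P.ι≡0⇒∣ {α ℤ.* h₁ ℤ.- γ ℤ.* h₃} (trans (ι-det α h₁ γ h₃) e₂) ,
    P.ι≡0⇒∣ {β ℤ.* h₁ ℤ.+ γ ℤ.* h₂} (trans (ι-plus β h₁ γ h₂) e₃)

  Parallel⇒Par : ∀ h₁ h₂ h₃ → Parallel p D (h₁ , h₂ , h₃) → Par (ι h₁) (ι h₂) (ι h₃)
  Parallel⇒Par h₁ h₂ h₃ (d₁ , d₂ , d₃) =
    trans (sym (ι-plus α h₂ β h₃)) (P.∣⇒ι≡0 {α ℤ.* h₂ ℤ.+ β ℤ.* h₃} d₁) ,
    trans (sym (ι-det α h₁ γ h₃)) (P.∣⇒ι≡0 {α ℤ.* h₁ ℤ.- γ ℤ.* h₃} d₂) ,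
    trans (sym (ι-plus β h₁ γ h₂)) (P.∣⇒ι≡0 {β ℤ.* h₁ ℤ.+ γ ℤ.* h₂} d₃)

  combine : ∀ {x y} u v → x ≡ 𝟘 → y ≡ 𝟘 → u ⊠ x ⊞ v ⊠ y ≡ 𝟘
  combine u v refl refl = trans (cong₂ _⊞_ (⊠-zeroʳ u) (⊠-zeroʳ v)) (⊞-identityˡ 𝟘)

  -- Both vectors are multiples of (c , - b , a). As Δ ≠ 0, one of a and b is invertible; if a = 0
  -- the third coordinates vanish and b takes over.
  crossK : ∀ h₁ h₂ h₃ k₁ k₂ k₃ → Par h₁ h₂ h₃ → Par k₁ k₂ k₃ →
           h₁ ⊠ k₂ ⊞ ⊟ (h₂ ⊠ k₁) ≡ 𝟘 × h₁ ⊠ k₃ ⊞ ⊟ (h₃ ⊠ k₁) ≡ 𝟘 × h₂ ⊠ k₃ ⊞ ⊟ (h₃ ⊠ k₂) ≡ 𝟘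
  crossK h₁ h₂ h₃ k₁ k₂ k₃ (e₁ , e₂ , e₃) (f₁ , f₂ , f₃) with a ≟K 𝟘
  ... | no a≢0 = integral (trans c₁₂ (combine₃ _ e₂ f₂ c₂₃≡)) a≢0 , integral (trans c₁₃ (combine k₃ (⊟ h₃) e₂ f₂)) a≢0 , c₂₃≡
    where
    c₂₃≡ : h₂ ⊠ k₃ ⊞ ⊟ (h₃ ⊠ k₂) ≡ 𝟘
    c₂₃≡ = integral (trans (solve 6 (λ a b h₂ h₃ k₂ k₃ → a :* (h₂ :* k₃ :+ :- (h₃ :* k₂)) := k₃ :* (a :* h₂ :+ b :* h₃) :+ (:- h₃) :* (a :* k₂ :+ b :* k₃)) refl a b h₂ h₃ k₂ k₃) (combine k₃ (⊟ h₃) e₁ f₁)) a≢0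
    c₁₃ : a ⊠ (h₁ ⊠ k₃ ⊞ ⊟ (h₃ ⊠ k₁)) ≡ k₃ ⊠ (a ⊠ h₁ ⊞ ⊟ (c ⊠ h₃)) ⊞ (⊟ h₃) ⊠ (a ⊠ k₁ ⊞ ⊟ (c ⊠ k₃))
    c₁₃ = solve 6 (λ a c h₁ h₃ k₁ k₃ → a :* (h₁ :* k₃ :+ :- (h₃ :* k₁)) := k₃ :* (a :* h₁ :+ :- (c :* h₃)) :+ (:- h₃) :* (a :* k₁ :+ :- (c :* k₃))) refl a c h₁ h₃ k₁ k₃
    c₁₂ : a ⊠ (h₁ ⊠ k₂ ⊞ ⊟ (h₂ ⊠ k₁)) ≡ (k₂ ⊠ (a ⊠ h₁ ⊞ ⊟ (c ⊠ h₃)) ⊞ (⊟ h₂) ⊠ (a ⊠ k₁ ⊞ ⊟ (c ⊠ k₃))) ⊞ (⊟ c) ⊠ (h₂ ⊠ k₃ ⊞ ⊟ (h₃ ⊠ k₂))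
    c₁₂ = solve 8 (λ a c h₁ h₂ h₃ k₁ k₂ k₃ → a :* (h₁ :* k₂ :+ :- (h₂ :* k₁)) := (k₂ :* (a :* h₁ :+ :- (c :* h₃)) :+ (:- h₂) :* (a :* k₁ :+ :- (c :* k₃))) :+ (:- c) :* (h₂ :* k₃ :+ :- (h₃ :* k₂))) refl a c h₁ h₂ h₃ k₁ k₂ k₃
    combine₃ : ∀ {x y z} u {v w : K} → x ≡ 𝟘 → y ≡ 𝟘 → z ≡ 𝟘 → (v ⊠ x ⊞ w ⊠ y) ⊞ u ⊠ z ≡ 𝟘
    combine₃ u {v} {w} ex ey refl = trans (cong₂ _⊞_ (combine v w ex ey) (⊠-zeroʳ u)) (⊞-identityˡ 𝟘)
  ... | yes a≡0 = integral (trans c₁₂ (combine k₂ (⊟ h₂) e₃ f₃)) b≢0 , trans (cong₂ (λ s t → h₁ ⊠ s ⊞ ⊟ (t ⊠ k₁)) (third f₁) (third e₁)) zeros₁ , trans (cong₂ (λ s t → h₂ ⊠ s ⊞ ⊟ (t ⊠ k₂)) (third f₁) (third e₁)) zeros₂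
    where
    b≢0 : b ≢ 𝟘
    b≢0 b≡0 = Δ≢𝟘 (trans (cong₂ (λ s t → s ⊠ s ⊞ ⊟ (four ⊠ (t ⊠ c))) b≡0 a≡0) (trans (cong₂ (λ s t → s ⊞ ⊟ (four ⊠ t)) (⊠-zeroˡ 𝟘) (⊠-zeroˡ c)) (trans (cong (λ t → 𝟘 ⊞ ⊟ t) (⊠-zeroʳ four)) (⊟-inverseʳ 𝟘))))
    third : ∀ {h₂ h₃} → a ⊠ h₂ ⊞ b ⊠ h₃ ≡ 𝟘 → h₃ ≡ 𝟘
    third {h₂} {h₃} e = integral (trans (sym (trans (cong (λ t → t ⊠ h₂ ⊞ b ⊠ h₃) a≡0) (trans (cong (_⊞ b ⊠ h₃) (⊠-zeroˡ h₂)) (⊞-identityˡ _)))) e) b≢0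
    zeros₁ : h₁ ⊠ 𝟘 ⊞ ⊟ (𝟘 ⊠ k₁) ≡ 𝟘
    zeros₁ = trans (cong₂ (λ s t → s ⊞ ⊟ t) (⊠-zeroʳ h₁) (⊠-zeroˡ k₁)) (⊟-inverseʳ 𝟘)
    zeros₂ : h₂ ⊠ 𝟘 ⊞ ⊟ (𝟘 ⊠ k₂) ≡ 𝟘
    zeros₂ = trans (cong₂ (λ s t → s ⊞ ⊟ t) (⊠-zeroʳ h₂) (⊠-zeroˡ k₂)) (⊟-inverseʳ 𝟘)
    c₁₂ : b ⊠ (h₁ ⊠ k₂ ⊞ ⊟ (h₂ ⊠ k₁)) ≡ k₂ ⊠ (b ⊠ h₁ ⊞ c ⊠ h₂) ⊞ (⊟ h₂) ⊠ (b ⊠ k₁ ⊞ c ⊠ k₂)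
    c₁₂ = solve 6 (λ b c h₁ h₂ k₁ k₂ → b :* (h₁ :* k₂ :+ :- (h₂ :* k₁)) := k₂ :* (b :* h₁ :+ c :* h₂) :+ (:- h₂) :* (b :* k₁ :+ c :* k₂)) refl b c h₁ h₂ k₁ k₂

  cross : ∀ h k → Parallel p D h → Parallel p D k → Crossed p h k
  cross (h₁ , h₂ , h₃) (k₁ , k₂ , k₃) ph pk with crossK (ι h₁) (ι h₂) (ι h₃) (ι k₁) (ι k₂) (ι k₃) (Parallel⇒Par h₁ h₂ h₃ ph) (Parallel⇒Par k₁ k₂ k₃ pk)
  ... | e₁ , e₂ , e₃ = P.ι≡0⇒∣ {h₁ ℤ.* k₂ ℤ.- h₂ ℤ.* k₁} (trans (ι-det h₁ k₂ h₂ k₁) e₁) ,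
                       P.ι≡0⇒∣ {h₁ ℤ.* k₃ ℤ.- h₃ ℤ.* k₁} (trans (ι-det h₁ k₃ h₃ k₁) e₂) ,
                       P.ι≡0⇒∣ {h₂ ℤ.* k₃ ℤ.- h₃ ℤ.* k₂} (trans (ι-det h₂ k₃ h₃ k₂) e₃)

  chr : ℤ → ℤ
  chr i = χ (ι i)

  chr-root : ∀ i → chr i ≢ ℤ.-1ℤ → Σ ℤ (λ r → p ∣ᶻ r ℤ.* r ℤ.- i)
  chr-root i ne with χ≢-1⇒square ne
  ... | y , y²≡ = P.toℤ y , P.ι≡0⇒∣ {P.toℤ y ℤ.* P.toℤ y ℤ.- i}
    (trans (ι-minus (P.toℤ y ℤ.* P.toℤ y) i) (trans (cong (_⊞ ⊟ ι i) (trans (ι-* (P.toℤ y) (P.toℤ y)) (trans (cong₂ _⊠_ (P.ι-toℤ y) (P.ι-toℤ y)) y²≡))) (⊟-inverseʳ (ι i))))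

  chr-D : ∀ l b t → chr (evalForm D (l ⊕₂ t ·₂ b)) ≡ χ (Q (ι (proj₁ l) ⊞ ι t ⊠ ι (proj₁ b)) (ι (proj₂ l) ⊞ ι t ⊠ ι (proj₂ b)))
  chr-D (l₁ , l₂) (b₁ , b₂) t = cong χ (trans (ι-D (l₁ ℤ.+ t ℤ.* b₁) (l₂ ℤ.+ t ℤ.* b₂)) (cong₂ Q (ι-shift l₁ t b₁) (ι-shift l₂ t b₂)))

  periodic : ∀ l k u → p ∣ᶻ k → chr (evalForm D (l ⊕₂ k ·₂ u)) ≡ chr (evalForm D l)
  periodic (l₁ , l₂) k (u₁ , u₂) p∣k = trans (chr-D (l₁ , l₂) (u₁ , u₂) k) (cong χ (trans (cong₂ Q (vanish l₁ u₁) (vanish l₂ u₂)) (sym (ι-D l₁ l₂))))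
    where
    vanish : ∀ i j → ι i ⊞ ι k ⊠ ι j ≡ ι i
    vanish i j = trans (cong (λ t → ι i ⊞ t ⊠ ι j) (P.∣⇒ι≡0 {k} p∣k)) (trans (cong (λ t → ι i ⊞ t) (⊠-zeroˡ (ι j))) (trans (⊞-comm (ι i) 𝟘) (⊞-identityˡ (ι i))))

  plane : List (K × K)
  plane = cart elems elems

  plane-unique : Unique plane
  plane-unique = Uniqueₚ.cartesianProduct⁺ unique unique

  plane-all : ∀ v → v ∈ plane
  plane-all (x , y) = ∈ₚ.∈-cartesianProduct⁺ (all∈ x) (all∈ y)

  ∑-permuted : (g : K × K → K × K) → (∀ {v w} → g v ≡ g w → v ≡ w) → (h : K × K → ℤ) → ℤΣ.∑ plane (h ∘ g) ≡ ℤΣ.∑ plane h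
  ∑-permuted g inj h = trans (sym (ℤΣ.∑-map g plane h)) (ℤΣ.∑-↭ h (injective⇒↭ (×ₚ.≡-dec _≟K_ _≟K_) g plane-unique plane-all inj))

  ⊞-cancelˡ : ∀ x {y w} → x ⊞ y ≡ x ⊞ w → y ≡ w
  ⊞-cancelˡ x {y} {w} eq = trans (solve 2 (λ x y → y := :- x :+ (x :+ y)) refl x y) (trans (cong (⊟ x ⊞_) eq) (solve 2 (λ x w → :- x :+ (x :+ w) := w) refl x w))

  residues : List ℤ
  residues = map P.toℤ elems

  residue≤ : ∀ u → u ∈ residues → ∣ u ∣ ≤ p
  residue≤ u u∈ with ∈ₚ.∈-map⁻ P.toℤ u∈
  ... | x , _ , refl = P.∣toℤ∣≤p x

  -- For p ∤ k the map v ↦ l + k v permutes the plane.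
  zero-sum-from : ℤΣ.∑ plane (λ v → χ (Q (proj₁ v) (proj₂ v))) ≡ 0ℤ → ∀ l k → ¬ p ∣ᶻ k →
    ℤΣ.∑ residues (λ u → ℤΣ.∑ residues (λ w → chr (evalForm D (l ⊕₂ k ·₂ (u , w))))) ≡ 0ℤ
  zero-sum-from total l@(l₁ , l₂) k p∤k = begin
    ℤΣ.∑ residues (λ u → ℤΣ.∑ residues (λ w → chr (evalForm D (l ⊕₂ k ·₂ (u , w)))))
      ≡⟨ trans (ℤΣ.∑-map P.toℤ elems _) (ℤΣ.∑-ext elems (λ u → ℤΣ.∑-map P.toℤ elems _)) ⟩
    ℤΣ.∑ elems (λ u → ℤΣ.∑ elems (λ w → chr (evalForm D (l ⊕₂ k ·₂ (P.toℤ u , P.toℤ w)))))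
      ≡⟨ ℤΣ.∑-cart elems elems (λ v → chr (evalForm D (l ⊕₂ k ·₂ (P.toℤ (proj₁ v) , P.toℤ (proj₂ v))))) ⟨
    ℤΣ.∑ plane (λ v → chr (evalForm D (l ⊕₂ k ·₂ (P.toℤ (proj₁ v) , P.toℤ (proj₂ v)))))
      ≡⟨ ℤΣ.∑-ext plane (λ v → trans (chr-D l (P.toℤ (proj₁ v) , P.toℤ (proj₂ v)) k)
           (cong₂ (λ s t → χ (Q (ι l₁ ⊞ ι k ⊠ s) (ι l₂ ⊞ ι k ⊠ t))) (P.ι-toℤ (proj₁ v)) (P.ι-toℤ (proj₂ v)))) ⟩
    ℤΣ.∑ plane (λ v → χ (Q (ι l₁ ⊞ ι k ⊠ proj₁ v) (ι l₂ ⊞ ι k ⊠ proj₂ v)))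
      ≡⟨ ∑-permuted (λ v → ι l₁ ⊞ ι k ⊠ proj₁ v , ι l₂ ⊞ ι k ⊠ proj₂ v) inj (λ v → χ (Q (proj₁ v) (proj₂ v))) ⟩
    ℤΣ.∑ plane (λ v → χ (Q (proj₁ v) (proj₂ v)))
      ≡⟨ total ⟩
    0ℤ ∎
    where
    k≢0 : ι k ≢ 𝟘
    k≢0 eq = p∤k (P.ι≡0⇒∣ {k} eq)
    inj : ∀ {v w} → (ι l₁ ⊞ ι k ⊠ proj₁ v , ι l₂ ⊞ ι k ⊠ proj₂ v) ≡ (ι l₁ ⊞ ι k ⊠ proj₁ w , ι l₂ ⊞ ι k ⊠ proj₂ w) → v ≡ w
    inj eq = cong₂ _,_ (⊠-cancelˡ k≢0 (⊞-cancelˡ (ι l₁) (cong proj₁ eq))) (⊠-cancelˡ k≢0 (⊞-cancelˡ (ι l₂) (cong proj₂ eq)))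

  isolated : ∀ {t t₁} → ¬ p ∣ᶻ t ℤ.- t₁ → ι t ≢ ι t₁
  isolated {t} {t₁} p∤ eq = p∤ (P.ι≡0⇒∣ {t ℤ.- t₁} (trans (ι-minus t t₁) (trans (cong (λ s → s ⊞ ⊟ ι t₁) eq) (⊟-inverseʳ _))))

  h₁K h₂K h₃K : Pair → Pair → Pair → Pair → K
  h₁K (l₁ , l₂) (b₁ , b₂) (l₁′ , l₂′) (b₁′ , b₂′) = ι l₁ ⊠ ι b₁′ ⊞ ⊟ (ι l₁′ ⊠ ι b₁)
  h₂K (l₁ , l₂) (b₁ , b₂) (l₁′ , l₂′) (b₁′ , b₂′) = (ι l₁ ⊠ ι b₂′ ⊞ ι l₂ ⊠ ι b₁′) ⊞ ⊟ (ι l₁′ ⊠ ι b₂ ⊞ ι l₂′ ⊠ ι b₁)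
  h₃K (l₁ , l₂) (b₁ , b₂) (l₁′ , l₂′) (b₁′ , b₂′) = ι l₂ ⊠ ι b₂′ ⊞ ⊟ (ι l₂′ ⊠ ι b₂)

  Par⇒wedge : ∀ l b l′ b′ → Par (h₁K l b l′ b′) (h₂K l b l′ b′) (h₃K l b l′ b′) → Parallel p D (wedge l b l′ b′)
  Par⇒wedge (l₁ , l₂) (b₁ , b₂) (l₁′ , l₂′) (b₁′ , b₂′) par = Par⇒Parallel _ _ _
    (Par-cong (sym (ι-det l₁ b₁′ l₁′ b₁))
      (sym (trans (ι-minus (l₁ ℤ.* b₂′ ℤ.+ l₂ ℤ.* b₁′) (l₁′ ℤ.* b₂ ℤ.+ l₂′ ℤ.* b₁)) (cong₂ (λ s t → s ⊞ ⊟ t) (ι-plus l₁ b₂′ l₂ b₁′) (ι-plus l₁′ b₂ l₂′ b₁))))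
      (sym (ι-det l₂ b₂′ l₂′ b₂)) par)
    where
    Par-cong : ∀ {h₁ h₂ h₃ k₁ k₂ k₃} → h₁ ≡ k₁ → h₂ ≡ k₂ → h₃ ≡ k₃ → Par h₁ h₂ h₃ → Par k₁ k₂ k₃
    Par-cong refl refl refl h = h

  ∣*∣≤1 : ∀ i j → ∣ i ∣ ≤ 1 → ∣ j ∣ ≤ 1 → ∣ i ℤ.* j ∣ ≤ 1
  ∣*∣≤1 i j p q = ≤-trans (≡⇒≤ (ℤₚ.abs-* i j)) (*-mono-≤ p q)

  χ²≡1 : ∀ {x} → x ≢ 𝟘 → χ x ℤ.* χ x ≡ 1ℤ
  χ²≡1 {x} x≢0 = trans (sym (χ-* x x)) (χ-square x≢0)

  χ-scaled : ∀ {κ x w} → κ ≢ 𝟘 → κ ⊠ x ≡ w → χ x ≡ χ κ ℤ.* χ w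
  χ-scaled {κ} {x} {w} κ≢0 eq = sym (begin
    χ κ ℤ.* χ w ≡⟨ cong (λ t → χ κ ℤ.* χ t) eq ⟨
    χ κ ℤ.* χ (κ ⊠ x) ≡⟨ cong (χ κ ℤ.*_) (χ-* κ x) ⟩
    χ κ ℤ.* (χ κ ℤ.* χ x) ≡⟨ ℤₚ.*-assoc (χ κ) (χ κ) (χ x) ⟨
    χ κ ℤ.* χ κ ℤ.* χ x ≡⟨ cong (ℤ._* χ x) (χ²≡1 κ≢0) ⟩
    1ℤ ℤ.* χ x ≡⟨ ℤₚ.*-identityˡ (χ x) ⟩
    χ x ∎)

  -- κ D = (e₁ X + f₁ Y) (e₂ X + f₂ Y) with independent factors. The scalar κ avoids a division by
  -- the leading coefficient; it will be 4 a or 1.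
  module Split (κ e₁ f₁ e₂ f₂ : K) (κ≢0 : κ ≢ 𝟘) (κa : κ ⊠ a ≡ e₁ ⊠ e₂) (κb : κ ⊠ b ≡ e₁ ⊠ f₂ ⊞ e₂ ⊠ f₁) (κc : κ ⊠ c ≡ f₁ ⊠ f₂)
               (det≢0 : e₁ ⊠ f₂ ⊞ ⊟ (e₂ ⊠ f₁) ≢ 𝟘) where

    form₁ form₂ : K → K → K
    form₁ x y = e₁ ⊠ x ⊞ f₁ ⊠ y
    form₂ x y = e₂ ⊠ x ⊞ f₂ ⊠ y

    factored : ∀ x y → κ ⊠ Q x y ≡ form₁ x y ⊠ form₂ x y
    factored x y = begin
      κ ⊠ Q x y
        ≡⟨ solve 6 (λ κ a b c x y → κ :* (a :* (x :* x) :+ b :* (x :* y) :+ c :* (y :* y)) := (κ :* a) :* (x :* x) :+ (κ :* b) :* (x :* y) :+ (κ :* c) :* (y :* y)) refl κ a b c x y ⟩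
      (κ ⊠ a) ⊠ (x ⊠ x) ⊞ (κ ⊠ b) ⊠ (x ⊠ y) ⊞ (κ ⊠ c) ⊠ (y ⊠ y)
        ≡⟨ cong₂ (λ s t → s ⊞ t ⊠ (y ⊠ y)) (cong₂ (λ s t → s ⊠ (x ⊠ x) ⊞ t ⊠ (x ⊠ y)) κa κb) κc ⟩
      (e₁ ⊠ e₂) ⊠ (x ⊠ x) ⊞ (e₁ ⊠ f₂ ⊞ e₂ ⊠ f₁) ⊠ (x ⊠ y) ⊞ (f₁ ⊠ f₂) ⊠ (y ⊠ y)
        ≡⟨ solve 6 (λ e₁ f₁ e₂ f₂ x y → (e₁ :* e₂) :* (x :* x) :+ (e₁ :* f₂ :+ e₂ :* f₁) :* (x :* y) :+ (f₁ :* f₂) :* (y :* y) := (e₁ :* x :+ f₁ :* y) :* (e₂ :* x :+ f₂ :* y)) refl e₁ f₁ e₂ f₂ x y ⟩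
      form₁ x y ⊠ form₂ x y ∎

    χ-Q : ∀ x y → χ (Q x y) ≡ χ κ ℤ.* (χ (form₁ x y) ℤ.* χ (form₂ x y))
    χ-Q x y = trans (χ-scaled κ≢0 (factored x y)) (cong (χ κ ℤ.*_) (χ-* (form₁ x y) (form₂ x y)))

    value₁ value₂ : Pair → K
    value₁ (x , y) = form₁ (ι x) (ι y)
    value₂ (x , y) = form₂ (ι x) (ι y)

    -- In the coordinates given by the two linear forms the sum is a product of two complete sums of
    -- χ.
    total : ℤΣ.∑ plane (λ v → χ (Q (proj₁ v) (proj₂ v))) ≡ 0ℤ
    total = begin
      ℤΣ.∑ plane (λ v → χ (Q (proj₁ v) (proj₂ v)))
        ≡⟨ trans (ℤΣ.∑-ext plane (λ v → χ-Q (proj₁ v) (proj₂ v))) (ℤΣ.∑-*ˡ (χ κ) plane _) ⟩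
      χ κ ℤ.* ℤΣ.∑ plane (λ v → χ (form₁ (proj₁ v) (proj₂ v)) ℤ.* χ (form₂ (proj₁ v) (proj₂ v)))
        ≡⟨ cong (χ κ ℤ.*_) (∑-permuted (λ v → form₁ (proj₁ v) (proj₂ v) , form₂ (proj₁ v) (proj₂ v)) inj (λ v → χ (proj₁ v) ℤ.* χ (proj₂ v))) ⟩
      χ κ ℤ.* ℤΣ.∑ plane (λ v → χ (proj₁ v) ℤ.* χ (proj₂ v))
        ≡⟨ cong (χ κ ℤ.*_) (trans (ℤΣ.∑-cart elems elems _) (sym (ℤΣ.∑-*-∑ elems elems χ χ))) ⟩
      χ κ ℤ.* (ℤΣ.∑ elems χ ℤ.* ℤΣ.∑ elems χ)
        ≡⟨ cong (λ s → χ κ ℤ.* (s ℤ.* s)) ∑χ≡0 ⟩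
      χ κ ℤ.* 0ℤ
        ≡⟨ ℤₚ.*-zeroʳ (χ κ) ⟩
      0ℤ ∎
      where
      inj : ∀ {v w} → (form₁ (proj₁ v) (proj₂ v) , form₂ (proj₁ v) (proj₂ v)) ≡ (form₁ (proj₁ w) (proj₂ w) , form₂ (proj₁ w) (proj₂ w)) → v ≡ w
      inj {x , y} {x′ , y′} eq = cong₂ _,_
        (⊠-cancelˡ det≢0 (trans (cramer₁ x y) (trans (cong₂ (λ s t → f₂ ⊠ s ⊞ ⊟ (f₁ ⊠ t)) (cong proj₁ eq) (cong proj₂ eq)) (sym (cramer₁ x′ y′)))))
        (⊠-cancelˡ det≢0 (trans (cramer₂ x y) (trans (cong₂ (λ s t → e₁ ⊠ t ⊞ ⊟ (e₂ ⊠ s)) (cong proj₁ eq) (cong proj₂ eq)) (sym (cramer₂ x′ y′)))))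
        where
        cramer₁ : ∀ x y → (e₁ ⊠ f₂ ⊞ ⊟ (e₂ ⊠ f₁)) ⊠ x ≡ f₂ ⊠ form₁ x y ⊞ ⊟ (f₁ ⊠ form₂ x y)
        cramer₁ x y = solve 6 (λ e₁ f₁ e₂ f₂ x y → (e₁ :* f₂ :+ :- (e₂ :* f₁)) :* x := f₂ :* (e₁ :* x :+ f₁ :* y) :+ :- (f₁ :* (e₂ :* x :+ f₂ :* y))) refl e₁ f₁ e₂ f₂ x y
        cramer₂ : ∀ x y → (e₁ ⊠ f₂ ⊞ ⊟ (e₂ ⊠ f₁)) ⊠ y ≡ e₁ ⊠ form₂ x y ⊞ ⊟ (e₂ ⊠ form₁ x y)
        cramer₂ x y = solve 6 (λ e₁ f₁ e₂ f₂ x y → (e₁ :* f₂ :+ :- (e₂ :* f₁)) :* y := e₁ :* (e₂ :* x :+ f₂ :* y) :+ :- (e₂ :* (e₁ :* x :+ f₁ :* y))) refl e₁ f₁ e₂ f₂ x y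

    linear : ∀ e f x x′ y y′ t → e ⊠ (x ⊞ t ⊠ x′) ⊞ f ⊠ (y ⊞ t ⊠ y′) ≡ (e ⊠ x ⊞ f ⊠ y) ⊞ t ⊠ (e ⊠ x′ ⊞ f ⊠ y′)
    linear = solve 7 (λ e f x x′ y y′ t → e :* (x :+ t :* x′) :+ f :* (y :+ t :* y′) := (e :* x :+ f :* y) :+ t :* (e :* x′ :+ f :* y′)) refl

    Class : Set
    Class = Maybe K × Maybe K

    cls : Pair → Pair → Class
    cls l b = Line.point (value₁ l) (value₁ b) , Line.point (value₂ l) (value₂ b)

    coef : Pair → Pair → ℤ
    coef l b = χ κ ℤ.* (Line.coefficient (value₁ l) (value₁ b) ℤ.* Line.coefficient (value₂ l) (value₂ b))

    s : Class → ℤ → ℤ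
    s (ξ , η) t = Line.sgn ξ t ℤ.* Line.sgn η t

    factor : ∀ l b t → chr (evalForm D (l ⊕₂ t ·₂ b)) ≡ coef l b ℤ.* s (cls l b) t
    factor l@(l₁ , l₂) b@(b₁ , b₂) t = begin
      chr (evalForm D (l ⊕₂ t ·₂ b)) ≡⟨ trans (chr-D l b t) (χ-Q _ _) ⟩
      χ κ ℤ.* (χ (form₁ _ _) ℤ.* χ (form₂ _ _))
        ≡⟨ cong₂ (λ u v → χ κ ℤ.* (χ u ℤ.* χ v)) (linear e₁ f₁ (ι l₁) (ι b₁) (ι l₂) (ι b₂) (ι t)) (linear e₂ f₂ (ι l₁) (ι b₁) (ι l₂) (ι b₂) (ι t)) ⟩
      χ κ ℤ.* (χ (value₁ l ⊞ ι t ⊠ value₁ b) ℤ.* χ (value₂ l ⊞ ι t ⊠ value₂ b))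
        ≡⟨ cong₂ (λ u v → χ κ ℤ.* (u ℤ.* v)) (Line.χ-linear (value₁ l) (value₁ b) t) (Line.χ-linear (value₂ l) (value₂ b) t) ⟩
      χ κ ℤ.* ((c₁ ℤ.* s₁) ℤ.* (c₂ ℤ.* s₂)) ≡⟨ regroup (χ κ) c₁ s₁ c₂ s₂ ⟩
      χ κ ℤ.* (c₁ ℤ.* c₂) ℤ.* (s₁ ℤ.* s₂) ∎
      where
      c₁ = Line.coefficient (value₁ l) (value₁ b)
      c₂ = Line.coefficient (value₂ l) (value₂ b)
      s₁ = Line.sgn (Line.point (value₁ l) (value₁ b)) t
      s₂ = Line.sgn (Line.point (value₂ l) (value₂ b)) t
      regroup : ∀ k c₁ s₁ c₂ s₂ → k ℤ.* ((c₁ ℤ.* s₁) ℤ.* (c₂ ℤ.* s₂)) ≡ k ℤ.* (c₁ ℤ.* c₂) ℤ.* (s₁ ℤ.* s₂)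
      regroup = ℤR.solve-∀

    -- Equal points on the line number i mean that h₁ e² + h₂ e f + h₃ f² vanishes at (eᵢ , fᵢ).
    -- With both zeros prescribed it is a multiple of the form with coefficients f₁ f₂ , - (e₁ f₂ +
    -- e₂ f₁) , e₁ e₂, and these are κ (c , - b , a).
    same : ∀ l b l′ b′ → cls l b ≡ cls l′ b′ → Parallel p D (wedge l b l′ b′)
    same l@(l₁ , l₂) b@(b₁ , b₂) l′@(l₁′ , l₂′) b′@(b₁′ , b₂′) eq = Par⇒wedge l b l′ b′
      ( integral first κ≢0
      , integral second κ≢0
      , integral third κ≢0 )
      where
      b₀ = ι β
      h₁ = h₁K l b l′ b′
      h₂ = h₂K l b l′ b′
      h₃ = h₃K l b l′ b′
      vanish : ∀ e f → (e ⊠ ι l₁ ⊞ f ⊠ ι l₂) ⊠ (e ⊠ ι b₁′ ⊞ f ⊠ ι b₂′) ≡ (e ⊠ ι l₁′ ⊞ f ⊠ ι l₂′) ⊠ (e ⊠ ι b₁ ⊞ f ⊠ ι b₂) →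
               (e ⊠ e) ⊠ h₁ ⊞ (e ⊠ f) ⊠ h₂ ⊞ (f ⊠ f) ⊠ h₃ ≡ 𝟘
      vanish e f eq = trans (solve 10 (λ e f l₁ l₂ b₁ b₂ m₁ m₂ n₁ n₂ →
          (e :* e) :* (l₁ :* n₁ :+ :- (m₁ :* b₁)) :+ (e :* f) :* ((l₁ :* n₂ :+ l₂ :* n₁) :+ :- (m₁ :* b₂ :+ m₂ :* b₁)) :+ (f :* f) :* (l₂ :* n₂ :+ :- (m₂ :* b₂))
          := (e :* l₁ :+ f :* l₂) :* (e :* n₁ :+ f :* n₂) :+ :- ((e :* m₁ :+ f :* m₂) :* (e :* b₁ :+ f :* b₂))) refl
          e f (ι l₁) (ι l₂) (ι b₁) (ι b₂) (ι l₁′) (ι l₂′) (ι b₁′) (ι b₂′))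
        (trans (cong (_⊞ ⊟ ((e ⊠ ι l₁′ ⊞ f ⊠ ι l₂′) ⊠ (e ⊠ ι b₁ ⊞ f ⊠ ι b₂))) eq) (⊟-inverseʳ _))
      E₁ : (e₁ ⊠ e₁) ⊠ h₁ ⊞ (e₁ ⊠ f₁) ⊠ h₂ ⊞ (f₁ ⊠ f₁) ⊠ h₃ ≡ 𝟘
      E₁ = vanish e₁ f₁ (Line.point-≡ (cong proj₁ eq))
      E₂ : (e₂ ⊠ e₂) ⊠ h₁ ⊞ (e₂ ⊠ f₂) ⊠ h₂ ⊞ (f₂ ⊠ f₂) ⊠ h₃ ≡ 𝟘
      E₂ = vanish e₂ f₂ (Line.point-≡ (cong proj₂ eq))
      first : κ ⊠ (a ⊠ h₂ ⊞ b₀ ⊠ h₃) ≡ 𝟘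
      first = trans (solve 5 (λ κ a b h₂ h₃ → κ :* (a :* h₂ :+ b :* h₃) := (κ :* a) :* h₂ :+ (κ :* b) :* h₃) refl κ a b₀ h₂ h₃)
        (trans (cong₂ (λ s t → s ⊠ h₂ ⊞ t ⊠ h₃) κa κb) (integral (trans (solve 7 (λ e₁ f₁ e₂ f₂ h₁ h₂ h₃ →
          (e₁ :* f₂ :+ :- (e₂ :* f₁)) :* ((e₁ :* e₂) :* h₂ :+ (e₁ :* f₂ :+ e₂ :* f₁) :* h₃)
          := (e₁ :* e₁) :* ((e₂ :* e₂) :* h₁ :+ (e₂ :* f₂) :* h₂ :+ (f₂ :* f₂) :* h₃) :+ (:- (e₂ :* e₂)) :* ((e₁ :* e₁) :* h₁ :+ (e₁ :* f₁) :* h₂ :+ (f₁ :* f₁) :* h₃)) refl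
          e₁ f₁ e₂ f₂ h₁ h₂ h₃) (combine (e₁ ⊠ e₁) (⊟ (e₂ ⊠ e₂)) E₂ E₁)) det≢0))
      second : κ ⊠ (a ⊠ h₁ ⊞ ⊟ (c ⊠ h₃)) ≡ 𝟘
      second = trans (solve 5 (λ κ a c h₁ h₃ → κ :* (a :* h₁ :+ :- (c :* h₃)) := (κ :* a) :* h₁ :+ :- ((κ :* c) :* h₃)) refl κ a c h₁ h₃)
        (trans (cong₂ (λ s t → s ⊠ h₁ ⊞ ⊟ (t ⊠ h₃)) κa κc) (integral (trans (solve 7 (λ e₁ f₁ e₂ f₂ h₁ h₂ h₃ →
          (e₁ :* f₂ :+ :- (e₂ :* f₁)) :* ((e₁ :* e₂) :* h₁ :+ :- ((f₁ :* f₂) :* h₃))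
          := (e₂ :* f₂) :* ((e₁ :* e₁) :* h₁ :+ (e₁ :* f₁) :* h₂ :+ (f₁ :* f₁) :* h₃) :+ (:- (e₁ :* f₁)) :* ((e₂ :* e₂) :* h₁ :+ (e₂ :* f₂) :* h₂ :+ (f₂ :* f₂) :* h₃)) refl
          e₁ f₁ e₂ f₂ h₁ h₂ h₃) (combine (e₂ ⊠ f₂) (⊟ (e₁ ⊠ f₁)) E₁ E₂)) det≢0))
      third : κ ⊠ (b₀ ⊠ h₁ ⊞ c ⊠ h₂) ≡ 𝟘
      third = trans (solve 5 (λ κ b c h₁ h₂ → κ :* (b :* h₁ :+ c :* h₂) := (κ :* b) :* h₁ :+ (κ :* c) :* h₂) refl κ b₀ c h₁ h₂)
        (trans (cong₂ (λ s t → s ⊠ h₁ ⊞ t ⊠ h₂) κb κc) (integral (trans (solve 7 (λ e₁ f₁ e₂ f₂ h₁ h₂ h₃ →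
          (e₁ :* f₂ :+ :- (e₂ :* f₁)) :* ((e₁ :* f₂ :+ e₂ :* f₁) :* h₁ :+ (f₁ :* f₂) :* h₂)
          := (f₂ :* f₂) :* ((e₁ :* e₁) :* h₁ :+ (e₁ :* f₁) :* h₂ :+ (f₁ :* f₁) :* h₃) :+ (:- (f₁ :* f₁)) :* ((e₂ :* e₂) :* h₁ :+ (e₂ :* f₂) :* h₂ :+ (f₂ :* f₂) :* h₃)) refl
          e₁ f₁ e₂ f₂ h₁ h₂ h₃) (combine (f₂ ⊠ f₂) (⊟ (f₁ ⊠ f₁)) E₁ E₂)) det≢0))

    classes : List Class
    classes = cart Line.points Line.points

    -- The classes form a product of two projective lines, so the sum is a square whose root is of
    -- size √p.
    moment : ∀ t₁ rest m′ → length rest ≡ 1 + 2 * m′ → (∀ t → t ∈ rest → ¬ p ∣ᶻ t ℤ.- t₁) →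
             ∣ ℤΣ.∑ classes (λ ξ → ℤΣ.∏ (t₁ ∷ rest) (s ξ)) ∣ ≤ localConst (length rest) * localConst (length rest) * p
    moment t₁ rest m′ oddLength iso = bound (sqrt8 q)
      where
      C = localConst (length rest)
      S = ℤΣ.∑ Line.points (λ ξ → ℤΣ.∏ (t₁ ∷ rest) (Line.sgn ξ))
      square : ℤΣ.∑ classes (λ ξ → ℤΣ.∏ (t₁ ∷ rest) (s ξ)) ≡ S ℤ.* S
      square = begin
        ℤΣ.∑ classes (λ ξ → ℤΣ.∏ (t₁ ∷ rest) (s ξ))
          ≡⟨ ℤΣ.∑-cart Line.points Line.points (λ ξ → ℤΣ.∏ (t₁ ∷ rest) (s ξ)) ⟩
        ℤΣ.∑ Line.points (λ ξ → ℤΣ.∑ Line.points (λ η → ℤΣ.∏ (t₁ ∷ rest) (λ t → Line.sgn ξ t ℤ.* Line.sgn η t)))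
          ≡⟨ ℤΣ.∑-ext Line.points (λ ξ → ℤΣ.∑-ext Line.points (λ η → ℤΣ.∏-* (t₁ ∷ rest) (Line.sgn ξ) (Line.sgn η))) ⟩
        ℤΣ.∑ Line.points (λ ξ → ℤΣ.∑ Line.points (λ η → ℤΣ.∏ (t₁ ∷ rest) (Line.sgn ξ) ℤ.* ℤΣ.∏ (t₁ ∷ rest) (Line.sgn η)))
          ≡⟨ ℤΣ.∑-*-∑ Line.points Line.points (λ ξ → ℤΣ.∏ (t₁ ∷ rest) (Line.sgn ξ)) (λ ξ → ℤΣ.∏ (t₁ ∷ rest) (Line.sgn ξ)) ⟨
        S ℤ.* S ∎
      small : ∀ μ → 8 * (μ * μ) ≤ q → suc μ * suc μ ≤ p
      small zero    _  = p>0
      small (suc μ) lo = ≤-trans (≤-trans (m≤m+n (suc (suc μ) * suc (suc μ)) (7 * (μ * μ) + 12 * μ + 4)) (≡⇒≤ (identity μ))) (≤-trans lo (≡⇒≤ q≡p))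
        where
        identity : ∀ μ → suc (suc μ) * suc (suc μ) + (7 * (μ * μ) + 12 * μ + 4) ≡ 8 * (suc μ * suc μ)
        identity = ℕR.solve-∀
      bound : Σ ℕ (λ μ → 8 * (μ * μ) ≤ q × q < 8 * (suc μ * suc μ)) → ∣ ℤΣ.∑ classes (λ ξ → ℤΣ.∏ (t₁ ∷ rest) (s ξ)) ∣ ≤ C * C * p
      bound (μ , lo , hi) = ≤-trans (≡⇒≤ (trans (cong ∣_∣ square) (ℤₚ.abs-* S S)))
        (≤-trans (*-mono-≤ one-line one-line) (≤-trans (≡⇒≤ (rearrange C (suc μ))) (*-monoʳ-≤ (C * C) (small μ lo))))
        where
        one-line : ∣ S ∣ ≤ C * suc μ
        one-line = Line.moment t₁ rest m′ oddLength (λ t t∈ → isolated (iso t t∈)) μ lo hi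
        rearrange : ∀ C m → C * m * (C * m) ≡ C * C * (m * m)
        rearrange = ℕR.solve-∀

    local : Local p D
    local = record
      { Ξ = Class ; _≟Ξ_ = ×ₚ.≡-dec (Maybeₚ.≡-dec _≟K_) (Maybeₚ.≡-dec _≟K_) ; classes = classes
      ; uniqueΞ = Uniqueₚ.cartesianProduct⁺ Line.points-unique Line.points-unique
      ; allΞ = λ { (ξ , η) → ∈ₚ.∈-cartesianProduct⁺ (Line.points-all ξ) (Line.points-all η) }
      ; sizeΞ = ≤-trans (≡⇒≤ (trans (length-cart _,_ Line.points Line.points) (cong (λ n → n * n) (trans Line.length-points (cong suc q≡p))))) size≤
      ; chr = chr ; ∣chr∣≤1 = λ i → ∣χ∣≤1 (ι i) ; chr-root = chr-root ; periodic = periodic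
      ; s = s ; ∣s∣≤1 = λ { (ξ , η) t → ∣*∣≤1 (Line.sgn ξ t) (Line.sgn η t) (Line.∣sgn∣≤1 ξ t) (Line.∣sgn∣≤1 η t) }
      ; cls = cls ; coef = coef
      ; ∣coef∣≤1 = λ l b → ∣*∣≤1 (χ κ) _ (∣χ∣≤1 κ) (∣*∣≤1 (Line.coefficient (value₁ l) (value₁ b)) _ (Line.∣coefficient∣≤1 _ _) (Line.∣coefficient∣≤1 _ _))
      ; factor = factor ; same = same ; cross = cross ; momentΞ = moment ; residues = residues ; ∣residues∣ = trans (Listₚ.length-map P.toℤ elems) q≡p ; residue≤ = residue≤ ; zero-sum = zero-sum-from total }
      where
      size≤ : suc p * suc p ≤ 4 * (p * p)
      size≤ = ≤-trans (*-mono-≤ double double) (≡⇒≤ (identity p))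
        where
        double : suc p ≤ 2 * p
        double = ≤-trans (+-monoˡ-≤ p p>0) (≡⇒≤ (cong (_+_ p) (sym (+-identityʳ p))))
        identity : ∀ p → 2 * p * (2 * p) ≡ 4 * (p * p)
        identity = ℕR.solve-∀

module LocalExistence (p : ℕ) (R : ResidueField p) (α β γ : ℤ) (nondegenerate : ¬ p ∣ᶻ disc (α , β , γ)) where
  private module P = ResidueField R
  open P using (q≡p; p>0)
  open FiniteField P.field-p
  open FieldTheory P.field-p
  open Character P.field-p
  open LocalClasses p R α β γ nondegenerate
  open ≡-Reasoning

  complete-square : ∀ x y → four ⊠ a ⊠ Q x y ≡ (two ⊠ (a ⊠ x) ⊞ b ⊠ y) ⊠ (two ⊠ (a ⊠ x) ⊞ b ⊠ y) ⊞ ⊟ (Δ ⊠ (y ⊠ y))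
  complete-square x y = begin
    four ⊠ a ⊠ Q x y
      ≡⟨ cong (λ f → f ⊠ a ⊠ Q x y) four≡ ⟩
    two ⊠ two ⊠ a ⊠ Q x y
      -- For the solver `two` is an indeterminate: the cross terms leave a multiple of two · two -
      -- (two + two), which vanishes in K by the next step.
      ≡⟨ solve 6 (λ two a b c x y → two :* two :* a :* (a :* (x :* x) :+ b :* (x :* y) :+ c :* (y :* y))
           := (two :* (a :* x) :+ b :* y) :* (two :* (a :* x) :+ b :* y) :+ (two :* two :- (two :+ two)) :* (a :* b :* (x :* y)) :+ :- ((b :* b :+ :- (two :* two :* (a :* c))) :* (y :* y))) refl two a b c x y ⟩
    (two ⊠ (a ⊠ x) ⊞ b ⊠ y) ⊠ (two ⊠ (a ⊠ x) ⊞ b ⊠ y) ⊞ (two ⊠ two ⊞ ⊟ (two ⊞ two)) ⊠ (a ⊠ b ⊠ (x ⊠ y)) ⊞ ⊟ ((b ⊠ b ⊞ ⊟ (two ⊠ two ⊠ (a ⊠ c))) ⊠ (y ⊠ y))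
      ≡⟨ cong₂ (λ s t → (two ⊠ (a ⊠ x) ⊞ b ⊠ y) ⊠ (two ⊠ (a ⊠ x) ⊞ b ⊠ y) ⊞ s ⊠ (a ⊠ b ⊠ (x ⊠ y)) ⊞ ⊟ ((b ⊠ b ⊞ ⊟ (t ⊠ (a ⊠ c))) ⊠ (y ⊠ y)))
           (trans (cong (λ t → t ⊞ ⊟ (two ⊞ two)) (trans (sym four≡) (ι-+ (+ 2) (+ 2)))) (⊟-inverseʳ _)) (sym four≡) ⟩
    (two ⊠ (a ⊠ x) ⊞ b ⊠ y) ⊠ (two ⊠ (a ⊠ x) ⊞ b ⊠ y) ⊞ 𝟘 ⊠ (a ⊠ b ⊠ (x ⊠ y)) ⊞ ⊟ (Δ ⊠ (y ⊠ y))
      ≡⟨ cong (_⊞ ⊟ (Δ ⊠ (y ⊠ y))) (trans (cong ((two ⊠ (a ⊠ x) ⊞ b ⊠ y) ⊠ (two ⊠ (a ⊠ x) ⊞ b ⊠ y) ⊞_) (⊠-zeroˡ _)) (⊞-identityʳ _)) ⟩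
    (two ⊠ (a ⊠ x) ⊞ b ⊠ y) ⊠ (two ⊠ (a ⊠ x) ⊞ b ⊠ y) ⊞ ⊟ (Δ ⊠ (y ⊠ y)) ∎

  four·a≢𝟘 : a ≢ 𝟘 → four ⊠ a ≢ 𝟘
  four·a≢𝟘 = ⊠-≢𝟘 four≢𝟘

  -- 4 a D(x , y) is the norm of (2 a x + b y) + y √Δ, so the character of D is the quadratic
  -- character of a linear form over the extension.
  module Nonsplit (nonsquare : ∀ y → y ⊠ y ≢ Δ) where
    open QuadraticExtension P.field-p Δ nonsquare using (L; extension; norm; embed; χ-norm; _⊕_; _⊗_)
    private
      module E = FiniteField extension
      module C = Character extension
      module Line = ProjectiveLine extension

    a≢𝟘 : a ≢ 𝟘
    a≢𝟘 a≡0 = nonsquare b (sym (trans (cong (λ t → b ⊠ b ⊞ ⊟ (four ⊠ (t ⊠ c))) a≡0) (trans (cong (λ t → b ⊠ b ⊞ ⊟ t) (trans (cong (four ⊠_) (⊠-zeroˡ c)) (⊠-zeroʳ four)))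
      (trans (cong (b ⊠ b ⊞_) (trans (sym (⊞-identityˡ _)) (⊟-inverseʳ 𝟘))) (⊞-identityʳ _)))))

    θ : K → K → L
    θ x y = two ⊠ (a ⊠ x) ⊞ b ⊠ y , y

    value : Pair → L
    value (x , y) = θ (ι x) (ι y)

    χ-Q : ∀ x y → χ (Q x y) ≡ χ (four ⊠ a) ℤ.* C.χ (θ x y)
    χ-Q x y = trans (χ-scaled (four·a≢𝟘 a≢𝟘) (complete-square x y)) (cong (χ (four ⊠ a) ℤ.*_) (χ-norm (θ x y)))

    total : ℤΣ.∑ plane (λ v → χ (Q (proj₁ v) (proj₂ v))) ≡ 0ℤ
    total = begin
      ℤΣ.∑ plane (λ v → χ (Q (proj₁ v) (proj₂ v)))
        ≡⟨ trans (ℤΣ.∑-ext plane (λ v → χ-Q (proj₁ v) (proj₂ v))) (ℤΣ.∑-*ˡ (χ (four ⊠ a)) plane _) ⟩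
      χ (four ⊠ a) ℤ.* ℤΣ.∑ plane (λ v → C.χ (θ (proj₁ v) (proj₂ v)))
        ≡⟨ cong (χ (four ⊠ a) ℤ.*_) (trans (∑-permuted (λ v → θ (proj₁ v) (proj₂ v)) inj C.χ) C.∑χ≡0) ⟩
      χ (four ⊠ a) ℤ.* 0ℤ
        ≡⟨ ℤₚ.*-zeroʳ (χ (four ⊠ a)) ⟩
      0ℤ ∎
      where
      inj : ∀ {v w} → θ (proj₁ v) (proj₂ v) ≡ θ (proj₁ w) (proj₂ w) → v ≡ w
      inj {x , y} {x′ , y′} eq with cong proj₂ eq
      ... | refl = cong (_, y) (⊠-cancelˡ a≢𝟘 (⊠-cancelˡ two≢𝟘 (⊞-cancelˡ (b ⊠ y) (trans (⊞-comm _ _) (trans (cong proj₁ eq) (⊞-comm _ _))))))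

    scalar : ∀ k z → E.ι k ⊗ z ≡ (ι k ⊠ proj₁ z , ι k ⊠ proj₂ z)
    scalar k (u , v) = cong₂ _,_
      (trans (cong (λ s → ι k ⊠ u ⊞ Δ ⊠ s) (⊠-zeroˡ v)) (trans (cong (ι k ⊠ u ⊞_) (⊠-zeroʳ Δ)) (⊞-identityʳ _)))
      (trans (cong (ι k ⊠ v ⊞_) (⊠-zeroˡ u)) (⊞-identityʳ _))

    linear : ∀ x x′ y y′ t → θ (x ⊞ ι t ⊠ x′) (y ⊞ ι t ⊠ y′) ≡ θ x y ⊕ E.ι t ⊗ θ x′ y′
    linear x x′ y y′ t = trans (cong (_, y ⊞ ι t ⊠ y′) (solve 7 (λ two a b x x′ y y′ → two :* (a :* x) :+ b :* y := two :* (a :* x) :+ b :* y) refl two a b _ x′ _ y′))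
      (trans (cong (_, y ⊞ ι t ⊠ y′) (solve 8 (λ two a b x x′ y y′ t → two :* (a :* (x :+ t :* x′)) :+ b :* (y :+ t :* y′) := (two :* (a :* x) :+ b :* y) :+ t :* (two :* (a :* x′) :+ b :* y′)) refl two a b x x′ y y′ (ι t)))
        (cong (θ x y ⊕_) (sym (scalar t (θ x′ y′)))))

    cls : Pair → Pair → Maybe L
    cls l b = Line.point (value l) (value b)

    coef : Pair → Pair → ℤ
    coef l b = χ (four ⊠ a) ℤ.* Line.coefficient (value l) (value b)

    factor : ∀ l b t → chr (evalForm D (l ⊕₂ t ·₂ b)) ≡ coef l b ℤ.* Line.sgn (cls l b) t
    factor l@(l₁ , l₂) b@(b₁ , b₂) t = begin
      chr (evalForm D (l ⊕₂ t ·₂ b))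
        ≡⟨ trans (chr-D l b t) (χ-Q _ _) ⟩
      χ (four ⊠ a) ℤ.* C.χ (θ (ι l₁ ⊞ ι t ⊠ ι b₁) (ι l₂ ⊞ ι t ⊠ ι b₂))
        ≡⟨ cong (λ w → χ (four ⊠ a) ℤ.* C.χ w) (linear (ι l₁) (ι b₁) (ι l₂) (ι b₂) t) ⟩
      χ (four ⊠ a) ℤ.* C.χ (value l ⊕ E.ι t ⊗ value b)
        ≡⟨ cong (χ (four ⊠ a) ℤ.*_) (Line.χ-linear (value l) (value b) t) ⟩
      χ (four ⊠ a) ℤ.* (Line.coefficient (value l) (value b) ℤ.* Line.sgn (cls l b) t)
        ≡⟨ ℤₚ.*-assoc (χ (four ⊠ a)) _ _ ⟨
      coef l b ℤ.* Line.sgn (cls l b) t ∎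

    -- One equation over the extension is two equations over 𝔽_p: its √Δ-component is `first`, and
    -- its rational component reduces by `first` to `second`.
    same : ∀ l b l′ b′ → cls l b ≡ cls l′ b′ → Parallel p D (wedge l b l′ b′)
    same l@(l₁ , l₂) b@(b₁ , b₂) l′@(l₁′ , l₂′) b′@(b₁′ , b₂′) eq = Par⇒wedge l b l′ b′ (first , second , third)
      where
      b₀ = ι β
      h₁ = h₁K l b l′ b′
      h₂ = h₂K l b l′ b′
      h₃ = h₃K l b l′ b′
      E : value l ⊗ value b′ ≡ value l′ ⊗ value b
      E = Line.point-≡ eq
      first : a ⊠ h₂ ⊞ b₀ ⊠ h₃ ≡ 𝟘
      first = integral (trans (solve 11 (λ two a b l₁ l₂ b₁ b₂ m₁ m₂ n₁ n₂ →
          two :* (a :* ((l₁ :* n₂ :+ l₂ :* n₁) :+ :- (m₁ :* b₂ :+ m₂ :* b₁)) :+ b :* (l₂ :* n₂ :+ :- (m₂ :* b₂)))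
          := (((two :* (a :* l₁) :+ b :* l₂) :* n₂ :+ l₂ :* (two :* (a :* n₁) :+ b :* n₂)) :+ :- ((two :* (a :* m₁) :+ b :* m₂) :* b₂ :+ m₂ :* (two :* (a :* b₁) :+ b :* b₂))) :+ (two :- con (+ 2)) :* (b :* (l₂ :* n₂ :+ :- (m₂ :* b₂)))) refl
          two a b₀ (ι l₁) (ι l₂) (ι b₁) (ι b₂) (ι l₁′) (ι l₂′) (ι b₁′) (ι b₂′))
        (trans (cong₂ (λ s t → (s ⊞ ⊟ proj₂ (value l′ ⊗ value b)) ⊞ t ⊠ (b₀ ⊠ h₃)) (cong proj₂ E) (⊟-inverseʳ two))
          (trans (cong₂ _⊞_ (⊟-inverseʳ _) (⊠-zeroˡ _)) (⊞-identityˡ 𝟘)))) two≢𝟘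
      second : a ⊠ h₁ ⊞ ⊟ (c ⊠ h₃) ≡ 𝟘
      second = integral (trans (solve 13 (λ two four a b c l₁ l₂ b₁ b₂ m₁ m₂ n₁ n₂ →
          two :* two :* a :* (a :* (l₁ :* n₁ :+ :- (m₁ :* b₁)) :+ :- (c :* (l₂ :* n₂ :+ :- (m₂ :* b₂))))
          := ((((two :* (a :* l₁) :+ b :* l₂) :* (two :* (a :* n₁) :+ b :* n₂) :+ (b :* b :+ :- (four :* (a :* c))) :* (l₂ :* n₂))
              :+ :- ((two :* (a :* m₁) :+ b :* m₂) :* (two :* (a :* b₁) :+ b :* b₂) :+ (b :* b :+ :- (four :* (a :* c))) :* (m₂ :* b₂)))
              :+ (:- (two :* b)) :* (a :* ((l₁ :* n₂ :+ l₂ :* n₁) :+ :- (m₁ :* b₂ :+ m₂ :* b₁)) :+ b :* (l₂ :* n₂ :+ :- (m₂ :* b₂))))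
              :+ ((two :- con (+ 2)) :* (b :* b :* (l₂ :* n₂ :+ :- (m₂ :* b₂))) :+ (four :- two :* two) :* (a :* c :* (l₂ :* n₂ :+ :- (m₂ :* b₂))))) refl
          two four a b₀ c (ι l₁) (ι l₂) (ι b₁) (ι b₂) (ι l₁′) (ι l₂′) (ι b₁′) (ι b₂′))
        (trans (cong₂ _⊞_ (cong₂ _⊞_ (trans (cong (λ s → s ⊞ ⊟ proj₁ (value l′ ⊗ value b)) (cong proj₁ E)) (⊟-inverseʳ _)) (trans (cong (⊟ (two ⊠ b₀) ⊠_) first) (⊠-zeroʳ _)))
                            (cong₂ _⊞_ (trans (cong (_⊠ (b₀ ⊠ b₀ ⊠ h₃)) (⊟-inverseʳ two)) (⊠-zeroˡ _)) (trans (cong (_⊠ (a ⊠ c ⊠ h₃)) (trans (cong (λ f → f ⊞ ⊟ (two ⊠ two)) four≡) (⊟-inverseʳ _))) (⊠-zeroˡ _))))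
          (trans (cong₂ _⊞_ (⊞-identityˡ 𝟘) (⊞-identityˡ 𝟘)) (⊞-identityˡ 𝟘)))) (⊠-≢𝟘 (⊠-≢𝟘 two≢𝟘 two≢𝟘) a≢𝟘)
      third : b₀ ⊠ h₁ ⊞ c ⊠ h₂ ≡ 𝟘
      third = integral (trans (solve 6 (λ a b c h₁ h₂ h₃ → a :* (b :* h₁ :+ c :* h₂) := b :* (a :* h₁ :+ :- (c :* h₃)) :+ c :* (a :* h₂ :+ b :* h₃)) refl a b₀ c h₁ h₂ h₃)
        (combine b₀ c second first)) a≢𝟘

    qL≡ : E.q ≡ p * p
    qL≡ = trans (length-cart _,_ elems elems) (cong₂ _*_ q≡p q≡p)

    moment : ∀ t₁ rest m′ → length rest ≡ 1 + 2 * m′ → (∀ t → t ∈ rest → ¬ p ∣ᶻ t ℤ.- t₁) →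
             ∣ ℤΣ.∑ Line.points (λ ξ → ℤΣ.∏ (t₁ ∷ rest) (Line.sgn ξ)) ∣ ≤ localConst (length rest) * localConst (length rest) * p
    moment t₁ rest m′ oddLength iso = bound (sqrt8 E.q)
      where
      bound : Σ ℕ (λ μ → 8 * (μ * μ) ≤ E.q × E.q < 8 * (suc μ * suc μ)) → _
      bound (μ , lo , hi) = ≤-trans (Line.moment t₁ rest m′ oddLength (λ t t∈ eq → isolated (iso t t∈) (cong proj₁ eq)) μ lo hi)
        (*-mono-≤ (m≤m*n (localConst (length rest)) (localConst (length rest))) small)
        where
        small : suc μ ≤ p
        small with suc μ ≤? p
        ... | yes le = le
        ... | no nle = ⊥-elim (<⇒≱ (*-mono-≤ p>0 p>0) (≤-trans (m≤m*n (p * p) 7) (≡⇒≤ (trans (*-comm (p * p) 7) zero-mult))))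
          where
          p≤μ : p ≤ μ
          p≤μ = s≤s⁻¹ (≰⇒> nle)
          8p²≤p² : 8 * (p * p) ≤ p * p
          8p²≤p² = ≤-trans (*-monoʳ-≤ 8 (*-mono-≤ p≤μ p≤μ)) (≤-trans lo (≡⇒≤ qL≡))
          zero-mult : 7 * (p * p) ≡ 0
          zero-mult = n≤0⇒n≡0 (+-cancelˡ-≤ (p * p) (7 * (p * p)) 0 (≤-trans 8p²≤p² (≡⇒≤ (sym (+-identityʳ _)))))

    local : Local p D
    local = record
      { Ξ = Maybe L ; _≟Ξ_ = Maybeₚ.≡-dec (×ₚ.≡-dec _≟K_ _≟K_) ; classes = Line.points
      ; uniqueΞ = Line.points-unique ; allΞ = Line.points-all
      ; sizeΞ = ≤-trans (≡⇒≤ (trans Line.length-points (cong suc qL≡))) (≤-trans (+-monoˡ-≤ (p * p) (*-mono-≤ p>0 p>0)) (+-monoʳ-≤ (p * p) (m≤m+n (p * p) _)))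
      ; chr = chr ; ∣chr∣≤1 = λ i → ∣χ∣≤1 (ι i) ; chr-root = chr-root ; periodic = periodic
      ; s = Line.sgn ; ∣s∣≤1 = Line.∣sgn∣≤1
      ; cls = cls ; coef = coef
      ; ∣coef∣≤1 = λ l b → ∣*∣≤1 (χ (four ⊠ a)) _ (∣χ∣≤1 (four ⊠ a)) (Line.∣coefficient∣≤1 (value l) (value b))
      ; factor = factor ; same = same ; cross = cross ; momentΞ = moment ; residues = residues ; ∣residues∣ = trans (Listₚ.length-map P.toℤ elems) q≡p ; residue≤ = residue≤ ; zero-sum = zero-sum-from total }

  -- If Δ = ρ² and a ≠ 0, then 4 a D = (2 a X + (b - ρ) Y) (2 a X + (b + ρ) Y); if a = 0, then D = Y
  -- (b X + c Y).
  local : Local p (α , β , γ)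
  local with Any.any? (λ y → y ⊠ y ≟K Δ) elems
  ... | no none = Nonsplit.local (λ y eq → none (Any.map (λ { refl → eq }) (all∈ y)))
  ... | yes some with find some
  ...   | ρ , _ , ρ²≡Δ with a ≟K 𝟘
  ...     | no a≢0 = Split.local (four ⊠ a) (two ⊠ a) (b ⊞ ⊟ ρ) (two ⊠ a) (b ⊞ ρ) (four·a≢𝟘 a≢0)
      (trans (cong (λ f → f ⊠ a ⊠ a) four≡) (solve 2 (λ two a → two :* two :* a :* a := (two :* a) :* (two :* a)) refl two a))
      (trans (cong (λ f → f ⊠ a ⊠ b) four≡) (trans (⊠-assoc (two ⊠ two) a b) (trans (⊠-assoc two two (a ⊠ b)) (trans (two-fold (two ⊠ (a ⊠ b)))
        (solve 4 (λ two a b ρ → two :* (a :* b) :+ two :* (a :* b) := (two :* a) :* (b :+ ρ) :+ (two :* a) :* (b :+ :- ρ)) refl two a b ρ)))))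
      (trans (trans (⊠-assoc four a c) (solve 2 (λ B f → f := B :* B :+ :- (B :* B :+ :- f)) refl b (four ⊠ (a ⊠ c))))
        (trans (cong (λ t → b ⊠ b ⊞ ⊟ t) (sym ρ²≡Δ)) (solve 2 (λ b ρ → b :* b :+ :- (ρ :* ρ) := (b :+ :- ρ) :* (b :+ ρ)) refl b ρ)))
      (λ eq → ⊠-≢𝟘 two≢𝟘 (⊠-≢𝟘 a≢0 ρ≢0) (integral (trans (sym (trans (solve 4 (λ two a b ρ → (two :* a) :* (b :+ ρ) :+ :- ((two :* a) :* (b :+ :- ρ)) := two :* (a :* ρ) :+ two :* (a :* ρ)) refl two a b ρ) (sym (two-fold (two ⊠ (a ⊠ ρ)))))) eq) two≢𝟘))
      where
      ρ≢0 : ρ ≢ 𝟘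
      ρ≢0 e = Δ≢𝟘 (trans (sym ρ²≡Δ) (trans (cong (λ t → t ⊠ t) e) (⊠-zeroˡ 𝟘)))
  ...     | yes a≡0 = Split.local 𝟏 𝟘 𝟏 b c 𝟏≢𝟘
      (trans (⊠-identityˡ a) (trans a≡0 (sym (⊠-zeroˡ b))))
      (trans (⊠-identityˡ b) (sym (trans (cong₂ _⊞_ (⊠-zeroˡ c) (⊠-identityʳ b)) (⊞-identityˡ b))))
      (trans (⊠-identityˡ c) (sym (⊠-identityˡ c)))
      (λ eq → b≢0 (trans (sym (trans (solve 1 (λ t → :- (:- t) := t) refl (b ⊠ 𝟏)) (⊠-identityʳ b))) (trans (cong ⊟_ (trans (sym (trans (cong (_⊞ ⊟ (b ⊠ 𝟏)) (⊠-zeroˡ c)) (⊞-identityˡ _))) eq)) (trans (sym (⊞-identityˡ _)) (⊟-inverseʳ 𝟘)))))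
      where
      b≢0 : b ≢ 𝟘
      b≢0 b≡0 = Δ≢𝟘 (trans (cong₂ (λ s t → s ⊠ s ⊞ ⊟ (four ⊠ (t ⊠ c))) b≡0 a≡0) (trans (cong₂ (λ s t → s ⊞ ⊟ (four ⊠ t)) (⊠-zeroˡ 𝟘) (⊠-zeroˡ c)) (trans (cong (λ t → 𝟘 ⊞ ⊟ t) (⊠-zeroʳ four)) (⊟-inverseʳ 𝟘))))

-- Prime products and the divisor bound

range₁ : ℕ → List ℕ
range₁ n = map suc (upTo n)

∈-range₁⁺ : ∀ {n k} → 1 ≤ k → k ≤ n → k ∈ range₁ n
∈-range₁⁺ {k = suc k} _ le = ∈ₚ.∈-map⁺ suc (∈ₚ.∈-upTo⁺ le)

∈-range₁⁻ : ∀ {n k} → k ∈ range₁ n → 1 ≤ k × k ≤ n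
∈-range₁⁻ k∈ with ∈ₚ.∈-map⁻ suc k∈
... | j , j∈ , refl = s≤s z≤n , ∈ₚ.∈-upTo⁻ j∈

range₁-unique : ∀ n → Unique (range₁ n)
range₁-unique n = Uniqueₚ.map⁺ suc-injective (Uniqueₚ.upTo⁺ n)

length-range₁ : ∀ n → length (range₁ n) ≡ n
length-range₁ n = trans (Listₚ.length-map suc (upTo n)) (Listₚ.length-upTo n)

∤-product : ∀ {p} qs → Prime p → All (p ≢_) qs → All Prime qs → ¬ p ∣ product qs
∤-product []       pp _          _         p∣1 = nonTrivial⇒≢1 {{prime⇒nonTrivial pp}} (∣ₚ.∣1⇒≡1 p∣1)
∤-product (q ∷ qs) pp (p≢q ∷ ne) (pq ∷ pr) p∣ with euclidsLemma q (product qs) pp p∣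
... | inj₂ p∣qs = ∤-product qs pp ne pr p∣qs
... | inj₁ p∣q with Primality.prime⇒irreducible pq p∣q
...   | inj₁ p≡1 = nonTrivial⇒≢1 {{prime⇒nonTrivial pp}} p≡1
...   | inj₂ p≡q = p≢q p≡q

∣-prime-product : ∀ ps {n} → Unique ps → All Prime ps → (∀ p → p ∈ ps → p ∣ n) → product ps ∣ n
∣-prime-product []       u        pr dv = ∣ₚ.1∣ _
∣-prime-product (p ∷ ps) {n} (p∉ ∷ u) (pp ∷ pr) dv with ∣-prime-product ps u pr (λ q q∈ → dv q (there q∈))
... | divides k n≡ with euclidsLemma k (product ps) pp (subst (p ∣_) n≡ (dv p (here refl)))
...   | inj₁ (divides j k≡) = divides j (trans n≡ (trans (cong (_* product ps) k≡) (*-assoc j p (product ps))))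
...   | inj₂ p∣ = ⊥-elim (∤-product ps pp p∉ pr p∣)

-- At most K members lie below K, which costs K^K; every other member is at least K and pays for its
-- own factor. This is how ω(n) = o(log n) enters.
^-length≤ : ∀ K ps → 1 ≤ K → Unique ps → (∀ p → p ∈ ps → 1 ≤ p) → K ^ length ps ≤ K ^ K * product ps
^-length≤ K ps 1≤K u pos = ≤-trans (weighted ps pos) (*-monoˡ-≤ (product ps) (^-monoʳ-≤ K {{>-nonZero 1≤K}} small))
  where
  small? : ∀ p → Dec (p < K)
  small? p = p <? K
  small : length (filter small? ps) ≤ K
  small = ≤-trans (injective⇒length≤ id (Uniqueₚ.filter⁺ small? u) (λ _ _ e → e) (λ p∈ → ∈ₚ.∈-upTo⁺ (proj₂ (∈ₚ.∈-filter⁻ small? {xs = ps} p∈)))) (≡⇒≤ (Listₚ.length-upTo K))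
  weighted : ∀ qs → (∀ p → p ∈ qs → 1 ≤ p) → K ^ length qs ≤ K ^ length (filter small? qs) * product qs
  weighted []       _   = ≤-refl
  weighted (p ∷ qs) pos with p <? K
  ... | yes p<K rewrite Listₚ.filter-accept small? {xs = qs} p<K = ≤-trans (*-monoʳ-≤ K (weighted qs (λ q q∈ → pos q (there q∈))))
    (≤-trans (≡⇒≤ (sym (*-assoc K _ (product qs)))) (*-monoʳ-≤ (K * K ^ length (filter small? qs)) (m≤n*m (product qs) p {{>-nonZero (pos p (here refl))}})))
  ... | no p≮K rewrite Listₚ.filter-reject small? {xs = qs} p≮K = ≤-trans (*-mono-≤ (≮⇒≥ p≮K) (weighted qs (λ q q∈ → pos q (there q∈)))) (≡⇒≤ (swap p (K ^ length (filter small? qs)) (product qs)))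
    where
    swap : ∀ a b c → a * (b * c) ≡ b * (a * c)
    swap = ℕR.solve-∀

divisors : ℕ → List ℕ
divisors n = filter (_∣? n) (upTo (suc n))

divisors-unique : ∀ n → Unique (divisors n)
divisors-unique n = Uniqueₚ.filter⁺ (_∣? n) (Uniqueₚ.upTo⁺ (suc n))

∈-divisors⁺ : ∀ {k n} → 1 ≤ n → k ∣ n → k ∈ divisors n
∈-divisors⁺ {k} {n} 1≤n k∣n = ∈ₚ.∈-filter⁺ (_∣? n) (∈ₚ.∈-upTo⁺ (s≤s (∣ₚ.∣⇒≤ {{>-nonZero 1≤n}} k∣n))) k∣n

∈-divisors⁻ : ∀ {k n} → k ∈ divisors n → k ∣ n
∈-divisors⁻ {n = n} k∈ = proj₂ (∈ₚ.∈-filter⁻ (_∣? n) {xs = upTo (suc n)} k∈)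

τ : ℕ → ℕ
τ n = length (divisors n)

extract : ∀ p n → 2 ≤ p → 1 ≤ n → Σ ℕ (λ a → Σ ℕ (λ m → n ≡ p ^ a * m × ¬ p ∣ m))
extract p n 2≤p 1≤n = go n n ≤-refl 1≤n
  where
  go : ∀ fuel n → n ≤ fuel → 1 ≤ n → Σ ℕ (λ a → Σ ℕ (λ m → n ≡ p ^ a * m × ¬ p ∣ m))
  go zero       n n≤ 1≤n = ⊥-elim (<⇒≱ 1≤n n≤)
  go (suc fuel) n n≤ 1≤n with p ∣? n
  ... | no p∤n = 0 , n , sym (+-identityʳ n) , p∤n
  ... | yes (divides k n≡) with go fuel k k≤ 1≤k
    where
    1≤k : 1 ≤ k
    1≤k = n≢0⇒n>0 (λ { refl → <⇒≱ 1≤n (≡⇒≤ n≡) })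
    k≤ : k ≤ fuel
    k≤ = s≤s⁻¹ (≤-trans (≤-trans (m<m*n k p {{>-nonZero 1≤k}} 2≤p) (≡⇒≤ (sym n≡))) n≤)
  ...   | a , m , k≡ , p∤m = suc a , m , trans n≡ (trans (*-comm k p) (trans (cong (p *_) k≡) (sym (*-assoc p (p ^ a) m)))) , p∤m

module _ {p : ℕ} (pp : Prime p) where
  private
    2≤p : 2 ≤ p
    2≤p = nonTrivial⇒n>1 p {{prime⇒nonTrivial pp}}

  coprime-prime : ∀ {e} → ¬ p ∣ e → Coprime e p
  coprime-prime p∤e (k∣e , k∣p) with Primality.prime⇒irreducible pp k∣p
  ... | inj₁ k≡1  = k≡1
  ... | inj₂ refl = ⊥-elim (p∤e k∣e)

  ∣-cancel-power : ∀ a {e m} → ¬ p ∣ e → e ∣ p ^ a * m → e ∣ m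
  ∣-cancel-power zero    {e} {m} p∤e e∣ = subst (e ∣_) (+-identityʳ m) e∣
  ∣-cancel-power (suc a) {e} {m} p∤e e∣ = ∣-cancel-power a p∤e (Coprime.coprime-divisor (coprime-prime p∤e) (subst (e ∣_) (*-assoc p (p ^ a) m) e∣))

  power-≤ : ∀ v a {e m} → ¬ p ∣ m → p ^ v * e ∣ p ^ a * m → v ≤ a
  power-≤ zero    a       p∤m dv = z≤n
  power-≤ (suc v) zero    {e} {m} p∤m dv = ⊥-elim (p∤m (subst (p ∣_) (+-identityʳ m) (∣ₚ.∣-trans (∣ₚ.m∣m*n (p ^ v * e)) (subst (_∣ 1 * m) (*-assoc p (p ^ v) e) dv))))
  power-≤ (suc v) (suc a) {e} {m} p∤m dv = s≤s (power-≤ v a p∤m (∣ₚ.*-cancelˡ-∣ p {{prime⇒nonZero pp}} (subst₂ _∣_ (*-assoc p (p ^ v) e) (*-assoc p (p ^ a) m) dv)))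

  -- A divisor is coded by its exponent at p, at most a, and by its part prime to p, which divides
  -- m.
  τ-power : ∀ a m → 1 ≤ m → ¬ p ∣ m → τ (p ^ a * m) ≤ suc a * τ m
  τ-power a m 1≤m p∤m = ≤-trans (injective⇒length≤ {ys = cart (upTo (suc a)) (divisors m)} code (divisors-unique n) inj into)
    (≡⇒≤ (trans (length-cart _,_ (upTo (suc a)) (divisors m)) (cong (_* τ m) (Listₚ.length-upTo (suc a)))))
    where
    n = p ^ a * m
    1≤n : 1 ≤ n
    1≤n = *-mono-≤ (m^n>0 p {{prime⇒nonZero pp}} a) 1≤m
    pos : ∀ {e} → e ∣ n → 1 ≤ e
    pos {e} e∣n = n≢0⇒n>0 (λ { refl → <⇒≱ 1≤n (≡⇒≤ (∣ₚ.0∣⇒≡0 e∣n)) })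
    code : ℕ → ℕ × ℕ
    code zero      = 0 , 0
    code e@(suc _) with extract p e 2≤p (s≤s z≤n)
    ... | v , e′ , _ = v , e′
    code-spec : ∀ e → 1 ≤ e → e ≡ p ^ proj₁ (code e) * proj₂ (code e) × ¬ p ∣ proj₂ (code e)
    code-spec e@(suc _) _ with extract p e 2≤p (s≤s z≤n)
    ... | v , e′ , eq , p∤e′ = eq , p∤e′
    inj : ∀ {e e′} → e ∈ divisors n → e′ ∈ divisors n → code e ≡ code e′ → e ≡ e′
    inj {e} {e′} e∈ e′∈ eq = trans (proj₁ (code-spec e (pos (∈-divisors⁻ {n = n} e∈)))) (trans (cong (λ c → p ^ proj₁ c * proj₂ c) eq) (sym (proj₁ (code-spec e′ (pos (∈-divisors⁻ {n = n} e′∈))))))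
    into : ∀ {e} → e ∈ divisors n → code e ∈ cart (upTo (suc a)) (divisors m)
    into {e} e∈ with code-spec e (pos (∈-divisors⁻ {n = n} e∈))
    ... | eq , p∤ = ∈ₚ.∈-cartesianProduct⁺
      (∈ₚ.∈-upTo⁺ (s≤s (power-≤ (proj₁ (code e)) a p∤m (subst (_∣ n) eq (∈-divisors⁻ {n = n} e∈)))))
      (∈-divisors⁺ 1≤m (∣-cancel-power a p∤ (∣ₚ.∣-trans (∣ₚ.n∣m*n (p ^ proj₁ (code e))) (subst (_∣ n) eq (∈-divisors⁻ {n = n} e∈)))))

suc≤2^ : ∀ a → suc a ≤ 2 ^ a
suc≤2^ zero    = ≤-refl
suc≤2^ (suc a) = ≤-trans (+-mono-≤ (m^n>0 2 a) (suc≤2^ a)) (≡⇒≤ (cong (λ t → 2 ^ a + t) (sym (+-identityʳ (2 ^ a)))))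

-- With a = r + c k and r < k: a + 1 ≤ k (c + 1) ≤ k 2ᶜ.
suc^≤ : ∀ k a → 1 ≤ k → suc a ^ k ≤ k ^ k * 2 ^ a
suc^≤ k a 1≤k = ≤-trans (^-monoˡ-≤ k base) (≤-trans (≡⇒≤ (^-distribʳ-* k k (2 ^ (a / k)))) (*-monoʳ-≤ (k ^ k) (≤-trans (≡⇒≤ (^-*-assoc 2 (a / k) k)) (^-monoʳ-≤ 2 (DM.m/n*n≤m a k)))))
  where
  instance
    k≢0 : NonZero k
    k≢0 = >-nonZero 1≤k
  ^-distribʳ-* : ∀ n a b → (a * b) ^ n ≡ a ^ n * b ^ n
  ^-distribʳ-* zero    a b = refl
  ^-distribʳ-* (suc n) a b = trans (cong (a * b *_) (^-distribʳ-* n a b)) (ℕΣ.*-interchange a b (a ^ n) (b ^ n))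
  base : suc a ≤ k * 2 ^ (a / k)
  base = ≤-trans (≤-trans (s≤s (≡⇒≤ (DM.m≡m%n+[m/n]*n a k))) (+-monoˡ-≤ (a / k * k) (DM.m%n<n a k)))
    (≤-trans (≡⇒≤ (*-comm (suc (a / k)) k)) (*-monoʳ-≤ k (suc≤2^ (a / k))))

^-distrib-* : ∀ n a b → (a * b) ^ n ≡ a ^ n * b ^ n
^-distrib-* zero    a b = refl
^-distrib-* (suc n) a b = trans (cong (a * b *_) (^-distrib-* n a b)) (ℕΣ.*-interchange a b (a ^ n) (b ^ n))

-- A prime power pᵃ contributes (a + 1)ᵏ to the left side. For p ≥ 2ᵏ this is at most pᵃ and costs
-- nothing; each smaller prime costs a factor kᵏ by `suc^≤`. The primes below 2ᵏ are removed in
-- increasing order, leaving ever rougher numbers.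
τ-bound : ∀ k → 1 ≤ k → Σ ℕ (λ C → 1 ≤ C × (∀ n → 1 ≤ n → τ n ^ k ≤ C * n))
τ-bound k 1≤k = proj₁ (all-primes (2 ^ k)) , proj₁ (proj₂ (all-primes (2 ^ k))) , λ n 1≤n → proj₂ (proj₂ (all-primes (2 ^ k))) 2 ≤-refl (m≤n+m (2 ^ k) 2) n 1≤n Primality.2-rough
  where
  Bound : ℕ → ℕ → Set
  Bound j C = ∀ n → 1 ≤ n → j Primality.Rough n → τ n ^ k ≤ C * n

  kᵏ>0 : 1 ≤ k ^ k
  kᵏ>0 = m^n>0 k {{>-nonZero 1≤k}} k

  extract-bound : ∀ {p a m} c C → Prime p → 1 ≤ m → ¬ p ∣ m → suc a ^ k ≤ c * p ^ a → τ m ^ k ≤ C * m → τ (p ^ a * m) ^ k ≤ c * C * (p ^ a * m)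
  extract-bound {p} {a} {m} c C pp 1≤m p∤m le₁ le₂ = ≤-trans (^-monoˡ-≤ k (τ-power pp a m 1≤m p∤m))
    (≤-trans (≡⇒≤ (^-distrib-* k (suc a) (τ m))) (≤-trans (*-mono-≤ le₁ le₂) (≡⇒≤ (ℕΣ.*-interchange c (p ^ a) C m))))

  -- If all prime factors are at least 2ᵏ then the constant is 1.
  rough : ∀ fuel n → n ≤ fuel → 1 ≤ n → (2 ^ k) Primality.Rough n → τ n ^ k ≤ 1 * n
  rough zero       n n≤ 1≤n r = ⊥-elim (<⇒≱ 1≤n n≤)
  rough (suc fuel) n n≤ 1≤n r with n ≟ 1
  ... | yes refl = ≡⇒≤ (trans (^-zeroˡ k) refl)
  ... | no n≢1 with factorise n {{>-nonZero 1≤n}}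
  ...   | record { factors = []     ; isFactorisation = eq } = ⊥-elim (n≢1 eq)
  ...   | record { factors = p ∷ ps ; isFactorisation = eq ; factorsPrime = pp ∷ _ } with extract p n (nonTrivial⇒n>1 p {{prime⇒nonTrivial pp}}) 1≤n
  ...     | zero , m , n≡ , p∤m = ⊥-elim (p∤m (subst (p ∣_) (trans n≡ (+-identityʳ m)) (divides (product ps) (trans eq (*-comm p (product ps))))))
  ...     | suc a , m , n≡ , p∤m = subst (λ t → τ t ^ k ≤ 1 * t) (sym n≡) (extract-bound {a = suc a} 1 1 pp 1≤m p∤m
            (≤-trans (^-monoˡ-≤ k (suc≤2^ (suc a))) (≤-trans (≡⇒≤ (trans (^-*-assoc 2 (suc a) k) (trans (cong (2 ^_) (*-comm (suc a) k)) (sym (^-*-assoc 2 k (suc a))))))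
              (≤-trans (^-monoˡ-≤ (suc a) 2ᵏ≤p) (≡⇒≤ (sym (+-identityʳ (p ^ suc a)))))))
            (rough fuel m m≤ 1≤m (Primality.rough∧∣⇒rough r m∣n)))
    where
    m∣n : m ∣ n
    m∣n = divides (p ^ suc a) n≡
    1≤m : 1 ≤ m
    1≤m = n≢0⇒n>0 (λ { refl → <⇒≱ 1≤n (≡⇒≤ (trans n≡ (*-zeroʳ (p ^ suc a)))) })
    2≤p : 2 ≤ p
    2≤p = nonTrivial⇒n>1 p {{prime⇒nonTrivial pp}}
    p∣n : p ∣ n
    p∣n = divides (product ps) (trans eq (*-comm p (product ps)))
    2ᵏ≤p : 2 ^ k ≤ p
    2ᵏ≤p = ≮⇒≥ (λ p<2ᵏ → r (∣ₚ.hasNonTrivialDivisor {{prime⇒nonTrivial pp}} p<2ᵏ p∣n))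
    m≤ : m ≤ fuel
    m≤ = s≤s⁻¹ (≤-trans (≤-trans (m<m*n m (p ^ suc a) {{>-nonZero 1≤m}} (≤-trans 2≤p (m≤m*n p (p ^ a) {{m^n≢0 p a {{prime⇒nonZero pp}}}}))) (≡⇒≤ (trans (*-comm m (p ^ suc a)) (sym n≡)))) n≤)

  step : ∀ j C → 2 ≤ j → 1 ≤ C → Bound (suc j) C → Bound j (k ^ k * C)
  step j C 2≤j 1≤C bound n 1≤n r with j ∣? n
  ... | no j∤n  = ≤-trans (bound n 1≤n (Primality.∤⇒rough-suc j∤n r)) (*-monoˡ-≤ n (m≤n*m C (k ^ k) {{>-nonZero kᵏ>0}}))
  ... | yes j∣n with extract j n 2≤j 1≤n
  ...   | a , m , n≡ , j∤m = subst (λ t → τ t ^ k ≤ k ^ k * C * t) (sym n≡) (extract-bound {a = a} (k ^ k) C jp 1≤m j∤m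
          (≤-trans (suc^≤ k a 1≤k) (*-monoʳ-≤ (k ^ k) (^-monoˡ-≤ a 2≤j)))
          (bound m 1≤m (Primality.∤⇒rough-suc j∤m (Primality.rough∧∣⇒rough r (divides (j ^ a) n≡)))))
    where
    jp : Prime j
    jp = Primality.rough∧∣⇒prime {{n>1⇒nonTrivial 2≤j}} r j∣n
    1≤m : 1 ≤ m
    1≤m = n≢0⇒n>0 (λ { refl → <⇒≱ 1≤n (≡⇒≤ (trans n≡ (*-zeroʳ (j ^ a)))) })

  all-primes : ∀ gap → Σ ℕ (λ C → 1 ≤ C × (∀ j → 2 ≤ j → 2 ^ k ≤ j + gap → Bound j C))
  all-primes zero = 1 , ≤-refl , λ j 2≤j le n 1≤n r → rough n n ≤-refl 1≤n (weaken (≤-trans le (≡⇒≤ (+-identityʳ j))) r)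
    where
    weaken : ∀ {i j n} → i ≤ j → j Primality.Rough n → i Primality.Rough n
    weaken i≤j r (∣ₚ.hasNonTrivialDivisor d<i d∣n) = r (∣ₚ.hasNonTrivialDivisor (≤-trans d<i i≤j) d∣n)
  all-primes (suc gap) with all-primes gap
  ... | C , 1≤C , bound = k ^ k * C , *-mono-≤ kᵏ>0 1≤C , λ j 2≤j le → step j C 2≤j 1≤C (bound (suc j) (m≤n⇒m≤1+n 2≤j) (≤-trans le (≡⇒≤ (+-suc j gap))))

-- The blocks of m consecutive integers that end at the multiples of m are disjoint and lie between
-- 1 and n.
multiples≤ : ∀ m n → 1 ≤ m → length (filter (m ∣?_) (range₁ n)) * m ≤ n
multiples≤ m n 1≤m = ≤-trans (≡⇒≤ (trans (cong (length M *_) (sym (Listₚ.length-upTo m))) (sym (length-cart _,_ M (upTo m)))))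
  (≤-trans (injective⇒length≤ {ys = range₁ n} (λ v → proj₁ v ∸ proj₂ v) (Uniqueₚ.cartesianProduct⁺ M-unique (Uniqueₚ.upTo⁺ m)) inj into) (≡⇒≤ (length-range₁ n)))
  where
  M = filter (m ∣?_) (range₁ n)
  M-unique = Uniqueₚ.filter⁺ (m ∣?_) (range₁-unique n)
  facts : ∀ {v} → v ∈ cart M (upTo m) → m ∣ proj₁ v × 1 ≤ proj₁ v × proj₁ v ≤ n × proj₂ v < m
  facts {x , j} v∈ with ∈ₚ.∈-cartesianProduct⁻ M (upTo m) v∈
  ... | x∈ , j∈ with ∈ₚ.∈-filter⁻ (m ∣?_) {xs = range₁ n} x∈
  ...   | x∈r , m∣x = m∣x , proj₁ (∈-range₁⁻ x∈r) , proj₂ (∈-range₁⁻ x∈r) , ∈ₚ.∈-upTo⁻ j∈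
  j<x : ∀ {v} → v ∈ cart M (upTo m) → proj₂ v < proj₁ v
  j<x v∈ with facts v∈
  ... | m∣x , 1≤x , _ , j<m = ≤-trans j<m (∣ₚ.∣⇒≤ {{>-nonZero 1≤x}} m∣x)
  into : ∀ {v} → v ∈ cart M (upTo m) → proj₁ v ∸ proj₂ v ∈ range₁ n
  into {x , j} v∈ = ∈-range₁⁺ (m<n⇒0<n∸m (j<x v∈)) (≤-trans (m∸n≤m x j) (proj₁ (proj₂ (proj₂ (facts v∈)))))
  inj : ∀ {v w} → v ∈ cart M (upTo m) → w ∈ cart M (upTo m) → proj₁ v ∸ proj₂ v ≡ proj₁ w ∸ proj₂ w → v ≡ w
  inj {x , i} {y , j} v∈ w∈ eq with facts v∈ | facts w∈
  ... | divides k refl , _ , _ , i<m | divides l refl , _ , _ , j<m with divMod-unique {m} {j} {i} {k} {l} j<m i<m balanced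
    where
    balanced : j + k * m ≡ i + l * m
    balanced = begin
      j + k * m ≡⟨ cong (_+_ j) (sym (m∸n+n≡m (<⇒≤ (j<x v∈)))) ⟩
      j + ((k * m ∸ i) + i) ≡⟨ cong (λ t → j + (t + i)) eq ⟩
      j + ((l * m ∸ j) + i) ≡⟨ rearrange j (l * m ∸ j) i ⟩
      i + ((l * m ∸ j) + j) ≡⟨ cong (_+_ i) (m∸n+n≡m (<⇒≤ (j<x w∈))) ⟩
      i + l * m ∎
      where
      open ≡-Reasoning
      rearrange : ∀ a b c → a + (b + c) ≡ c + (b + a)
      rearrange = ℕR.solve-∀
  ...   | refl , refl = refl

-- Lattice points

ints : ℕ → List ℤ
ints H = map (λ n → + n ℤ.- + H) (upTo (suc (2 * H)))

ints-unique : ∀ H → Unique (ints H)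
ints-unique H = Uniqueₚ.map⁺ (λ {m} {n} eq → ℤₚ.+-injective (trans (undo (+ m) (+ H)) (trans (cong (ℤ._+ + H) eq) (sym (undo (+ n) (+ H)))))) (Uniqueₚ.upTo⁺ _)
  where
  undo : ∀ m h → m ≡ (m ℤ.- h) ℤ.+ h
  undo = ℤR.solve-∀

length-ints : ∀ H → length (ints H) ≡ suc (2 * H)
length-ints H = trans (Listₚ.length-map _ (upTo (suc (2 * H)))) (Listₚ.length-upTo _)

shift-nonneg : ∀ {H} i → ∣ i ∣ ≤ H → + ∣ i ℤ.+ + H ∣ ≡ i ℤ.+ + H
shift-nonneg (+ n)      le = refl
shift-nonneg {H} -[1+ n ] le = trans (cong (λ j → + ∣ j ∣) (ℤₚ.⊖-≥ le)) (sym (ℤₚ.⊖-≥ le))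

shift-≤ : ∀ {H} i → ∣ i ∣ ≤ H → ∣ i ℤ.+ + H ∣ ≤ 2 * H
shift-≤ {H} i le = ≤-trans (ℤₚ.∣i+j∣≤∣i∣+∣j∣ i (+ H)) (≤-trans (+-monoˡ-≤ H le) (≡⇒≤ (cong (_+_ H) (sym (+-identityʳ H)))))

∈-ints⁺ : ∀ {H} i → ∣ i ∣ ≤ H → i ∈ ints H
∈-ints⁺ {H} i le = subst (_∈ ints H) eq (∈ₚ.∈-map⁺ (λ n → + n ℤ.- + H) (∈ₚ.∈-upTo⁺ (s≤s (shift-≤ i le))))
  where
  eq : + ∣ i ℤ.+ + H ∣ ℤ.- + H ≡ i
  eq = trans (cong (ℤ._- + H) (shift-nonneg i le)) (undo i (+ H))
    where
    undo : ∀ m h → (m ℤ.+ h) ℤ.- h ≡ m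
    undo = ℤR.solve-∀

∈-ints⁻ : ∀ {H i} → i ∈ ints H → ∣ i ∣ ≤ H
∈-ints⁻ {H} i∈ with ∈ₚ.∈-map⁻ (λ n → + n ℤ.- + H) i∈
... | n , n∈ , refl = ≤-trans (≡⇒≤ (cong ∣_∣ (ℤₚ.m-n≡m⊖n n H))) (∣⊖∣≤ n H H (≤-trans (s≤s⁻¹ (∈ₚ.∈-upTo⁻ n∈)) (≡⇒≤ (cong (_+_ H) (+-identityʳ H)))) (m≤n+m H n))

∣ᶻ⇒≡ : ∀ {d} i → d ∣ᶻ i → Σ ℤ (λ k → i ≡ k ℤ.* + d)
∣ᶻ⇒≡ {d} i (divides k eq) with ∣∣≡⇒± i eq
... | inj₁ e = + k , trans e (ℤₚ.pos-* k d)
... | inj₂ e = ℤ.- (+ k) , trans e (trans (cong ℤ.-_ (ℤₚ.pos-* k d)) (ℤₚ.neg-distribˡ-* (+ k) (+ d)))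

≡⇒∣ᶻ : ∀ {d} i k → i ≡ k ℤ.* + d → d ∣ᶻ i
≡⇒∣ᶻ {d} i k eq = divides ∣ k ∣ (trans (cong ∣_∣ eq) (ℤₚ.abs-* k (+ d)))

∣ᶻ-minus : ∀ {d} i j → d ∣ᶻ i → d ∣ᶻ j → d ∣ᶻ i ℤ.- j
∣ᶻ-minus {d} i j d∣i d∣j with ∣ᶻ⇒≡ i d∣i | ∣ᶻ⇒≡ j d∣j
... | k , ei | l , ej = ≡⇒∣ᶻ (i ℤ.- j) (k ℤ.- l) (trans (cong₂ ℤ._-_ ei ej) (factor k l (+ d)))
  where
  factor : ∀ k l d → k ℤ.* d ℤ.- l ℤ.* d ≡ (k ℤ.- l) ℤ.* d
  factor = ℤR.solve-∀

argmin : {A : Set} (f : A → ℕ) (x : A) (xs : List A) → Σ A (λ m → m ∈ x ∷ xs × (∀ y → y ∈ x ∷ xs → f m ≤ f y))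
argmin f x []       = x , here refl , λ { y (here refl) → ≤-refl }
argmin f x (y ∷ ys) with argmin f y ys
... | m , m∈ , least with f x ≤? f m
...   | yes le = x , here refl , λ { w (here refl) → ≤-refl ; w (there w∈) → ≤-trans le (least w w∈) }
...   | no nle = m , there m∈ , λ { w (here refl) → <⇒≤ (≰⇒> nle) ; w (there w∈) → least w w∈ }

sup : Triple → ℕ
sup (h₁ , h₂ , h₃) = ∣ h₁ ∣ ⊔ (∣ h₂ ∣ ⊔ ∣ h₃ ∣)

minus : Triple → Triple → Triple
minus (h₁ , h₂ , h₃) (k₁ , k₂ , k₃) = h₁ ℤ.- k₁ , h₂ ℤ.- k₂ , h₃ ℤ.- k₃

crossing : Triple → Triple → Triple
crossing (h₁ , h₂ , h₃) (k₁ , k₂ , k₃) = h₁ ℤ.* k₂ ℤ.- h₂ ℤ.* k₁ , h₁ ℤ.* k₃ ℤ.- h₃ ℤ.* k₁ , h₂ ℤ.* k₃ ℤ.- h₃ ℤ.* k₂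

𝟎 : Triple
𝟎 = 0ℤ , 0ℤ , 0ℤ

_≟₃_ : DecidableEquality Triple
_≟₃_ = ×ₚ.≡-dec ℤ._≟_ (×ₚ.≡-dec ℤ._≟_ ℤ._≟_)

cube : ℕ → List Triple
cube H = cart (ints H) (cart (ints H) (ints H))

cube-unique : ∀ H → Unique (cube H)
cube-unique H = Uniqueₚ.cartesianProduct⁺ (ints-unique H) (Uniqueₚ.cartesianProduct⁺ (ints-unique H) (ints-unique H))

∈-cube⁺ : ∀ {H} h → sup h ≤ H → h ∈ cube H
∈-cube⁺ (h₁ , h₂ , h₃) le = ∈ₚ.∈-cartesianProduct⁺ (∈-ints⁺ h₁ (≤-trans (m≤m⊔n ∣ h₁ ∣ _) le))
  (∈ₚ.∈-cartesianProduct⁺ (∈-ints⁺ h₂ (≤-trans (m≤m⊔n ∣ h₂ ∣ _) (≤-trans (m≤n⊔m ∣ h₁ ∣ _) le))) (∈-ints⁺ h₃ (≤-trans (m≤n⊔m ∣ h₂ ∣ _) (≤-trans (m≤n⊔m ∣ h₁ ∣ _) le))))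

∈-cube⁻ : ∀ {H h} → h ∈ cube H → sup h ≤ H
∈-cube⁻ {H} {h₁ , h₂ , h₃} h∈ with ∈ₚ.∈-cartesianProduct⁻ (ints H) _ h∈
... | h₁∈ , r with ∈ₚ.∈-cartesianProduct⁻ (ints H) (ints H) r
...   | h₂∈ , h₃∈ = ⊔-lub (∈-ints⁻ h₁∈) (⊔-lub (∈-ints⁻ h₂∈) (∈-ints⁻ h₃∈))

∣i-j∣≤ : ∀ {a b} i j → ∣ i ∣ ≤ a → ∣ j ∣ ≤ b → ∣ i ℤ.- j ∣ ≤ a + b
∣i-j∣≤ i j p q = ≤-trans (ℤₚ.∣i-j∣≤∣i∣+∣j∣ i j) (+-mono-≤ p q)

∣i*j∣≤ : ∀ {a b} i j → ∣ i ∣ ≤ a → ∣ j ∣ ≤ b → ∣ i ℤ.* j ∣ ≤ a * b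
∣i*j∣≤ i j p q = ≤-trans (≡⇒≤ (ℤₚ.abs-* i j)) (*-mono-≤ p q)

∣∣≡0 : ∀ {i} → ∣ i ∣ ≤ 0 → i ≡ 0ℤ
∣∣≡0 {i} le = ℤₚ.∣i∣≡0⇒i≡0 (n≤0⇒n≡0 le)

-≡0⇒≡ : ∀ i j → i ℤ.- j ≡ 0ℤ → i ≡ j
-≡0⇒≡ i j eq = trans (undo i j) (trans (cong (ℤ._+ j) eq) (ℤₚ.+-identityˡ j))
  where
  undo : ∀ i j → i ≡ (i ℤ.- j) ℤ.+ j
  undo = ℤR.solve-∀

/-close : ∀ {η} m n .{{_ : NonZero η}} → m / η ≡ n / η → ∣ m ℤ.⊖ n ∣ < η
/-close {η@(suc e)} m n eq = s≤s (∣⊖∣≤ m n e (close m n eq) (close n m (sym eq)))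
  where
  close : ∀ m n → m / η ≡ n / η → m ≤ n + e
  close m n eq = ≤-trans (≡⇒≤ (DM.m≡m%n+[m/n]*n m η)) (≤-trans (+-mono-≤ (s≤s⁻¹ (DM.m%n<n m η)) (≤-trans (≡⇒≤ (cong (_* η) eq)) (DM.m/n*n≤m n η))) (≡⇒≤ (+-comm e n)))

-- A discrete subgroup of ℤ³ in which all cross products are divisible by d: its points in a cube are
-- determined by their cross product with a shortest vector together with their position along that vector.
module LatticeCount (d : ℕ) (1≤d : 1 ≤ d) (P : Triple → Set) (P? : ∀ h → Dec (P h)) (P-minus : ∀ h k → P h → P k → P (minus h k))
                    (P-cross : ∀ h k → P h → P k → Crossed d h k) (H R : ℕ) (1≤H : 1 ≤ H) (HR : 4 * (H * H) ≤ d * R) where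

  points : List Triple
  points = filter P? (cube H)

  points-unique : Unique points
  points-unique = Uniqueₚ.filter⁺ P? (cube-unique H)

  ∈-points : ∀ {h} → h ∈ points → sup h ≤ H × P h
  ∈-points h∈ with ∈ₚ.∈-filter⁻ P? {xs = cube H} h∈
  ... | h∈c , Ph = ∈-cube⁻ h∈c , Ph

  Nonzero : Triple → Set
  Nonzero h = P h × h ≢ 𝟎

  nonzero? : ∀ h → Dec (Nonzero h)
  nonzero? h with P? h | h ≟₃ 𝟎
  ... | yes p | no ne  = yes (p , ne)
  ... | yes p | yes eq = no (λ q → proj₂ q eq)
  ... | no ¬p | _      = no (λ q → ¬p (proj₁ q))

  sup-minus : ∀ h k → sup h ≤ H → sup k ≤ H → sup (minus h k) ≤ 2 * H
  sup-minus h@(h₁ , h₂ , h₃) k@(k₁ , k₂ , k₃) p q = ⊔-lub (bound h₁ k₁ (m≤m⊔n _ _) (m≤m⊔n _ _))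
    (⊔-lub (bound h₂ k₂ (≤-trans (m≤m⊔n _ ∣ h₃ ∣) (m≤n⊔m ∣ h₁ ∣ _)) (≤-trans (m≤m⊔n _ ∣ k₃ ∣) (m≤n⊔m ∣ k₁ ∣ _)))
           (bound h₃ k₃ (≤-trans (m≤n⊔m ∣ h₂ ∣ _) (m≤n⊔m ∣ h₁ ∣ _)) (≤-trans (m≤n⊔m ∣ k₂ ∣ _) (m≤n⊔m ∣ k₁ ∣ _))))
    where
    bound : ∀ i j → ∣ i ∣ ≤ sup h → ∣ j ∣ ≤ sup k → ∣ i ℤ.- j ∣ ≤ 2 * H
    bound i j a b = ≤-trans (∣i-j∣≤ i j (≤-trans a p) (≤-trans b q)) (≡⇒≤ (cong (_+_ H) (sym (+-identityʳ H))))

  short : List Triple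
  short = filter nonzero? (cube (2 * H))

  minus≡𝟎 : ∀ h k → minus h k ≡ 𝟎 → h ≡ k
  minus≡𝟎 (h₁ , h₂ , h₃) (k₁ , k₂ , k₃) eq = cong₂ _,_ (-≡0⇒≡ h₁ k₁ (cong proj₁ eq))
    (cong₂ _,_ (-≡0⇒≡ h₂ k₂ (cong (proj₁ ∘ proj₂) eq)) (-≡0⇒≡ h₃ k₃ (cong (proj₂ ∘ proj₂) eq)))

  -- The first term counts points on a single line; the second is for a shortest vector so long that
  -- every component of the code takes only O(R) values.
  bound₀ : ℕ
  bound₀ = suc (2 * H) + (suc (2 * R)) ^ 4

  -- `pr` is a coordinate in which s₀ attains its maximum norm. On vectors parallel to s₀ it then
  -- attains the maximum norm as well, and this is `pivot`.
  module Shortest (s₀ : Triple) (Ps₀ : P s₀) (s₀≢𝟎 : s₀ ≢ 𝟎) (s₀≤ : sup s₀ ≤ 2 * H) (least : ∀ u → P u → u ≢ 𝟎 → sup u ≤ 2 * H → sup s₀ ≤ sup u)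
                  (pr : Triple → ℤ) (pr-minus : ∀ h k → pr (minus h k) ≡ pr h ℤ.- pr k) (pr≤ : ∀ h → ∣ pr h ∣ ≤ sup h)
                  (pivot : ∀ u → crossing u s₀ ≡ 𝟎 → sup u * sup s₀ ≤ ∣ pr u ∣ * sup s₀) where

    η : ℕ
    η = sup s₀

    1≤η : 1 ≤ η
    1≤η = n≢0⇒n>0 (λ eq → s₀≢𝟎 (sup-𝟎 s₀ (≡⇒≤ eq)))
      where
      sup-𝟎 : ∀ h → sup h ≤ 0 → h ≡ 𝟎
      sup-𝟎 (h₁ , h₂ , h₃) le = cong₂ _,_ (∣∣≡0 (≤-trans (m≤m⊔n _ _) le)) (cong₂ _,_ (∣∣≡0 (≤-trans (m≤m⊔n _ ∣ h₃ ∣) (≤-trans (m≤n⊔m ∣ h₁ ∣ _) le))) (∣∣≡0 (≤-trans (m≤n⊔m ∣ h₂ ∣ _) (≤-trans (m≤n⊔m ∣ h₁ ∣ _) le))))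

    instance
      η≢0 : NonZero η
      η≢0 = >-nonZero 1≤η
      d≢0 : NonZero d
      d≢0 = >-nonZero 1≤d

    position : Triple → ℕ
    position h = ∣ pr h ℤ.+ + H ∣ / η

    quot₃ : Triple → Triple
    quot₃ (i , j , k) = i ℤDM./ℕ d , j ℤDM./ℕ d , k ℤDM./ℕ d

    code : Triple → Triple × ℕ
    code h = quot₃ (crossing h s₀) , position h

    exact : ∀ i → d ∣ᶻ i → i ≡ (i ℤDM./ℕ d) ℤ.* + d
    exact i d∣i with ∣ᶻ⇒≡ i d∣i
    ... | k , eq = trans (ℤDM.a≡a%ℕn+[a/ℕn]*n i d) (trans (cong (λ r → + r ℤ.+ (i ℤDM./ℕ d) ℤ.* + d) (remainder k eq)) (ℤₚ.+-identityˡ _))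
      where
      remainder : ∀ k → i ≡ k ℤ.* + d → i ℤDM.%ℕ d ≡ 0
      remainder k eq with ℤDM.n%ℕd<d i d | ℤDM.a≡a%ℕn+[a/ℕn]*n i d
      ... | r<d | e = small (i ℤDM.%ℕ d) r<d (k ℤ.- (i ℤDM./ℕ d)) (trans (isolate (+ (i ℤDM.%ℕ d)) (i ℤDM./ℕ d) (+ d)) (trans (cong (ℤ._- (i ℤDM./ℕ d) ℤ.* + d) (trans (sym e) eq)) (factor k (i ℤDM./ℕ d) (+ d))))
        where
        isolate : ∀ r c d → r ≡ (r ℤ.+ c ℤ.* d) ℤ.- c ℤ.* d
        isolate = ℤR.solve-∀
        factor : ∀ k c d → k ℤ.* d ℤ.- c ℤ.* d ≡ (k ℤ.- c) ℤ.* d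
        factor = ℤR.solve-∀
        small : ∀ r → r < d → ∀ m → + r ≡ m ℤ.* + d → r ≡ 0
        small r r<d m eq with ∣ m ∣ in em | trans (cong ∣_∣ eq) (ℤₚ.abs-* m (+ d))
        ... | zero  | e = e
        ... | suc c | e = ⊥-elim (<⇒≱ r<d (≤-trans (m≤m+n d (c * d)) (≡⇒≤ (sym e))))

    component : ∀ {K} i → d ∣ᶻ i → ∀ X → ∣ i ∣ ≤ X → X < suc K * d → ∣ i ℤDM./ℕ d ∣ ≤ K
    component {K} i d∣i X i≤X X< = s≤s⁻¹ (*-cancelʳ-< d _ _ (≤-trans (s≤s (≤-trans (≡⇒≤ (sym (trans (cong ∣_∣ (exact i d∣i)) (ℤₚ.abs-* (i ℤDM./ℕ d) (+ d))))) i≤X)) X<))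

    crossing-≤ : ∀ h → sup h ≤ H → sup (crossing h s₀) ≤ 2 * (H * η)
    crossing-≤ h@(h₁ , h₂ , h₃) le = ⊔-lub (one h₁ (proj₁ (proj₂ s₀)) h₂ (proj₁ s₀) (m≤m⊔n _ _) (mid h) (mid s₀) (m≤m⊔n _ _))
      (⊔-lub (one h₁ (proj₂ (proj₂ s₀)) h₃ (proj₁ s₀) (m≤m⊔n _ _) (last h) (last s₀) (m≤m⊔n _ _)) (one h₂ (proj₂ (proj₂ s₀)) h₃ (proj₁ (proj₂ s₀)) (mid h) (last h) (last s₀) (mid s₀)))
      where
      mid : ∀ h → ∣ proj₁ (proj₂ h) ∣ ≤ sup h
      mid (h₁ , h₂ , h₃) = ≤-trans (m≤m⊔n ∣ h₂ ∣ ∣ h₃ ∣) (m≤n⊔m ∣ h₁ ∣ _)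
      last : ∀ h → ∣ proj₂ (proj₂ h) ∣ ≤ sup h
      last (h₁ , h₂ , h₃) = ≤-trans (m≤n⊔m ∣ h₂ ∣ ∣ h₃ ∣) (m≤n⊔m ∣ h₁ ∣ _)
      one : ∀ i x j y → ∣ i ∣ ≤ sup h → ∣ j ∣ ≤ sup h → ∣ x ∣ ≤ η → ∣ y ∣ ≤ η → ∣ i ℤ.* x ℤ.- j ℤ.* y ∣ ≤ 2 * (H * η)
      one i x j y a b c e = ≤-trans (∣i-j∣≤ (i ℤ.* x) (j ℤ.* y) (∣i*j∣≤ i x (≤-trans a le) c) (∣i*j∣≤ j y (≤-trans b le) e)) (≡⇒≤ (cong (λ t → H * η + t) (sym (+-identityʳ _))))

    crossing-minus : ∀ h k s → crossing (minus h k) s ≡ minus (crossing h s) (crossing k s)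
    crossing-minus (h₁ , h₂ , h₃) (k₁ , k₂ , k₃) (s₁ , s₂ , s₃) = cong₂ _,_ (one h₁ h₂ k₁ k₂ s₁ s₂) (cong₂ _,_ (one h₁ h₃ k₁ k₃ s₁ s₃) (one h₂ h₃ k₂ k₃ s₂ s₃))
      where
      one : ∀ a b c e x y → (a ℤ.- c) ℤ.* y ℤ.- (b ℤ.- e) ℤ.* x ≡ (a ℤ.* y ℤ.- b ℤ.* x) ℤ.- (c ℤ.* y ℤ.- e ℤ.* x)
      one = ℤR.solve-∀

    -- Equal cross products make the difference parallel to s₀, and equal positions make it shorter
    -- than s₀; by minimality it is zero.
    code-injective : ∀ {h k} → h ∈ points → k ∈ points → code h ≡ code k → h ≡ k
    code-injective {h} {k} h∈ k∈ eq with minus h k ≟₃ 𝟎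
    ... | yes e = minus≡𝟎 h k e
    ... | no ne = ⊥-elim (<⇒≱ too-short (least u (P-minus h k Ph Pk) ne (sup-minus h k h≤ k≤)))
      where
      u = minus h k
      ch = crossing h s₀
      ck = crossing k s₀
      h≤ = proj₁ (∈-points h∈)
      k≤ = proj₁ (∈-points k∈)
      Ph = proj₂ (∈-points h∈)
      Pk = proj₂ (∈-points k∈)
      same-quotient : ∀ i j → d ∣ᶻ i → d ∣ᶻ j → (i ℤDM./ℕ d) ≡ (j ℤDM./ℕ d) → i ℤ.- j ≡ 0ℤ
      same-quotient i j di dj e = trans (cong₂ ℤ._-_ (exact i di) (trans (exact j dj) (cong (ℤ._* + d) (sym e)))) (ℤₚ.+-inverseʳ ((i ℤDM./ℕ d) ℤ.* + d))
      parallel : crossing u s₀ ≡ 𝟎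
      parallel with P-cross h s₀ Ph Ps₀ | P-cross k s₀ Pk Ps₀
      ... | a , b , c | a′ , b′ , c′ = trans (crossing-minus h k s₀) (cong₂ _,_ (same-quotient (proj₁ ch) (proj₁ ck) a a′ (cong (proj₁ ∘ proj₁) eq))
        (cong₂ _,_ (same-quotient (proj₁ (proj₂ ch)) (proj₁ (proj₂ ck)) b b′ (cong (proj₁ ∘ proj₂ ∘ proj₁) eq)) (same-quotient (proj₂ (proj₂ ch)) (proj₂ (proj₂ ck)) c c′ (cong (proj₂ ∘ proj₂ ∘ proj₁) eq))))
      pr-close : ∣ pr u ∣ < η
      pr-close = ≤-trans (s≤s (≡⇒≤ (cong ∣_∣ (trans (pr-minus h k) (trans (add-sub (pr h) (pr k) (+ H))
        (trans (cong₂ ℤ._-_ (sym (shift-nonneg (pr h) (≤-trans (pr≤ h) h≤))) (sym (shift-nonneg (pr k) (≤-trans (pr≤ k) k≤)))) (ℤₚ.m-n≡m⊖n ∣ pr h ℤ.+ + H ∣ ∣ pr k ℤ.+ + H ∣))))))) (/-close ∣ pr h ℤ.+ + H ∣ ∣ pr k ℤ.+ + H ∣ (cong proj₂ eq))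
        where
        add-sub : ∀ a b h → a ℤ.- b ≡ (a ℤ.+ h) ℤ.- (b ℤ.+ h)
        add-sub = ℤR.solve-∀
      too-short : sup u < sup s₀
      too-short = ≤-trans (s≤s (*-cancelʳ-≤ (sup u) ∣ pr u ∣ η (pivot u parallel))) pr-close

    position-≤ : ∀ h → sup h ≤ H → position h * η ≤ 2 * H
    position-≤ h le = ≤-trans (DM.m/n*n≤m _ η) (shift-≤ (pr h) (≤-trans (pr≤ h) le))

    count-into : ∀ K I → 2 * (H * η) < suc K * d → (∀ h → sup h ≤ H → position h ≤ I) → length points ≤ suc (2 * K) ^ 3 * suc I
    count-into K I K< pos = ≤-trans (injective⇒length≤ {ys = cart (cube K) (upTo (suc I))} code points-unique code-injective into)
      (≡⇒≤ (trans (length-cart _,_ (cube K) (upTo (suc I))) (cong₂ _*_ length-cube (Listₚ.length-upTo (suc I)))))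
      where
      length-cube : length (cube K) ≡ suc (2 * K) ^ 3
      length-cube = trans (length-cart _,_ (ints K) (cart (ints K) (ints K))) (cong₂ _*_ (length-ints K) (trans (length-cart _,_ (ints K) (ints K)) (cong₂ _*_ (length-ints K) (trans (length-ints K) (sym (*-identityʳ _))))))
      into : ∀ {h} → h ∈ points → code h ∈ cart (cube K) (upTo (suc I))
      into {h} h∈ with ∈-points h∈
      ... | h≤ , Ph with P-cross h s₀ Ph Ps₀
      ...   | a , b , c = ∈ₚ.∈-cartesianProduct⁺ (∈-cube⁺ (quot₃ (crossing h s₀)) (⊔-lub (bounded c₁ a (m≤m⊔n ∣ c₁ ∣ _))
                (⊔-lub (bounded c₂ b (≤-trans (m≤m⊔n ∣ c₂ ∣ ∣ c₃ ∣) (m≤n⊔m ∣ c₁ ∣ _))) (bounded c₃ c (≤-trans (m≤n⊔m ∣ c₂ ∣ ∣ c₃ ∣) (m≤n⊔m ∣ c₁ ∣ _))))))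
              (∈ₚ.∈-upTo⁺ (s≤s (pos h h≤)))
        where
        c₁ = proj₁ (crossing h s₀)
        c₂ = proj₁ (proj₂ (crossing h s₀))
        c₃ = proj₂ (proj₂ (crossing h s₀))
        bounded : ∀ i → d ∣ᶻ i → ∣ i ∣ ≤ sup (crossing h s₀) → ∣ i ℤDM./ℕ d ∣ ≤ K
        bounded i di le = component i di (2 * (H * η)) (≤-trans le (crossing-≤ h h≤)) K<

    points≤ : length points ≤ bound₀
    points≤ with 2 * (H * η) <? d
    -- The cross products with s₀ are divisible by d and smaller than d, hence zero: all points lie
    -- on the line of s₀.
    ... | yes lt = ≤-trans (count-into 0 (2 * H) (≤-trans lt (≡⇒≤ (sym (+-identityʳ d)))) (λ h le → ≤-trans (m≤m*n (position h) η) (position-≤ h le)))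
      (≤-trans (≡⇒≤ (+-identityʳ _)) (m≤m+n (suc (2 * H)) _))
    -- Now d ≤ 2 H η. Positions are at most 2 H/η ≤ 4 H²/d ≤ R, and as η ≤ 2 H the cross products
    -- divided by d are also at most 4 H²/d ≤ R.
    ... | no nlt = ≤-trans (count-into R R K< pos) (≤-trans (≤-trans (*-monoʳ-≤ (suc (2 * R) ^ 3) (s≤s (m≤n*m R 2))) (≡⇒≤ (*-comm (suc (2 * R) ^ 3) (suc (2 * R))))) (m≤n+m _ (suc (2 * H))))
      where
      d≤ : d ≤ 2 * (H * η)
      d≤ = ≮⇒≥ nlt
      2Hη≤ : 2 * (H * η) ≤ d * R
      2Hη≤ = ≤-trans (*-monoʳ-≤ 2 (*-monoʳ-≤ H s₀≤)) (≤-trans (≡⇒≤ (identity H)) HR)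
        where
        identity : ∀ H → 2 * (H * (2 * H)) ≡ 4 * (H * H)
        identity = ℕR.solve-∀
      K< : 2 * (H * η) < suc R * d
      K< = ≤-trans (s≤s 2Hη≤) (≤-trans (+-monoˡ-≤ (d * R) 1≤d) (≡⇒≤ (cong (_+_ d) (*-comm d R))))
      pos : ∀ h → sup h ≤ H → position h ≤ R
      pos h le = *-cancelʳ-≤ (position h) R d (≤-trans (*-monoʳ-≤ (position h) d≤) (≤-trans (≡⇒≤ (rearrange (position h) H η))
        (≤-trans (*-monoˡ-≤ (2 * H) (position-≤ h le)) (≤-trans (≡⇒≤ (identity H)) (≤-trans HR (≡⇒≤ (*-comm d R)))))))
        where
        rearrange : ∀ p H η → p * (2 * (H * η)) ≡ p * η * (2 * H)
        rearrange = ℕR.solve-∀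
        identity : ∀ H → 2 * H * (2 * H) ≡ 4 * (H * H)
        identity = ℕR.solve-∀

  cross-swap : ∀ a b c e → a ℤ.* b ℤ.- c ℤ.* e ≡ 0ℤ → ∣ c ∣ * ∣ e ∣ ≤ ∣ a ∣ * ∣ b ∣
  cross-swap a b c e eq = ≡⇒≤ (trans (sym (ℤₚ.abs-* c e)) (trans (cong ∣_∣ (sym (-≡0⇒≡ (a ℤ.* b) (c ℤ.* e) eq))) (ℤₚ.abs-* a b)))

  cross-swap′ : ∀ a b c e → a ℤ.* b ℤ.- c ℤ.* e ≡ 0ℤ → ∣ a ∣ * ∣ b ∣ ≤ ∣ c ∣ * ∣ e ∣
  cross-swap′ a b c e eq = ≡⇒≤ (trans (sym (ℤₚ.abs-* a b)) (trans (cong ∣_∣ (-≡0⇒≡ (a ℤ.* b) (c ℤ.* e) eq)) (ℤₚ.abs-* c e)))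

  lattice-count : length points ≤ bound₀
  lattice-count with short in eq
  ... | [] = ≤-trans (injective⇒length≤ {ys = tt ∷ []} (λ _ → tt) points-unique single (λ _ → here refl)) (s≤s z≤n)
    where
    single : ∀ {h k} → h ∈ points → k ∈ points → tt ≡ tt → h ≡ k
    single {h} {k} h∈ k∈ _ with minus h k ≟₃ 𝟎
    ... | yes e = minus≡𝟎 h k e
    ... | no ne = ⊥-elim (empty (subst (minus h k ∈_) eq (∈ₚ.∈-filter⁺ nonzero? (∈-cube⁺ (minus h k) (sup-minus h k (proj₁ (∈-points h∈)) (proj₁ (∈-points k∈))))
      (P-minus h k (proj₂ (∈-points h∈)) (proj₂ (∈-points k∈)) , ne))))
      where
      empty : ∀ {x : Triple} → x ∈ [] → ⊥
      empty ()
  ... | x ∷ xs with argmin sup x xs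
  ...   | s₀@(a , b , c) , s₀∈ , least = choose
    where
    s₀∈short : s₀ ∈ short
    s₀∈short = subst (s₀ ∈_) (sym eq) s₀∈
    facts = ∈ₚ.∈-filter⁻ nonzero? {xs = cube (2 * H)} s₀∈short
    least′ : ∀ u → P u → u ≢ 𝟎 → sup u ≤ 2 * H → sup s₀ ≤ sup u
    least′ u Pu ne le = least u (subst (u ∈_) eq (∈ₚ.∈-filter⁺ nonzero? (∈-cube⁺ u le) (Pu , ne)))
    swap : ∀ {m n k} → m * k ≤ n → k * m ≤ n
    swap {m} {n} {k} le = ≤-trans (≡⇒≤ (*-comm k m)) le
    open Shortest s₀ (proj₁ (proj₂ facts)) (proj₂ (proj₂ facts)) (∈-cube⁻ (proj₁ facts)) least′
    sup* : ∀ u m n → ∣ proj₁ u ∣ * m ≤ n → ∣ proj₁ (proj₂ u) ∣ * m ≤ n → ∣ proj₂ (proj₂ u) ∣ * m ≤ n → sup u * m ≤ n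
    sup* (u₁ , u₂ , u₃) m n p q r = ≤-trans (≡⇒≤ (trans (*-distribʳ-⊔ m ∣ u₁ ∣ _) (cong (∣ u₁ ∣ * m ⊔_) (*-distribʳ-⊔ m ∣ u₂ ∣ ∣ u₃ ∣)))) (⊔-lub p (⊔-lub q r))
    choose : length points ≤ bound₀
    choose with ⊔-sel ∣ a ∣ (∣ b ∣ ⊔ ∣ c ∣)
    ... | inj₁ e = points≤ proj₁ (λ _ _ → refl) (λ h → m≤m⊔n _ _) pivot
      where
      pivot : ∀ u → crossing u s₀ ≡ 𝟎 → sup u * sup s₀ ≤ ∣ proj₁ u ∣ * sup s₀
      pivot u@(u₁ , u₂ , u₃) z = sup* u (sup s₀) _ ≤-refl
        (≤-trans (≤-trans (≡⇒≤ (cong (∣ u₂ ∣ *_) e)) (cross-swap u₁ b u₂ a (cong proj₁ z))) (*-monoʳ-≤ ∣ u₁ ∣ (≤-trans (m≤m⊔n ∣ b ∣ ∣ c ∣) (m≤n⊔m ∣ a ∣ _))))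
        (≤-trans (≤-trans (≡⇒≤ (cong (∣ u₃ ∣ *_) e)) (cross-swap u₁ c u₃ a (cong (proj₁ ∘ proj₂) z))) (*-monoʳ-≤ ∣ u₁ ∣ (≤-trans (m≤n⊔m ∣ b ∣ ∣ c ∣) (m≤n⊔m ∣ a ∣ _))))
    ... | inj₂ e with ⊔-sel ∣ b ∣ ∣ c ∣
    ...   | inj₁ e′ = points≤ (proj₁ ∘ proj₂) (λ _ _ → refl) (λ h → ≤-trans (m≤m⊔n _ _) (m≤n⊔m ∣ proj₁ h ∣ _)) pivot
      where
      pivot : ∀ u → crossing u s₀ ≡ 𝟎 → sup u * sup s₀ ≤ ∣ proj₁ (proj₂ u) ∣ * sup s₀
      pivot u@(u₁ , u₂ , u₃) z = sup* u (sup s₀) _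
        (≤-trans (≤-trans (≡⇒≤ (cong (∣ u₁ ∣ *_) (trans e e′))) (cross-swap′ u₁ b u₂ a (cong proj₁ z))) (*-monoʳ-≤ ∣ u₂ ∣ (m≤m⊔n ∣ a ∣ _)))
        ≤-refl
        (≤-trans (≤-trans (≡⇒≤ (cong (∣ u₃ ∣ *_) (trans e e′))) (cross-swap u₂ c u₃ b (cong (proj₂ ∘ proj₂) z))) (*-monoʳ-≤ ∣ u₂ ∣ (≤-trans (m≤n⊔m ∣ b ∣ ∣ c ∣) (m≤n⊔m ∣ a ∣ _))))
    ...   | inj₂ e′ = points≤ (proj₂ ∘ proj₂) (λ _ _ → refl) (λ h → ≤-trans (m≤n⊔m ∣ proj₁ (proj₂ h) ∣ _) (m≤n⊔m ∣ proj₁ h ∣ _)) pivot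
      where
      pivot : ∀ u → crossing u s₀ ≡ 𝟎 → sup u * sup s₀ ≤ ∣ proj₂ (proj₂ u) ∣ * sup s₀
      pivot u@(u₁ , u₂ , u₃) z = sup* u (sup s₀) _
        (≤-trans (≤-trans (≡⇒≤ (cong (∣ u₁ ∣ *_) (trans e e′))) (cross-swap′ u₁ c u₃ a (cong (proj₁ ∘ proj₂) z))) (*-monoʳ-≤ ∣ u₃ ∣ (m≤m⊔n ∣ a ∣ _)))
        (≤-trans (≤-trans (≡⇒≤ (cong (∣ u₂ ∣ *_) (trans e e′))) (cross-swap′ u₂ c u₃ b (cong (proj₂ ∘ proj₂) z))) (*-monoʳ-≤ ∣ u₃ ∣ (≤-trans (m≤m⊔n ∣ b ∣ ∣ c ∣) (m≤n⊔m ∣ a ∣ _))))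
        ≤-refl

-- Energy of wedge products

det : Pair → Pair → ℤ
det (x₁ , x₂) (y₁ , y₂) = x₁ ℤ.* y₂ ℤ.- x₂ ℤ.* y₁

-- Up to the factor (b₂)², the value of the polynomial h₁ + h₂ s + h₃ s² at the root s = −b₁/b₂ of b₁ + b₂ s.
atRoot : Pair → Triple → ℤ
atRoot (b₁ , b₂) (h₁ , h₂ , h₃) = b₂ ℤ.* b₂ ℤ.* h₁ ℤ.- b₁ ℤ.* b₂ ℤ.* h₂ ℤ.+ b₁ ℤ.* b₁ ℤ.* h₃

atRoot-wedge : ∀ x b x′ b′ → atRoot b (wedge x b x′ b′) ≡ det x b ℤ.* det b′ b
atRoot-wedge (x₁ , x₂) (b₁ , b₂) (x₁′ , x₂′) (b₁′ , b₂′) = identity x₁ x₂ b₁ b₂ x₁′ x₂′ b₁′ b₂′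
  where
  identity : ∀ x₁ x₂ b₁ b₂ y₁ y₂ c₁ c₂ →
    b₂ ℤ.* b₂ ℤ.* (x₁ ℤ.* c₁ ℤ.- y₁ ℤ.* b₁) ℤ.- b₁ ℤ.* b₂ ℤ.* ((x₁ ℤ.* c₂ ℤ.+ x₂ ℤ.* c₁) ℤ.- (y₁ ℤ.* b₂ ℤ.+ y₂ ℤ.* b₁)) ℤ.+ b₁ ℤ.* b₁ ℤ.* (x₂ ℤ.* c₂ ℤ.- y₂ ℤ.* b₂)
    ≡ (x₁ ℤ.* b₂ ℤ.- x₂ ℤ.* b₁) ℤ.* (c₁ ℤ.* b₂ ℤ.- c₂ ℤ.* b₁)
  identity = ℤR.solve-∀

vec : ℕ × ℕ → Pair
vec (m , n) = + m , + n

vec-injective : ∀ {c c′} → vec c ≡ vec c′ → c ≡ c′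
vec-injective e = cong₂ _,_ (ℤₚ.+-injective (cong proj₁ e)) (ℤₚ.+-injective (cong proj₂ e))

integralᶻ : ∀ i j → i ℤ.* j ≡ 0ℤ → i ≢ 0ℤ → j ≡ 0ℤ
integralᶻ i j eq ne with ℤₚ.i*j≡0⇒i≡0∨j≡0 i eq
... | inj₁ e = ⊥-elim (ne e)
... | inj₂ e = e

*-cancelʳᶻ : ∀ i j k → k ≢ 0ℤ → i ℤ.* k ≡ j ℤ.* k → i ≡ j
*-cancelʳᶻ i j k ne eq = -≡0⇒≡ i j (integralᶻ k (i ℤ.- j) (trans (distrib k i j) (trans (cong (ℤ._- j ℤ.* k) eq) (ℤₚ.+-inverseʳ (j ℤ.* k)))) ne)
  where
  distrib : ∀ k i j → k ℤ.* (i ℤ.- j) ≡ i ℤ.* k ℤ.- j ℤ.* k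
  distrib = ℤR.solve-∀

-- A binary quadratic form with three distinct zeros is zero. `expand` evaluates it at Δ (u , v),
-- written in terms of the first two zeros: only the polar term remains, and the third zero kills
-- it.
three-roots : ∀ b b′ b″ h → det b b′ ≢ 0ℤ → det b″ b′ ≢ 0ℤ → det b b″ ≢ 0ℤ →
              atRoot b h ≡ 0ℤ → atRoot b′ h ≡ 0ℤ → atRoot b″ h ≡ 0ℤ → h ≡ 𝟎
three-roots (p , q) (r , s) (t , k) (h₁ , h₂ , h₃) Δ≢0 δ≢0 δ′≢0 f₁ f₂ f₃ = cong₂ _,_ h₁≡0 (cong₂ _,_ h₂≡0 h₃≡0)
  where
  f : ℤ → ℤ → ℤ
  f u v = v ℤ.* v ℤ.* h₁ ℤ.- u ℤ.* v ℤ.* h₂ ℤ.+ u ℤ.* u ℤ.* h₃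
  polar : ℤ
  polar = + 2 ℤ.* (q ℤ.* s ℤ.* h₁) ℤ.- (p ℤ.* s ℤ.+ q ℤ.* r) ℤ.* h₂ ℤ.+ + 2 ℤ.* (p ℤ.* r ℤ.* h₃)
  Δ : ℤ
  Δ = p ℤ.* s ℤ.- q ℤ.* r
  expand : ∀ p q r s u v h₁ h₂ h₃ →
    (p ℤ.* s ℤ.- q ℤ.* r) ℤ.* ((p ℤ.* s ℤ.- q ℤ.* r) ℤ.* (v ℤ.* v ℤ.* h₁ ℤ.- u ℤ.* v ℤ.* h₂ ℤ.+ u ℤ.* u ℤ.* h₃)) ≡
    (u ℤ.* s ℤ.- v ℤ.* r) ℤ.* (u ℤ.* s ℤ.- v ℤ.* r) ℤ.* (q ℤ.* q ℤ.* h₁ ℤ.- p ℤ.* q ℤ.* h₂ ℤ.+ p ℤ.* p ℤ.* h₃) ℤ.+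
    (p ℤ.* v ℤ.- q ℤ.* u) ℤ.* (p ℤ.* v ℤ.- q ℤ.* u) ℤ.* (s ℤ.* s ℤ.* h₁ ℤ.- r ℤ.* s ℤ.* h₂ ℤ.+ r ℤ.* r ℤ.* h₃) ℤ.+
    (u ℤ.* s ℤ.- v ℤ.* r) ℤ.* ((p ℤ.* v ℤ.- q ℤ.* u) ℤ.* (+ 2 ℤ.* (q ℤ.* s ℤ.* h₁) ℤ.- (p ℤ.* s ℤ.+ q ℤ.* r) ℤ.* h₂ ℤ.+ + 2 ℤ.* (p ℤ.* r ℤ.* h₃)))
  expand = ℤR.solve-∀
  drop : ∀ A B {x y} X → x ≡ 0ℤ → y ≡ 0ℤ → A ℤ.* x ℤ.+ B ℤ.* y ℤ.+ X ≡ X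
  drop A B X refl refl = identity A B X
    where
    identity : ∀ A B X → A ℤ.* 0ℤ ℤ.+ B ℤ.* 0ℤ ℤ.+ X ≡ X
    identity = ℤR.solve-∀
  twice : ∀ A B {x} → x ≡ 0ℤ → A ℤ.* (B ℤ.* x) ≡ 0ℤ
  twice A B refl = trans (cong (A ℤ.*_) (ℤₚ.*-zeroʳ B)) (ℤₚ.*-zeroʳ A)
  polar≡0 : polar ≡ 0ℤ
  polar≡0 = integralᶻ σ polar (integralᶻ ρ (σ ℤ.* polar) (trans (sym (drop (ρ ℤ.* ρ) (σ ℤ.* σ) (ρ ℤ.* (σ ℤ.* polar)) f₁ f₂))
    (trans (sym (expand p q r s t k h₁ h₂ h₃)) (twice Δ Δ f₃))) δ≢0) δ′≢0
    where
    ρ = t ℤ.* s ℤ.- k ℤ.* r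
    σ = p ℤ.* k ℤ.- q ℤ.* t
  vanish : ∀ u v → f u v ≡ 0ℤ
  vanish u v = integralᶻ Δ (f u v) (integralᶻ Δ (Δ ℤ.* f u v) (trans (expand p q r s u v h₁ h₂ h₃)
    (trans (drop (ρ ℤ.* ρ) (σ ℤ.* σ) (ρ ℤ.* (σ ℤ.* polar)) f₁ f₂) (twice ρ σ polar≡0))) Δ≢0) Δ≢0
    where
    ρ = u ℤ.* s ℤ.- v ℤ.* r
    σ = p ℤ.* v ℤ.- q ℤ.* u
  h₁≡0 : h₁ ≡ 0ℤ
  h₁≡0 = trans (sym (at h₁ h₂ h₃)) (vanish 0ℤ 1ℤ)
    where
    at : ∀ h₁ h₂ h₃ → 1ℤ ℤ.* 1ℤ ℤ.* h₁ ℤ.- 0ℤ ℤ.* 1ℤ ℤ.* h₂ ℤ.+ 0ℤ ℤ.* 0ℤ ℤ.* h₃ ≡ h₁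
    at = ℤR.solve-∀
  h₃≡0 : h₃ ≡ 0ℤ
  h₃≡0 = trans (sym (at h₁ h₂ h₃)) (vanish 1ℤ 0ℤ)
    where
    at : ∀ h₁ h₂ h₃ → 0ℤ ℤ.* 0ℤ ℤ.* h₁ ℤ.- 1ℤ ℤ.* 0ℤ ℤ.* h₂ ℤ.+ 1ℤ ℤ.* 1ℤ ℤ.* h₃ ≡ h₃
    at = ℤR.solve-∀
  h₂≡0 : h₂ ≡ 0ℤ
  h₂≡0 = trans (sym (at h₁ h₂ h₃)) (trans (cong₂ (λ x y → x ℤ.+ y ℤ.- f 1ℤ 1ℤ) h₁≡0 h₃≡0) (cong (λ x → 0ℤ ℤ.+ 0ℤ ℤ.- x) (vanish 1ℤ 1ℤ)))
    where
    at : ∀ h₁ h₂ h₃ → h₁ ℤ.+ h₃ ℤ.- (1ℤ ℤ.* 1ℤ ℤ.* h₁ ℤ.- 1ℤ ℤ.* 1ℤ ℤ.* h₂ ℤ.+ 1ℤ ℤ.* 1ℤ ℤ.* h₃) ≡ h₂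
    at = ℤR.solve-∀

-- Primitivity makes b the smallest step between integral points on a line of direction b; with B <
-- 8 b₁ such a line has at most 16 points in the box.
Good : ℕ → ℕ × ℕ → Set
Good B (b₁ , b₂) = gcd b₁ b₂ ≡ 1 × B < 8 * b₁

good? : ∀ B b → Dec (Good B b)
good? B (b₁ , b₂) with gcd b₁ b₂ ≟ 1 | B <? 8 * b₁
... | yes p | yes q = yes (p , q)
... | no ¬p | _     = no (¬p ∘ proj₁)
... | yes _ | no ¬q = no (¬q ∘ proj₂)

directions : ℕ → List (ℕ × ℕ)
directions B = filter (good? B) (cart (range₁ B) (range₁ B))

directions-unique : ∀ B → Unique (directions B)
directions-unique B = Uniqueₚ.filter⁺ (good? B) (Uniqueₚ.cartesianProduct⁺ (range₁-unique B) (range₁-unique B))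

record IsDirection (B : ℕ) (b : ℕ × ℕ) : Set where
  field
    b₁>0    : 1 ≤ proj₁ b
    b₁≤     : proj₁ b ≤ B
    b₂>0    : 1 ≤ proj₂ b
    b₂≤     : proj₂ b ≤ B
    coprime : Coprime (proj₁ b) (proj₂ b)
    large   : B < 8 * proj₁ b

∈-directions : ∀ {B b} → b ∈ directions B → IsDirection B b
∈-directions {B} {b₁ , b₂} b∈ with ∈ₚ.∈-filter⁻ (good? B) {xs = cart (range₁ B) (range₁ B)} b∈
... | b∈c , g , l with ∈ₚ.∈-cartesianProduct⁻ (range₁ B) (range₁ B) b∈c
...   | p , q = record { b₁>0 = proj₁ (∈-range₁⁻ p) ; b₁≤ = proj₂ (∈-range₁⁻ p) ; b₂>0 = proj₁ (∈-range₁⁻ q) ; b₂≤ = proj₂ (∈-range₁⁻ q)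
                       ; coprime = Coprime.gcd≡1⇒coprime g ; large = l }

length-directions : ∀ B → length (directions B) ≤ B * B
length-directions B = ≤-trans (Listₚ.length-filter (good? B) (cart (range₁ B) (range₁ B)))
  (≡⇒≤ (trans (length-cart _,_ (range₁ B) (range₁ B)) (cong₂ _*_ (length-range₁ B) (length-range₁ B))))

box : ℕ → List Pair
box B = cart (ints B) (ints B)

box-unique : ∀ B → Unique (box B)
box-unique B = Uniqueₚ.cartesianProduct⁺ (ints-unique B) (ints-unique B)

length-box : ∀ B → length (box B) ≡ suc (2 * B) * suc (2 * B)
length-box B = trans (length-cart _,_ (ints B) (ints B)) (cong₂ _*_ (length-ints B) (length-ints B))

-- Two integral points on a line parallel to the primitive vector b differ by a multiple of b.
line-injective : ∀ {B b} → IsDirection B b → ∀ x y → det x (vec b) ≡ det y (vec b) → ∣ proj₁ x ℤ.- proj₁ y ∣ < proj₁ b → x ≡ y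
line-injective {B} {b₁ , b₂} dir (x₁ , x₂) (y₁ , y₂) eq close = cong₂ _,_ x₁≡y₁ x₂≡y₂
  where
  open IsDirection dir
  balance : (x₁ ℤ.- y₁) ℤ.* + b₂ ≡ (x₂ ℤ.- y₂) ℤ.* + b₁
  balance = -≡0⇒≡ _ _ (trans (regroup x₁ x₂ y₁ y₂ (+ b₁) (+ b₂)) (trans (cong (ℤ._- (y₁ ℤ.* + b₂ ℤ.- y₂ ℤ.* + b₁)) eq) (ℤₚ.+-inverseʳ (y₁ ℤ.* + b₂ ℤ.- y₂ ℤ.* + b₁))))
    where
    regroup : ∀ x₁ x₂ y₁ y₂ b₁ b₂ → (x₁ ℤ.- y₁) ℤ.* b₂ ℤ.- (x₂ ℤ.- y₂) ℤ.* b₁ ≡ (x₁ ℤ.* b₂ ℤ.- x₂ ℤ.* b₁) ℤ.- (y₁ ℤ.* b₂ ℤ.- y₂ ℤ.* b₁)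
    regroup = ℤR.solve-∀
  divides₁ : b₁ ∣ ∣ x₁ ℤ.- y₁ ∣
  divides₁ = Coprime.coprime-divisor coprime (divides ∣ x₂ ℤ.- y₂ ∣ (trans (*-comm b₂ ∣ x₁ ℤ.- y₁ ∣) (trans (sym (ℤₚ.abs-* (x₁ ℤ.- y₁) (+ b₂))) (trans (cong ∣_∣ balance) (ℤₚ.abs-* (x₂ ℤ.- y₂) (+ b₁))))))
  x₁≡y₁ : x₁ ≡ y₁
  x₁≡y₁ = -≡0⇒≡ x₁ y₁ (ℤₚ.∣i∣≡0⇒i≡0 (small ∣ x₁ ℤ.- y₁ ∣ divides₁ close))
    where
    small : ∀ n → b₁ ∣ n → n < b₁ → n ≡ 0
    small zero    _  _  = refl
    small (suc n) dv lt = ⊥-elim (<⇒≱ lt (∣ₚ.∣⇒≤ dv))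
  x₂≡y₂ : x₂ ≡ y₂
  x₂≡y₂ = -≡0⇒≡ x₂ y₂ (integralᶻ (+ b₁) (x₂ ℤ.- y₂) (trans (ℤₚ.*-comm (+ b₁) (x₂ ℤ.- y₂)) (trans (sym balance) (trans (cong (λ t → (t ℤ.- y₁) ℤ.* + b₂) x₁≡y₁) (trans (cong (ℤ._* + b₂) (ℤₚ.+-inverseʳ y₁)) (ℤₚ.*-zeroˡ (+ b₂))))))
    (λ e → <⇒≱ b₁>0 (≡⇒≤ (ℤₚ.+-injective e))))

det≡0⇒≡ : ∀ {B b b′} → IsDirection B b → IsDirection B b′ → det (vec b) (vec b′) ≡ 0ℤ → b ≡ b′
det≡0⇒≡ {B} {b₁ , b₂} {b₁′ , b₂′} dir dir′ eq = cong₂ _,_ b₁≡ (*-cancelˡ-≡ b₂ b₂′ b₁ {{>-nonZero D.b₁>0}} (trans (*-comm b₁ b₂) (trans (trans (cong (b₂ *_) b₁≡) (sym balance)) refl)))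
  where
  module D = IsDirection dir
  module D′ = IsDirection dir′
  balance : b₁ * b₂′ ≡ b₂ * b₁′
  balance = ℤₚ.+-injective (trans (ℤₚ.pos-* b₁ b₂′) (trans (-≡0⇒≡ (+ b₁ ℤ.* + b₂′) (+ b₂ ℤ.* + b₁′) eq) (sym (ℤₚ.pos-* b₂ b₁′))))
  b₁≡ : b₁ ≡ b₁′
  b₁≡ = ∣ₚ.∣-antisym (Coprime.coprime-divisor D.coprime (divides b₂′ (trans (sym balance) (*-comm b₁ b₂′))))
                      (Coprime.coprime-divisor D′.coprime (divides b₂ (trans (*-comm b₂′ b₁) balance)))

filter-⊎ : {A : Set} {P Q R : A → Set} (P? : ∀ x → Dec (P x)) (Q? : ∀ x → Dec (Q x)) (R? : ∀ x → Dec (R x)) (xs : List A) →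
           (∀ x → x ∈ xs → P x → Q x ⊎ R x) → length (filter P? xs) ≤ length (filter Q? xs) + length (filter R? xs)
filter-⊎ P? Q? R? xs split = ≤-trans (≡⇒≤ (length-filter P? xs)) (≤-trans (∑-mono xs one)
  (≡⇒≤ (trans (ℕΣ.∑-+ xs _ _) (cong₂ _+_ (sym (length-filter Q? xs)) (sym (length-filter R? xs))))))
  where
  one : ∀ x → x ∈ xs → 𝟙 (P? x) ≤ 𝟙 (Q? x) + 𝟙 (R? x)
  one x x∈ with P? x
  ... | no _  = z≤n
  ... | yes p with split x x∈ p
  ...   | inj₁ q = ≤-trans (≡⇒≤ (sym (𝟙-yes (Q? x) q))) (m≤m+n _ _)
  ...   | inj₂ r = ≤-trans (≡⇒≤ (sym (𝟙-yes (R? x) r))) (m≤n+m _ (𝟙 (Q? x)))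

infixr 3 _×?_

_×?_ : {P Q : Set} → Dec P → Dec Q → Dec (P × Q)
yes p ×? yes q = yes (p , q)
no ¬p ×? _     = no (¬p ∘ proj₁)
yes _ ×? no ¬q = no (¬q ∘ proj₂)

module Fibres (B : ℕ) where

  -- More than B/8 and at most b₁: the range of length 2 B falls into at most 16 slots, and each
  -- slot holds at most one point of a line of direction b.
  width : ℕ
  width = suc (B / 8)

  B<8width : B < 8 * width
  B<8width = ≤-trans (s≤s (≡⇒≤ (DM.m≡m%n+[m/n]*n B 8))) (≤-trans (+-monoˡ-≤ (B / 8 * 8) (DM.m%n<n B 8)) (≡⇒≤ (*-comm (suc (B / 8)) 8)))

  slot : ℕ → ℕ
  slot n = n / width

  slot< : ∀ n → n ≤ 2 * B → slot n < 16
  slot< n le = DM.m<n*o⇒m/o<n (≤-trans (s≤s le) (≤-trans (≤-trans (n≤1+n _) (≡⇒≤ (identity B))) (≤-trans (*-monoʳ-≤ 2 B<8width) (≡⇒≤ (sym (*-assoc 2 8 width))))))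
    where
    identity : ∀ B → suc (suc (2 * B)) ≡ 2 * suc B
    identity = ℕR.solve-∀

  module _ {b : ℕ × ℕ} (dir : IsDirection B b) where
    open IsDirection dir

    width≤ : width ≤ proj₁ b
    width≤ = DM.m<n*o⇒m/o<n (≤-trans large (≡⇒≤ (*-comm 8 (proj₁ b))))

  -- For a fixed direction b, (x , y , c) comes from a collision of two lines with directions b and
  -- c; x and y are the displacements of their base points from those of a reference collision.
  Data : Set
  Data = Pair × Pair × (ℕ × ℕ)

  family : List Data
  family = cart (box B) (cart (box B) (directions B))

  family-unique : Unique family
  family-unique = Uniqueₚ.cartesianProduct⁺ (box-unique B) (Uniqueₚ.cartesianProduct⁺ (box-unique B) (directions-unique B))

  record InFamily (t : Data) : Set where
    field
      x₁≤  : ∣ proj₁ (proj₁ t) ∣ ≤ B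
      x₂≤  : ∣ proj₂ (proj₁ t) ∣ ≤ B
      y₁≤  : ∣ proj₁ (proj₁ (proj₂ t)) ∣ ≤ B
      y₂≤  : ∣ proj₂ (proj₁ (proj₂ t)) ∣ ≤ B
      x∈   : proj₁ t ∈ box B
      c∈   : proj₂ (proj₂ t) ∈ directions B
      dir′ : IsDirection B (proj₂ (proj₂ t))

  ∈-family : ∀ {t} → t ∈ family → InFamily t
  ∈-family {x , y , c} t∈ with ∈ₚ.∈-cartesianProduct⁻ (box B) _ t∈
  ... | x∈ , r with ∈ₚ.∈-cartesianProduct⁻ (box B) (directions B) r
  ...   | y∈ , c∈ with ∈ₚ.∈-cartesianProduct⁻ (ints B) (ints B) x∈ | ∈ₚ.∈-cartesianProduct⁻ (ints B) (ints B) y∈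
  ...     | a , a′ | e , e′ = record { x₁≤ = ∈-ints⁻ a ; x₂≤ = ∈-ints⁻ a′ ; y₁≤ = ∈-ints⁻ e ; y₂≤ = ∈-ints⁻ e′ ; x∈ = x∈ ; c∈ = c∈ ; dir′ = ∈-directions {B} c∈ }

  wedgeOf : ℕ × ℕ → Data → Triple
  wedgeOf b (x , y , c) = wedge x (vec b) y (vec c)

  slotX : Data → ℕ
  slotX (x , _ , _) = slot ∣ proj₁ x ℤ.+ + B ∣

  slotC : Data → ℕ
  slotC (_ , _ , c) = slot (proj₁ c)

  slotX< : ∀ {t} → InFamily t → slotX t < 16
  slotX< {x , _ , _} f = slot< _ (shift-≤ (proj₁ x) (InFamily.x₁≤ f))

  slotC< : ∀ {t} → InFamily t → slotC t < 16
  slotC< f = slot< _ (≤-trans (IsDirection.b₁≤ (InFamily.dir′ f)) (m≤m+n B _))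

  module Fixed (b : ℕ × ℕ) (b∈ : b ∈ directions B) (h : Triple) where
    private
      dir = ∈-directions {B} b∈
    open IsDirection dir

    detX detC : Data → ℤ
    detX (x , _ , _) = det x (vec b)
    detC (_ , _ , c) = det (vec c) (vec b)

    same-x : ∀ {t t′} → InFamily t → InFamily t′ → detX t ≡ detX t′ → slotX t ≡ slotX t′ → proj₁ t ≡ proj₁ t′
    same-x {x , _} {x′ , _} f f′ eq s = line-injective dir x x′ eq (≤-trans (s≤s (≡⇒≤ (cong ∣_∣ (trans (add-sub (proj₁ x) (proj₁ x′) (+ B))
      (trans (cong₂ ℤ._-_ (sym (shift-nonneg (proj₁ x) (InFamily.x₁≤ f))) (sym (shift-nonneg (proj₁ x′) (InFamily.x₁≤ f′)))) (ℤₚ.m-n≡m⊖n ∣ proj₁ x ℤ.+ + B ∣ ∣ proj₁ x′ ℤ.+ + B ∣))))))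
      (≤-trans (/-close ∣ proj₁ x ℤ.+ + B ∣ ∣ proj₁ x′ ℤ.+ + B ∣ s) (width≤ dir)))
      where
      add-sub : ∀ a b h → a ℤ.- b ≡ (a ℤ.+ h) ℤ.- (b ℤ.+ h)
      add-sub = ℤR.solve-∀

    same-c : ∀ {t t′} → detC t ≡ detC t′ → slotC t ≡ slotC t′ → proj₂ (proj₂ t) ≡ proj₂ (proj₂ t′)
    same-c {_ , _ , c} {_ , _ , c′} eq s = vec-injective (line-injective dir (vec c) (vec c′) eq
      (≤-trans (s≤s (≡⇒≤ (cong ∣_∣ (ℤₚ.m-n≡m⊖n (proj₁ c) (proj₁ c′))))) (≤-trans (/-close (proj₁ c) (proj₁ c′) s) (width≤ dir))))

    same-y : ∀ {t t′} → wedgeOf b t ≡ h → wedgeOf b t′ ≡ h → proj₁ t ≡ proj₁ t′ → proj₂ (proj₂ t) ≡ proj₂ (proj₂ t′) → t ≡ t′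
    same-y {x , y , c} {.x , y′ , .c} w w′ refl refl = cong (λ y → x , y , c) (cong₂ _,_
      (recover (proj₁ x ℤ.* + proj₁ c) (proj₁ y) (proj₁ y′) (proj₁ b) b₁>0 (cong proj₁ (trans w (sym w′))))
      (recover (proj₂ x ℤ.* + proj₂ c) (proj₂ y) (proj₂ y′) (proj₂ b) b₂>0 (cong (proj₂ ∘ proj₂) (trans w (sym w′)))))
      where
      recover : ∀ a i j n → 1 ≤ n → a ℤ.- i ℤ.* + n ≡ a ℤ.- j ℤ.* + n → i ≡ j
      recover a i j n 1≤n eq = *-cancelʳᶻ i j (+ n) (λ e → <⇒≱ 1≤n (≡⇒≤ (ℤₚ.+-injective e)))
        (trans (undo a (i ℤ.* + n)) (trans (cong (λ t → a ℤ.- t) eq) (sym (undo a (j ℤ.* + n)))))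
        where
        undo : ∀ a u → u ≡ a ℤ.- (a ℤ.- u)
        undo = ℤR.solve-∀

    n₀ : ℤ
    n₀ = atRoot (vec b) h

    product-det : ∀ {t} → wedgeOf b t ≡ h → detX t ℤ.* detC t ≡ n₀
    product-det {x , y , c} w = trans (sym (atRoot-wedge x (vec b) y (vec c))) (cong (atRoot (vec b)) w)

    is-h? : ∀ t → Dec (wedgeOf b t ≡ h)
    is-h? t = wedgeOf b t ≟₃ h

    fibre : List Data
    fibre = filter is-h? family

    ∈-fibre : ∀ {t} → t ∈ fibre → InFamily t × wedgeOf b t ≡ h
    ∈-fibre t∈ with ∈ₚ.∈-filter⁻ is-h? {xs = family} t∈
    ... | t∈f , w = ∈-family t∈f , w

    det≤ : ∀ (x : Pair) (n : ℕ × ℕ) → ∣ proj₁ x ∣ ≤ B → ∣ proj₂ x ∣ ≤ B → proj₁ n ≤ B → proj₂ n ≤ B → ∣ det x (vec n) ∣ ≤ B * B + B * B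
    det≤ (x₁ , x₂) (n₁ , n₂) p q r s = ∣i-j∣≤ (x₁ ℤ.* + n₂) (x₂ ℤ.* + n₁) (∣i*j∣≤ x₁ (+ n₂) p s) (∣i*j∣≤ x₂ (+ n₁) q r)

    -- By `product-det`, det x b · det c b = n₀ ≠ 0. A divisor of n₀ and a sign fix both
    -- determinants, two slots then fix x and c, and the wedge fixes y. 512 = 2 · 16 · 16.
    generic : ∀ T → (∀ n → 1 ≤ n → n ≤ 4 * (B * B * (B * B)) → τ n ≤ T) → n₀ ≢ 0ℤ → length fibre ≤ 512 * T
    generic T τ≤ n₀≢0 with fibre in eq
    ... | [] = z≤n
    ... | t₀ ∷ ts = subst (λ l → length l ≤ 512 * T) eq (≤-trans (injective⇒length≤ {ys = codes} code (Uniqueₚ.filter⁺ is-h? family-unique) inj into) size≤)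
      where
      signs : List Bool
      signs = true ∷ false ∷ []
      isPos : ℤ → Bool
      isPos (+ _)    = true
      isPos -[1+ _ ] = false
      codes : List (ℕ × Bool × ℕ × ℕ)
      codes = cart (divisors ∣ n₀ ∣) (cart signs (cart (upTo 16) (upTo 16)))
      code : Data → ℕ × Bool × ℕ × ℕ
      code t = ∣ detX t ∣ , isPos (detX t) , slotX t , slotC t
      recover : ∀ i j → ∣ i ∣ ≡ ∣ j ∣ → isPos i ≡ isPos j → i ≡ j
      recover (+ _)    (+ _)    e _ = cong +_ e
      recover -[1+ _ ] -[1+ _ ] e _ = cong -[1+_] (suc-injective e)
      isPos∈ : ∀ i → isPos i ∈ signs
      isPos∈ (+ _)    = here refl
      isPos∈ -[1+ _ ] = there (here refl)
      detX≢0 : ∀ {t} → wedgeOf b t ≡ h → detX t ≢ 0ℤ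
      detX≢0 {t} w e = n₀≢0 (trans (sym (product-det {t} w)) (trans (cong (ℤ._* detC t) e) (ℤₚ.*-zeroˡ (detC t))))
      n₀>0 : 1 ≤ ∣ n₀ ∣
      n₀>0 = n≢0⇒n>0 (λ e → n₀≢0 (ℤₚ.∣i∣≡0⇒i≡0 e))
      inj : ∀ {t t′} → t ∈ fibre → t′ ∈ fibre → code t ≡ code t′ → t ≡ t′
      inj {t} {t′} t∈ t′∈ e with ∈-fibre t∈ | ∈-fibre t′∈
      ... | f , w | f′ , w′ = same-y {t} {t′} w w′ (same-x f f′ X≡ (cong (proj₁ ∘ proj₂ ∘ proj₂) e)) (same-c {t} {t′} C≡ (cong (proj₂ ∘ proj₂ ∘ proj₂) e))
        where
        X≡ : detX t ≡ detX t′
        X≡ = recover _ _ (cong proj₁ e) (cong (proj₁ ∘ proj₂) e)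
        C≡ : detC t ≡ detC t′
        C≡ = *-cancelʳᶻ (detC t) (detC t′) (detX t) (detX≢0 {t} w) (trans (ℤₚ.*-comm (detC t) (detX t)) (trans (product-det {t} w)
          (trans (sym (product-det {t′} w′)) (trans (cong (ℤ._* detC t′) (sym X≡)) (ℤₚ.*-comm (detX t) (detC t′))))))
      into : ∀ {t} → t ∈ fibre → code t ∈ codes
      into {t} t∈ with ∈-fibre t∈
      ... | f , w = ∈ₚ.∈-cartesianProduct⁺ (∈-divisors⁺ n₀>0 (divides ∣ detC t ∣ (trans (cong ∣_∣ (sym (product-det {t} w))) (trans (ℤₚ.abs-* (detX t) (detC t)) (*-comm ∣ detX t ∣ ∣ detC t ∣)))))
        (∈ₚ.∈-cartesianProduct⁺ (isPos∈ (detX t)) (∈ₚ.∈-cartesianProduct⁺ (∈ₚ.∈-upTo⁺ (slotX< f)) (∈ₚ.∈-upTo⁺ (slotC< f))))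
      n₀≤ : ∣ n₀ ∣ ≤ 4 * (B * B * (B * B))
      n₀≤ with ∈-fibre {t₀} (subst (t₀ ∈_) (sym eq) (here refl))
      ... | f , w = ≤-trans (≡⇒≤ (trans (cong ∣_∣ (sym (product-det {t₀} w))) (ℤₚ.abs-* (detX t₀) (detC t₀))))
        (≤-trans (*-mono-≤ (det≤ (proj₁ t₀) b (InFamily.x₁≤ f) (InFamily.x₂≤ f) b₁≤ b₂≤)
                           (det≤ (vec (proj₂ (proj₂ t₀))) b (IsDirection.b₁≤ (InFamily.dir′ f)) (IsDirection.b₂≤ (InFamily.dir′ f)) b₁≤ b₂≤)) (≡⇒≤ (identity (B * B))))
        where
        identity : ∀ s → (s + s) * (s + s) ≡ 4 * (s * s)
        identity = ℕR.solve-∀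
      size≤ : length codes ≤ 512 * T
      size≤ = ≤-trans (≡⇒≤ (length-cart _,_ (divisors ∣ n₀ ∣) (cart signs (cart (upTo 16) (upTo 16))))) (≤-trans (*-monoˡ-≤ 512 (τ≤ ∣ n₀ ∣ n₀>0 n₀≤)) (≡⇒≤ (*-comm T 512)))

    -- One of det c b and det x b vanishes, so c or x is confined to a line through the origin and
    -- fixed by its slot; the other one is free.
    degenerate : n₀ ≡ 0ℤ → length fibre ≤ 16 * (suc (2 * B) * suc (2 * B)) + 16 * (B * B)
    degenerate n₀≡0 = ≤-trans (filter-⊎ is-h? (λ t → is-h? t ×? (detC t ℤ.≟ 0ℤ)) (λ t → is-h? t ×? (detX t ℤ.≟ 0ℤ)) family split) (+-mono-≤ C-zero X-zero)
      where
      split : ∀ t → t ∈ family → wedgeOf b t ≡ h → (wedgeOf b t ≡ h × detC t ≡ 0ℤ) ⊎ (wedgeOf b t ≡ h × detX t ≡ 0ℤ)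
      split t _ w = [ (λ e → inj₂ (w , e)) , (λ e → inj₁ (w , e)) ]′ (ℤₚ.i*j≡0⇒i≡0∨j≡0 (detX t) (trans (product-det {t} w) n₀≡0))
      C-zero : length (filter (λ t → is-h? t ×? (detC t ℤ.≟ 0ℤ)) family) ≤ 16 * (suc (2 * B) * suc (2 * B))
      C-zero = ≤-trans (injective⇒length≤ {ys = cart (upTo 16) (box B)} (λ t → slotC t , proj₁ t) (Uniqueₚ.filter⁺ zero? family-unique) inj into)
        (≡⇒≤ (trans (length-cart _,_ (upTo 16) (box B)) (cong (16 *_) (length-box B))))
        where
        zero? : ∀ t → Dec (wedgeOf b t ≡ h × detC t ≡ 0ℤ)
        zero? t = is-h? t ×? (detC t ℤ.≟ 0ℤ)
        facts : ∀ {t} → t ∈ filter zero? family → InFamily t × wedgeOf b t ≡ h × detC t ≡ 0ℤ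
        facts t∈ with ∈ₚ.∈-filter⁻ zero? {xs = family} t∈
        ... | t∈f , r = ∈-family t∈f , r
        inj : ∀ {t t′} → t ∈ filter zero? family → t′ ∈ filter zero? family → (slotC t , proj₁ t) ≡ (slotC t′ , proj₁ t′) → t ≡ t′
        inj {t} {t′} t∈ t′∈ e with facts t∈ | facts t′∈
        ... | f , w , z | f′ , w′ , z′ = same-y {t} {t′} w w′ (cong proj₂ e) (same-c {t} {t′} (trans z (sym z′)) (cong proj₁ e))
        into : ∀ {t} → t ∈ filter zero? family → (slotC t , proj₁ t) ∈ cart (upTo 16) (box B)
        into t∈ = ∈ₚ.∈-cartesianProduct⁺ (∈ₚ.∈-upTo⁺ (slotC< (proj₁ (facts t∈)))) (InFamily.x∈ (proj₁ (facts t∈)))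
      X-zero : length (filter (λ t → is-h? t ×? (detX t ℤ.≟ 0ℤ)) family) ≤ 16 * (B * B)
      X-zero = ≤-trans (injective⇒length≤ {ys = cart (upTo 16) (directions B)} (λ t → slotX t , proj₂ (proj₂ t)) (Uniqueₚ.filter⁺ zero? family-unique) inj into)
        (≤-trans (≡⇒≤ (length-cart _,_ (upTo 16) (directions B))) (*-monoʳ-≤ 16 (length-directions B)))
        where
        zero? : ∀ t → Dec (wedgeOf b t ≡ h × detX t ≡ 0ℤ)
        zero? t = is-h? t ×? (detX t ℤ.≟ 0ℤ)
        facts : ∀ {t} → t ∈ filter zero? family → InFamily t × wedgeOf b t ≡ h × detX t ≡ 0ℤ
        facts t∈ with ∈ₚ.∈-filter⁻ zero? {xs = family} t∈
        ... | t∈f , r = ∈-family t∈f , r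
        inj : ∀ {t t′} → t ∈ filter zero? family → t′ ∈ filter zero? family → (slotX t , proj₂ (proj₂ t)) ≡ (slotX t′ , proj₂ (proj₂ t′)) → t ≡ t′
        inj {t} {t′} t∈ t′∈ e with facts t∈ | facts t′∈
        ... | f , w , z | f′ , w′ , z′ = same-y {t} {t′} w w′ (same-x f f′ (trans z (sym z′)) (cong proj₁ e)) (cong proj₂ e)
        into : ∀ {t} → t ∈ filter zero? family → (slotX t , proj₂ (proj₂ t)) ∈ cart (upTo 16) (directions B)
        into t∈ = ∈ₚ.∈-cartesianProduct⁺ (∈ₚ.∈-upTo⁺ (slotX< (proj₁ (facts t∈)))) (InFamily.c∈ (proj₁ (facts t∈)))

    count : ∀ T → (∀ n → 1 ≤ n → n ≤ 4 * (B * B * (B * B)) → τ n ≤ T) →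
            length fibre ≤ 512 * T + (16 * (suc (2 * B) * suc (2 * B)) + 16 * (B * B)) * 𝟙 (n₀ ℤ.≟ 0ℤ)
    count T τ≤ with n₀ ℤ.≟ 0ℤ
    ... | yes e = ≤-trans (≤-trans (degenerate e) (≡⇒≤ (sym (*-identityʳ _)))) (m≤n+m _ (512 * T))
    ... | no ne = ≤-trans (generic T τ≤ ne) (m≤m+n _ _)

-- Abundance of primitive directions

module PrimitiveCount (B : ℕ) where

  multiples : ℕ → ℕ
  multiples g = length (filter (g ∣?_) (range₁ B))

  square≤ : ∀ g → 1 ≤ g → g * g * (multiples g * multiples g) ≤ B * B
  square≤ g 1≤g = ≤-trans (≡⇒≤ (identity g (multiples g))) (*-mono-≤ (multiples≤ g B 1≤g) (multiples≤ g B 1≤g))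
    where
    identity : ∀ g n → g * g * (n * n) ≡ n * g * (n * g)
    identity = ℕR.solve-∀

  tail : ℕ → ℕ
  tail zero    = 0
  tail (suc k) = tail k + multiples (3 + k) * multiples (3 + k)

  -- Telescoping Σ 1/g² ≤ Σ 1/(g − 1) − 1/g over g ≥ 3.
  tail≤ : ∀ k → 2 * (2 + k) * tail k ≤ k * (B * B)
  tail≤ zero    = z≤n
  tail≤ (suc k) = *-cancelˡ-≤ (2 + k) (≤-trans (≡⇒≤ (expand k (tail k) N)) (≤-trans
    (+-mono-≤ (*-monoʳ-≤ (3 + k) (tail≤ k)) (*-monoʳ-≤ 2 (≤-trans (*-monoˡ-≤ N (*-monoˡ-≤ (3 + k) (n≤1+n (2 + k)))) (square≤ (3 + k) (s≤s z≤n)))))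
    (≡⇒≤ (collect k (B * B)))))
    where
    N = multiples (3 + k) * multiples (3 + k)
    expand : ∀ k w n → (2 + k) * (2 * (2 + suc k) * (w + n)) ≡ (3 + k) * (2 * (2 + k) * w) + 2 * ((2 + k) * (3 + k) * n)
    expand = ℕR.solve-∀
    collect : ∀ k b → (3 + k) * (k * b) + 2 * b ≡ (2 + k) * (suc k * b)
    collect = ℕR.solve-∀

  square : List (ℕ × ℕ)
  square = cart (range₁ B) (range₁ B)

  common : ℕ → ℕ × ℕ → ℕ
  common g (x , y) = 𝟙 (g ∣? x) * 𝟙 (g ∣? y)

  ∑-common : ∀ g → ∑ square (common g) ≡ multiples g * multiples g
  ∑-common g = trans (ℕΣ.∑-cart (range₁ B) (range₁ B) (common g)) (trans (sym (ℕΣ.∑-*-∑ (range₁ B) (range₁ B) (λ x → 𝟙 (g ∣? x)) (λ y → 𝟙 (g ∣? y))))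
    (cong₂ _*_ (sym (length-filter (g ∣?_) (range₁ B))) (sym (length-filter (g ∣?_) (range₁ B)))))

  cover : ℕ → ℕ × ℕ → ℕ
  cover zero    v = 0
  cover (suc k) v = cover k v + common (3 + k) v

  ∑-cover : ∀ k → ∑ square (cover k) ≡ tail k
  ∑-cover zero    = ℕΣ.∑-0 square
  ∑-cover (suc k) = trans (ℕΣ.∑-+ square (cover k) (common (3 + k))) (cong₂ _+_ (∑-cover k) (∑-common (3 + k)))

  common≥1 : ∀ g x y → g ∣ x → g ∣ y → 1 ≤ common g (x , y)
  common≥1 g x y p q = ≡⇒≤ (sym (cong₂ _*_ (𝟙-yes (g ∣? x) p) (𝟙-yes (g ∣? y) q)))

  cover≥1 : ∀ k j x y → j < k → 3 + j ∣ x → 3 + j ∣ y → 1 ≤ cover k (x , y)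
  cover≥1 (suc k) j x y j<k p q with j ≟ k
  ... | yes refl = ≤-trans (common≥1 (3 + k) x y p q) (m≤n+m _ (cover k (x , y)))
  ... | no ne    = ≤-trans (cover≥1 k j x y (≤∧≢⇒< (s≤s⁻¹ j<k) ne) p q) (m≤m+n _ _)

  coprime? : ∀ (v : ℕ × ℕ) → Dec (gcd (proj₁ v) (proj₂ v) ≡ 1)
  coprime? v = gcd (proj₁ v) (proj₂ v) ≟ 1

  low? : ∀ (v : ℕ × ℕ) → Dec (8 * proj₁ v ≤ B)
  low? v = 8 * proj₁ v ≤? B

  classify : ∀ v → v ∈ square → 1 ≤ 𝟙 (coprime? v) + (common 2 v + cover B v)
  classify (x , y) v∈ with ∈ₚ.∈-cartesianProduct⁻ (range₁ B) (range₁ B) v∈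
  ... | x∈ , y∈ = by-gcd (gcd x y) refl
    where
    x>0 = proj₁ (∈-range₁⁻ x∈)
    by-gcd : ∀ g → gcd x y ≡ g → 1 ≤ 𝟙 (coprime? (x , y)) + (common 2 (x , y) + cover B (x , y))
    by-gcd 0 e = ⊥-elim (<⇒≱ x>0 (≡⇒≤ (GCD.gcd[m,n]≡0⇒m≡0 e)))
    by-gcd 1 e = ≤-trans (≡⇒≤ (sym (𝟙-yes (coprime? (x , y)) e))) (m≤m+n (𝟙 (coprime? (x , y))) _)
    by-gcd 2 e = ≤-trans (≤-trans (common≥1 2 x y (subst (_∣ x) e (gcd[m,n]∣m x y)) (subst (_∣ y) e (gcd[m,n]∣n x y))) (m≤m+n _ _)) (m≤n+m _ (𝟙 (coprime? (x , y))))
    by-gcd (suc (suc (suc j))) e = ≤-trans (≤-trans (cover≥1 B j x y j<B g∣x (subst (_∣ y) e (gcd[m,n]∣n x y))) (m≤n+m _ (common 2 (x , y)))) (m≤n+m _ (𝟙 (coprime? (x , y))))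
      where
      g∣x : 3 + j ∣ x
      g∣x = subst (_∣ x) e (gcd[m,n]∣m x y)
      j<B : j < B
      j<B = ≤-trans (≤-trans (s≤s (m≤n+m j 2)) (∣ₚ.∣⇒≤ {{>-nonZero x>0}} g∣x)) (proj₂ (∈-range₁⁻ x∈))

  coprime-pairs low-pairs : ℕ
  coprime-pairs = ∑ square (λ v → 𝟙 (coprime? v))
  low-pairs     = ∑ square (λ v → 𝟙 (low? v))

  length-square : length square ≡ B * B
  length-square = trans (length-cart _,_ (range₁ B) (range₁ B)) (cong₂ _*_ (length-range₁ B) (length-range₁ B))

  -- Pairs with the common divisor g number at most B²/g²: this is B²/4 for g = 2, and at most B²/2
  -- for all g ≥ 3 together by `tail≤`.
  B²≤4coprime : B * B ≤ 4 * coprime-pairs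
  B²≤4coprime = +-cancelʳ-≤ (3 * (B * B)) _ _ (≤-trans (≡⇒≤ (four (B * B))) (≤-trans (*-monoʳ-≤ 4 all) (≤-trans (≡⇒≤ (split coprime-pairs (multiples 2 * multiples 2) (tail B)))
    (+-monoʳ-≤ (4 * coprime-pairs) (≤-trans (+-mono-≤ (square≤ 2 (s≤s z≤n)) (*-monoʳ-≤ 2 tail-bound)) (≡⇒≤ (three (B * B))))))))
    where
    four : ∀ b → b + 3 * b ≡ 4 * b
    four = ℕR.solve-∀
    three : ∀ b → b + 2 * b ≡ 3 * b
    three = ℕR.solve-∀
    split : ∀ c n t → 4 * (c + (n + t)) ≡ 4 * c + (2 * 2 * n + 2 * (2 * t))
    split = ℕR.solve-∀
    all : B * B ≤ coprime-pairs + (multiples 2 * multiples 2 + tail B)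
    all = ≤-trans (≡⇒≤ (sym (trans (∑-const square 1) (trans (*-identityʳ _) length-square)))) (≤-trans (∑-mono square classify)
      (≡⇒≤ (trans (ℕΣ.∑-+ square _ _) (cong (λ t → coprime-pairs + t) (trans (ℕΣ.∑-+ square (common 2) (cover B)) (cong₂ _+_ (∑-common 2) (∑-cover B)))))))
    tail-bound : 2 * tail B ≤ B * B
    tail-bound = *-cancelˡ-≤ (2 + B) (≤-trans (≡⇒≤ (rearrange B (tail B))) (≤-trans (tail≤ B) (*-monoˡ-≤ (B * B) (m≤n+m B 2))))
      where
      rearrange : ∀ b t → (2 + b) * (2 * t) ≡ 2 * (2 + b) * t
      rearrange = ℕR.solve-∀

  8low≤ : 8 * low-pairs ≤ B * B
  8low≤ = ≤-trans (*-monoʳ-≤ 8 (≤-trans (≡⇒≤ (sym (length-filter low? square))) small)) (≤-trans (≡⇒≤ (sym (*-assoc 8 (B / 8) B))) (*-monoˡ-≤ B (≤-trans (≡⇒≤ (*-comm 8 (B / 8))) (DM.m/n*n≤m B 8))))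
    where
    small : length (filter low? square) ≤ B / 8 * B
    small = ≤-trans (injective⇒length≤ {ys = cart (range₁ (B / 8)) (range₁ B)} id (Uniqueₚ.filter⁺ low? (Uniqueₚ.cartesianProduct⁺ (range₁-unique B) (range₁-unique B))) (λ _ _ e → e) into)
      (≡⇒≤ (trans (length-cart _,_ (range₁ (B / 8)) (range₁ B)) (cong₂ _*_ (length-range₁ (B / 8)) (length-range₁ B))))
      where
      into : ∀ {v} → v ∈ filter low? square → v ∈ cart (range₁ (B / 8)) (range₁ B)
      into {x , y} v∈ with ∈ₚ.∈-filter⁻ low? {xs = square} v∈
      ... | v∈s , le with ∈ₚ.∈-cartesianProduct⁻ (range₁ B) (range₁ B) v∈s
      ...   | x∈ , y∈ = ∈ₚ.∈-cartesianProduct⁺ (∈-range₁⁺ (proj₁ (∈-range₁⁻ x∈)) (≤-trans (≡⇒≤ (sym (DM.m*n/n≡m x 8))) (DM./-monoˡ-≤ 8 (≤-trans (≡⇒≤ (*-comm x 8)) le)))) y∈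

  -- From at least B²/4 coprime pairs, at most B²/8 pairs with 8 b₁ ≤ B are discarded.
  directions≥ : B * B ≤ 8 * length (directions B)
  directions≥ = +-cancelʳ-≤ (B * B) _ _ (≤-trans (≡⇒≤ (cong (λ t → B * B + t) (sym (+-identityʳ (B * B))))) (≤-trans (*-monoʳ-≤ 2 B²≤4coprime)
    (≤-trans (≡⇒≤ (sym (*-assoc 2 4 coprime-pairs))) (≤-trans (*-monoʳ-≤ 8 split) (≤-trans (≡⇒≤ (*-distribˡ-+ 8 (length (directions B)) low-pairs)) (+-monoʳ-≤ (8 * length (directions B)) 8low≤))))))
    where
    split : coprime-pairs ≤ length (directions B) + low-pairs
    split = ≤-trans (≡⇒≤ (sym (length-filter coprime? square))) (≤-trans (filter-⊎ coprime? (good? B) low? square decide) (+-monoʳ-≤ (length (directions B)) (≡⇒≤ (length-filter low? square))))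
      where
      decide : ∀ v → v ∈ square → gcd (proj₁ v) (proj₂ v) ≡ 1 → Good B v ⊎ 8 * proj₁ v ≤ B
      decide v _ g with B <? 8 * proj₁ v
      ... | yes lt = inj₁ (g , lt)
      ... | no nlt = inj₂ (≮⇒≥ nlt)

module Energy (d : ℕ) (1≤d : 1 ≤ d) (P : Triple → Set) (P? : ∀ h → Dec (P h)) (P-minus : ∀ h k → P h → P k → P (minus h k))
              (P-cross : ∀ h k → P h → P k → Crossed d h k) (B R T : ℕ) (1≤B : 1 ≤ B) (HR : 4 * (4 * (B * B) * (4 * (B * B))) ≤ d * R)
              (τ≤ : ∀ n → 1 ≤ n → n ≤ 4 * (B * B * (B * B)) → τ n ≤ T) where
  open Fibres B

  -- The middle coordinate of a wedge consists of four products, each of size at most B².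
  H : ℕ
  H = 4 * (B * B)

  open LatticeCount d 1≤d P P? P-minus P-cross H R (*-mono-≤ {1} {4} (s≤s z≤n) (*-mono-≤ 1≤B 1≤B)) HR

  dirs : List (ℕ × ℕ)
  dirs = directions B

  wedge-bound : ∀ b t → IsDirection B b → InFamily t → sup (wedgeOf b t) ≤ H
  wedge-bound b (x , y , c) dir f = ⊔-lub (outer (proj₁ x) (+ proj₁ c) (proj₁ y) (+ proj₁ b) F.x₁≤ C.b₁≤ F.y₁≤ D.b₁≤)
    (⊔-lub (≤-trans (∣i-j∣≤ (proj₁ x ℤ.* + proj₂ c ℤ.+ proj₂ x ℤ.* + proj₁ c) (proj₁ y ℤ.* + proj₂ b ℤ.+ proj₂ y ℤ.* + proj₁ b)
             (both (proj₁ x) (+ proj₂ c) (proj₂ x) (+ proj₁ c) F.x₁≤ C.b₂≤ F.x₂≤ C.b₁≤) (both (proj₁ y) (+ proj₂ b) (proj₂ y) (+ proj₁ b) F.y₁≤ D.b₂≤ F.y₂≤ D.b₁≤)) (≡⇒≤ (four (B * B))))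
           (outer (proj₂ x) (+ proj₂ c) (proj₂ y) (+ proj₂ b) F.x₂≤ C.b₂≤ F.y₂≤ D.b₂≤))
    where
    module F = InFamily f
    module C = IsDirection (InFamily.dir′ f)
    module D = IsDirection dir
    four : ∀ s → s + s + (s + s) ≡ 4 * s
    four = ℕR.solve-∀
    both : ∀ i j k l → ∣ i ∣ ≤ B → ∣ j ∣ ≤ B → ∣ k ∣ ≤ B → ∣ l ∣ ≤ B → ∣ i ℤ.* j ℤ.+ k ℤ.* l ∣ ≤ B * B + B * B
    both i j k l p q r s = ≤-trans (ℤₚ.∣i+j∣≤∣i∣+∣j∣ (i ℤ.* j) (k ℤ.* l)) (+-mono-≤ (∣i*j∣≤ i j p q) (∣i*j∣≤ k l r s))
    outer : ∀ i j k l → ∣ i ∣ ≤ B → ∣ j ∣ ≤ B → ∣ k ∣ ≤ B → ∣ l ∣ ≤ B → ∣ i ℤ.* j ℤ.- k ℤ.* l ∣ ≤ H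
    outer i j k l p q r s = ≤-trans (∣i-j∣≤ (i ℤ.* j) (k ℤ.* l) (∣i*j∣≤ i j p q) (∣i*j∣≤ k l r s)) (≤-trans (m≤m+n _ (B * B + B * B)) (≡⇒≤ (four (B * B))))

  root? : ∀ b h → Dec (atRoot (vec b) h ≡ 0ℤ)
  root? b h = atRoot (vec b) h ℤ.≟ 0ℤ

  roots≤2 : ∀ h → h ≢ 𝟎 → length (filter (λ b → root? b h) dirs) ≤ 2
  roots≤2 h h≢𝟎 with filter (λ b → root? b h) dirs in eq
  ... | []         = z≤n
  ... | _ ∷ []     = s≤s z≤n
  ... | _ ∷ _ ∷ [] = s≤s (s≤s z≤n)
  ... | b ∷ b′ ∷ b″ ∷ rest = ⊥-elim (contra (subst Unique eq (Uniqueₚ.filter⁺ (λ b → root? b h) (directions-unique B))))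
    where
    facts : ∀ {c} → c ∈ b ∷ b′ ∷ b″ ∷ rest → IsDirection B c × atRoot (vec c) h ≡ 0ℤ
    facts {c} c∈ with ∈ₚ.∈-filter⁻ (λ b → root? b h) {xs = dirs} (subst (c ∈_) (sym eq) c∈)
    ... | c∈d , z = ∈-directions {B} c∈d , z
    contra : Unique (b ∷ b′ ∷ b″ ∷ rest) → ⊥
    contra ((b≢b′ ∷ b≢b″ ∷ _) ∷ (b′≢b″ ∷ _) ∷ _) = h≢𝟎 (three-roots (vec b) (vec b′) (vec b″) h
      (λ e → b≢b′ (det≡0⇒≡ (proj₁ f) (proj₁ f′) e)) (λ e → b′≢b″ (sym (det≡0⇒≡ (proj₁ f″) (proj₁ f′) e))) (λ e → b≢b″ (det≡0⇒≡ (proj₁ f) (proj₁ f″) e))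
      (proj₂ f) (proj₂ f′) (proj₂ f″))
      where
      f  = facts (here refl)
      f′ = facts (there (here refl))
      f″ = facts (there (there (here refl)))

  waste : ℕ
  waste = 16 * (suc (2 * B) * suc (2 * B)) + 16 * (B * B)

  -- A nonzero h is a root of at most two directions and only h = 0 is a root of all, so the large
  -- fibres of `degenerate` occur rarely.
  ∑-roots : ∑ points (λ h → ∑ dirs (λ b → 𝟙 (root? b h))) ≤ 2 * bound₀ + B * B
  ∑-roots = ≤-trans (∑-mono points one) (≤-trans (≡⇒≤ (ℕΣ.∑-+ points (λ _ → 2) (λ h → 𝟙 (𝟎 ≟₃ h) * (B * B))))
    (+-mono-≤ (≤-trans (≡⇒≤ (trans (∑-const points 2) (*-comm (length points) 2))) (*-monoʳ-≤ 2 lattice-count)) zero-term))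
    where
    one : ∀ h → h ∈ points → ∑ dirs (λ b → 𝟙 (root? b h)) ≤ 2 + 𝟙 (𝟎 ≟₃ h) * (B * B)
    one h _ with 𝟎 ≟₃ h
    ... | no ne = ≤-trans (≤-trans (≡⇒≤ (sym (length-filter (λ b → root? b h) dirs))) (roots≤2 h (λ e → ne (sym e)))) (m≤m+n 2 _)
    ... | yes _ = ≤-trans (≤-trans (∑-≤const dirs 1 (λ b _ → 𝟙≤1 (root? b h))) (≤-trans (≡⇒≤ (*-identityʳ (length dirs))) (length-directions B))) (≤-trans (≡⇒≤ (sym (+-identityʳ (B * B)))) (m≤n+m (1 * (B * B)) 2))
      where
      𝟙≤1 : {Q : Set} (q : Dec Q) → 𝟙 q ≤ 1
      𝟙≤1 (yes _) = ≤-refl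
      𝟙≤1 (no _)  = z≤n
    zero-term : ∑ points (λ h → 𝟙 (𝟎 ≟₃ h) * (B * B)) ≤ B * B
    zero-term with Any.any? (𝟎 ≟₃_) points
    ... | yes 𝟎∈ = ≡⇒≤ (∑-pick _≟₃_ (λ _ → B * B) 𝟎 points-unique 𝟎∈)
    ... | no 𝟎∉  = ≤-trans (≡⇒≤ (trans (ℕΣ.∑-cong points (λ h h∈ → cong (_* (B * B)) (𝟙-no (𝟎 ≟₃ h) (λ e → 𝟎∉ (Any.map (λ { refl → e }) h∈))))) (ℕΣ.∑-0 points))) z≤n

  energyBound : ℕ
  energyBound = B * B * (bound₀ * (512 * T)) + waste * (2 * bound₀ + B * B)

  energy≤ : ∑ dirs (λ b → ∑ family (λ t → 𝟙 (P? (wedgeOf b t)))) ≤ energyBound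
  energy≤ = ≤-trans (∑-mono dirs by-value) (≤-trans (∑-mono dirs (λ b b∈ → ∑-mono points (λ h _ → Fixed.count b b∈ h T τ≤)))
    (≤-trans (≡⇒≤ rearrange) (+-mono-≤ main rest)))
    where
    by-value : ∀ b → b ∈ dirs → ∑ family (λ t → 𝟙 (P? (wedgeOf b t))) ≤ ∑ points (λ h → length (filter (λ t → wedgeOf b t ≟₃ h) family))
    by-value b b∈ = ≤-trans (∑-mono family (λ t t∈ → spread t t∈ (P? (wedgeOf b t)))) (≡⇒≤ (trans (ℕΣ.∑-swap family points (λ t h → 𝟙 (wedgeOf b t ≟₃ h)))
      (ℕΣ.∑-ext points (λ h → sym (length-filter (λ t → wedgeOf b t ≟₃ h) family)))))
      where
      spread : ∀ t → t ∈ family → (p : Dec (P (wedgeOf b t))) → 𝟙 p ≤ ∑ points (λ h → 𝟙 (wedgeOf b t ≟₃ h))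
      spread t t∈ (no _)  = z≤n
      spread t t∈ (yes p) = ≤-trans (≡⇒≤ (sym (𝟙-yes (wedgeOf b t ≟₃ wedgeOf b t) refl)))
        (∈⇒≤∑ (λ h → 𝟙 (wedgeOf b t ≟₃ h)) (∈ₚ.∈-filter⁺ P? (∈-cube⁺ (wedgeOf b t) (wedge-bound b t (∈-directions {B} b∈) (∈-family t∈))) p))
    rearrange : ∑ dirs (λ b → ∑ points (λ h → 512 * T + waste * 𝟙 (root? b h))) ≡ length dirs * (length points * (512 * T)) + waste * ∑ points (λ h → ∑ dirs (λ b → 𝟙 (root? b h)))
    rearrange = trans (ℕΣ.∑-ext dirs (λ b → trans (ℕΣ.∑-+ points (λ _ → 512 * T) (λ h → waste * 𝟙 (root? b h))) (cong₂ _+_ (∑-const points (512 * T)) (ℕΣ.∑-*ˡ waste points (λ h → 𝟙 (root? b h))))))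
      (trans (ℕΣ.∑-+ dirs (λ _ → length points * (512 * T)) (λ b → waste * ∑ points (λ h → 𝟙 (root? b h)))) (cong₂ _+_ (∑-const dirs (length points * (512 * T))) (trans (ℕΣ.∑-*ˡ waste dirs (λ b → ∑ points (λ h → 𝟙 (root? b h)))) (cong (waste *_) (ℕΣ.∑-swap dirs points (λ b h → 𝟙 (root? b h)))))))
    main : length dirs * (length points * (512 * T)) ≤ B * B * (bound₀ * (512 * T))
    main = *-mono-≤ (length-directions B) (*-monoˡ-≤ (512 * T) lattice-count)
    rest : waste * ∑ points (λ h → ∑ dirs (λ b → 𝟙 (root? b h))) ≤ waste * (2 * bound₀ + B * B)
    rest = *-monoʳ-≤ waste ∑-roots

-- Moments of sign sums

GoodPrime : Form → Set
GoodPrime D = Σ ℕ (λ p → Prime p × Odd p × ¬ p ∣ᶻ disc D)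

pos-∑ : {A : Set} (xs : List A) (f : A → ℕ) → + ∑ xs f ≡ ℤΣ.∑ xs (λ x → + f x)
pos-∑ []       f = refl
pos-∑ (x ∷ xs) f = cong (λ t → + f x ℤ.+ t) (pos-∑ xs f)

square-pos : ∀ i → i ℤ.* i ≡ + (∣ i ∣ * ∣ i ∣)
square-pos (+ n)    = sym (ℤₚ.pos-* n n)
square-pos -[1+ n ] = refl

pow-pos : ∀ m n → ℤΣ.pow (+ m) n ≡ + (m ^ n)
pow-pos m zero    = refl
pow-pos m (suc n) = trans (cong (λ t → + m ℤ.* t) (pow-pos m n)) (sym (ℤₚ.pos-* m (m ^ n)))

pow-even : ∀ i r → ℤΣ.pow i (2 * r) ≡ + (∣ i ∣ ^ (2 * r))
pow-even i r = trans (sym (ℤΣ.pow-∘ i 2 r)) (trans (cong (λ t → ℤΣ.pow t r) (trans (cong (i ℤ.*_) (ℤₚ.*-identityʳ i)) (square-pos i)))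
  (trans (pow-pos (∣ i ∣ * ∣ i ∣) r) (cong +_ (trans (cong (_^ r) (cong (∣ i ∣ *_) (sym (*-identityʳ ∣ i ∣)))) (^-*-assoc ∣ i ∣ 2 r)))))

∈-words⁻ : {A : Set} {n : ℕ} {xs ρ : List A} → ρ ∈ words n xs → length ρ ≡ n × (∀ x → x ∈ ρ → x ∈ xs)
∈-words⁻ {n = zero}          (here refl) = refl , λ _ ()
∈-words⁻ {n = suc n} {xs} ρ∈ with ∈ₚ.∈-cartesianProductWith⁻ _∷_ xs (words n xs) ρ∈
... | x , σ , x∈ , σ∈ , refl = cong suc (proj₁ (∈-words⁻ σ∈)) , λ { y (here refl) → x∈ ; y (there y∈) → proj₂ (∈-words⁻ {n = n} σ∈) y y∈ }

∈-words⁺ : {A : Set} {xs : List A} (ρ : List A) → (∀ x → x ∈ ρ → x ∈ xs) → ρ ∈ words (length ρ) xs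
∈-words⁺ []      sub = here refl
∈-words⁺ (x ∷ ρ) sub = ∈ₚ.∈-cartesianProductWith⁺ _∷_ (sub x (here refl)) (∈-words⁺ ρ (λ y y∈ → sub y (there y∈)))

picks : {A : Set} → List A → List (A × List A)
picks []       = []
picks (x ∷ xs) = (x , xs) ∷ map (λ v → proj₁ v , x ∷ proj₂ v) (picks xs)

picks-↭ : {A : Set} {τ : List A} {v : A × List A} → v ∈ picks τ → τ ↭ proj₁ v ∷ proj₂ v
picks-↭ {τ = x ∷ xs} (here refl) = ↭.refl
picks-↭ {τ = x ∷ xs} (there v∈) with ∈ₚ.∈-map⁻ _ v∈
... | w , w∈ , refl = ↭.trans (↭.prep x (picks-↭ w∈)) (↭.swap x (proj₁ w) ↭.refl)

picks-remove : {A : Set} {t : A} {τ : List A} (t∈ : t ∈ τ) → (t , remove t∈) ∈ picks τ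
picks-remove (here refl) = here refl
picks-remove (there t∈)  = there (∈ₚ.∈-map⁺ _ (picks-remove t∈))

-- A word with a marked letter amounts to that letter, the word without it, and one of suc n places
-- to reinsert it.
∑-picks : {A : Set} (T : List A) (n : ℕ) (W : A × List A → ℕ) →
          ∑ (words (suc n) T) (λ τ → ∑ (picks τ) W) ≡ suc n * ∑ T (λ t → ∑ (words n T) (λ ρ → W (t , ρ)))
∑-picks T zero W = trans (ℕΣ.∑-cartWith _∷_ T ([] ∷ []) (λ τ → ∑ (picks τ) W)) (trans (ℕΣ.∑-ext T (λ t → trans (+-identityʳ _) refl)) (sym (+-identityʳ _)))
∑-picks T (suc n) W = begin
  ∑ (words (2 + n) T) (λ τ → ∑ (picks τ) W)
    ≡⟨ ℕΣ.∑-cartWith _∷_ T (words (suc n) T) (λ τ → ∑ (picks τ) W) ⟩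
  ∑ T (λ x → ∑ (words (suc n) T) (λ ρ → W (x , ρ) + ∑ (map (λ v → proj₁ v , x ∷ proj₂ v) (picks ρ)) W))
    ≡⟨ ℕΣ.∑-ext T (λ x → trans (ℕΣ.∑-+ (words (suc n) T) (λ ρ → W (x , ρ)) _) (cong (λ t → ∑ (words (suc n) T) (λ ρ → W (x , ρ)) + t)
         (trans (ℕΣ.∑-ext (words (suc n) T) (λ ρ → ℕΣ.∑-map (λ v → proj₁ v , x ∷ proj₂ v) (picks ρ) W)) (∑-picks T n (λ v → W (proj₁ v , x ∷ proj₂ v)))))) ⟩
  ∑ T (λ x → ∑ (words (suc n) T) (λ ρ → W (x , ρ)) + suc n * ∑ T (λ t → ∑ (words n T) (λ ρ → W (t , x ∷ ρ))))
    ≡⟨ trans (ℕΣ.∑-+ T _ _) (cong (_+_ total) (trans (ℕΣ.∑-*ˡ (suc n) T _) (cong (suc n *_) regroup))) ⟩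
  total + suc n * total ∎
  where
  open ≡-Reasoning
  total = ∑ T (λ t → ∑ (words (suc n) T) (λ ρ → W (t , ρ)))
  regroup : ∑ T (λ x → ∑ T (λ t → ∑ (words n T) (λ ρ → W (t , x ∷ ρ)))) ≡ total
  regroup = trans (ℕΣ.∑-swap T T _) (ℕΣ.∑-ext T (λ t → sym (ℕΣ.∑-cartWith _∷_ T (words n T) (λ ρ → W (t , ρ)))))

∑-remove : {A : Set} {t : A} {τ : List A} (f : A → ℕ) (t∈ : t ∈ τ) → ∑ τ f ≡ f t + ∑ (remove t∈) f
∑-remove f (here refl) = refl
∑-remove {t = t} {x ∷ τ} f (there t∈) = trans (cong (_+_ (f x)) (∑-remove f t∈)) (swap (f x) (f t) _)
  where
  swap : ∀ a b c → a + (b + c) ≡ b + (a + c)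
  swap = ℕR.solve-∀

nub : List ℕ → List ℕ
nub []       = []
nub (x ∷ xs) = x ∷ filter (λ y → ¬? (x ≟ y)) (nub xs)

nub-unique : ∀ xs → Unique (nub xs)
nub-unique []       = []
nub-unique (x ∷ xs) = All.tabulate (λ y∈ → proj₂ (∈ₚ.∈-filter⁻ (λ y → ¬? (x ≟ y)) {xs = nub xs} y∈)) ∷ Uniqueₚ.filter⁺ (λ y → ¬? (x ≟ y)) (nub-unique xs)

∈-nub⁺ : ∀ {x xs} → x ∈ xs → x ∈ nub xs
∈-nub⁺ (here refl) = here refl
∈-nub⁺ {x} {y ∷ xs} (there x∈) with y ≟ x
... | yes refl = here refl
... | no ne    = there (∈ₚ.∈-filter⁺ (λ z → ¬? (y ≟ z)) (∈-nub⁺ x∈) ne)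

∈-nub⁻ : ∀ {x} xs → x ∈ nub xs → x ∈ xs
∈-nub⁻ (y ∷ xs) (here refl) = here refl
∈-nub⁻ (y ∷ xs) (there x∈)  = there (∈-nub⁻ xs (proj₁ (∈ₚ.∈-filter⁻ (λ z → ¬? (y ≟ z)) {xs = nub xs} x∈)))

∑-𝟙-unique : ∀ {u} x → Unique u → ∑ u (λ t → 𝟙 (t ≟ x)) ≤ 1
∑-𝟙-unique {[]}    x _ = z≤n
∑-𝟙-unique {t ∷ u} x (t∉ ∷ uu) with t ≟ x
... | no _     = ∑-𝟙-unique x uu
... | yes refl = s≤s (≡⇒≤ (trans (ℕΣ.∑-cong u (λ y y∈ → 𝟙-no (y ≟ t) (λ e → All.lookup t∉ y∈ (sym e)))) (ℕΣ.∑-0 u)))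

Isolated : ℕ × List ℕ → Set
Isolated (t , ρ) = t ∉ ρ

isolated? : ∀ v → Dec (Isolated v)
isolated? (t , ρ) = ¬? (Any.any? (t ≟_) ρ)

-- Some letter occurs exactly once: then the product of signs cancels over the classes. Otherwise
-- every letter occurs at least twice, and such words are few.
Simple : List ℕ → Set
Simple τ = Any Isolated (picks τ)

simple? : ∀ τ → Dec (Simple τ)
simple? τ = Any.any? isolated? (picks τ)

nub-half : ∀ τ → ¬ Simple τ → 2 * length (nub τ) ≤ length τ
nub-half τ ns = ≤-trans (≡⇒≤ (trans (*-comm 2 (length (nub τ))) (sym (∑-const (nub τ) 2)))) (≤-trans (∑-mono (nub τ) twice)
  (≤-trans (≡⇒≤ (ℕΣ.∑-swap (nub τ) τ (λ t x → 𝟙 (t ≟ x)))) (≤-trans (∑-≤const τ 1 (λ x _ → ∑-𝟙-unique x (nub-unique τ))) (≡⇒≤ (*-identityʳ _)))))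
  where
  twice : ∀ t → t ∈ nub τ → 2 ≤ ∑ τ (λ x → 𝟙 (t ≟ x))
  twice t t∈n = ≤-trans (+-mono-≤ (≡⇒≤ (sym (𝟙-yes (t ≟ t) refl))) (≤-trans (≡⇒≤ (sym (𝟙-yes (t ≟ t) refl))) (∈⇒≤∑ (λ x → 𝟙 (t ≟ x)) again))) (≡⇒≤ (sym (∑-remove (λ x → 𝟙 (t ≟ x)) t∈)))
    where
    t∈ : t ∈ τ
    t∈ = ∈-nub⁻ τ t∈n
    again : t ∈ remove t∈
    again with Any.any? (t ≟_) (remove t∈)
    ... | yes a = a
    ... | no na = ⊥-elim (ns (Any.map (λ { refl → na }) (picks-remove t∈)))

member? : ∀ (ρ : List ℕ) x → Dec (x ∈ ρ)
member? ρ x = Any.any? (x ≟_) ρ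

-- The at most r distinct letters, padded by repetition, form a word ρ of length r. There are A^r
-- choices of ρ and at most r^(2 r) words in its letters.
nonsimple-count : ∀ r A → 1 ≤ r → ∑ (words (2 * r) (upTo A)) (λ τ → 𝟙 (¬? (simple? τ))) ≤ r ^ (2 * r) * A ^ r
nonsimple-count r A 1≤r = ≤-trans (∑-mono (words (2 * r) T) covered) (≤-trans (≡⇒≤ (ℕΣ.∑-swap (words (2 * r) T) (words r T) (λ τ ρ → ∏ τ (λ x → 𝟙 (member? ρ x)))))
  (≤-trans (∑-≤const (words r T) (r ^ (2 * r)) (λ ρ ρ∈ → ≤-trans (≡⇒≤ (trans (sym (ℕΣ.∑-pow T (λ x → 𝟙 (member? ρ x)) (2 * r))) (pow≡^ _ (2 * r)))) (^-monoˡ-≤ (2 * r) (few ρ ρ∈))))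
    (≡⇒≤ (trans (cong (_* r ^ (2 * r)) (length-words r)) (*-comm (A ^ r) _)))))
  where
  T = upTo A
  length-words : ∀ n → length (words n T) ≡ A ^ n
  length-words zero    = refl
  length-words (suc n) = trans (length-cart _∷_ T (words n T)) (cong₂ _*_ (Listₚ.length-upTo A) (length-words n))
  few : ∀ ρ → ρ ∈ words r T → ∑ T (λ x → 𝟙 (member? ρ x)) ≤ r
  few ρ ρ∈ = ≤-trans (≡⇒≤ (sym (length-filter (member? ρ) T))) (≤-trans (injective⇒length≤ {ys = ρ} id (Uniqueₚ.filter⁺ (member? ρ) (Uniqueₚ.upTo⁺ A)) (λ _ _ e → e)
    (λ x∈ → proj₂ (∈ₚ.∈-filter⁻ (member? ρ) {xs = T} x∈))) (≡⇒≤ (proj₁ (∈-words⁻ ρ∈))))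
  covered : ∀ τ → τ ∈ words (2 * r) T → 𝟙 (¬? (simple? τ)) ≤ ∑ (words r T) (λ ρ → ∏ τ (λ x → 𝟙 (member? ρ x)))
  covered τ τ∈ with simple? τ
  ... | yes _ = z≤n
  ... | no ns with τ | ∈-words⁻ {n = 2 * r} τ∈ | nub-half τ ns
  ...   | []        | l , _   | _    = ⊥-elim (<⇒≱ 1≤r (*-cancelˡ-≤ 2 (≤-trans (≡⇒≤ (sym l)) z≤n)))
  ...   | t ∷ τ′    | l , sub | half = ≤-trans (≡⇒≤ (sym all-in)) (∈⇒≤∑ (λ ρ → ∏ (t ∷ τ′) (λ x → 𝟙 (member? ρ x))) ρ∈)
    where
    u = nub (t ∷ τ′)
    u≤r : length u ≤ r
    u≤r = *-cancelˡ-≤ 2 (≤-trans half (≡⇒≤ l))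
    ρ = u ++ replicate (r ∸ length u) t
    ρ-length : length ρ ≡ r
    ρ-length = trans (Listₚ.length-++ u) (trans (cong (_+_ (length u)) (Listₚ.length-replicate (r ∸ length u))) (m+[n∸m]≡n u≤r))
    ρ∈ : ρ ∈ words r T
    ρ∈ = subst (λ n → ρ ∈ words n T) ρ-length (∈-words⁺ ρ (λ x x∈ → sub x (back x (∈ₚ.∈-++⁻ u x∈))))
      where
      back : ∀ x → x ∈ u ⊎ x ∈ replicate (r ∸ length u) t → x ∈ t ∷ τ′
      back x (inj₁ x∈) = ∈-nub⁻ (t ∷ τ′) x∈
      back x (inj₂ x∈) = here (constant (r ∸ length u) x∈)
        where
        constant : ∀ n {x} → x ∈ replicate n t → x ≡ t
        constant (suc n) (here e)   = e
        constant (suc n) (there x∈) = constant n x∈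
    all-in : ∏ (t ∷ τ′) (λ x → 𝟙 (member? ρ x)) ≡ 1
    all-in = trans (ℕΣ.∏-cong (t ∷ τ′) (λ x x∈ → 𝟙-yes (member? ρ x) (∈ₚ.∈-++⁺ˡ (∈-nub⁺ x∈)))) (ℕΣ.∏-1 (t ∷ τ′))

-- The gcd of n with a prime p. It is the price of a difference of shifts divisible by p, where the
-- trivial bound replaces cancellation.
primePart : ℕ → ℕ → ℕ
primePart p n with p ∣? n
... | yes _ = p
... | no _  = 1

primePart≤ : ∀ p n → primePart p n ≤ 1 + p * 𝟙 (p ∣? n)
primePart≤ p n with p ∣? n
... | yes _ = ≤-trans (≡⇒≤ (sym (*-identityʳ p))) (n≤1+n _)
... | no _  = s≤s z≤n

primePart≥1 : ∀ p n → 1 ≤ p → 1 ≤ primePart p n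
primePart≥1 p n 1≤p with p ∣? n
... | yes _ = 1≤p
... | no _  = ≤-refl

module Global (D : Form) where

  GP : Set
  GP = GoodPrime D

  abstract
    locally : (g : GP) → Local (proj₁ g) D
    locally (p , pp , odd , nd) = LocalExistence.local p (residueField p pp odd) (proj₁ D) (proj₁ (proj₂ D)) (proj₂ (proj₂ D)) nd

  prime-of : (g : GP) → Prime (proj₁ g)
  prime-of g = proj₁ (proj₂ g)

  1≤p : (g : GP) → 1 ≤ proj₁ g
  1≤p g = >-nonZero⁻¹ (proj₁ g) {{prime⇒nonZero (prime-of g)}}

  modulus : List GP → ℕ
  modulus ds = ∏ ds proj₁

  part : List GP → ℕ → ℕ
  part ds n = ∏ ds (λ g → primePart (proj₁ g) n)

  Distinct : List GP → Set
  Distinct ds = Unique (map proj₁ ds)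

  -- `part ds n` is gcd(n , d), with mean value at most 2^ω over n ≤ A. The divisor m is there for
  -- the induction: gcd(p , n) ≤ 1 + p · [p ∣ n] moves the prime p into m.
  ∑-part : ∀ ds m A → 1 ≤ m → Distinct ds → (∀ g → g ∈ ds → ¬ proj₁ g ∣ m) →
           m * ∑ (range₁ A) (λ n → 𝟙 (m ∣? n) * part ds n) ≤ A * 2 ^ length ds
  ∑-part [] m A 1≤m u cop = ≤-trans (≡⇒≤ (trans (cong (m *_) (trans (ℕΣ.∑-ext (range₁ A) (λ n → *-identityʳ _)) (sym (length-filter (m ∣?_) (range₁ A))))) (*-comm m _)))
    (≤-trans (multiples≤ m A 1≤m) (≡⇒≤ (sym (*-identityʳ A))))
  ∑-part (g ∷ ds) m A 1≤m (g∉ ∷ u) cop = ≤-trans (*-monoʳ-≤ m (∑-mono (range₁ A) (λ n _ → split n))) (≤-trans (≡⇒≤ rearrange)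
    (≤-trans (+-mono-≤ (∑-part ds m A 1≤m u (λ h h∈ → cop h (there h∈))) (∑-part ds (m * p) A (*-mono-≤ 1≤m (1≤p g)) u cop′))
      (≡⇒≤ (two A (2 ^ length ds)))))
    where
    p = proj₁ g
    cop′ : ∀ h → h ∈ ds → ¬ proj₁ h ∣ m * p
    cop′ h h∈ dv with euclidsLemma m p (prime-of h) dv
    ... | inj₁ h∣m = cop h (there h∈) h∣m
    ... | inj₂ h∣p with Primality.prime⇒irreducible (prime-of g) h∣p
    ...   | inj₁ h≡1 = nonTrivial⇒≢1 {{prime⇒nonTrivial (prime-of h)}} h≡1
    ...   | inj₂ h≡p = All.lookup g∉ (∈ₚ.∈-map⁺ proj₁ h∈) (sym h≡p)
    both : ∀ n → 𝟙 (m ∣? n) * 𝟙 (p ∣? n) ≤ 𝟙 (m * p ∣? n)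
    both n with m ∣? n | p ∣? n
    ... | no _  | _     = z≤n
    ... | yes _ | no _  = z≤n
    ... | yes (divides k refl) | yes p∣n = ≡⇒≤ (sym (𝟙-yes (m * p ∣? k * m) (∣mp (euclidsLemma k m (prime-of g) p∣n))))
      where
      ∣mp : (p ∣ k) ⊎ (p ∣ m) → m * p ∣ k * m
      ∣mp (inj₁ (divides j refl)) = divides j (trans (*-assoc j p m) (cong (j *_) (*-comm p m)))
      ∣mp (inj₂ p∣m) = ⊥-elim (cop g (here refl) p∣m)
    split : ∀ n → 𝟙 (m ∣? n) * (primePart p n * part ds n) ≤ 𝟙 (m ∣? n) * part ds n + p * (𝟙 (m * p ∣? n) * part ds n)
    split n = ≤-trans (*-monoʳ-≤ (𝟙 (m ∣? n)) (*-monoˡ-≤ (part ds n) (primePart≤ p n))) (≤-trans (≡⇒≤ (expand (𝟙 (m ∣? n)) p (𝟙 (p ∣? n)) (part ds n)))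
      (+-monoʳ-≤ (𝟙 (m ∣? n) * part ds n) (*-monoʳ-≤ p (*-monoˡ-≤ (part ds n) (both n)))))
      where
      expand : ∀ a p b G → a * ((1 + p * b) * G) ≡ a * G + p * (a * b * G)
      expand = ℕR.solve-∀
    rearrange : m * ∑ (range₁ A) (λ n → 𝟙 (m ∣? n) * part ds n + p * (𝟙 (m * p ∣? n) * part ds n)) ≡
                m * ∑ (range₁ A) (λ n → 𝟙 (m ∣? n) * part ds n) + m * p * ∑ (range₁ A) (λ n → 𝟙 (m * p ∣? n) * part ds n)
    rearrange = trans (cong (m *_) (trans (ℕΣ.∑-+ (range₁ A) _ _) (cong (λ t → ∑ (range₁ A) (λ n → 𝟙 (m ∣? n) * part ds n) + t) (ℕΣ.∑-*ˡ p (range₁ A) _))))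
      (trans (*-distribˡ-+ m _ _) (cong (λ t → m * ∑ (range₁ A) (λ n → 𝟙 (m ∣? n) * part ds n) + t) (sym (*-assoc m p _))))
    two : ∀ A k → A * k + A * k ≡ A * (2 * k)
    two = ℕR.solve-∀

  dist : ℕ → ℕ → ℕ
  dist x t = ∣ + x ℤ.- + t ∣

  dist-cases : ∀ x t n → dist x t ≡ n → x ≡ t + n ⊎ x ≡ t ∸ n
  dist-cases x t n eq with ∣∣≡⇒± (+ x ℤ.- + t) eq
  ... | inj₁ e = inj₁ (ℤₚ.+-injective (trans (undo (+ x) (+ t)) (cong (λ s → + t ℤ.+ s) e)))
    where
    undo : ∀ x t → x ≡ t ℤ.+ (x ℤ.- t)
    undo = ℤR.solve-∀
  ... | inj₂ e = inj₂ (trans (sym (m+n∸n≡m x n)) (cong (_∸ n) (ℤₚ.+-injective (trans (cong (λ s → + x ℤ.+ s) n≡) (undo (+ x) (+ t))))))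
    where
    n≡ : + n ≡ + t ℤ.- + x
    n≡ = trans (sym (ℤₚ.neg-involutive (+ n))) (trans (cong ℤ.-_ (sym e)) (flip (+ x) (+ t)))
      where
      flip : ∀ x t → ℤ.- (x ℤ.- t) ≡ t ℤ.- x
      flip = ℤR.solve-∀
    undo : ∀ x t → x ℤ.+ (t ℤ.- x) ≡ t
    undo = ℤR.solve-∀

  -- The value 0 at x = t extinguishes the words in which t recurs, so the weights can be summed
  -- over all words, as a power of one sum.
  apart : List GP → ℕ → ℕ → ℕ
  apart ds t x with t ≟ x
  ... | yes _ = 0
  ... | no _  = part ds (dist x t)

  ∑-apart : ∀ ds A t → t < A → Distinct ds → ∑ (upTo A) (apart ds t) ≤ 2 * (A * 2 ^ length ds)
  ∑-apart ds A t t<A u = ≤-trans (∑-mono (upTo A) one) (≤-trans (≡⇒≤ (ℕΣ.∑-swap (upTo A) (range₁ A) (λ x n → 𝟙 (dist x t ≟ n) * part ds n)))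
    (≤-trans (∑-mono (range₁ A) (λ n _ → ≤-trans (≡⇒≤ (ℕΣ.∑-*ʳ (part ds n) (upTo A) (λ x → 𝟙 (dist x t ≟ n)))) (*-monoˡ-≤ (part ds n) (two n))))
      (≤-trans (≡⇒≤ (ℕΣ.∑-*ˡ 2 (range₁ A) (part ds))) (*-monoʳ-≤ 2 (≤-trans (≡⇒≤ (sym (trans (*-identityˡ _) (ℕΣ.∑-ext (range₁ A) (λ n → trans (cong (_* part ds n) (𝟙-yes (1 ∣? n) (∣ₚ.1∣ n))) (*-identityˡ _))))))
        (∑-part ds 1 A ≤-refl u (λ g _ g∣1 → nonTrivial⇒≢1 {{prime⇒nonTrivial (prime-of g)}} (∣ₚ.∣1⇒≡1 g∣1))))))))
    where
    two : ∀ n → ∑ (upTo A) (λ x → 𝟙 (dist x t ≟ n)) ≤ 2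
    two n = ≤-trans (≡⇒≤ (sym (length-filter (λ x → dist x t ≟ n) (upTo A)))) (injective⇒length≤ {ys = t + n ∷ t ∸ n ∷ []} id (Uniqueₚ.filter⁺ (λ x → dist x t ≟ n) (Uniqueₚ.upTo⁺ A)) (λ _ _ e → e)
      (λ {x} x∈ → place (dist-cases x t n (proj₂ (∈ₚ.∈-filter⁻ (λ x → dist x t ≟ n) {xs = upTo A} x∈)))))
      where
      place : ∀ {x} → x ≡ t + n ⊎ x ≡ t ∸ n → x ∈ t + n ∷ t ∸ n ∷ []
      place (inj₁ e) = here e
      place (inj₂ e) = there (here e)
    one : ∀ x → x ∈ upTo A → apart ds t x ≤ ∑ (range₁ A) (λ n → 𝟙 (dist x t ≟ n) * part ds n)
    one x x∈ with t ≟ x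
    ... | yes _ = z≤n
    ... | no ne = ≤-trans (≡⇒≤ (sym (trans (cong (_* part ds (dist x t)) (𝟙-yes (dist x t ≟ dist x t) refl)) (*-identityˡ _))))
      (∈⇒≤∑ (λ n → 𝟙 (dist x t ≟ n) * part ds n) (∈-range₁⁺ (n≢0⇒n>0 (λ e → ne (sym (ℤₚ.+-injective (-≡0⇒≡ (+ x) (+ t) (ℤₚ.∣i∣≡0⇒i≡0 e))))))
        (≤-trans (≡⇒≤ (cong ∣_∣ (ℤₚ.m-n≡m⊖n x t))) (∣⊖∣≤ x t A (≤-trans (<⇒≤ (∈ₚ.∈-upTo⁻ x∈)) (m≤n+m A t)) (≤-trans (<⇒≤ t<A) (m≤n+m A x))))))

  Class : List GP → Set
  Class []       = ⊤
  Class (g ∷ ds) = Local.Ξ (locally g) × Class ds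

  classesOf : ∀ ds → List (Class ds)
  classesOf []       = tt ∷ []
  classesOf (g ∷ ds) = cart (Local.classes (locally g)) (classesOf ds)

  signAt : ∀ ds → Class ds → ℤ → ℤ
  signAt []       _       t = 1ℤ
  signAt (g ∷ ds) (ξ , η) t = Local.s (locally g) ξ t ℤ.* signAt ds η t

  localSum : List ℤ → GP → ℤ
  localSum τ g = ℤΣ.∑ (Local.classes (locally g)) (λ ξ → ℤΣ.∏ τ (Local.s (locally g) ξ))

  -- A class modulo d is a tuple of local classes and its sign a product of local signs, so the sum
  -- factors over the primes.
  ∑-classes : ∀ ds τ → ℤΣ.∑ (classesOf ds) (λ ξ → ℤΣ.∏ τ (signAt ds ξ)) ≡ ℤΣ.∏ ds (localSum τ)
  ∑-classes []       τ = trans (ℤₚ.+-identityʳ _) (ℤΣ.∏-1 τ)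
  ∑-classes (g ∷ ds) τ = trans (ℤΣ.∑-cart (Local.classes (locally g)) (classesOf ds) (λ ξ → ℤΣ.∏ τ (signAt (g ∷ ds) ξ)))
    (trans (ℤΣ.∑-ext (Local.classes (locally g)) (λ ξ → ℤΣ.∑-ext (classesOf ds) (λ η → ℤΣ.∏-* τ (Local.s (locally g) ξ) (signAt ds η))))
    (trans (sym (ℤΣ.∑-*-∑ (Local.classes (locally g)) (classesOf ds) (λ ξ → ℤΣ.∏ τ (Local.s (locally g) ξ)) (λ η → ℤΣ.∏ τ (signAt ds η))))
      (cong (localSum τ g ℤ.*_) (∑-classes ds τ))))

  signSum : ∀ ds → ℕ → Class ds → ℤ
  signSum ds A ξ = ℤΣ.∑ (upTo A) (λ t → signAt ds ξ (+ t))

  module Moment (ds : List GP) (distinct : Distinct ds) (A m′ : ℕ) where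

    r C ω d : ℕ
    r = suc m′
    C = localConst (1 + 2 * m′) * localConst (1 + 2 * m′)
    ω = length ds
    d = modulus ds

    4≤C : 4 ≤ C
    4≤C = *-mono-≤ {2} {localConst (1 + 2 * m′)} {2} (≤-trans (m≤m+n 2 (1 + 2 * m′)) (m≤m+n _ _)) (≤-trans (m≤m+n 2 (1 + 2 * m′)) (m≤m+n _ _))

    trivially : ∀ τ g → ∣ localSum τ g ∣ ≤ C * (proj₁ g * proj₁ g)
    trivially τ g = ≤-trans (∣∑∣≤∑∣∣ L.classes (λ ξ → ℤΣ.∏ τ (L.s ξ))) (≤-trans (∑-≤const L.classes 1 (λ ξ _ → ≤-trans (≡⇒≤ (∣∏∣≡∏∣∣ τ (L.s ξ)))
      (≤-trans (∏-mono τ (λ t _ → L.∣s∣≤1 ξ t)) (≡⇒≤ (ℕΣ.∏-1 τ))))) (≤-trans (≡⇒≤ (*-identityʳ _)) (≤-trans L.sizeΞ (*-monoˡ-≤ (proj₁ g * proj₁ g) 4≤C))))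
      where module L = Local (locally g)

    shiftsOf : List ℕ → List ℤ
    shiftsOf = map (λ n → + n)

    -- If no other shift is congruent to t modulo p, `momentΞ` applies. Otherwise the product on the
    -- right contains a factor p, and the trivial bound C p² is enough.
    isolated-bound : ∀ t ρ g → length ρ ≡ 1 + 2 * m′ → ∣ localSum (shiftsOf (t ∷ ρ)) g ∣ ≤ C * proj₁ g * ∏ ρ (λ x → primePart (proj₁ g) (dist x t))
    isolated-bound t ρ g len with Any.any? (λ x → proj₁ g ∣? dist x t) ρ
    ... | yes some = ≤-trans (trivially (shiftsOf (t ∷ ρ)) g) (≤-trans (≡⇒≤ (sym (*-assoc C p p))) (*-monoʳ-≤ (C * p) (factor≥ ρ some)))
      where
      p = proj₁ g
      factor≥ : ∀ ρ → Any (λ x → p ∣ dist x t) ρ → p ≤ ∏ ρ (λ x → primePart p (dist x t))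
      factor≥ (x ∷ ρ) (here p∣) = ≤-trans (≡⇒≤ (sym (*-identityʳ p))) (*-mono-≤ (≡⇒≤ (sym (hit p∣))) (≤-trans (≡⇒≤ (sym (ℕΣ.∏-1 ρ))) (∏-mono ρ (λ y _ → primePart≥1 p (dist y t) (1≤p g)))))
        where
        hit : p ∣ dist x t → primePart p (dist x t) ≡ p
        hit p∣ with p ∣? dist x t
        ... | yes _ = refl
        ... | no n  = ⊥-elim (n p∣)
      factor≥ (x ∷ ρ) (there p∣) = ≤-trans (factor≥ ρ p∣) (m≤n*m _ (primePart p (dist x t)) {{>-nonZero (primePart≥1 p (dist x t) (1≤p g))}})
    ... | no none = ≤-trans (≤-trans (Local.momentΞ (locally g) (+ t) (shiftsOf ρ) m′ (trans (Listₚ.length-map (λ n → + n) ρ) len) avoid)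
        (≡⇒≤ (cong (λ n → localConst n * localConst n * proj₁ g) (trans (Listₚ.length-map (λ n → + n) ρ) len))))
        (m≤m*n (C * proj₁ g) _ {{>-nonZero (≤-trans (≡⇒≤ (sym (ℕΣ.∏-1 ρ))) (∏-mono ρ (λ y _ → primePart≥1 (proj₁ g) (dist y t) (1≤p g))))}})
      where
      avoid : ∀ x → x ∈ shiftsOf ρ → ¬ proj₁ g ∣ᶻ x ℤ.- + t
      avoid x x∈ dv with ∈ₚ.∈-map⁻ (λ n → + n) x∈
      ... | y , y∈ , refl = none (Any.map (λ { refl → dv }) y∈)

    weight : ℕ × List ℕ → ℕ
    weight (t , ρ) = C ^ ω * d * ∏ ρ (apart ds t)

    ∏-local≤ : ∀ (f : GP → ℕ) → ∏ ds (λ g → C * f g) ≡ C ^ ω * ∏ ds f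
    ∏-local≤ f = trans (ℕΣ.∏-* ds (λ _ → C) f) (cong (_* ∏ ds f) (trans (ℕΣ.∏-const ds C) (pow≡^ C ω)))

    word-bound : ∀ τ → τ ∈ words (2 * r) (upTo A) →
                 ∏ ds (λ g → ∣ localSum (shiftsOf τ) g ∣) ≤ ∑ (picks τ) weight + C ^ ω * (d * d) * 𝟙 (¬? (simple? τ))
    word-bound τ τ∈ with simple? τ
    ... | no _ = ≤-trans (∏-mono ds (λ g _ → trivially (shiftsOf τ) g)) (≤-trans (≡⇒≤ (trans (∏-local≤ (λ g → proj₁ g * proj₁ g)) (trans (cong (C ^ ω *_) (ℕΣ.∏-* ds proj₁ proj₁)) (sym (*-identityʳ _)))))
      (m≤n+m _ (∑ (picks τ) weight)))
    ... | yes some with find some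
    ...   | (t , ρ) , v∈ , t∉ρ = ≤-trans (≤-trans (∏-mono ds (λ g _ → ≤-trans (≡⇒≤ (cong ∣_∣ (permuted g))) (isolated-bound t ρ g ρ-length))) (≡⇒≤ regroup))
            (≤-trans (∈⇒≤∑ weight v∈) (m≤m+n _ _))
      where
      permuted : ∀ g → localSum (shiftsOf τ) g ≡ localSum (shiftsOf (t ∷ ρ)) g
      permuted g = ℤΣ.∑-ext (Local.classes (locally g)) (λ ξ → ℤΣ.∏-↭ (Local.s (locally g) ξ) (↭ₚ.map⁺ (λ n → + n) (picks-↭ v∈)))
      ρ-length : length ρ ≡ 1 + 2 * m′
      ρ-length = suc-injective (trans (sym (↭ₚ.↭-length (picks-↭ v∈))) (trans (proj₁ (∈-words⁻ {n = 2 * r} {xs = upTo A} τ∈)) (identity m′)))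
        where
        identity : ∀ m → 2 * suc m ≡ suc (1 + 2 * m)
        identity = ℕR.solve-∀
      regroup : ∏ ds (λ g → C * proj₁ g * ∏ ρ (λ x → primePart (proj₁ g) (dist x t))) ≡ weight (t , ρ)
      regroup = trans (ℕΣ.∏-* ds (λ g → C * proj₁ g) _) (cong₂ _*_ (∏-local≤ proj₁) (trans (ℕΣ.∏-swap ds ρ (λ g x → primePart (proj₁ g) (dist x t)))
        (ℕΣ.∏-cong ρ (λ x x∈ → sym (away x x∈)))))
        where
        away : ∀ x → x ∈ ρ → apart ds t x ≡ part ds (dist x t)
        away x x∈ with t ≟ x
        ... | yes refl = ⊥-elim (t∉ρ x∈)
        ... | no _     = refl

    -- Up to factors in r and ω, the words with an isolated letter give d A^(2 r), the others d² A^r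
    -- from the trivial bound; the first dominates once A^r is at least d.
    momentBound : ℕ
    momentBound = C ^ ω * d * (2 * r * (A * (2 * (A * 2 ^ ω)) ^ (1 + 2 * m′))) + C ^ ω * (d * d) * (r ^ (2 * r) * A ^ r)

    moment : ∑ (classesOf ds) (λ ξ → ∣ signSum ds A ξ ∣ ^ (2 * r)) ≤ momentBound
    moment = ≤-trans (≡⇒≤ (cong ∣_∣ as-words)) (≤-trans (∣∑∣≤∑∣∣ (words (2 * r) (upTo A)) (λ τ → ℤΣ.∏ ds (localSum (shiftsOf τ))))
      (≤-trans (∑-mono (words (2 * r) (upTo A)) (λ τ τ∈ → ≤-trans (≡⇒≤ (∣∏∣≡∏∣∣ ds (localSum (shiftsOf τ)))) (word-bound τ τ∈)))
        (≤-trans (≡⇒≤ (ℕΣ.∑-+ (words (2 * r) (upTo A)) _ _)) (+-mono-≤ simple-part rest))))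
      where
      as-words : + ∑ (classesOf ds) (λ ξ → ∣ signSum ds A ξ ∣ ^ (2 * r)) ≡ ℤΣ.∑ (words (2 * r) (upTo A)) (λ τ → ℤΣ.∏ ds (localSum (shiftsOf τ)))
      as-words = begin
        + ∑ (classesOf ds) (λ ξ → ∣ signSum ds A ξ ∣ ^ (2 * r))
          ≡⟨ pos-∑ (classesOf ds) _ ⟩
        ℤΣ.∑ (classesOf ds) (λ ξ → + (∣ signSum ds A ξ ∣ ^ (2 * r)))
          ≡⟨ ℤΣ.∑-ext (classesOf ds) (λ ξ → trans (sym (pow-even (signSum ds A ξ) r)) (ℤΣ.∑-pow (upTo A) (λ t → signAt ds ξ (+ t)) (2 * r))) ⟩
        ℤΣ.∑ (classesOf ds) (λ ξ → ℤΣ.∑ (words (2 * r) (upTo A)) (λ τ → ℤΣ.∏ τ (λ t → signAt ds ξ (+ t))))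
          ≡⟨ ℤΣ.∑-swap (classesOf ds) (words (2 * r) (upTo A)) _ ⟩
        ℤΣ.∑ (words (2 * r) (upTo A)) (λ τ → ℤΣ.∑ (classesOf ds) (λ ξ → ℤΣ.∏ τ (λ t → signAt ds ξ (+ t))))
          ≡⟨ ℤΣ.∑-ext (words (2 * r) (upTo A)) (λ τ → trans (ℤΣ.∑-ext (classesOf ds) (λ ξ → sym (ℤΣ.∏-map (λ n → + n) τ (signAt ds ξ)))) (∑-classes ds (shiftsOf τ))) ⟩
        ℤΣ.∑ (words (2 * r) (upTo A)) (λ τ → ℤΣ.∏ ds (localSum (shiftsOf τ))) ∎
        where open ≡-Reasoning
      2r : ∀ m → 2 * suc m ≡ suc (1 + 2 * m)
      2r = ℕR.solve-∀
      n = 1 + 2 * m′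
      simple-part : ∑ (words (2 * r) (upTo A)) (λ τ → ∑ (picks τ) weight) ≤ C ^ ω * d * (2 * r * (A * (2 * (A * 2 ^ ω)) ^ n))
      simple-part = ≤-trans (≡⇒≤ (trans (cong (λ k → ∑ (words k (upTo A)) (λ τ → ∑ (picks τ) weight)) (2r m′)) (∑-picks (upTo A) n weight)))
        (≤-trans (*-monoʳ-≤ (suc n) (≤-trans (∑-≤const (upTo A) (C ^ ω * d * (2 * (A * 2 ^ ω)) ^ n) by-centre) (≡⇒≤ (cong (_* (C ^ ω * d * (2 * (A * 2 ^ ω)) ^ n)) (Listₚ.length-upTo A)))))
          (≡⇒≤ (trans (rearrange (suc n) A (C ^ ω * d) ((2 * (A * 2 ^ ω)) ^ n)) (cong (λ k → C ^ ω * d * (k * (A * (2 * (A * 2 ^ ω)) ^ n))) (sym (2r m′))))))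
        where
        rearrange : ∀ k A c X → k * (A * (c * X)) ≡ c * (k * (A * X))
        rearrange = ℕR.solve-∀
        by-centre : ∀ t → t ∈ upTo A → ∑ (words n (upTo A)) (λ ρ → weight (t , ρ)) ≤ C ^ ω * d * (2 * (A * 2 ^ ω)) ^ n
        by-centre t t∈ = ≤-trans (≡⇒≤ (trans (ℕΣ.∑-*ˡ (C ^ ω * d) (words n (upTo A)) (λ ρ → ∏ ρ (apart ds t)))
            (cong (C ^ ω * d *_) (trans (sym (ℕΣ.∑-pow (upTo A) (apart ds t) n)) (pow≡^ (∑ (upTo A) (apart ds t)) n)))))
          (*-monoʳ-≤ (C ^ ω * d) (^-monoˡ-≤ n (∑-apart ds A t (∈ₚ.∈-upTo⁻ t∈) distinct)))
      rest : ∑ (words (2 * r) (upTo A)) (λ τ → C ^ ω * (d * d) * 𝟙 (¬? (simple? τ))) ≤ C ^ ω * (d * d) * (r ^ (2 * r) * A ^ r)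
      rest = ≤-trans (≡⇒≤ (ℕΣ.∑-*ˡ (C ^ ω * (d * d)) (words (2 * r) (upTo A)) _)) (*-monoʳ-≤ (C ^ ω * (d * d)) (nonsimple-count r A (s≤s z≤n)))

-- Burgess's inequality

≤-square : ∀ m n → m * m ≤ n * n → m ≤ n
≤-square m n le with m ≤? n
... | yes m≤n = m≤n
... | no m≰n  = ⊥-elim (<⇒≱ (*-mono-< (≰⇒> m≰n) (≰⇒> m≰n)) le)

4xy≤ : ∀ x y → 4 * (x * y) ≤ (x + y) * (x + y)
4xy≤ x y = [ ordered x y , (λ le → ≤-trans (≡⇒≤ (cong (4 *_) (*-comm x y))) (≤-trans (ordered y x le) (≡⇒≤ (cong (λ s → s * s) (+-comm y x))))) ]′ (≤-total x y)
  where
  ordered : ∀ x y → x ≤ y → 4 * (x * y) ≤ (x + y) * (x + y)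
  ordered x y x≤y with m≤n⇒∃[o]m+o≡n x≤y
  ... | k , refl = ≤-trans (m≤m+n _ (k * k)) (≡⇒≤ (identity x k))
    where
    identity : ∀ x k → 4 * (x * (x + k)) + k * k ≡ (x + (x + k)) * (x + (x + k))
    identity = ℕR.solve-∀

cauchy-schwarz : {A : Set} (xs : List A) (f g : A → ℕ) →
                 ∑ xs (λ x → f x * g x) * ∑ xs (λ x → f x * g x) ≤ ∑ xs (λ x → f x * f x) * ∑ xs (λ x → g x * g x)
cauchy-schwarz []       f g = z≤n
cauchy-schwarz (x ∷ xs) f g = extend (f x) (g x) (∑ xs (λ x → f x * g x)) (∑ xs (λ x → f x * f x)) (∑ xs (λ x → g x * g x)) (cauchy-schwarz xs f g)
  where
  extend : ∀ a b S P Q → S * S ≤ P * Q → (a * b + S) * (a * b + S) ≤ (a * a + P) * (b * b + Q)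
  extend a b S P Q S²≤ = ≤-trans (≡⇒≤ (left a b S)) (≤-trans (+-mono-≤ (+-monoʳ-≤ (a * a * (b * b)) (≤-square (2 * (a * b * S)) (a * a * Q + b * b * P) mixed)) S²≤) (≡⇒≤ (sym (right a b P Q))))
    where
    left : ∀ a b S → (a * b + S) * (a * b + S) ≡ a * a * (b * b) + 2 * (a * b * S) + S * S
    left = ℕR.solve-∀
    right : ∀ a b P Q → (a * a + P) * (b * b + Q) ≡ a * a * (b * b) + (a * a * Q + b * b * P) + P * Q
    right = ℕR.solve-∀
    square : ∀ a b S → 2 * (a * b * S) * (2 * (a * b * S)) ≡ 4 * (a * a * (b * b)) * (S * S)
    square = ℕR.solve-∀
    regroup : ∀ a b P Q → 4 * (a * a * (b * b)) * (P * Q) ≡ 4 * (a * a * Q * (b * b * P))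
    regroup = ℕR.solve-∀
    mixed : 2 * (a * b * S) * (2 * (a * b * S)) ≤ (a * a * Q + b * b * P) * (a * a * Q + b * b * P)
    mixed = ≤-trans (≡⇒≤ (square a b S)) (≤-trans (*-monoʳ-≤ (4 * (a * a * (b * b))) S²≤) (≤-trans (≡⇒≤ (regroup a b P Q)) (4xy≤ (a * a * Q) (b * b * P))))

-- Amounts to (x - y) (xᵏ - yᵏ) ≥ 0.
chebyshev : ∀ k x y → x * y ^ k + y * x ^ k ≤ x * x ^ k + y * y ^ k
chebyshev k x y = [ ordered x y , (λ le → ≤-trans (≡⇒≤ (+-comm (x * y ^ k) _)) (≤-trans (ordered y x le) (≡⇒≤ (+-comm (y * y ^ k) _)))) ]′ (≤-total x y)
  where
  expand : ∀ x X j l → x * (X + l) + (x + j) * X + j * l ≡ x * X + (x + j) * (X + l)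
  expand = ℕR.solve-∀
  ordered : ∀ x y → x ≤ y → x * y ^ k + y * x ^ k ≤ x * x ^ k + y * y ^ k
  ordered x y x≤y with m≤n⇒∃[o]m+o≡n x≤y | m≤n⇒∃[o]m+o≡n (^-monoˡ-≤ k x≤y)
  ... | j , refl | l , eq = subst (λ Y → x * Y + (x + j) * x ^ k ≤ x * x ^ k + (x + j) * Y) eq (≤-trans (m≤m+n _ (j * l)) (≡⇒≤ (expand x (x ^ k) j l)))

-- Induction on the exponent, where `chebyshev` summed over all pairs separates one factor f.
power-mean : {A : Set} (xs : List A) (f : A → ℕ) (m : ℕ) → ∑ xs f ^ suc m ≤ length xs ^ m * ∑ xs (λ x → f x ^ suc m)
power-mean xs f zero    = ≡⇒≤ (trans (*-identityʳ _) (trans (ℕΣ.∑-ext xs (λ x → sym (*-identityʳ (f x)))) (sym (+-identityʳ _))))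
power-mean xs f (suc m) = ≤-trans (*-monoʳ-≤ (∑ xs f) (power-mean xs f m)) (≤-trans (≡⇒≤ (swap (∑ xs f) (n ^ m) (∑ xs (λ x → f x ^ suc m))))
  (≤-trans (*-monoʳ-≤ (n ^ m) correlated) (≡⇒≤ (assoc n (n ^ m) _))))
  where
  n = length xs
  swap : ∀ a b c → a * (b * c) ≡ b * (a * c)
  swap = ℕR.solve-∀
  assoc : ∀ n N c → N * (n * c) ≡ n * N * c
  assoc = ℕR.solve-∀
  F : ℕ → ℕ
  F k = ∑ xs (λ x → f x ^ k)
  correlated : ∑ xs f * F (suc m) ≤ n * F (2 + m)
  correlated = *-cancelˡ-≤ 2 (≤-trans (≡⇒≤ doubled) (≤-trans (∑-mono xs (λ x _ → ∑-mono xs (λ y _ → chebyshev (suc m) (f x) (f y)))) (≡⇒≤ diagonal)))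
    where
    doubled : 2 * (∑ xs f * F (suc m)) ≡ ∑ xs (λ x → ∑ xs (λ y → f x * f y ^ suc m + f y * f x ^ suc m))
    doubled = trans (cong (λ t → ∑ xs f * F (suc m) + t) (+-identityʳ _)) (trans (cong₂ _+_ (ℕΣ.∑-*-∑ xs xs f (λ y → f y ^ suc m))
      (trans (ℕΣ.∑-*-∑ xs xs f (λ y → f y ^ suc m)) (ℕΣ.∑-swap xs xs _))) (trans (sym (ℕΣ.∑-+ xs _ _)) (ℕΣ.∑-ext xs (λ x → sym (ℕΣ.∑-+ xs _ _)))))
    diagonal : ∑ xs (λ x → ∑ xs (λ y → f x ^ (2 + m) + f y ^ (2 + m))) ≡ 2 * (n * F (2 + m))
    diagonal = trans (ℕΣ.∑-ext xs (λ x → trans (ℕΣ.∑-+ xs _ _) (cong (_+ F (2 + m)) (∑-const xs (f x ^ (2 + m))))))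
      (trans (ℕΣ.∑-+ xs _ _) (cong₂ _+_ (ℕΣ.∑-*ˡ n xs _) (trans (∑-const xs (F (2 + m))) (sym (+-identityʳ _)))))

^-double : ∀ x k → x ^ (2 * k) ≡ x ^ k * x ^ k
^-double x k = trans (cong (λ j → x ^ (k + j)) (+-identityʳ k)) (^-distribˡ-+-* x k k)

module Fibred {A X : Set} (V : List A) (Ξ : List X) (_≟X_ : DecidableEquality X) (uniqueX : Unique Ξ) (allX : ∀ ξ → ξ ∈ Ξ) (f : A → X) where

  collisions : ℕ
  collisions = ∑ V (λ v → ∑ V (λ w → 𝟙 (f w ≟X f v)))

  fibre-size : X → ℕ
  fibre-size ξ = ∑ V (λ v → 𝟙 (f v ≟X ξ))

  ∑-fibres : (T : X → ℕ) → ∑ V (λ v → T (f v)) ≡ ∑ Ξ (λ ξ → fibre-size ξ * T ξ)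
  ∑-fibres T = trans (ℕΣ.∑-ext V (λ v → sym (∑-pick _≟X_ T (f v) uniqueX (allX (f v))))) (trans (ℕΣ.∑-swap V Ξ _) (ℕΣ.∑-ext Ξ (λ ξ → ℕΣ.∑-*ʳ (T ξ) V _)))

  ∑-squares : ∑ Ξ (λ ξ → fibre-size ξ * fibre-size ξ) ≡ collisions
  ∑-squares = trans (ℕΣ.∑-ext Ξ (λ ξ → ℕΣ.∑-*-∑ V V _ _)) (trans (ℕΣ.∑-swap Ξ V _) (ℕΣ.∑-ext V (λ v → trans (ℕΣ.∑-swap Ξ V _)
    (ℕΣ.∑-ext V (λ w → ∑-pick _≟X_ (λ ξ → 𝟙 (f w ≟X ξ)) (f v) uniqueX (allX (f v)))))))

  -- The power mean inequality over V, then Cauchy-Schwarz over the classes, where the squares of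
  -- the fibre sizes add up to the number of collisions.
  hölder : (T : X → ℕ) (m : ℕ) → ∑ V (λ v → T (f v)) ^ (2 * suc m) ≤ length V ^ (2 * m) * (collisions * ∑ Ξ (λ ξ → T ξ ^ (2 * suc m)))
  hölder T m = ≤-trans (≡⇒≤ (^-double (∑ V (λ v → T (f v))) (suc m))) (≤-trans (*-mono-≤ mean mean) (≤-trans (≡⇒≤ (regroup (length V ^ m) (∑ V (λ v → T (f v) ^ suc m))))
    (*-mono-≤ (≡⇒≤ (sym (^-double (length V) m))) (≤-trans squared (*-monoʳ-≤ collisions (≡⇒≤ (ℕΣ.∑-ext Ξ (λ ξ → sym (^-double (T ξ) (suc m))))))))))
    where
    mean : ∑ V (λ v → T (f v)) ^ suc m ≤ length V ^ m * ∑ V (λ v → T (f v) ^ suc m)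
    mean = power-mean V (λ v → T (f v)) m
    regroup : ∀ N S → N * S * (N * S) ≡ N * N * (S * S)
    regroup = ℕR.solve-∀
    squared : ∑ V (λ v → T (f v) ^ suc m) * ∑ V (λ v → T (f v) ^ suc m) ≤ collisions * ∑ Ξ (λ ξ → T ξ ^ suc m * T ξ ^ suc m)
    squared = ≤-trans (≡⇒≤ (cong (λ s → s * s) (∑-fibres (λ ξ → T ξ ^ suc m)))) (≤-trans (cauchy-schwarz Ξ fibre-size (λ ξ → T ξ ^ suc m)) (≡⇒≤ (cong (_* _) ∑-squares)))

natPair : ℕ × ℕ → Pair
natPair (x , y) = + x , + y

minus₂ : Pair → Pair → Pair
minus₂ (x , y) (x′ , y′) = x ℤ.- x′ , y ℤ.- y′

wedge-minus : ∀ l u v b u′ v′ c → wedge (minus₂ u v) b (minus₂ u′ v′) c ≡ minus (wedge (l ⊕₂ u) b (l ⊕₂ u′) c) (wedge (l ⊕₂ v) b (l ⊕₂ v′) c)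
wedge-minus (l₁ , l₂) (u₁ , u₂) (v₁ , v₂) (b₁ , b₂) (u₁′ , u₂′) (v₁′ , v₂′) (c₁ , c₂) = cong₂ _,_ (outer l₁ u₁ v₁ u₁′ v₁′ b₁ c₁) (cong₂ _,_ (middle l₁ l₂ u₁ u₂ v₁ v₂ u₁′ u₂′ v₁′ v₂′ b₁ b₂ c₁ c₂) (outer l₂ u₂ v₂ u₂′ v₂′ b₂ c₂))
  where
  outer : ∀ l u v u′ v′ b c → (u ℤ.- v) ℤ.* c ℤ.- (u′ ℤ.- v′) ℤ.* b ≡ ((l ℤ.+ u) ℤ.* c ℤ.- (l ℤ.+ u′) ℤ.* b) ℤ.- ((l ℤ.+ v) ℤ.* c ℤ.- (l ℤ.+ v′) ℤ.* b)
  outer = ℤR.solve-∀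
  middle : ∀ l₁ l₂ u₁ u₂ v₁ v₂ u₁′ u₂′ v₁′ v₂′ b₁ b₂ c₁ c₂ →
    ((u₁ ℤ.- v₁) ℤ.* c₂ ℤ.+ (u₂ ℤ.- v₂) ℤ.* c₁) ℤ.- ((u₁′ ℤ.- v₁′) ℤ.* b₂ ℤ.+ (u₂′ ℤ.- v₂′) ℤ.* b₁) ≡
    (((l₁ ℤ.+ u₁) ℤ.* c₂ ℤ.+ (l₂ ℤ.+ u₂) ℤ.* c₁) ℤ.- ((l₁ ℤ.+ u₁′) ℤ.* b₂ ℤ.+ (l₂ ℤ.+ u₂′) ℤ.* b₁)) ℤ.-
    (((l₁ ℤ.+ v₁) ℤ.* c₂ ℤ.+ (l₂ ℤ.+ v₂) ℤ.* c₁) ℤ.- ((l₁ ℤ.+ v₁′) ℤ.* b₂ ℤ.+ (l₂ ℤ.+ v₂′) ℤ.* b₁))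
  middle = ℤR.solve-∀

-- Subtracting one solution z from all of them is injective and turns an inhomogeneous condition
-- into a homogeneous one; without any solution the left side is 0.
filter-shift : {A B : Set} {P : A → Set} {Q : B → Set} (P? : ∀ x → Dec (P x)) (Q? : ∀ x → Dec (Q x)) {xs : List A} {ys : List B} (move : A → A → B) → Unique xs →
               (∀ z {x x′} → move z x ≡ move z x′ → x ≡ x′) → (∀ {z x} → z ∈ xs → x ∈ xs → P z → P x → move z x ∈ ys × Q (move z x)) →
               ∑ xs (λ x → 𝟙 (P? x)) ≤ ∑ ys (λ y → 𝟙 (Q? y))
filter-shift {P = P} P? Q? {xs} {ys} move u inj into = ≤-trans (≡⇒≤ (sym (length-filter P? xs))) (≤-trans (matched (filter P? xs) (λ x∈ → ∈ₚ.∈-filter⁻ P? {xs = xs} x∈) (Uniqueₚ.filter⁺ P? u)) (≡⇒≤ (length-filter Q? ys)))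
  where
  matched : ∀ zs → (∀ {x} → x ∈ zs → x ∈ xs × P x) → Unique zs → length zs ≤ length (filter Q? ys)
  matched []       facts _ = z≤n
  matched (z ∷ zs) facts w = injective⇒length≤ (move z) w (λ _ _ → inj z) (λ x∈ → let z∈ , Pz = facts (here refl) ; x∈xs , Px = facts x∈ ; m∈ , q = into z∈ x∈xs Pz Px in ∈ₚ.∈-filter⁺ Q? m∈ q)

-- Characters and classes to a composite modulus

module Classes (D : Form) where
  open Global D

  classOf : ∀ ds → Pair → Pair → Class ds
  classOf []       l b = tt
  classOf (g ∷ ds) l b = Local.cls (locally g) l b , classOf ds l b

  character : List GP → Pair → ℤ
  character ds l = ℤΣ.∏ ds (λ g → Local.chr (locally g) (evalForm D l))

  coefOf : List GP → Pair → Pair → ℤ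
  coefOf ds l b = ℤΣ.∏ ds (λ g → Local.coef (locally g) l b)

  ∣∏∣≤1 : ∀ ds (f : GP → ℤ) → (∀ g → ∣ f g ∣ ≤ 1) → ∣ ℤΣ.∏ ds f ∣ ≤ 1
  ∣∏∣≤1 ds f f≤1 = ≤-trans (≡⇒≤ (∣∏∣≡∏∣∣ ds f)) (≤-trans (∏-mono ds (λ g _ → f≤1 g)) (≡⇒≤ (ℕΣ.∏-1 ds)))

  ∣character∣≤1 : ∀ ds l → ∣ character ds l ∣ ≤ 1
  ∣character∣≤1 ds l = ∣∏∣≤1 ds _ (λ g → Local.∣chr∣≤1 (locally g) (evalForm D l))

  character-line : ∀ ds l b t → character ds (l ⊕₂ t ·₂ b) ≡ coefOf ds l b ℤ.* signAt ds (classOf ds l b) t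
  character-line []       l b t = refl
  character-line (g ∷ ds) l b t = trans (cong₂ ℤ._*_ (Local.factor (locally g) l b t) (character-line ds l b t))
    (ℤΣ.*-interchange (Local.coef (locally g) l b) (Local.s (locally g) (Local.cls (locally g) l b) t) (coefOf ds l b) (signAt ds (classOf ds l b) t))

  ∣line∣≤ : ∀ ds A l b → ∣ ℤΣ.∑ (upTo A) (λ t → character ds (l ⊕₂ + t ·₂ b)) ∣ ≤ ∣ signSum ds A (classOf ds l b) ∣
  ∣line∣≤ ds A l b = ≤-trans (≡⇒≤ (trans (cong ∣_∣ (trans (ℤΣ.∑-ext (upTo A) (λ t → character-line ds l b (+ t))) (ℤΣ.∑-*ˡ (coefOf ds l b) (upTo A) (λ t → signAt ds (classOf ds l b) (+ t)))))
    (ℤₚ.abs-* (coefOf ds l b) _))) (≤-trans (*-monoˡ-≤ _ (∣∏∣≤1 ds _ (λ g → Local.∣coef∣≤1 (locally g) l b))) (≡⇒≤ (*-identityˡ _)))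

  sameClass? : ∀ ds → DecidableEquality (Class ds)
  sameClass? []       tt tt = yes refl
  sameClass? (g ∷ ds) = ×ₚ.≡-dec (Local._≟Ξ_ (locally g)) (sameClass? ds)

  classesOf-unique : ∀ ds → Unique (classesOf ds)
  classesOf-unique []       = [] ∷ []
  classesOf-unique (g ∷ ds) = Uniqueₚ.cartesianProduct⁺ (Local.uniqueΞ (locally g)) (classesOf-unique ds)

  classesOf-all : ∀ ds ξ → ξ ∈ classesOf ds
  classesOf-all []       tt      = here refl
  classesOf-all (g ∷ ds) (ξ , η) = ∈ₚ.∈-cartesianProduct⁺ (Local.allΞ (locally g) ξ) (classesOf-all ds η)

  Aligned : List GP → Triple → Set
  Aligned ds h = All (λ g → Parallel (proj₁ g) D h) ds

  aligned? : ∀ ds h → Dec (Aligned ds h)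
  aligned? ds h = All.all? (λ g → (proj₁ g ∣? _) ×? ((proj₁ g ∣? _) ×? (proj₁ g ∣? _))) ds

  same-class⇒aligned : ∀ ds l b l′ b′ → classOf ds l b ≡ classOf ds l′ b′ → Aligned ds (wedge l b l′ b′)
  same-class⇒aligned []       l b l′ b′ eq = []
  same-class⇒aligned (g ∷ ds) l b l′ b′ eq = Local.same (locally g) l b l′ b′ (cong proj₁ eq) ∷ same-class⇒aligned ds l b l′ b′ (cong proj₂ eq)

  aligned-minus : ∀ ds h k → Aligned ds h → Aligned ds k → Aligned ds (minus h k)
  aligned-minus ds (h₁ , h₂ , h₃) (k₁ , k₂ , k₃) Ah Ak = All.zipWith (λ {g} (a , b) → both g a b) (Ah , Ak)
    where
    α β γ : ℤ
    α = proj₁ D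
    β = proj₁ (proj₂ D)
    γ = proj₂ (proj₂ D)
    combination : ∀ p a b h k h′ k′ → p ∣ᶻ a ℤ.* h ℤ.+ b ℤ.* k → p ∣ᶻ a ℤ.* h′ ℤ.+ b ℤ.* k′ → p ∣ᶻ a ℤ.* (h ℤ.- h′) ℤ.+ b ℤ.* (k ℤ.- k′)
    combination p a b h k h′ k′ x y = subst (λ i → p ∣ᶻ i) (identity a b h k h′ k′) (∣ᶻ-minus (a ℤ.* h ℤ.+ b ℤ.* k) (a ℤ.* h′ ℤ.+ b ℤ.* k′) x y)
      where
      identity : ∀ a b h k h′ k′ → (a ℤ.* h ℤ.+ b ℤ.* k) ℤ.- (a ℤ.* h′ ℤ.+ b ℤ.* k′) ≡ a ℤ.* (h ℤ.- h′) ℤ.+ b ℤ.* (k ℤ.- k′)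
      identity = ℤR.solve-∀
    difference : ∀ p a b h k h′ k′ → p ∣ᶻ a ℤ.* h ℤ.- b ℤ.* k → p ∣ᶻ a ℤ.* h′ ℤ.- b ℤ.* k′ → p ∣ᶻ a ℤ.* (h ℤ.- h′) ℤ.- b ℤ.* (k ℤ.- k′)
    difference p a b h k h′ k′ x y = subst (λ i → p ∣ᶻ i) (identity a b h k h′ k′) (∣ᶻ-minus (a ℤ.* h ℤ.- b ℤ.* k) (a ℤ.* h′ ℤ.- b ℤ.* k′) x y)
      where
      identity : ∀ a b h k h′ k′ → (a ℤ.* h ℤ.- b ℤ.* k) ℤ.- (a ℤ.* h′ ℤ.- b ℤ.* k′) ≡ a ℤ.* (h ℤ.- h′) ℤ.- b ℤ.* (k ℤ.- k′)
      identity = ℤR.solve-∀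
    both : ∀ g → Parallel (proj₁ g) D (h₁ , h₂ , h₃) → Parallel (proj₁ g) D (k₁ , k₂ , k₃) → Parallel (proj₁ g) D (minus (h₁ , h₂ , h₃) (k₁ , k₂ , k₃))
    both (p , _) (a₁ , a₂ , a₃) (b₁ , b₂ , b₃) = combination p α β h₂ h₃ k₂ k₃ a₁ b₁ , difference p α γ h₁ h₃ k₁ k₃ a₂ b₂ , combination p β γ h₁ h₂ k₁ k₂ a₃ b₃

  product-primes : ∀ ds → product (map proj₁ ds) ≡ modulus ds
  product-primes []       = refl
  product-primes (g ∷ ds) = cong (proj₁ g *_) (product-primes ds)

  modulus-∣ : ∀ ds {n} → Distinct ds → (∀ g → g ∈ ds → proj₁ g ∣ n) → modulus ds ∣ n
  modulus-∣ ds {n} u dv = subst (_∣ n) (product-primes ds) (∣-prime-product (map proj₁ ds) u (Allₚ.map⁺ (All.tabulate (λ {g} _ → prime-of g)))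
    (λ p p∈ → let g , g∈ , eq = ∈ₚ.∈-map⁻ proj₁ p∈ in subst (_∣ n) (sym eq) (dv g g∈)))

  aligned-cross : ∀ ds → Distinct ds → ∀ h k → Aligned ds h → Aligned ds k → Crossed (modulus ds) h k
  aligned-cross ds u h k Ah Ak = modulus-∣ ds u (λ g g∈ → proj₁ (at g g∈)) , modulus-∣ ds u (λ g g∈ → proj₁ (proj₂ (at g g∈))) , modulus-∣ ds u (λ g g∈ → proj₂ (proj₂ (at g g∈)))
    where
    at : ∀ g → g ∈ ds → Crossed (proj₁ g) h k
    at g g∈ = Local.cross (locally g) h k (All.lookup Ah g∈) (All.lookup Ak g∈)

  1≤modulus : ∀ ds → 1 ≤ modulus ds
  1≤modulus []       = ≤-refl
  1≤modulus (g ∷ ds) = *-mono-≤ (1≤p g) (1≤modulus ds)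

module Burgess (D : Form) (ds : List (GoodPrime D)) (distinct : Global.Distinct D ds) (B R T : ℕ) (1≤B : 1 ≤ B)
               (HR : 4 * (4 * (B * B) * (4 * (B * B))) ≤ Global.modulus D ds * R)
               (τ≤ : ∀ n → 1 ≤ n → n ≤ 4 * (B * B * (B * B)) → τ n ≤ T) (A m′ : ℕ) (l₀ : Pair) where
  open Global D
  open Classes D
  open Moment ds distinct A m′ using (momentBound; moment) public
  open Energy (modulus ds) (1≤modulus ds) (Aligned ds) (aligned? ds) (aligned-minus ds) (aligned-cross ds distinct) B R T 1≤B HR τ≤ using (energyBound; energy≤; dirs) public
  open Fibres B using (family)

  square : List (ℕ × ℕ)
  square = cart (upTo B) (upTo B)

  lines : List ((ℕ × ℕ) × (ℕ × ℕ))
  lines = cart square dirs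

  class : (ℕ × ℕ) × (ℕ × ℕ) → Class ds
  class (u , b) = classOf ds (l₀ ⊕₂ natPair u) (vec b)

  open Fibred lines (classesOf ds) (sameClass? ds) (classesOf-unique ds) (classesOf-all ds) class using (collisions; hölder)

  -- For fixed directions the wedge is affine in the pair of base points. Differences from a
  -- reference collision are therefore aligned themselves, and l₀ disappears.
  collisions≤ : collisions ≤ energyBound
  collisions≤ = ≤-trans (≡⇒≤ reorder) (≤-trans (∑-mono dirs (λ b _ → ∑-mono dirs (λ c _ → translate b c))) (≤-trans (≡⇒≤ (ℕΣ.∑-ext dirs (λ b → sym (by-direction b)))) energy≤))
    where
    coll : ℕ × ℕ → ℕ × ℕ → ℕ × ℕ → ℕ × ℕ → ℕ
    coll b c u u′ = 𝟙 (sameClass? ds (class (u′ , c)) (class (u , b)))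
    reorder : collisions ≡ ∑ dirs (λ b → ∑ dirs (λ c → ∑ square (λ u → ∑ square (coll b c u))))
    reorder = trans (ℕΣ.∑-cart square dirs _) (trans (ℕΣ.∑-ext square (λ u → ℕΣ.∑-ext dirs (λ b → trans (ℕΣ.∑-cart square dirs _) (ℕΣ.∑-swap square dirs _))))
      (trans (ℕΣ.∑-swap square dirs _) (ℕΣ.∑-ext dirs (λ b → ℕΣ.∑-swap square dirs _))))
    aligned : ℕ × ℕ → ℕ × ℕ → Pair × Pair → ℕ
    aligned b c (x , y) = 𝟙 (aligned? ds (wedge x (vec b) y (vec c)))
    by-direction : ∀ b → ∑ family (λ t → 𝟙 (aligned? ds (Fibres.wedgeOf B b t))) ≡ ∑ dirs (λ c → ∑ (cart (box B) (box B)) (aligned b c))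
    by-direction b = trans (ℕΣ.∑-cart (box B) (cart (box B) dirs) _) (trans (ℕΣ.∑-ext (box B) (λ x → trans (ℕΣ.∑-cart (box B) dirs _) (ℕΣ.∑-swap (box B) dirs _)))
      (trans (ℕΣ.∑-swap (box B) dirs _) (ℕΣ.∑-ext dirs (λ c → sym (ℕΣ.∑-cart (box B) (box B) (aligned b c))))))
    move : (ℕ × ℕ) × (ℕ × ℕ) → (ℕ × ℕ) × (ℕ × ℕ) → Pair × Pair
    move (v , v′) (u , u′) = minus₂ (natPair u) (natPair v) , minus₂ (natPair u′) (natPair v′)
    cancel : ∀ x y v → + x ℤ.- + v ≡ + y ℤ.- + v → x ≡ y
    cancel x y v eq = ℤₚ.+-injective (trans (undo (+ x) (+ v)) (trans (cong (λ t → t ℤ.+ + v) eq) (sym (undo (+ y) (+ v)))))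
      where
      undo : ∀ x v → x ≡ (x ℤ.- v) ℤ.+ v
      undo = ℤR.solve-∀
    in-box : ∀ {u v} → u ∈ square → v ∈ square → minus₂ (natPair u) (natPair v) ∈ box B
    in-box {u} {v} u∈ v∈ with ∈ₚ.∈-cartesianProduct⁻ (upTo B) (upTo B) u∈ | ∈ₚ.∈-cartesianProduct⁻ (upTo B) (upTo B) v∈
    ... | u₁∈ , u₂∈ | v₁∈ , v₂∈ = ∈ₚ.∈-cartesianProduct⁺ (one (proj₁ u) (proj₁ v) u₁∈ v₁∈) (one (proj₂ u) (proj₂ v) u₂∈ v₂∈)
      where
      one : ∀ x y → x ∈ upTo B → y ∈ upTo B → + x ℤ.- + y ∈ ints B
      one x y x∈ y∈ = ∈-ints⁺ (+ x ℤ.- + y) (≤-trans (≡⇒≤ (cong ∣_∣ (ℤₚ.m-n≡m⊖n x y))) (∣⊖∣≤ x y B (≤-trans (<⇒≤ (∈ₚ.∈-upTo⁻ x∈)) (m≤n+m B y)) (≤-trans (<⇒≤ (∈ₚ.∈-upTo⁻ y∈)) (m≤n+m B x))))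
    translate : ∀ b c → ∑ square (λ u → ∑ square (coll b c u)) ≤ ∑ (cart (box B) (box B)) (aligned b c)
    translate b c = ≤-trans (≡⇒≤ (sym (ℕΣ.∑-cart square square (λ v → coll b c (proj₁ v) (proj₂ v)))))
      (filter-shift (λ v → sameClass? ds (class (proj₂ v , c)) (class (proj₁ v , b))) (λ w → aligned? ds (wedge (proj₁ w) (vec b) (proj₂ w) (vec c))) move
        (Uniqueₚ.cartesianProduct⁺ square-unique square-unique) inj into)
      where
      square-unique : Unique square
      square-unique = Uniqueₚ.cartesianProduct⁺ (Uniqueₚ.upTo⁺ B) (Uniqueₚ.upTo⁺ B)
      inj : ∀ z {x x′} → move z x ≡ move z x′ → x ≡ x′
      inj ((a₁ , a₂) , (a₃ , a₄)) {(x₁ , x₂) , (x₃ , x₄)} {(y₁ , y₂) , (y₃ , y₄)} eq = cong₂ _,_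
        (cong₂ _,_ (cancel x₁ y₁ a₁ (cong (proj₁ ∘ proj₁) eq)) (cancel x₂ y₂ a₂ (cong (proj₂ ∘ proj₁) eq)))
        (cong₂ _,_ (cancel x₃ y₃ a₃ (cong (proj₁ ∘ proj₂) eq)) (cancel x₄ y₄ a₄ (cong (proj₂ ∘ proj₂) eq)))
      into : ∀ {z x} → z ∈ cart square square → x ∈ cart square square → class (proj₂ z , c) ≡ class (proj₁ z , b) → class (proj₂ x , c) ≡ class (proj₁ x , b) →
             move z x ∈ cart (box B) (box B) × Aligned ds (wedge (proj₁ (move z x)) (vec b) (proj₂ (move z x)) (vec c))
      into {v , v′} {u , u′} z∈ x∈ ez ex with ∈ₚ.∈-cartesianProduct⁻ square square z∈ | ∈ₚ.∈-cartesianProduct⁻ square square x∈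
      ... | v∈ , v′∈ | u∈ , u′∈ = ∈ₚ.∈-cartesianProduct⁺ (in-box u∈ v∈) (in-box u′∈ v′∈) ,
        subst (Aligned ds) (sym (wedge-minus l₀ (natPair u) (natPair v) (vec b) (natPair u′) (natPair v′) (vec c)))
          (aligned-minus ds _ _ (same-class⇒aligned ds (l₀ ⊕₂ natPair u) (vec b) (l₀ ⊕₂ natPair u′) (vec c) (sym ex))
                                (same-class⇒aligned ds (l₀ ⊕₂ natPair v) (vec b) (l₀ ⊕₂ natPair v′) (vec c) (sym ez)))

  lineSum : (ℕ × ℕ) × (ℕ × ℕ) → ℕ
  lineSum (u , b) = ∣ ℤΣ.∑ (upTo A) (λ t → character ds ((l₀ ⊕₂ natPair u) ⊕₂ + t ·₂ vec b)) ∣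

  burgess : ∑ lines lineSum ^ (2 * suc m′) ≤ length lines ^ (2 * m′) * (energyBound * momentBound)
  burgess = ≤-trans (^-monoˡ-≤ (2 * suc m′) (∑-mono lines (λ { (u , b) _ → ∣line∣≤ ds A (l₀ ⊕₂ natPair u) (vec b) })))
    (≤-trans (hölder (λ ξ → ∣ signSum ds A ξ ∣) m′) (*-monoʳ-≤ (length lines ^ (2 * m′)) (*-mono-≤ collisions≤ moment)))

-- Sizes of the parameters

^-cancelˡ-≤ : ∀ k m n → 1 ≤ k → m ^ k ≤ n ^ k → m ≤ n
^-cancelˡ-≤ (suc k) m n _ le with m ≤? n
... | yes m≤n = m≤n
... | no m≰n  = ⊥-elim (<⇒≱ (^-monoˡ-< (suc k) (≰⇒> m≰n)) le)

energy-shape : ∀ k₁ k₂ c b z X w → 1 ≤ z → X ≤ c * b → w ≤ k₂ * b →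
              b * (X * (k₁ * z)) + w * (2 * X + b) ≤ (c * k₁ + k₂ * (2 * c + 1)) * (z * (b * b))
energy-shape k₁ k₂ c b z X w 1≤z X≤ w≤ = ≤-trans (+-mono-≤ (*-monoʳ-≤ b (*-monoˡ-≤ (k₁ * z) X≤)) (≤-trans (*-mono-≤ w≤ (+-monoˡ-≤ b (*-monoʳ-≤ 2 X≤)))
    (≤-trans (≡⇒≤ (sym (*-identityʳ _))) (*-monoʳ-≤ (k₂ * b * (2 * (c * b) + b)) 1≤z)))) (≡⇒≤ (identity k₁ k₂ c b z))
  where
  identity : ∀ k₁ k₂ c b z → b * (c * b * (k₁ * z)) + k₂ * b * (2 * (c * b) + b) * z ≡ (c * k₁ + k₂ * (2 * c + 1)) * (z * (b * b))
  identity = ℕR.solve-∀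

-- Z ≤ z^r turns the term d² z^r of the words without an isolated letter into a multiple of Z z^(2
-- r), the size of the other term.
moment-size : ∀ C ω Ω d D₀ Z z m′ → 1 ≤ C → ω ≤ Ω → d ≤ D₀ * Z → Z ≤ z ^ suc m′ →
              C ^ ω * d * (2 * suc m′ * (z * (2 * (z * 2 ^ ω)) ^ (1 + 2 * m′))) + C ^ ω * (d * d) * (suc m′ ^ (2 * suc m′) * z ^ suc m′) ≤
              (D₀ * (2 * suc m′ * 2 ^ (2 * suc m′)) + D₀ * D₀ * suc m′ ^ (2 * suc m′)) * (C ^ Ω * (2 ^ Ω) ^ (2 * suc m′)) * (Z * z ^ (2 * suc m′))
moment-size C ω Ω d D₀ Z z m′ 1≤C ω≤Ω d≤ Z≤ = ≤-trans (+-mono-≤ first second) (≡⇒≤ (total (C ^ Ω) D₀ Z (2 * r) (2 ^ (2 * r)) (z ^ (2 * r)) (W ^ (2 * r)) (r ^ (2 * r))))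
  where
  r n w W : ℕ
  r = suc m′
  n = 1 + 2 * m′
  w = 2 ^ ω
  W = 2 ^ Ω
  C≤ : C ^ ω ≤ C ^ Ω
  C≤ = ^-monoʳ-≤ C {{>-nonZero 1≤C}} ω≤Ω
  w≤W : w ≤ W
  w≤W = ^-monoʳ-≤ 2 ω≤Ω
  2r : suc n ≡ 2 * r
  2r = identity m′
    where
    identity : ∀ m → suc (1 + 2 * m) ≡ 2 * suc m
    identity = ℕR.solve-∀
  power : z * (2 * (z * w)) ^ n ≤ 2 ^ (2 * r) * (z ^ (2 * r) * W ^ (2 * r))
  power = ≤-trans (≡⇒≤ (trans (cong (z *_) (trans (^-distrib-* n 2 (z * w)) (cong (2 ^ n *_) (^-distrib-* n z w)))) (identity z (2 ^ n) (z ^ n) (w ^ n))))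
    (≤-trans (*-mono-≤ (^-monoʳ-≤ 2 (n≤1+n n)) (*-monoʳ-≤ (z ^ suc n) (≤-trans (^-monoˡ-≤ n w≤W) (^-monoʳ-≤ W {{>-nonZero (m^n>0 2 Ω)}} (n≤1+n n)))))
      (≡⇒≤ (cong (λ k → 2 ^ k * (z ^ k * W ^ k)) 2r)))
    where
    identity : ∀ z a b c → z * (a * (b * c)) ≡ a * (z * b * c)
    identity = ℕR.solve-∀
  first : C ^ ω * d * (2 * r * (z * (2 * (z * w)) ^ n)) ≤ C ^ Ω * (D₀ * Z) * (2 * r * (2 ^ (2 * r) * (z ^ (2 * r) * W ^ (2 * r))))
  first = *-mono-≤ (*-mono-≤ C≤ d≤) (*-monoʳ-≤ (2 * r) power)
  second : C ^ ω * (d * d) * (r ^ (2 * r) * z ^ r) ≤ C ^ Ω * (D₀ * Z * D₀) * (r ^ (2 * r) * z ^ (2 * r)) * W ^ (2 * r)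
  second = ≤-trans (*-monoˡ-≤ (r ^ (2 * r) * z ^ r) (*-mono-≤ C≤ (*-mono-≤ d≤ d≤))) (≤-trans (≡⇒≤ (identity (C ^ Ω) D₀ Z (r ^ (2 * r)) (z ^ r)))
    (≤-trans (*-monoʳ-≤ (C ^ Ω * (D₀ * Z * D₀)) (*-monoʳ-≤ (r ^ (2 * r)) (≤-trans (*-monoˡ-≤ (z ^ r) Z≤) (≡⇒≤ (sym (^-double z r))))))
      (≤-trans (≡⇒≤ (sym (*-identityʳ _))) (*-monoʳ-≤ (C ^ Ω * (D₀ * Z * D₀) * (r ^ (2 * r) * z ^ (2 * r))) (m^n>0 W {{>-nonZero (m^n>0 2 Ω)}} (2 * r))))))
    where
    identity : ∀ C D Z x y → C * (D * Z * (D * Z)) * (x * y) ≡ C * (D * Z * D) * (x * (Z * y))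
    identity = ℕR.solve-∀
  total : ∀ C D Z r₂ t z₂ w₂ x → C * (D * Z) * (r₂ * (t * (z₂ * w₂))) + C * (D * Z * D) * (x * z₂) * w₂ ≡ (D * (r₂ * t) + D * D * x) * (C * w₂) * (Z * z₂)
  total = ℕR.solve-∀

energyConst : ℕ → ℕ → ℕ → ℕ → ℕ
energyConst k₁ k₂ k₃ k₄ = (k₃ + k₄ ^ 4) * k₁ + k₂ * (2 * (k₃ + k₄ ^ 4) + 1)

energy-size : ∀ k₁ k₂ k₃ k₄ b z x y w → 1 ≤ z → x ≤ k₃ * b → y ≤ k₄ * z ^ 4 → z ^ 16 ≤ b → w ≤ k₂ * b →
              b * ((x + y ^ 4) * (k₁ * z)) + w * (2 * (x + y ^ 4) + b) ≤ energyConst k₁ k₂ k₃ k₄ * (z * (b * b))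
energy-size k₁ k₂ k₃ k₄ b z x y w 1≤z x≤ y≤ z≤ w≤ = energy-shape k₁ k₂ (k₃ + k₄ ^ 4) b z (x + y ^ 4) w 1≤z points w≤
  where
  points : x + y ^ 4 ≤ (k₃ + k₄ ^ 4) * b
  points = ≤-trans (+-mono-≤ x≤ (≤-trans (^-monoˡ-≤ 4 y≤) (≤-trans (≡⇒≤ (trans (^-distrib-* 4 k₄ (z ^ 4)) (cong (k₄ ^ 4 *_) (^-*-assoc z 4 4)))) (*-monoʳ-≤ (k₄ ^ 4) z≤))))
    (≡⇒≤ (sym (*-distribʳ-+ b k₃ (k₄ ^ 4))))

momentConst : ℕ → ℕ → ℕ
momentConst D₀ m′ = D₀ * (2 * suc m′ * 2 ^ (2 * suc m′)) + D₀ * D₀ * suc m′ ^ (2 * suc m′)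

-- bb = B⁴ exceeds Z by the factor z⁴. The energy takes one z of it, and of the remaining z³ a
-- single z pays for all constants and all powers C^Ω and 2^Ω.
absorb : ∀ k c₂ c₃ z bb Z y t C W E S → 1 ≤ z → E ≤ c₂ * (z * bb) → S ≤ c₃ * (C * W) * (Z * y) → bb ≡ Z * z ^ 4 → k * c₂ * c₃ * t * (C * (W * W)) ≤ z →
         k * (E * S * (t * W)) ≤ y * bb * bb
absorb k c₂ c₃ z bb Z y t C W E S 1≤z E≤ S≤ bb≡ le = ≤-trans (*-monoʳ-≤ k (*-monoˡ-≤ (t * W) (*-mono-≤ E≤ S≤))) (≤-trans (≡⇒≤ (regroup k c₂ z bb c₃ C W Z y t))
  (≤-trans (*-mono-≤ le (*-monoʳ-≤ (y * bb) (*-monoˡ-≤ Z (m≤m*n z (z * z) {{>-nonZero (*-mono-≤ 1≤z 1≤z)}})))) (≡⇒≤ (trans (collect z (y * bb) Z) (cong (y * bb *_) (sym bb≡))))))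
  where
  regroup : ∀ k c₂ z b c₃ C W Z y t → k * (c₂ * (z * b) * (c₃ * (C * W) * (Z * y)) * (t * W)) ≡ k * c₂ * c₃ * t * (C * (W * W)) * (y * b * (z * Z))
  regroup = ℕR.solve-∀
  collect : ∀ z X Z → z * (X * (z * (z * z) * Z)) ≡ X * (Z * (z * (z * (z * (z * 1)))))
  collect = ℕR.solve-∀

-- Hölder's inequality has n^(2 m′), two factors n short of the full power; bb² ≤ X² n² = k n²
-- restores them before the root is taken.
take-root : ∀ k m′ V W z n X bb E₀ → 1 ≤ k → V ^ (2 * suc m′) ≤ n ^ (2 * m′) * E₀ → bb ≤ X * n → X * X ≡ k → k * (E₀ * W ^ (2 * suc m′)) ≤ z ^ (2 * suc m′) * bb * bb → V * W ≤ z * n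
take-root k m′ V W z n X bb E₀ 1≤k V≤ bb≤ X²≡ le = ^-cancelˡ-≤ (2 * suc m′) (V * W) (z * n) (s≤s z≤n) (*-cancelˡ-≤ k {{>-nonZero 1≤k}} (≤-trans (≡⇒≤ (cong (k *_) (^-distrib-* (2 * suc m′) V W)))
  (≤-trans (*-monoʳ-≤ k (*-monoˡ-≤ (W ^ (2 * suc m′)) V≤)) (≤-trans (≡⇒≤ (left k (n ^ (2 * m′)) E₀ (W ^ (2 * suc m′))))
    (≤-trans (*-monoʳ-≤ (n ^ (2 * m′)) (≤-trans le (≤-trans (≡⇒≤ (*-assoc (z ^ (2 * suc m′)) bb bb)) (*-monoʳ-≤ (z ^ (2 * suc m′)) (*-mono-≤ bb≤ bb≤)))))
      (≡⇒≤ (trans (right X (n ^ (2 * m′)) (z ^ (2 * suc m′)) n) (cong₂ _*_ X²≡ (trans (cong (z ^ (2 * suc m′) *_) n-power) (sym (^-distrib-* (2 * suc m′) z n)))))))))))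
  where
  left : ∀ k N E w → k * (N * E * w) ≡ N * (k * (E * w))
  left = ℕR.solve-∀
  right : ∀ X N y n → N * (y * (X * n * (X * n))) ≡ X * X * (y * (n * (n * N)))
  right = ℕR.solve-∀
  n-power : n * (n * n ^ (2 * m′)) ≡ n ^ (2 * suc m′)
  n-power = cong (n ^_) (identity m′)
    where
    identity : ∀ m → suc (suc (2 * m)) ≡ 2 * suc m
    identity = ℕR.solve-∀

fourth-power : ∀ μ z → z ^ suc μ * z ^ suc μ * (z ^ suc μ * z ^ suc μ) ≡ z ^ (4 * μ) * z ^ 4
fourth-power μ z = trans (fourth (z ^ suc μ)) (trans (^-*-assoc z (suc μ) 4) (trans (cong (z ^_) (exponent μ)) (^-distribˡ-+-* z (4 * μ) 4)))
  where
  fourth : ∀ B → B * B * (B * B) ≡ B * (B * (B * (B * 1)))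
  fourth = ℕR.solve-∀
  exponent : ∀ μ → suc μ * 4 ≡ 4 * μ + 4
  exponent = ℕR.solve-∀

linesOf : ℕ → List ((ℕ × ℕ) × (ℕ × ℕ))
linesOf B = cart (cart (upTo B) (upTo B)) (directions B)

length-linesOf≥ : ∀ B → B * B * (B * B) ≤ 8 * length (linesOf B)
length-linesOf≥ B = ≤-trans (*-monoʳ-≤ (B * B) (PrimitiveCount.directions≥ B)) (≡⇒≤ (trans (swap (B * B) 8 (length (directions B))) (cong (8 *_) (sym length-lines))))
  where
  swap : ∀ a k c → a * (k * c) ≡ k * (a * c)
  swap = ℕR.solve-∀
  length-lines : length (linesOf B) ≡ B * B * length (directions B)
  length-lines = trans (length-cart _,_ (cart (upTo B) (upTo B)) (directions B)) (cong (_* length (directions B)) (trans (length-cart _,_ (upTo B) (upTo B)) (cong (λ k → k * k) (Listₚ.length-upTo B))))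

lineSumOf : (D : Form) → List (GoodPrime D) → ℕ → Pair → (ℕ × ℕ) × (ℕ × ℕ) → ℕ
lineSumOf D ds A l₀ (u , b) = ∣ ℤΣ.∑ (upTo A) (λ t → Classes.character D ds ((l₀ ⊕₂ natPair u) ⊕₂ + t ·₂ vec b)) ∣

-- For a modulus d with z^(4μ) ≤ d, lines of length z through boxes of side z^(μ+1) suffice.
module Parameters (μ : ℕ) (7≤μ : 7 ≤ μ) where

  M m′ : ℕ
  M  = 4 * μ
  -- The moment has order 2 r with r = M + 1, so z^r is at least z^M, which is d up to the factor
  -- 2^M.
  m′ = M

  abstract
    c₂ c₃ C : ℕ
    -- 512 codes for each divisor in `generic`, `waste` at most 160 B², 2 H + 1 at most 9 B², and 2
    -- R + 1 at most 129 z⁴.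
    c₂ = energyConst 512 160 9 129
    c₃ = momentConst (2 ^ M) m′
    C  = localConst (1 + 2 * m′) * localConst (1 + 2 * m′)

    energy-abs : ∀ b z x y w → 1 ≤ z → x ≤ 9 * b → y ≤ 129 * z ^ 4 → z ^ 16 ≤ b → w ≤ 160 * b →
                 b * ((x + y ^ 4) * (512 * z)) + w * (2 * (x + y ^ 4) + b) ≤ c₂ * (z * (b * b))
    energy-abs = energy-size 512 160 9 129

    moment-abs : ∀ D (ds : List (GoodPrime D)) distinct z Ω → length ds ≤ Ω → Global.modulus D ds ≤ (2 * z) ^ M → 1 ≤ z →
                 Global.Moment.momentBound D ds distinct z m′ ≤ c₃ * (C ^ Ω * (2 ^ Ω) ^ (2 * suc m′)) * (z ^ M * z ^ (2 * suc m′))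
    moment-abs D ds distinct z Ω ω≤Ω hi 1≤z = moment-size (localConst (1 + 2 * m′) * localConst (1 + 2 * m′)) (length ds) Ω (Global.modulus D ds) (2 ^ M) (z ^ M) z m′
      (*-mono-≤ {1} {localConst (1 + 2 * m′)} {1} {localConst (1 + 2 * m′)} (s≤s z≤n) (s≤s z≤n)) ω≤Ω (≤-trans hi (≡⇒≤ (^-distrib-* M 2 z))) (^-monoʳ-≤ z {{>-nonZero 1≤z}} (n≤1+n M))

    -- The numbers in question are at most 4 B⁴ = 4 z^(M + 4). The exponent 6 + M keeps τ below z
    -- and leaves z² for the constant 4 `Cτ`.
    Cτ : ℕ
    Cτ = proj₁ (τ-bound (6 + M) (s≤s z≤n))

    1≤Cτ : 1 ≤ Cτ
    1≤Cτ = proj₁ (proj₂ (τ-bound (6 + M) (s≤s z≤n)))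

    τ≤Cτ : ∀ n → 1 ≤ n → τ n ^ (6 + M) ≤ Cτ * n
    τ≤Cτ = proj₂ (proj₂ (τ-bound (6 + M) (s≤s z≤n)))

  K C′ : ℕ
  K  = 64 * c₂ * c₃ * 2 ^ (2 * suc m′)
  C′ = C * (2 ^ (2 * suc m′) * 2 ^ (2 * suc m′))

  constants : ∀ Ω → C′ ^ Ω ≡ C ^ Ω * ((2 ^ Ω) ^ (2 * suc m′) * (2 ^ Ω) ^ (2 * suc m′))
  constants Ω = trans (^-distrib-* Ω C _) (cong (C ^ Ω *_) (trans (^-distrib-* Ω (2 ^ R) (2 ^ R)) (cong (λ s → s * s) (trans (^-*-assoc 2 R Ω) (trans (cong (2 ^_) (*-comm R Ω)) (sym (^-*-assoc 2 Ω R)))))))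
    where
    R = 2 * suc m′

  module LargeModulus (D : Form) (ds : List (GoodPrime D)) (distinct : Global.Distinct D ds) (z Ω : ℕ) (lo : z ^ M ≤ Global.modulus D ds) (hi : Global.modulus D ds ≤ (2 * z) ^ M)
                      (ω≤Ω : length ds ≤ Ω) (z-large : K * C′ ^ Ω ≤ z) (τ-large : 4 * Cτ ≤ z) where
    open Global D using (modulus)

    1≤z : 1 ≤ z
    1≤z = ≤-trans (*-mono-≤ {1} {4} (s≤s z≤n) 1≤Cτ) τ-large

    instance
      z≢0 : NonZero z
      z≢0 = >-nonZero 1≤z

    B R : ℕ
    -- Slightly above d^(1/4): B⁴ = z^M z⁴. With H = 4 B² the condition 4 H² ≤ d R reads 64 z^M z⁴ ≤
    -- d R, whence the value of R.
    B = z ^ suc μ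
    R = 64 * z ^ 4

    1≤B : 1 ≤ B
    1≤B = m^n>0 z (suc μ)

    HR : 4 * (4 * (B * B) * (4 * (B * B))) ≤ modulus ds * R
    HR = ≤-trans (≡⇒≤ (trans (identity (B * B)) (cong (64 *_) (fourth-power μ z)))) (≤-trans (*-monoʳ-≤ 64 (*-monoˡ-≤ (z ^ 4) lo)) (≡⇒≤ (swap 64 (modulus ds) (z ^ 4))))
      where
      identity : ∀ b → 4 * (4 * b * (4 * b)) ≡ 64 * (b * b)
      identity = ℕR.solve-∀
      swap : ∀ k x y → k * (x * y) ≡ x * (k * y)
      swap = ℕR.solve-∀

    τ≤ : ∀ n → 1 ≤ n → n ≤ 4 * (B * B * (B * B)) → τ n ≤ z
    τ≤ n 1≤n n≤ = ^-cancelˡ-≤ (6 + M) (τ n) z (s≤s z≤n) (≤-trans (τ≤Cτ n 1≤n) (≤-trans (*-monoʳ-≤ Cτ n≤)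
      (≤-trans (≡⇒≤ (trans (regroup Cτ (B * B * (B * B))) (cong (4 * Cτ *_) (fourth-power μ z)))) (≤-trans (*-monoˡ-≤ (z ^ M * z ^ 4) (≤-trans τ-large (m≤m*n z z))) (≡⇒≤ (trans (powers z (z ^ M) (z ^ 4)) exponent))))))
      where
      regroup : ∀ c x → c * (4 * x) ≡ 4 * c * x
      regroup = ℕR.solve-∀
      powers : ∀ z x y → z * z * (x * y) ≡ z * (z * (y * x))
      powers = ℕR.solve-∀
      exponent : z * (z * (z ^ 4 * z ^ M)) ≡ z ^ (6 + M)
      exponent = cong (λ s → z * (z * s)) (sym (^-distribˡ-+-* z 4 M))

    energy≤ : Energy.energyBound (modulus ds) (Classes.1≤modulus D ds) (Classes.Aligned D ds) (Classes.aligned? D ds) (Classes.aligned-minus D ds) (Classes.aligned-cross D ds distinct) B R z 1≤B HR τ≤ ≤ c₂ * (z * (B * B * (B * B)))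
    energy≤ = energy-abs (B * B) z (suc (2 * (4 * (B * B)))) (suc (2 * R)) (16 * (suc (2 * B) * suc (2 * B)) + 16 * (B * B)) 1≤z (near (*-mono-≤ 1≤B 1≤B)) (far (z ^ 4) (m^n>0 z 4))
      -- z^16 ≤ B² = z^(2 (μ + 1)): this is where 7 ≤ μ comes from. It hides the term (2 R + 1)⁴ of
      -- the lattice count behind B².
      (≤-trans (^-monoʳ-≤ z (*-monoʳ-≤ 2 (s≤s 7≤μ))) (≡⇒≤ (^-double z (suc μ)))) (waste 16 B 1≤B)
      where
      near : ∀ {b} → 1 ≤ b → suc (2 * (4 * b)) ≤ 9 * b
      near {b} 1≤b = ≤-trans (+-monoˡ-≤ (2 * (4 * b)) 1≤b) (≡⇒≤ (identity b))
        where
        identity : ∀ b → b + 2 * (4 * b) ≡ 9 * b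
        identity = ℕR.solve-∀
      far : ∀ x → 1 ≤ x → suc (2 * (64 * x)) ≤ 129 * x
      far x 1≤x = ≤-trans (+-monoˡ-≤ (2 * (64 * x)) 1≤x) (≡⇒≤ (cong (_+_ x) (sym (*-assoc 2 64 x))))
      waste : ∀ k B → 1 ≤ B → k * (suc (2 * B) * suc (2 * B)) + k * (B * B) ≤ 10 * k * (B * B)
      waste k B 1≤B = ≤-trans (+-monoˡ-≤ (k * (B * B)) (*-monoʳ-≤ k (*-mono-≤ tripled tripled))) (≡⇒≤ (identity k B))
        where
        tripled : suc (2 * B) ≤ 3 * B
        tripled = +-monoˡ-≤ (2 * B) 1≤B
        identity : ∀ k B → k * (3 * B * (3 * B)) + k * (B * B) ≡ 10 * k * (B * B)
        identity = ℕR.solve-∀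

    -- An average line sum of length z saves 2 · 2^Ω: 2^Ω for the divisors in `exists-unobstructed`,
    -- and 2 because the boundary terms in `large-modulus` claim the other half.
    burgess-bound : ∀ l₀ → ∑ (linesOf B) (lineSumOf D ds z l₀) * (2 * 2 ^ Ω) ≤ z * length (linesOf B)
    burgess-bound l₀ = take-root 64 m′ V (2 * 2 ^ Ω) z (length (linesOf B)) 8 (B * B * (B * B)) (energyBound * momentBound) (s≤s z≤n) burgess (length-linesOf≥ B) refl
      (≤-trans (≡⇒≤ (cong (λ s → 64 * (energyBound * momentBound * s)) (^-distrib-* (2 * suc m′) 2 (2 ^ Ω))))
        (absorb 64 c₂ c₃ z (B * B * (B * B)) (z ^ M) (z ^ (2 * suc m′)) (2 ^ (2 * suc m′)) (C ^ Ω) ((2 ^ Ω) ^ (2 * suc m′)) energyBound momentBound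
          1≤z energy≤ (moment-abs D ds distinct z Ω ω≤Ω hi 1≤z) (fourth-power μ z) (≤-trans (≡⇒≤ (cong (K *_) (sym (constants Ω)))) z-large)))
      where
      open Burgess D ds distinct B R z 1≤B HR τ≤ z m′ l₀ using (burgess; energyBound; momentBound)
      V : ℕ
      V = ∑ (linesOf B) (lineSumOf D ds z l₀)

-- Square values of binary forms

∑-upTo-shift : (f : ℤ → ℤ) (L : ℕ) → ℤΣ.∑ (upTo L) (λ x → f (+ suc x)) ≡ ℤΣ.∑ (upTo L) (λ x → f (+ x)) ℤ.+ (f (+ L) ℤ.- f 0ℤ)
∑-upTo-shift f L = isolate (f 0ℤ) (ℤΣ.∑ (upTo L) (λ x → f (+ suc x))) (ℤΣ.∑ (upTo L) (λ x → f (+ x))) (f (+ L)) (trans (trans (cong (λ s → f 0ℤ ℤ.+ s) (sym tail)) (sym (cong (λ xs → ℤΣ.∑ xs (λ x → f (+ x))) (Listₚ.upTo-∷ʳ L)))) last)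
  where
  tail : ℤΣ.∑ (Data.List.Base.applyUpTo suc L) (λ x → f (+ x)) ≡ ℤΣ.∑ (upTo L) (λ x → f (+ suc x))
  tail = trans (cong (λ xs → ℤΣ.∑ xs (λ x → f (+ x))) (sym (Listₚ.map-upTo suc L))) (ℤΣ.∑-map suc (upTo L) (λ x → f (+ x)))
  last : ℤΣ.∑ (upTo L ++ L ∷ []) (λ x → f (+ x)) ≡ ℤΣ.∑ (upTo L) (λ x → f (+ x)) ℤ.+ f (+ L)
  last = trans (ℤΣ.∑-++ (upTo L) (L ∷ []) (λ x → f (+ x))) (cong (λ s → ℤΣ.∑ (upTo L) (λ x → f (+ x)) ℤ.+ s) (ℤₚ.+-identityʳ (f (+ L))))
  isolate : ∀ a b c e → a ℤ.+ b ≡ c ℤ.+ e → b ≡ c ℤ.+ (e ℤ.- a)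
  isolate a b c e eq = trans (undo a b) (trans (cong (ℤ._- a) eq) (assoc c e a))
    where
    undo : ∀ a b → b ≡ (a ℤ.+ b) ℤ.- a
    undo = ℤR.solve-∀
    assoc : ∀ c e a → (c ℤ.+ e) ℤ.- a ≡ c ℤ.+ (e ℤ.- a)
    assoc = ℤR.solve-∀

triangleᶻ : ∀ i j k → ∣ i ℤ.- k ∣ ≤ ∣ i ℤ.- j ∣ + ∣ j ℤ.- k ∣
triangleᶻ i j k = ≤-trans (≡⇒≤ (cong ∣_∣ (split i j k))) (ℤₚ.∣i+j∣≤∣i∣+∣j∣ (i ℤ.- j) (j ℤ.- k))
  where
  split : ∀ i j k → i ℤ.- k ≡ (i ℤ.- j) ℤ.+ (j ℤ.- k)
  split = ℤR.solve-∀

-- Moving an interval by one step changes the sum by two of its terms.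
shift-by : (f : ℤ → ℤ) → (∀ i → ∣ f i ∣ ≤ 1) → (L : ℕ) (s : ℤ) → ∣ ℤΣ.∑ (upTo L) (λ x → f (+ x)) ℤ.- ℤΣ.∑ (upTo L) (λ x → f (+ x ℤ.+ s)) ∣ ≤ 2 * ∣ s ∣
shift-by f f≤1 L s = by-sign s
  where
  forward : (f : ℤ → ℤ) → (∀ i → ∣ f i ∣ ≤ 1) → (n : ℕ) → ∣ ℤΣ.∑ (upTo L) (λ x → f (+ x)) ℤ.- ℤΣ.∑ (upTo L) (λ x → f (+ x ℤ.+ + n)) ∣ ≤ 2 * n
  forward f f≤1 zero = ≡⇒≤ (cong ∣_∣ (trans (cong (λ t → S ℤ.- t) (ℤΣ.∑-ext (upTo L) (λ x → cong f (ℤₚ.+-identityʳ (+ x))))) (ℤₚ.+-inverseʳ S)))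
    where
    S = ℤΣ.∑ (upTo L) (λ x → f (+ x))
  forward f f≤1 (suc n) = ≤-trans (triangleᶻ (ℤΣ.∑ (upTo L) (λ x → f (+ x))) (ℤΣ.∑ (upTo L) (λ x → f (+ x ℤ.+ + n))) (ℤΣ.∑ (upTo L) (λ x → f (+ x ℤ.+ + suc n))))
    (≤-trans (+-mono-≤ (forward f f≤1 n) one) (≡⇒≤ (count n)))
    where
    count : ∀ n → 2 * n + 2 ≡ 2 * suc n
    count = ℕR.solve-∀
    g : ℤ → ℤ
    g i = f (i ℤ.+ + n)
    G = ℤΣ.∑ (upTo L) (λ x → g (+ x))
    step : ℤΣ.∑ (upTo L) (λ x → f (+ x ℤ.+ + suc n)) ≡ G ℤ.+ (g (+ L) ℤ.- g 0ℤ)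
    step = trans (ℤΣ.∑-ext (upTo L) (λ x → cong f (cong +_ (+-suc x n)))) (∑-upTo-shift g L)
    one : ∣ G ℤ.- ℤΣ.∑ (upTo L) (λ x → f (+ x ℤ.+ + suc n)) ∣ ≤ 2
    one = ≤-trans (≡⇒≤ (cong ∣_∣ (trans (cong (λ t → G ℤ.- t) step) (cancel G (g (+ L)) (g 0ℤ))))) (∣i-j∣≤ (g 0ℤ) (g (+ L)) (f≤1 _) (f≤1 _))
      where
      cancel : ∀ G a b → G ℤ.- (G ℤ.+ (a ℤ.- b)) ≡ b ℤ.- a
      cancel = ℤR.solve-∀
  by-sign : ∀ s → ∣ ℤΣ.∑ (upTo L) (λ x → f (+ x)) ℤ.- ℤΣ.∑ (upTo L) (λ x → f (+ x ℤ.+ s)) ∣ ≤ 2 * ∣ s ∣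
  by-sign (+ n)      = forward f f≤1 n
  by-sign s@(-[1+ n ]) = ≤-trans (≡⇒≤ (trans (ℤₚ.∣i-j∣≡∣j-i∣ (ℤΣ.∑ (upTo L) (λ x → f (+ x))) G) (cong (λ t → ∣ G ℤ.- t ∣) (ℤΣ.∑-ext (upTo L) (λ x → cong f (undo (+ x) s))))))
    (forward (λ i → f (i ℤ.+ s)) (λ i → f≤1 (i ℤ.+ s)) (suc n))
    where
    G = ℤΣ.∑ (upTo L) (λ x → f (+ x ℤ.+ s))
    undo : ∀ x s → x ≡ (x ℤ.+ ℤ.- s) ℤ.+ s
    undo = ℤR.solve-∀

gridSum : ℕ → (Pair → ℤ) → ℤ
gridSum L f = ℤΣ.∑ (upTo L) (λ x → ℤΣ.∑ (upTo L) (λ y → f (+ x , + y)))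

norm₁ : Pair → ℕ
norm₁ (x , y) = ∣ x ∣ + ∣ y ∣

∑-- : {A : Set} (xs : List A) (f g : A → ℤ) → ℤΣ.∑ xs (λ x → f x ℤ.- g x) ≡ ℤΣ.∑ xs f ℤ.- ℤΣ.∑ xs g
∑-- []       f g = refl
∑-- (x ∷ xs) f g = trans (cong (λ s → (f x ℤ.- g x) ℤ.+ s) (∑-- xs f g)) (regroup (f x) (g x) (ℤΣ.∑ xs f) (ℤΣ.∑ xs g))
  where
  regroup : ∀ a b c e → (a ℤ.- b) ℤ.+ (c ℤ.- e) ≡ (a ℤ.+ c) ℤ.- (b ℤ.+ e)
  regroup = ℤR.solve-∀

grid-shift : (f : Pair → ℤ) → (∀ l → ∣ f l ∣ ≤ 1) → (L : ℕ) (s : Pair) → ∣ gridSum L f ℤ.- gridSum L (λ l → f (l ⊕₂ s)) ∣ ≤ 2 * (norm₁ s * L)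
grid-shift f f≤1 L (s₁ , s₂) = ≤-trans (triangleᶻ (gridSum L f) (gridSum L (λ l → f (l ⊕₂ (0ℤ , s₂)))) (gridSum L (λ l → f (l ⊕₂ (s₁ , s₂))))) (≤-trans (+-mono-≤ vertical horizontal) (≡⇒≤ (collect L ∣ s₁ ∣ ∣ s₂ ∣)))
  where
  collect : ∀ L a b → L * (2 * b) + L * (2 * a) ≡ 2 * ((a + b) * L)
  collect = ℕR.solve-∀
  total≤ : (h : ℕ → ℤ) (c : ℕ) → (∀ x → ∣ h x ∣ ≤ c) → ∣ ℤΣ.∑ (upTo L) h ∣ ≤ L * c
  total≤ h c h≤ = ≤-trans (∣∑∣≤∑∣∣ (upTo L) h) (≤-trans (∑-≤const (upTo L) c (λ x _ → h≤ x)) (≡⇒≤ (cong (_* c) (Listₚ.length-upTo L))))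
  vertical : ∣ gridSum L f ℤ.- gridSum L (λ l → f (l ⊕₂ (0ℤ , s₂))) ∣ ≤ L * (2 * ∣ s₂ ∣)
  vertical = ≤-trans (≡⇒≤ (cong ∣_∣ (sym (∑-- (upTo L) _ _)))) (total≤ _ (2 * ∣ s₂ ∣) (λ x → ≤-trans
    (≡⇒≤ (cong (λ t → ∣ ℤΣ.∑ (upTo L) (λ y → f (+ x , + y)) ℤ.- t ∣) (ℤΣ.∑-ext (upTo L) (λ y → cong (λ i → f (i , + y ℤ.+ s₂)) (ℤₚ.+-identityʳ (+ x))))))
    (shift-by (λ y → f (+ x , y)) (λ y → f≤1 (+ x , y)) L s₂)))
  horizontal : ∣ gridSum L (λ l → f (l ⊕₂ (0ℤ , s₂))) ℤ.- gridSum L (λ l → f (l ⊕₂ (s₁ , s₂))) ∣ ≤ L * (2 * ∣ s₁ ∣)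
  horizontal = ≤-trans (≡⇒≤ (cong ∣_∣ (trans (cong₂ ℤ._-_ (ℤΣ.∑-swap (upTo L) (upTo L) (λ x y → f (+ x ℤ.+ 0ℤ , + y ℤ.+ s₂))) (ℤΣ.∑-swap (upTo L) (upTo L) (λ x y → f (+ x ℤ.+ s₁ , + y ℤ.+ s₂)))) (sym (∑-- (upTo L) _ _)))))
    (total≤ _ (2 * ∣ s₁ ∣) (λ y → ≤-trans
      (≡⇒≤ (cong (λ t → ∣ t ℤ.- ℤΣ.∑ (upTo L) (λ x → f (+ x ℤ.+ s₁ , + y ℤ.+ s₂)) ∣) (ℤΣ.∑-ext (upTo L) (λ x → cong (λ i → f (i , + y ℤ.+ s₂)) (ℤₚ.+-identityʳ (+ x))))))
      (shift-by (λ x → f (x , + y ℤ.+ s₂)) (λ x → f≤1 (x , + y ℤ.+ s₂)) L s₁)))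

-- Burgess's averaging: the mean over the shifts replaces single values by sums over `vs`, and each
-- shift costs only boundary terms 2 σ L. The factor k carries a saving without division.
average : {V : Set} (vs : List V) (s : V → Pair) (σ : ℕ) → (∀ v → v ∈ vs → norm₁ (s v) ≤ σ) → (f : Pair → ℤ) → (∀ l → ∣ f l ∣ ≤ 1) → (L k X : ℕ) →
          (∀ l → ∣ ℤΣ.∑ vs (λ v → f (l ⊕₂ s v)) ∣ * k ≤ X) → length vs * (∣ gridSum L f ∣ * k) ≤ L * (L * X) + length vs * (2 * (σ * L) * k)
average vs s σ s≤ f f≤1 L k X sums = ≤-trans (≡⇒≤ (trans (sym (*-assoc (length vs) ∣ G ∣ k)) (cong (_* k) (sym magnitude)))) (≤-trans (≡⇒≤ (cong (λ i → ∣ i ∣ * k) decompose))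
  (≤-trans (*-monoˡ-≤ k (ℤₚ.∣i+j∣≤∣i∣+∣j∣ (ℤΣ.∑ vs shifted) (ℤΣ.∑ vs (λ v → G ℤ.- shifted v)))) (≤-trans (≡⇒≤ (*-distribʳ-+ k ∣ ℤΣ.∑ vs shifted ∣ _)) (+-mono-≤ main (≤-trans (*-monoˡ-≤ k errors) (≡⇒≤ (*-assoc (length vs) (2 * (σ * L)) k)))))))
  where
  G = gridSum L f
  shifted : _ → ℤ
  shifted v = gridSum L (λ l → f (l ⊕₂ s v))
  repeat : ∀ (ws : List _) → ℤΣ.∑ ws (λ _ → G) ≡ + length ws ℤ.* G
  repeat []       = refl
  repeat (w ∷ ws) = trans (cong (λ t → G ℤ.+ t) (repeat ws)) (sym (trans (ℤₚ.*-distribʳ-+ G (+ 1) (+ length ws)) (cong (λ t → t ℤ.+ + length ws ℤ.* G) (ℤₚ.*-identityˡ G))))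
  magnitude : ∣ + length vs ℤ.* G ∣ ≡ length vs * ∣ G ∣
  magnitude = ℤₚ.abs-* (+ length vs) G
  decompose : + length vs ℤ.* G ≡ ℤΣ.∑ vs shifted ℤ.+ ℤΣ.∑ vs (λ v → G ℤ.- shifted v)
  decompose = trans (sym (repeat vs)) (trans (ℤΣ.∑-ext vs (λ v → split G (shifted v))) (ℤΣ.∑-+ vs shifted _))
    where
    split : ∀ a b → a ≡ b ℤ.+ (a ℤ.- b)
    split = ℤR.solve-∀
  errors : ∣ ℤΣ.∑ vs (λ v → G ℤ.- shifted v) ∣ ≤ length vs * (2 * (σ * L))
  errors = ≤-trans (∣∑∣≤∑∣∣ vs _) (∑-≤const vs (2 * (σ * L)) (λ v v∈ → ≤-trans (grid-shift f f≤1 L (s v)) (*-monoʳ-≤ 2 (*-monoˡ-≤ L (s≤ v v∈)))))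
  constant≤ : (h : ℕ → ℕ) (c : ℕ) → (∀ x → h x ≤ c) → ∑ (upTo L) h ≤ L * c
  constant≤ h c h≤ = ≤-trans (∑-≤const (upTo L) c (λ x _ → h≤ x)) (≡⇒≤ (cong (_* c) (Listₚ.length-upTo L)))
  main : ∣ ℤΣ.∑ vs shifted ∣ * k ≤ L * (L * X)
  main = ≤-trans (*-monoˡ-≤ k (≤-trans (≡⇒≤ (cong ∣_∣ (trans (ℤΣ.∑-swap vs (upTo L) _) (ℤΣ.∑-ext (upTo L) (λ x → ℤΣ.∑-swap vs (upTo L) _)))))
      (≤-trans (∣∑∣≤∑∣∣ (upTo L) _) (∑-mono (upTo L) (λ x _ → ∣∑∣≤∑∣∣ (upTo L) (λ y → ℤΣ.∑ vs (λ v → f ((+ x , + y) ⊕₂ s v))))))))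
    (≤-trans (≡⇒≤ (sym (ℕΣ.∑-*ʳ k (upTo L) _))) (constant≤ _ (L * X) (λ x → ≤-trans (≡⇒≤ (sym (ℕΣ.∑-*ʳ k (upTo L) _))) (constant≤ _ X (λ y → sums (+ x , + y))))))

⊕₂-assoc : ∀ l u v → l ⊕₂ (u ⊕₂ v) ≡ (l ⊕₂ u) ⊕₂ v
⊕₂-assoc (l₁ , l₂) (u₁ , u₂) (v₁ , v₂) = cong₂ _,_ (sym (ℤₚ.+-assoc l₁ u₁ v₁)) (sym (ℤₚ.+-assoc l₂ u₂ v₂))

-- The box starts at (1 , 1) so that y ≠ 0; otherwise the plane spanned by (y , - x , 0) and (0 , 0
-- , 1) could degenerate.
𝟏𝟏 : Pair
𝟏𝟏 = 1ℤ , 1ℤ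

integer-root : ∀ k n → 1 ≤ k → Σ ℕ (λ z → z ^ k ≤ n × n < suc z ^ k)
integer-root (suc k) zero    _ = 0 , z≤n , m^n>0 1 (suc k)
integer-root (suc k) (suc n) _ with integer-root (suc k) n (s≤s z≤n)
... | z , lo , hi with suc n <? suc z ^ suc k
...   | yes lt = z , ≤-trans lo (n≤1+n n) , lt
...   | no ge  = suc z , ≮⇒≥ ge , ≤-<-trans hi (^-monoˡ-< (suc k) (n<1+n (suc z)))

-- From character sums to a common square value

module CharacterSums (D : Form) where
  open Global D
  open Classes D

  charSum : ℕ → List GP → ℤ
  charSum L ds = gridSum L (λ l → character ds (𝟏𝟏 ⊕₂ l))

  -- Shifting by multiples of the other primes leaves a complete sum modulo p.
  small-modulus : ∀ g ds L → Distinct (g ∷ ds) → ∣ charSum L (g ∷ ds) ∣ ≤ 4 * modulus (g ∷ ds) * L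
  small-modulus g ds L (g∉ ∷ u) = *-cancelˡ-≤ N {{>-nonZero 1≤N}} (≤-trans (≡⇒≤ (cong (N *_) (sym (*-identityʳ ∣ charSum L (g ∷ ds) ∣)))) (≤-trans (average vs (λ v → + e ·₂ v) (2 * (p * e)) size f f≤1 L 1 0 (λ l → ≡⇒≤ (cong (λ i → ∣ i ∣ * 1) (complete l))))
      (≡⇒≤ (trans (cong (_+ N * (2 * (2 * (p * e) * L) * 1)) (trans (cong (L *_) (*-zeroʳ L)) (*-zeroʳ L))) (cong (N *_) (identity (p * e) L))))))
    where
    module P = Local (locally g)
    p e : ℕ
    p = proj₁ g
    e = modulus ds
    vs : List Pair
    vs = cart P.residues P.residues
    N : ℕ
    N = length vs
    1≤N : 1 ≤ N
    1≤N = ≤-trans (*-mono-≤ (1≤p g) (1≤p g)) (≡⇒≤ (sym (trans (length-cart _,_ P.residues P.residues) (cong (λ n → n * n) P.∣residues∣))))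
    identity : ∀ d L → 2 * (2 * d * L) * 1 ≡ 4 * d * L
    identity = ℕR.solve-∀
    f : Pair → ℤ
    f l = character (g ∷ ds) (𝟏𝟏 ⊕₂ l)
    f≤1 : ∀ l → ∣ f l ∣ ≤ 1
    f≤1 l = ∣character∣≤1 (g ∷ ds) (𝟏𝟏 ⊕₂ l)
    size : ∀ v → v ∈ vs → norm₁ (+ e ·₂ v) ≤ 2 * (p * e)
    size v v∈ with ∈ₚ.∈-cartesianProduct⁻ P.residues P.residues v∈
    ... | a , b = ≤-trans (+-mono-≤ (one (proj₁ v) a) (one (proj₂ v) b)) (≡⇒≤ (cong (λ t → p * e + t) (sym (+-identityʳ (p * e)))))
      where
      one : ∀ i → i ∈ P.residues → ∣ + e ℤ.* i ∣ ≤ p * e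
      one i i∈ = ≤-trans (≡⇒≤ (trans (ℤₚ.abs-* (+ e) i) (*-comm e ∣ i ∣))) (*-monoˡ-≤ e (P.residue≤ i i∈))
    p∤e : ¬ p ∣ᶻ + e
    p∤e dv = ∤-product (map proj₁ ds) (prime-of g) g∉ (Allₚ.map⁺ (All.tabulate (λ {h} _ → prime-of h))) (subst (p ∣_) (sym (product-primes ds)) dv)
    divides-e : ∀ hs h → h ∈ hs → proj₁ h ∣ modulus hs
    divides-e (h ∷ hs) h (here refl) = ∣ₚ.m∣m*n (modulus hs)
    divides-e (k ∷ hs) h (there h∈) = ∣ₚ.∣n⇒∣m*n (proj₁ k) (divides-e hs h h∈)
    complete : ∀ l → ℤΣ.∑ vs (λ v → f (l ⊕₂ + e ·₂ v)) ≡ 0ℤ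
    complete l = begin
      ℤΣ.∑ vs (λ v → f (l ⊕₂ + e ·₂ v))
        ≡⟨ ℤΣ.∑-ext vs (λ v → trans (cong (character (g ∷ ds)) (⊕₂-assoc 𝟏𝟏 l (+ e ·₂ v))) (cong (P.chr (evalForm D (l′ ⊕₂ + e ·₂ v)) ℤ.*_) (fixed v))) ⟩
      ℤΣ.∑ vs (λ v → P.chr (evalForm D (l′ ⊕₂ + e ·₂ v)) ℤ.* character ds l′)
        ≡⟨ ℤΣ.∑-*ʳ (character ds l′) vs _ ⟩
      ℤΣ.∑ vs (λ v → P.chr (evalForm D (l′ ⊕₂ + e ·₂ v))) ℤ.* character ds l′
        ≡⟨ cong (ℤ._* character ds l′) (trans (ℤΣ.∑-cart P.residues P.residues _) (P.zero-sum l′ (+ e) p∤e)) ⟩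
      0ℤ ℤ.* character ds l′
        ≡⟨ ℤₚ.*-zeroˡ (character ds l′) ⟩
      0ℤ ∎
      where
      open ≡-Reasoning
      l′ = 𝟏𝟏 ⊕₂ l
      fixed : ∀ v → character ds (l′ ⊕₂ + e ·₂ v) ≡ character ds l′
      fixed v = ℤΣ.∏-cong ds (λ h h∈ → Local.periodic (locally h) l′ (+ e) v (divides-e ds h h∈))

  -- Of the total 2 L² one half goes to the line sums and the other to the boundary terms, the
  -- shifts u + t b having size at most 4 A B.
  large-modulus : ∀ ds B A L W → 1 ≤ A → 1 ≤ length (linesOf B) → (∀ l₀ → ∑ (linesOf B) (lineSumOf D ds A l₀) * (2 * W) ≤ A * length (linesOf B)) → 16 * (A * B) * W ≤ L →
                  ∣ charSum L ds ∣ * W ≤ L * L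
  large-modulus ds B A L W 1≤A 1≤n lines≤ wide = *-cancelˡ-≤ 2 (≤-trans (≡⇒≤ (swap 2 ∣ charSum L ds ∣ W)) (*-cancelˡ-≤ N {{>-nonZero 1≤N}} (≤-trans averaged
      (≤-trans (≡⇒≤ (cong (λ n → L * (L * n) + N * (2 * (4 * (A * B) * L) * (2 * W))) An≡N)) (≤-trans (≡⇒≤ (expand L N (A * B) W)) (≤-trans (+-monoʳ-≤ (N * (L * L)) (*-monoʳ-≤ (N * L) wide)) (≡⇒≤ (finish L N))))))))
    where
    vs : List (((ℕ × ℕ) × (ℕ × ℕ)) × ℕ)
    vs = cart (linesOf B) (upTo A)
    N : ℕ
    N = length vs
    An≡N : A * length (linesOf B) ≡ N
    An≡N = sym (trans (length-cart _,_ (linesOf B) (upTo A)) (trans (cong (length (linesOf B) *_) (Listₚ.length-upTo A)) (*-comm (length (linesOf B)) A)))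
    1≤N : 1 ≤ N
    1≤N = ≤-trans (*-mono-≤ 1≤A 1≤n) (≡⇒≤ An≡N)
    swap : ∀ k a w → k * (a * w) ≡ a * (k * w)
    swap = ℕR.solve-∀
    expand : ∀ L N x W → L * (L * N) + N * (2 * (4 * x * L) * (2 * W)) ≡ N * (L * L) + N * L * (16 * x * W)
    expand = ℕR.solve-∀
    finish : ∀ L N → N * (L * L) + N * L * L ≡ N * (2 * (L * L))
    finish = ℕR.solve-∀
    f : Pair → ℤ
    f l = character ds (𝟏𝟏 ⊕₂ l)
    s : ((ℕ × ℕ) × (ℕ × ℕ)) × ℕ → Pair
    s ((u , b) , t) = natPair u ⊕₂ + t ·₂ vec b
    size : ∀ v → v ∈ vs → norm₁ (s v) ≤ 4 * (A * B)
    size ((u , b) , t) v∈ with ∈ₚ.∈-cartesianProduct⁻ (linesOf B) (upTo A) v∈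
    ... | ub∈ , t∈ with ∈ₚ.∈-cartesianProduct⁻ (cart (upTo B) (upTo B)) (directions B) ub∈
    ...   | u∈ , b∈ with ∈ₚ.∈-cartesianProduct⁻ (upTo B) (upTo B) u∈
    ...     | u₁∈ , u₂∈ = ≤-trans (+-mono-≤ (one (proj₁ u) (proj₁ b) u₁∈ (proj₁ b≤)) (one (proj₂ u) (proj₂ b) u₂∈ (proj₂ b≤))) (≡⇒≤ (identity (A * B)))
      where
      b≤ : proj₁ b ≤ B × proj₂ b ≤ B
      b≤ = let module I = IsDirection (∈-directions {B} b∈) in I.b₁≤ , I.b₂≤
      identity : ∀ x → x + x + (x + x) ≡ 4 * x
      identity = ℕR.solve-∀
      one : ∀ x c → x ∈ upTo B → c ≤ B → ∣ + x ℤ.+ + t ℤ.* + c ∣ ≤ A * B + A * B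
      one x c x∈ c≤ = ≤-trans (ℤₚ.∣i+j∣≤∣i∣+∣j∣ (+ x) (+ t ℤ.* + c)) (+-mono-≤ (≤-trans (<⇒≤ (∈ₚ.∈-upTo⁻ x∈)) (m≤n*m B A {{>-nonZero 1≤A}}))
        (≤-trans (≡⇒≤ (ℤₚ.abs-* (+ t) (+ c))) (*-mono-≤ (<⇒≤ (∈ₚ.∈-upTo⁻ t∈)) c≤)))
    sums : ∀ l → ∣ ℤΣ.∑ vs (λ v → f (l ⊕₂ s v)) ∣ * (2 * W) ≤ A * length (linesOf B)
    sums l = ≤-trans (*-monoˡ-≤ (2 * W) (≤-trans (≡⇒≤ (cong ∣_∣ (ℤΣ.∑-cart (linesOf B) (upTo A) _))) (≤-trans (∣∑∣≤∑∣∣ (linesOf B) _)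
      (∑-mono (linesOf B) (λ { (u , b) _ → ≡⇒≤ (cong ∣_∣ (ℤΣ.∑-ext (upTo A) (λ t → cong (character ds) (trans (⊕₂-assoc 𝟏𝟏 l _) (⊕₂-assoc (𝟏𝟏 ⊕₂ l) (natPair u) (+ t ·₂ vec b)))))) }))))) (lines≤ (𝟏𝟏 ⊕₂ l))
    averaged : N * (∣ charSum L ds ∣ * (2 * W)) ≤ L * (L * (A * length (linesOf B))) + N * (2 * (4 * (A * B) * L) * (2 * W))
    averaged = average vs s (4 * (A * B)) size f (λ l → ∣character∣≤1 ds (𝟏𝟏 ⊕₂ l)) L (2 * W) (A * length (linesOf B)) sums

  nonempty : List GP → List (List GP)
  nonempty []       = []
  nonempty (g ∷ gs) = (g ∷ []) ∷ nonempty gs ++ map (g ∷_) (nonempty gs)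

  suc-length-nonempty : ∀ gs → suc (length (nonempty gs)) ≡ 2 ^ length gs
  suc-length-nonempty []       = refl
  suc-length-nonempty (g ∷ gs) = trans (cong (_+_ 2) (trans (Listₚ.length-++ (nonempty gs)) (cong (_+_ (length (nonempty gs))) (Listₚ.length-map (g ∷_) (nonempty gs)))))
    (trans (identity (length (nonempty gs))) (cong (2 *_) (suc-length-nonempty gs)))
    where
    identity : ∀ n → 2 + (n + n) ≡ 2 * suc n
    identity = ℕR.solve-∀

  expand-∏ : ∀ gs (f : GP → ℤ) → ℤΣ.∏ gs (λ g → 1ℤ ℤ.+ f g) ≡ 1ℤ ℤ.+ ℤΣ.∑ (nonempty gs) (λ ds → ℤΣ.∏ ds f)
  expand-∏ []       f = refl
  expand-∏ (g ∷ gs) f = trans (cong ((1ℤ ℤ.+ f g) ℤ.*_) (expand-∏ gs f)) (trans (distribute (f g) N) (cong (λ t → 1ℤ ℤ.+ (f g ℤ.* 1ℤ ℤ.+ t))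
    (sym (trans (ℤΣ.∑-++ (nonempty gs) _ _) (cong (λ t → N ℤ.+ t) (trans (ℤΣ.∑-map (g ∷_) (nonempty gs) _) (ℤΣ.∑-*ˡ (f g) (nonempty gs) _)))))))
    where
    N = ℤΣ.∑ (nonempty gs) (λ ds → ℤΣ.∏ ds f)
    distribute : ∀ a N → (1ℤ ℤ.+ a) ℤ.* (1ℤ ℤ.+ N) ≡ 1ℤ ℤ.+ (a ℤ.* 1ℤ ℤ.+ (N ℤ.+ a ℤ.* N))
    distribute = ℤR.solve-∀

  record Part (gs ds : List GP) : Set where
    field
      first     : GP
      others    : List GP
      shape     : ds ≡ first ∷ others
      distinct  : Distinct ds
      modulus≤  : modulus ds ≤ modulus gs
      length≤   : length ds ≤ length gs
      within    : ∀ p → p ∈ map proj₁ ds → p ∈ map proj₁ gs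

  ∈-nonempty : ∀ {gs ds} → Distinct gs → ds ∈ nonempty gs → Part gs ds
  ∈-nonempty {g ∷ gs} (g∉ ∷ u) (here refl) = record
    { first = g ; others = [] ; shape = refl ; distinct = [] ∷ [] ; modulus≤ = *-monoʳ-≤ (proj₁ g) (1≤modulus gs) ; length≤ = s≤s z≤n ; within = λ { p (here e) → here e } }
  ∈-nonempty {g ∷ gs} (g∉ ∷ u) (there ds∈) with ∈ₚ.∈-++⁻ (nonempty gs) ds∈
  ... | inj₁ ds∈′ = record
    { first = P.first ; others = P.others ; shape = P.shape ; distinct = P.distinct ; modulus≤ = ≤-trans P.modulus≤ (m≤n*m (modulus gs) (proj₁ g) {{>-nonZero (1≤p g)}}) ; length≤ = ≤-trans P.length≤ (n≤1+n _) ; within = λ p p∈ → there (P.within p p∈) }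
    where module P = Part (∈-nonempty u ds∈′)
  ... | inj₂ ds∈′ with ∈ₚ.∈-map⁻ (g ∷_) ds∈′
  ...   | es , es∈ , refl = record
    { first = g ; others = es ; shape = refl ; distinct = All.tabulate (λ {p} p∈ → All.lookup g∉ (P.within p p∈)) ∷ P.distinct ; modulus≤ = *-monoʳ-≤ (proj₁ g) P.modulus≤ ; length≤ = s≤s P.length≤
    ; within = λ { p (here e) → here e ; p (there p∈) → there (P.within p p∈) } }
    where module P = Part (∈-nonempty u es∈)

  Unobstructed : List GP → Pair → Set
  Unobstructed gs l = All (λ g → Local.chr (locally g) (evalForm D l) ≢ ℤ.-1ℤ) gs

  -- ∏ (1 + χ_p(D)) vanishes at every obstructed point. If it vanished throughout the box, L² would
  -- be cancelled by the sums over the nonempty subsets of the primes; but these number only 2^ω -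
  -- 1, each with a sum of at most L²/2^ω.
  exists-unobstructed : ∀ gs L → 1 ≤ L → (∀ ds → ds ∈ nonempty gs → ∣ charSum L ds ∣ * 2 ^ length gs ≤ L * L) →
                        Σ (ℕ × ℕ) (λ u → u ∈ cart (upTo L) (upTo L) × Unobstructed gs (𝟏𝟏 ⊕₂ natPair u))
  exists-unobstructed gs L 1≤L small with Any.any? (λ u → All.all? (λ g → ¬? (Local.chr (locally g) (evalForm D (𝟏𝟏 ⊕₂ natPair u)) ℤ.≟ ℤ.-1ℤ)) gs) (cart (upTo L) (upTo L))
  ... | yes some = find some
  ... | no none = ⊥-elim (<⇒≱ strict bound)
    where
    F : Pair → ℤ
    F l = ℤΣ.∏ gs (λ g → 1ℤ ℤ.+ Local.chr (locally g) (evalForm D (𝟏𝟏 ⊕₂ l)))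
    vanishing : ∀ gs (f : GP → ℤ) → ¬ All (λ g → f g ≢ ℤ.-1ℤ) gs → ℤΣ.∏ gs (λ g → 1ℤ ℤ.+ f g) ≡ 0ℤ
    vanishing []       f no-all = ⊥-elim (no-all [])
    vanishing (g ∷ gs) f no-all with f g ℤ.≟ ℤ.-1ℤ
    ... | yes e = trans (cong (λ t → (1ℤ ℤ.+ t) ℤ.* ℤΣ.∏ gs (λ g → 1ℤ ℤ.+ f g)) e) (ℤₚ.*-zeroˡ (ℤΣ.∏ gs (λ g → 1ℤ ℤ.+ f g)))
    ... | no ne = trans (cong ((1ℤ ℤ.+ f g) ℤ.*_) (vanishing gs f (λ all → no-all (ne ∷ all)))) (ℤₚ.*-zeroʳ (1ℤ ℤ.+ f g))
    total : gridSum L F ≡ 0ℤ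
    total = trans (ℤΣ.∑-cong (upTo L) (λ x x∈ → trans (ℤΣ.∑-cong (upTo L) (λ y y∈ → vanishing gs (λ g → Local.chr (locally g) (evalForm D (𝟏𝟏 ⊕₂ (+ x , + y))))
      (λ all → none (lose (∈ₚ.∈-cartesianProduct⁺ x∈ y∈) all)))) (ℤΣ.∑-0 (upTo L)))) (ℤΣ.∑-0 (upTo L))
    ones : ∀ n → ℤΣ.∑ (upTo n) (λ _ → 1ℤ) ≡ + n
    ones n = trans (sym (pos-∑ (upTo n) (λ _ → 1))) (cong +_ (trans (∑-const (upTo n) 1) (trans (*-identityʳ _) (Listₚ.length-upTo n))))
    expanded : gridSum L F ≡ + (L * L) ℤ.+ ℤΣ.∑ (nonempty gs) (charSum L)
    expanded = trans (ℤΣ.∑-ext (upTo L) (λ x → trans (ℤΣ.∑-ext (upTo L) (λ y → expand-∏ gs (λ g → Local.chr (locally g) (evalForm D (𝟏𝟏 ⊕₂ (+ x , + y)))))) (ℤΣ.∑-+ (upTo L) _ _)))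
      (trans (ℤΣ.∑-+ (upTo L) _ _) (cong₂ ℤ._+_ (trans (ℤΣ.∑-ext (upTo L) (λ _ → ones L)) constant)
        (trans (ℤΣ.∑-ext (upTo L) (λ x → ℤΣ.∑-swap (upTo L) (nonempty gs) _)) (ℤΣ.∑-swap (upTo L) (nonempty gs) _))))
      where
      constant : ℤΣ.∑ (upTo L) (λ _ → + L) ≡ + (L * L)
      constant = trans (sym (pos-∑ (upTo L) (λ _ → L))) (cong +_ (trans (∑-const (upTo L) L) (cong (_* L) (Listₚ.length-upTo L))))
    opposite : ∀ i j → i ℤ.+ j ≡ 0ℤ → ∣ i ∣ ≡ ∣ j ∣
    opposite i j e = trans (cong ∣_∣ (trans (undo i j) (trans (cong (λ t → t ℤ.- j) e) (ℤₚ.+-identityˡ (ℤ.- j))))) (ℤₚ.∣-i∣≡∣i∣ j)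
      where
      undo : ∀ i j → i ≡ (i ℤ.+ j) ℤ.- j
      undo = ℤR.solve-∀
    W = 2 ^ length gs
    bound : W * (L * L) ≤ length (nonempty gs) * (L * L)
    bound = ≤-trans (≡⇒≤ (trans (*-comm W (L * L)) (cong (_* W) (opposite (+ (L * L)) (ℤΣ.∑ (nonempty gs) (charSum L)) (trans (sym expanded) total))))) (≤-trans (*-monoˡ-≤ W (∣∑∣≤∑∣∣ (nonempty gs) (charSum L)))
      (≤-trans (≡⇒≤ (sym (ℕΣ.∑-*ʳ W (nonempty gs) _))) (∑-≤const (nonempty gs) (L * L) small)))
    strict : length (nonempty gs) * (L * L) < W * (L * L)
    strict = *-monoˡ-< (L * L) {{>-nonZero (*-mono-≤ 1≤L 1≤L)}} (≡⇒≤ (suc-length-nonempty gs))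

-- With N = c^(2 M), `^-length≤` gives c^(2 M ω) ≤ N^N times the product, which is below (2 y)^M. So
-- (k c^ω)^(2 M) is at most a constant times y^M, and y₀ turns that constant into another y^M.
omega-small : ∀ k c M → 1 ≤ c → 1 ≤ M → Σ ℕ (λ y₀ → ∀ y ps → y₀ ≤ y → Unique ps → (∀ p → p ∈ ps → 1 ≤ p) → product ps < suc y ^ M → 1 ≤ y → k * c ^ length ps ≤ y)
omega-small k c M 1≤c 1≤M = y₀ , bound
  where
  N y₀ : ℕ
  N  = c ^ (2 * M)
  y₀ = k ^ (2 * M) * (N ^ N * 2 ^ M)
  bound : ∀ y ps → y₀ ≤ y → Unique ps → (∀ p → p ∈ ps → 1 ≤ p) → product ps < suc y ^ M → 1 ≤ y → k * c ^ length ps ≤ y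
  bound y ps y₀≤y u pos lt 1≤y = ^-cancelˡ-≤ (2 * M) (k * c ^ length ps) y (≤-trans 1≤M (m≤m+n M _)) (begin
    (k * c ^ length ps) ^ (2 * M) ≡⟨ ^-distrib-* (2 * M) k (c ^ length ps) ⟩
    k ^ (2 * M) * (c ^ length ps) ^ (2 * M) ≡⟨ cong (k ^ (2 * M) *_) (trans (^-*-assoc c (length ps) (2 * M)) (trans (cong (c ^_) (*-comm (length ps) (2 * M))) (sym (^-*-assoc c (2 * M) (length ps))))) ⟩
    k ^ (2 * M) * N ^ length ps ≤⟨ *-monoʳ-≤ (k ^ (2 * M)) (^-length≤ N ps (m^n>0 c {{>-nonZero 1≤c}} (2 * M)) u pos) ⟩
    k ^ (2 * M) * (N ^ N * product ps) ≤⟨ *-monoʳ-≤ (k ^ (2 * M)) (*-monoʳ-≤ (N ^ N) (≤-trans (<⇒≤ lt) (≤-trans (^-monoˡ-≤ M doubled) (≡⇒≤ (^-distrib-* M 2 y))))) ⟩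
    k ^ (2 * M) * (N ^ N * (2 ^ M * y ^ M)) ≡⟨ regroup (k ^ (2 * M)) (N ^ N) (2 ^ M) (y ^ M) ⟩
    y₀ * y ^ M ≤⟨ *-monoˡ-≤ (y ^ M) (≤-trans y₀≤y (≤-trans (≡⇒≤ (sym (*-identityʳ y))) (^-monoʳ-≤ y {{>-nonZero 1≤y}} 1≤M))) ⟩
    y ^ M * y ^ M ≡⟨ ^-double y M ⟨
    y ^ (2 * M) ∎)
    where
    open ≤-Reasoning
    doubled : suc y ≤ 2 * y
    doubled = ≤-trans (+-monoˡ-≤ y 1≤y) (≡⇒≤ (cong (_+_ y) (sym (+-identityʳ y))))
    regroup : ∀ a b c d → a * (b * (c * d)) ≡ a * (b * c) * d
    regroup = ℕR.solve-∀

-- The fourth power is due to z, which is only known to satisfy y < (z + 1)⁴ and yet has to exceed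
-- such a quantity.
omega-small⁴ : ∀ k a c M → 1 ≤ c → 1 ≤ M → Σ ℕ (λ y₀ → ∀ y ps → y₀ ≤ y → Unique ps → (∀ p → p ∈ ps → 1 ≤ p) → product ps < suc y ^ M → 1 ≤ y → k * (a * c ^ length ps) ^ 4 ≤ y)
omega-small⁴ k a c M 1≤c 1≤M = proj₁ base , λ y ps y₀≤y u pos lt 1≤y → ≤-trans (≡⇒≤ (trans (cong (k *_) (trans (^-distrib-* 4 a (c ^ length ps)) (cong (a ^ 4 *_)
    (trans (^-*-assoc c (length ps) 4) (trans (cong (c ^_) (*-comm (length ps) 4)) (sym (^-*-assoc c 4 (length ps)))))))) (sym (*-assoc k (a ^ 4) ((c ^ 4) ^ length ps))))) (proj₂ base y ps y₀≤y u pos lt 1≤y)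
  where
  base = omega-small (k * a ^ 4) (c ^ 4) M (m^n>0 c {{>-nonZero 1≤c}} 4) 1≤M

module Existence (μ : ℕ) (7≤μ : 7 ≤ μ) where
  open Parameters μ 7≤μ

  -- A common upper bound for K C′^Ω, 4 Cτ and 2^Ω, the quantities that the parameters of Burgess's
  -- method have to dominate.
  Threshold : ℕ → ℕ
  Threshold Ω = (K + 4 * Cτ + 1) * (2 + C′) ^ Ω

  K≤Threshold : ∀ Ω → K * C′ ^ Ω ≤ Threshold Ω
  K≤Threshold Ω = *-mono-≤ (≤-trans (m≤m+n K (4 * Cτ)) (m≤m+n _ 1)) (^-monoˡ-≤ Ω (m≤n+m C′ 2))

  1≤power : ∀ Ω → 1 ≤ (2 + C′) ^ Ω
  1≤power Ω = m^n>0 (2 + C′) Ω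

  τ≤Threshold : ∀ Ω → 4 * Cτ ≤ Threshold Ω
  τ≤Threshold Ω = ≤-trans (≡⇒≤ (sym (*-identityʳ (4 * Cτ)))) (*-mono-≤ (≤-trans (m≤n+m (4 * Cτ) K) (m≤m+n _ 1)) (1≤power Ω))

  2≤Threshold : ∀ Ω → 2 ^ Ω ≤ Threshold Ω
  2≤Threshold Ω = ≤-trans (≡⇒≤ (sym (*-identityˡ (2 ^ Ω)))) (*-mono-≤ (m≤n+m 1 (K + 4 * Cτ)) (^-monoˡ-≤ Ω (m≤m+n 2 C′)))

  module _ (D : Form) (gs : List (GoodPrime D)) (distinct : Global.Distinct D gs) (q y : ℕ) (gs≤q : Global.modulus D gs ≤ q) (q< : q < suc y ^ M)
           (y-large : 16 * Threshold (length gs) ^ 4 ≤ y) where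
    open Global D
    open Classes D
    open CharacterSums D

    Ω W L : ℕ
    Ω = length gs
    W = 2 ^ Ω
    -- The shifts have size z B = z^(2 + μ) ≤ y^(2 + μ), and one more y absorbs 16 · 2^Ω; L is thus
    -- q^(1/4) up to a bounded power of y.
    L = y ^ (3 + μ)

    16W≤y : 16 * W ≤ y
    16W≤y = ≤-trans (*-monoʳ-≤ 16 (≤-trans (2≤Threshold Ω) (≤-trans (≡⇒≤ (sym (*-identityʳ (Threshold Ω)))) (^-monoʳ-≤ (Threshold Ω) {{>-nonZero (≤-trans (m^n>0 2 Ω) (2≤Threshold Ω))}} (s≤s {0} {3} z≤n))))) y-large

    1≤y : 1 ≤ y
    1≤y = ≤-trans (*-mono-≤ {1} {16} (s≤s z≤n) (m^n>0 2 Ω)) 16W≤y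

    instance
      y≢0 : NonZero y
      y≢0 = >-nonZero 1≤y

    -- Let z be the integer part of d^(1/M). If (z + 1)⁴ ≤ y then d ≤ y^μ, well below L, and
    -- complete sums suffice. Otherwise z is at least y^(1/4)/2, large enough for Burgess's method.
    sum≤ : ∀ ds → ds ∈ nonempty gs → ∣ charSum L ds ∣ * W ≤ L * L
    sum≤ ds ds∈ = by-size (integer-root M (modulus ds) 1≤M)
      where
      module P = Part (∈-nonempty distinct ds∈)
      1≤M : 1 ≤ M
      1≤M = ≤-trans (s≤s z≤n) (*-mono-≤ {1} {4} (s≤s z≤n) 7≤μ)
      by-size : Σ ℕ (λ z → z ^ M ≤ modulus ds × modulus ds < suc z ^ M) → ∣ charSum L ds ∣ * W ≤ L * L
      by-size (z , lo , hi) with suc z ^ 4 ≤? y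
      ... | yes tiny = ≤-trans (*-monoˡ-≤ W (subst (λ es → ∣ charSum L es ∣ ≤ 4 * modulus es * L) (sym P.shape) (small-modulus P.first P.others L (subst Distinct P.shape P.distinct))))
          (≤-trans (≡⇒≤ (swap (modulus ds) L W)) (*-monoʳ-≤ L (≤-trans (*-mono-≤ 4W≤ d≤) (≡⇒≤ (sym (^-distribˡ-+-* y 3 μ))))))
        where
        swap : ∀ d L W → 4 * d * L * W ≡ L * (4 * W * d)
        swap = ℕR.solve-∀
        4W≤ : 4 * W ≤ y ^ 3
        4W≤ = ≤-trans (*-monoˡ-≤ W (m≤m+n 4 12)) (≤-trans 16W≤y (≤-trans (≡⇒≤ (sym (*-identityʳ y))) (^-monoʳ-≤ y (s≤s {0} {2} z≤n))))
        d≤ : modulus ds ≤ y ^ μ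
        d≤ = ≤-trans (<⇒≤ hi) (≤-trans (≡⇒≤ (sym (^-*-assoc (suc z) 4 μ))) (^-monoˡ-≤ μ tiny))
      ... | no huge = large-modulus ds (z ^ suc μ) z L W 1≤z 1≤lines (LargeModulus.burgess-bound D ds P.distinct z Ω lo (≤-trans (<⇒≤ hi) (^-monoˡ-≤ M doubled)) P.length≤ (≤-trans (K≤Threshold Ω) X≤z) (≤-trans (τ≤Threshold Ω) X≤z)) wide
        where
        y<  : y < suc z ^ 4
        y< = ≰⇒> huge
        positive : ∀ z → y < suc z ^ 4 → 1 ≤ z
        positive zero    lt = ⊥-elim (<⇒≱ lt 1≤y)
        positive (suc z) _  = s≤s z≤n
        1≤z : 1 ≤ z
        1≤z = positive z y<
        doubled : suc z ≤ 2 * z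
        doubled = ≤-trans (+-monoˡ-≤ z 1≤z) (≡⇒≤ (cong (_+_ z) (sym (+-identityʳ z))))
        X≤z : Threshold Ω ≤ z
        X≤z = ^-cancelˡ-≤ 4 (Threshold Ω) z (s≤s z≤n) (*-cancelˡ-≤ 16 (≤-trans y-large (≤-trans (<⇒≤ y<) (≤-trans (^-monoˡ-≤ 4 doubled) (≡⇒≤ (^-distrib-* 4 2 z))))))
        z≤y : z ≤ y
        z≤y with z ≤? y
        ... | yes le = le
        ... | no z≰y = ⊥-elim (<⇒≱ (≤-<-trans (≤-trans lo (≤-trans P.modulus≤ gs≤q)) q<) (^-monoˡ-≤ M (≰⇒> z≰y)))
        1≤lines : 1 ≤ length (linesOf (z ^ suc μ))
        1≤lines = nonzero (length (linesOf (z ^ suc μ))) (≤-trans (*-mono-≤ (*-mono-≤ 1≤B 1≤B) (*-mono-≤ 1≤B 1≤B)) (length-linesOf≥ (z ^ suc μ)))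
          where
          1≤B : 1 ≤ z ^ suc μ
          1≤B = m^n>0 z {{>-nonZero 1≤z}} (suc μ)
          nonzero : ∀ n → 1 ≤ 8 * n → 1 ≤ n
          nonzero zero    ()
          nonzero (suc n) _ = s≤s z≤n
        wide : 16 * (z * z ^ suc μ) * W ≤ L
        wide = ≤-trans (≡⇒≤ (swap (z * z ^ suc μ) W)) (*-mono-≤ 16W≤y (^-monoˡ-≤ (2 + μ) z≤y))
          where
          swap : ∀ x W → 16 * x * W ≡ 16 * W * x
          swap = ℕR.solve-∀

    exists-square-value : Σ (ℕ × ℕ) (λ u → u ∈ cart (upTo L) (upTo L) × Unobstructed gs (𝟏𝟏 ⊕₂ natPair u))
    exists-square-value = exists-unobstructed gs L (m^n>0 y (3 + μ)) sum≤

  abstract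
    threshold : Σ ℕ (λ y₀ → ∀ y ps → y₀ ≤ y → Unique ps → (∀ p → p ∈ ps → 1 ≤ p) → product ps < suc y ^ M → 1 ≤ y → 16 * Threshold (length ps) ^ 4 ≤ y)
    threshold = omega-small⁴ 16 (K + 4 * Cτ + 1) (2 + C′) M (s≤s z≤n) (≤-trans (s≤s z≤n) (*-mono-≤ {1} {4} (s≤s z≤n) 7≤μ))

-- Short vectors

-- The discriminant of the restriction of Q to the plane spanned by (y , − x , 0) and (0 , 0 , 1), as a quadratic form in (x , y).
descent : TernaryForm → Form
descent (form a b c d e f) = f ℤ.* f ℤ.- + 4 ℤ.* (b ℤ.* c) , + 4 ℤ.* (c ℤ.* d) ℤ.- + 2 ℤ.* (e ℤ.* f) , e ℤ.* e ℤ.- + 4 ℤ.* (a ℤ.* c)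

leading : TernaryForm → ℤ
leading = TernaryForm.c

-- The identity behind the special treatment of the primes dividing c: among the primes of q, D
-- degenerates modulo exactly these.
disc-descent : ∀ Q → disc (descent Q) ≡ -[1+ 7 ] ℤ.* (leading Q ℤ.* det2M Q)
disc-descent (form a b c d e f) = identity a b c d e f
  where
  identity : ∀ a b c d e f →
    (+ 4 ℤ.* (c ℤ.* d) ℤ.- + 2 ℤ.* (e ℤ.* f)) ℤ.* (+ 4 ℤ.* (c ℤ.* d) ℤ.- + 2 ℤ.* (e ℤ.* f)) ℤ.- + 4 ℤ.* ((f ℤ.* f ℤ.- + 4 ℤ.* (b ℤ.* c)) ℤ.* (e ℤ.* e ℤ.- + 4 ℤ.* (a ℤ.* c))) ≡
    -[1+ 7 ] ℤ.* (c ℤ.* (+ 8 ℤ.* a ℤ.* b ℤ.* c ℤ.+ + 2 ℤ.* d ℤ.* e ℤ.* f ℤ.- + 2 ℤ.* a ℤ.* f ℤ.* f ℤ.- + 2 ℤ.* b ℤ.* e ℤ.* e ℤ.- + 2 ℤ.* c ℤ.* d ℤ.* d))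
  identity = ℤR.solve-∀

slice : Pair → ℤ → ℤ → Pt
slice (x , y) s r = pt (s ℤ.* y) (ℤ.- (s ℤ.* x)) r

∣-+ᶻ : ∀ p i j → p ∣ᶻ i → p ∣ᶻ j → p ∣ᶻ i ℤ.+ j
∣-+ᶻ p i j p∣i p∣j = subst (λ k → p ∣ᶻ k) (undo i j) (∣ᶻ-minus i (ℤ.- j) p∣i (subst (p ∣_) (sym (ℤₚ.∣-i∣≡∣i∣ j)) p∣j))
  where
  undo : ∀ i j → i ℤ.- ℤ.- j ≡ i ℤ.+ j
  undo = ℤR.solve-∀

∣-*ᶻ : ∀ p i j → p ∣ᶻ j → p ∣ᶻ i ℤ.* j
∣-*ᶻ p i j p∣j = subst (p ∣_) (sym (ℤₚ.abs-* i j)) (∣ₚ.∣n⇒∣m*n ∣ i ∣ p∣j)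

odd-prime∤2 : ∀ p → Prime p → Odd p → ¬ p ∣ 2
odd-prime∤2 p pp odd p∣2 with Primality.prime⇒irreducible Primality.prime[2] p∣2
... | inj₁ p≡1 = nonTrivial⇒≢1 {{prime⇒nonTrivial pp}} p≡1
... | inj₂ p≡2 = odd (∣ₚ.∣-reflexive (sym p≡2))

odd-prime∤4 : ∀ p → Prime p → Odd p → ¬ p ∣ 4
odd-prime∤4 p pp odd p∣4 = [ odd-prime∤2 p pp odd , odd-prime∤2 p pp odd ]′ (euclidsLemma 2 2 pp p∣4)

descent-nondegenerate : ∀ Q p → Prime p → Odd p → ¬ p ∣ᶻ det2M Q → ¬ p ∣ᶻ leading Q → ¬ p ∣ᶻ disc (descent Q)
descent-nondegenerate Q p pp odd ∤det ∤c p∣ = [ ∤8 , (λ p∣cd → [ ∤c , ∤det ]′ (euclidsLemma ∣ leading Q ∣ ∣ det2M Q ∣ pp (subst (p ∣_) (ℤₚ.abs-* (leading Q) (det2M Q)) p∣cd))) ]′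
    (euclidsLemma 8 ∣ leading Q ℤ.* det2M Q ∣ pp (subst (p ∣_) (trans (cong ∣_∣ (disc-descent Q)) (ℤₚ.abs-* -[1+ 7 ] (leading Q ℤ.* det2M Q))) p∣))
  where
  ∤8 : ¬ p ∣ 8
  ∤8 p∣8 = [ odd-prime∤2 p pp odd , odd-prime∤4 p pp odd ]′ (euclidsLemma 2 4 pp p∣8)

-- 4 c Q(s y , − s x , r) = (2 c r + s (e y − f x))² − s² D(x , y), so a root of D(x , y) modulo p splits off a linear factor.
linear-factor : ∀ Q l p → Prime p → Odd p → (p ∣ᶻ leading Q) ⊎ (¬ p ∣ᶻ leading Q × Σ ℤ (λ ρ → p ∣ᶻ ρ ℤ.* ρ ℤ.- evalForm (descent Q) l)) →
                Σ (ℤ × ℤ) (λ c → ∀ s r → p ∣ᶻ proj₁ c ℤ.* s ℤ.+ proj₂ c ℤ.* r → p ∣ᶻ eval Q (slice l s r))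
-- Modulo p the term c r² drops out, so s splits off and the cofactor A s + E r is linear.
linear-factor (form a b c d e f) (x , y) p pp odd (inj₁ p∣c) = (A , E) , λ s r p∣ → subst (λ i → p ∣ᶻ i) (sym (split a b c d e f x y s r))
    (∣-+ᶻ p (s ℤ.* (A ℤ.* s ℤ.+ E ℤ.* r)) (r ℤ.* r ℤ.* c) (∣-*ᶻ p s (A ℤ.* s ℤ.+ E ℤ.* r) p∣) (∣-*ᶻ p (r ℤ.* r) c p∣c))
  where
  A E : ℤ
  A = a ℤ.* y ℤ.* y ℤ.+ b ℤ.* x ℤ.* x ℤ.- d ℤ.* x ℤ.* y
  E = e ℤ.* y ℤ.- f ℤ.* x
  split : ∀ a b c d e f x y s r →
    a ℤ.* (s ℤ.* y) ℤ.* (s ℤ.* y) ℤ.+ b ℤ.* (ℤ.- (s ℤ.* x)) ℤ.* (ℤ.- (s ℤ.* x)) ℤ.+ c ℤ.* r ℤ.* r ℤ.+ d ℤ.* (s ℤ.* y) ℤ.* (ℤ.- (s ℤ.* x)) ℤ.+ e ℤ.* (s ℤ.* y) ℤ.* r ℤ.+ f ℤ.* (ℤ.- (s ℤ.* x)) ℤ.* r ≡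
    s ℤ.* ((a ℤ.* y ℤ.* y ℤ.+ b ℤ.* x ℤ.* x ℤ.- d ℤ.* x ℤ.* y) ℤ.* s ℤ.+ (e ℤ.* y ℤ.- f ℤ.* x) ℤ.* r) ℤ.+ r ℤ.* r ℤ.* c
  split = ℤR.solve-∀
linear-factor Q@(form a b c d e f) (x , y) p pp odd (inj₂ (p∤c , ρ , p∣ρ)) = (E ℤ.- ρ , + 2 ℤ.* c) , λ s r p∣ → remove-4c s r (subst (λ i → p ∣ᶻ i) (sym (complete-square a b c d e f x y s r ρ))
    (∣-+ᶻ p (h s r ℤ.* (h s r ℤ.+ + 2 ℤ.* (s ℤ.* ρ))) (s ℤ.* s ℤ.* (ρ ℤ.* ρ ℤ.- evalForm (descent Q) (x , y)))
      (subst (λ i → p ∣ᶻ i) (ℤₚ.*-comm (h s r ℤ.+ + 2 ℤ.* (s ℤ.* ρ)) (h s r)) (∣-*ᶻ p (h s r ℤ.+ + 2 ℤ.* (s ℤ.* ρ)) (h s r) p∣)) (∣-*ᶻ p (s ℤ.* s) _ p∣ρ)))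
  where
  E : ℤ
  E = e ℤ.* y ℤ.- f ℤ.* x
  h : ℤ → ℤ → ℤ
  h s r = (E ℤ.- ρ) ℤ.* s ℤ.+ + 2 ℤ.* c ℤ.* r
  remove-4c : ∀ s r → p ∣ᶻ + 4 ℤ.* (c ℤ.* eval Q (slice (x , y) s r)) → p ∣ᶻ eval Q (slice (x , y) s r)
  remove-4c s r p∣ with euclidsLemma 4 ∣ c ℤ.* v ∣ pp (subst (p ∣_) (ℤₚ.abs-* (+ 4) (c ℤ.* v)) p∣)
    where v = eval Q (slice (x , y) s r)
  ... | inj₁ p∣4  = ⊥-elim (odd-prime∤4 p pp odd p∣4)
  ... | inj₂ p∣cv with euclidsLemma ∣ c ∣ _ pp (subst (p ∣_) (ℤₚ.abs-* c (eval Q (slice (x , y) s r))) p∣cv)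
  ...   | inj₁ p∣c = ⊥-elim (p∤c p∣c)
  ...   | inj₂ p∣v = p∣v
  complete-square : ∀ a b c d e f x y s r ρ →
    + 4 ℤ.* (c ℤ.* (a ℤ.* (s ℤ.* y) ℤ.* (s ℤ.* y) ℤ.+ b ℤ.* (ℤ.- (s ℤ.* x)) ℤ.* (ℤ.- (s ℤ.* x)) ℤ.+ c ℤ.* r ℤ.* r ℤ.+ d ℤ.* (s ℤ.* y) ℤ.* (ℤ.- (s ℤ.* x)) ℤ.+ e ℤ.* (s ℤ.* y) ℤ.* r ℤ.+ f ℤ.* (ℤ.- (s ℤ.* x)) ℤ.* r)) ≡
    ((e ℤ.* y ℤ.- f ℤ.* x ℤ.- ρ) ℤ.* s ℤ.+ + 2 ℤ.* c ℤ.* r) ℤ.* (((e ℤ.* y ℤ.- f ℤ.* x ℤ.- ρ) ℤ.* s ℤ.+ + 2 ℤ.* c ℤ.* r) ℤ.+ + 2 ℤ.* (s ℤ.* ρ)) ℤ.+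
    s ℤ.* s ℤ.* (ρ ℤ.* ρ ℤ.- ((f ℤ.* f ℤ.- + 4 ℤ.* (b ℤ.* c)) ℤ.* (x ℤ.* x) ℤ.+ (+ 4 ℤ.* (c ℤ.* d) ℤ.- + 2 ℤ.* (e ℤ.* f)) ℤ.* (x ℤ.* y) ℤ.+ (e ℤ.* e ℤ.- + 4 ℤ.* (a ℤ.* c)) ℤ.* (y ℤ.* y)))
  complete-square = ℤR.solve-∀

module Pigeonhole (F : ℤ → ℤ → ℤ) where

  -- A single linear congruence modulo p that forces F ≡ 0. One factor of the split form is enough,
  -- so the residues take only p values and not p².
  Linear : ℕ → Set
  Linear p = NonZero p × Σ (ℤ × ℤ) (λ c → ∀ s r → p ∣ᶻ proj₁ c ℤ.* s ℤ.+ proj₂ c ℤ.* r → p ∣ᶻ F s r)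

  residue : ∀ p → Linear p → ℕ × ℕ → ℕ
  residue p (nz , (λ₁ , λ₂) , _) (s , r) = ((λ₁ ℤ.* + s ℤ.+ λ₂ ℤ.* + r) ℤDM.%ℕ p) {{nz}}

  code : ∀ {ps} → All Linear ps → ℕ × ℕ → List ℕ
  code {[]}     []       v = []
  code {p ∷ ps} (l ∷ ls) v = residue p l v ∷ code ls v

  tuples : List ℕ → List (List ℕ)
  tuples []       = [] ∷ []
  tuples (p ∷ ps) = cartWith _∷_ (upTo p) (tuples ps)

  length-tuples : ∀ ps → length (tuples ps) ≡ product ps
  length-tuples []       = refl
  length-tuples (p ∷ ps) = trans (length-cart _∷_ (upTo p) (tuples ps)) (cong₂ _*_ (Listₚ.length-upTo p) (length-tuples ps))

  code∈tuples : ∀ {ps} (ls : All Linear ps) v → code ls v ∈ tuples ps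
  code∈tuples {[]}     []                  v = here refl
  code∈tuples {p ∷ ps} (l@(nz , c , _) ∷ ls) v = ∈ₚ.∈-cartesianProductWith⁺ _∷_ (∈ₚ.∈-upTo⁺ (ℤDM.n%ℕd<d (proj₁ c ℤ.* + proj₁ v ℤ.+ proj₂ c ℤ.* + proj₂ v) p {{nz}})) (code∈tuples ls v)

  same-residue : ∀ i j p .{{_ : NonZero p}} → i ℤDM.%ℕ p ≡ j ℤDM.%ℕ p → p ∣ᶻ i ℤ.- j
  same-residue i j p eq = ≡⇒∣ᶻ (i ℤ.- j) (i ℤDM./ℕ p ℤ.- j ℤDM./ℕ p) (trans (cong₂ ℤ._-_ (ℤDM.a≡a%ℕn+[a/ℕn]*n i p) (ℤDM.a≡a%ℕn+[a/ℕn]*n j p))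
    (trans (cong (λ t → (+ t ℤ.+ i ℤDM./ℕ p ℤ.* + p) ℤ.- (+ (j ℤDM.%ℕ p) ℤ.+ j ℤDM./ℕ p ℤ.* + p)) eq) (cancel (+ (j ℤDM.%ℕ p)) (i ℤDM./ℕ p) (j ℤDM./ℕ p) (+ p))))
    where
    cancel : ∀ t a b p → (t ℤ.+ a ℤ.* p) ℤ.- (t ℤ.+ b ℤ.* p) ≡ (a ℤ.- b) ℤ.* p
    cancel = ℤR.solve-∀

  solved : ∀ {ps} (ls : All Linear ps) v w → code ls v ≡ code ls w → All (λ p → p ∣ᶻ F (+ proj₁ v ℤ.- + proj₁ w) (+ proj₂ v ℤ.- + proj₂ w)) ps
  solved {[]}     []       v w eq = []
  solved {p ∷ ps} ((nz , (λ₁ , λ₂) , linear) ∷ ls) (s , r) (s′ , r′) eq =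
    linear (+ s ℤ.- + s′) (+ r ℤ.- + r′) (subst (λ i → p ∣ᶻ i) (difference-of λ₁ λ₂ (+ s) (+ r) (+ s′) (+ r′))
      (same-residue (λ₁ ℤ.* + s ℤ.+ λ₂ ℤ.* + r) (λ₁ ℤ.* + s′ ℤ.+ λ₂ ℤ.* + r′) p {{nz}} (Listₚ.∷-injectiveˡ eq))) ∷ solved ls (s , r) (s′ , r′) (Listₚ.∷-injectiveʳ eq)
    where
    difference-of : ∀ a b s r s′ r′ → (a ℤ.* s ℤ.+ b ℤ.* r) ℤ.- (a ℤ.* s′ ℤ.+ b ℤ.* r′) ≡ a ℤ.* (s ℤ.- s′) ℤ.+ b ℤ.* (r ℤ.- r′)
    difference-of = ℤR.solve-∀

  -- More points in the S × R grid than residue vectors: two points agree, and the congruences are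
  -- linear, so their difference is a solution.
  short-solution : ∀ {ps} S R → All Linear ps → product ps < S * R →
                   Σ ℤ (λ s → Σ ℤ (λ r → ¬ (s ≡ 0ℤ × r ≡ 0ℤ) × ∣ s ∣ ≤ S × ∣ r ∣ ≤ R × All (λ p → p ∣ᶻ F s r) ps))
  short-solution {ps} S R ls lt with Any.any? collision? (cart grid grid)
    where
    grid = cart (upTo S) (upTo R)
    _≟₂_ : DecidableEquality (ℕ × ℕ)
    _≟₂_ = ×ₚ.≡-dec _≟_ _≟_
    collision? : ∀ (v : (ℕ × ℕ) × (ℕ × ℕ)) → Dec (code ls (proj₁ v) ≡ code ls (proj₂ v) × ¬ proj₁ v ≡ proj₂ v)
    collision? (v , w) = Listₚ.≡-dec _≟_ (code ls v) (code ls w) ×? ¬? (v ≟₂ w)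
  ... | no none = ⊥-elim (<⇒≱ lt (≤-trans (≡⇒≤ (sym (trans (length-cart _,_ (upTo S) (upTo R)) (cong₂ _*_ (Listₚ.length-upTo S) (Listₚ.length-upTo R)))))
      (≤-trans (injective⇒length≤ {ys = tuples ps} (code ls) (Uniqueₚ.cartesianProduct⁺ (Uniqueₚ.upTo⁺ S) (Uniqueₚ.upTo⁺ R)) injective (λ {v} _ → code∈tuples ls v)) (≡⇒≤ (length-tuples ps)))))
    where
    injective : ∀ {v w} → v ∈ cart (upTo S) (upTo R) → w ∈ cart (upTo S) (upTo R) → code ls v ≡ code ls w → v ≡ w
    injective {v} {w} v∈ w∈ eq with ×ₚ.≡-dec _≟_ _≟_ v w
    ... | yes e = e
    ... | no ne = ⊥-elim (none (lose (∈ₚ.∈-cartesianProduct⁺ v∈ w∈) (eq , ne)))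
  ... | yes some with find some
  ...   | (v , w) , vw∈ , eq , ne with ∈ₚ.∈-cartesianProduct⁻ (cart (upTo S) (upTo R)) (cart (upTo S) (upTo R)) vw∈
  ...     | v∈ , w∈ with ∈ₚ.∈-cartesianProduct⁻ (upTo S) (upTo R) v∈ | ∈ₚ.∈-cartesianProduct⁻ (upTo S) (upTo R) w∈
  ...       | a , b | a′ , b′ = + proj₁ v ℤ.- + proj₁ w , + proj₂ v ℤ.- + proj₂ w ,
    (λ { (e₁ , e₂) → ne (cong₂ _,_ (ℤₚ.+-injective (-≡0⇒≡ (+ proj₁ v) (+ proj₁ w) e₁)) (ℤₚ.+-injective (-≡0⇒≡ (+ proj₂ v) (+ proj₂ w) e₂))) }) ,
    near (proj₁ v) (proj₁ w) S (∈ₚ.∈-upTo⁻ a) (∈ₚ.∈-upTo⁻ a′) , near (proj₂ v) (proj₂ w) R (∈ₚ.∈-upTo⁻ b) (∈ₚ.∈-upTo⁻ b′) , solved ls v w eq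
    where
    near : ∀ m n N → m < N → n < N → ∣ + m ℤ.- + n ∣ ≤ N
    near m n N m< n< = ≤-trans (≡⇒≤ (cong ∣_∣ (ℤₚ.m-n≡m⊖n m n))) (∣⊖∣≤ m n N (≤-trans (<⇒≤ m<) (m≤n+m N n)) (≤-trans (<⇒≤ n<) (m≤n+m N m)))

module GoodPrimes (D : Form) (c : ℤ) where
  open Global D
  open Classes D
  open CharacterSums D

  Admissible : ℕ → Set
  Admissible p = Prime p × Odd p × (¬ p ∣ᶻ c → ¬ p ∣ᶻ disc D)

  -- Modulo a prime dividing c the restricted form factors for every (x , y), so only the other
  -- primes enter the character sums; `solvable` reunites both kinds.
  good-primes : ∀ {ps} → All Admissible ps → List GP
  good-primes {[]} [] = []
  good-primes {p ∷ ps} ((pp , odd , nd) ∷ as) with p ∣? ∣ c ∣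
  ... | yes _  = good-primes as
  ... | no p∤c = (p , pp , odd , nd p∤c) ∷ good-primes as

  good-primes⊆ : ∀ {ps} (as : All Admissible ps) {p} → p ∈ map proj₁ (good-primes as) → p ∈ ps
  good-primes⊆ {p ∷ ps} ((pp , odd , nd) ∷ as) p∈ with p ∣? ∣ c ∣
  good-primes⊆ {p ∷ ps} ((pp , odd , nd) ∷ as) p∈         | yes _ = there (good-primes⊆ as p∈)
  good-primes⊆ {p ∷ ps} ((pp , odd , nd) ∷ as) (here e)   | no _  = here e
  good-primes⊆ {p ∷ ps} ((pp , odd , nd) ∷ as) (there p∈) | no _  = there (good-primes⊆ as p∈)

  good-primes-distinct : ∀ {ps} (as : All Admissible ps) → Unique ps → Distinct (good-primes as)
  good-primes-distinct {[]} [] u = []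
  good-primes-distinct {p ∷ ps} ((pp , odd , nd) ∷ as) (p∉ ∷ u) with p ∣? ∣ c ∣
  ... | yes _ = good-primes-distinct as u
  ... | no _  = All.tabulate (λ r∈ → All.lookup p∉ (good-primes⊆ as r∈)) ∷ good-primes-distinct as u

  good-primes-modulus : ∀ {ps} (as : All Admissible ps) → modulus (good-primes as) ≤ product ps
  good-primes-modulus {[]} [] = ≤-refl
  good-primes-modulus {p ∷ ps} ((pp , odd , nd) ∷ as) with p ∣? ∣ c ∣
  ... | yes _ = ≤-trans (good-primes-modulus as) (m≤n*m (product ps) p {{prime⇒nonZero pp}})
  ... | no _  = *-monoʳ-≤ p (good-primes-modulus as)

  solvable : ∀ {ps} (as : All Admissible ps) l → Unobstructed (good-primes as) l →
             All (λ p → (p ∣ᶻ c) ⊎ (¬ p ∣ᶻ c × Σ ℤ (λ ρ → p ∣ᶻ ρ ℤ.* ρ ℤ.- evalForm D l))) ps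
  solvable {[]} [] l un = []
  solvable {p ∷ ps} ((pp , odd , nd) ∷ as) l un with p ∣? ∣ c ∣
  solvable {p ∷ ps} ((pp , odd , nd) ∷ as) l un       | yes p∣c = inj₁ p∣c ∷ solvable as l un
  solvable {p ∷ ps} ((pp , odd , nd) ∷ as) l (x ∷ un) | no p∤c  = inj₂ (p∤c , Local.chr-root (locally (p , pp , odd , nd p∤c)) (evalForm D l) x) ∷ solvable as l un

prime-factors : ∀ q → Odd q → SquareFree q → Σ (List ℕ) (λ ps → product ps ≡ q × Unique ps × All (λ p → Prime p × Odd p × p ∣ q) ps)
prime-factors zero odd sf = ⊥-elim (odd (2 ∣ₚ.∣0))
prime-factors q@(suc _) odd sf = ps , sym isFactorisation , distinct ps (λ p p² → sf p (subst (p * p ∣_) (sym isFactorisation) p²)) factorsPrime , All.zipWith id (factorsPrime , All.tabulate oddness)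
  where
  open PrimeFactorisation (factorise q) renaming (factors to ps)
  dividing : ∀ ps {p} → p ∈ ps → p ∣ product ps
  dividing (r ∷ ps) (here refl) = ∣ₚ.m∣m*n (product ps)
  dividing (r ∷ ps) (there p∈)  = ∣ₚ.∣n⇒∣m*n r (dividing ps p∈)
  oddness : ∀ {p} → p ∈ ps → Odd p × p ∣ q
  oddness {p} p∈ = (λ 2∣p → odd (∣ₚ.∣-trans 2∣p p∣q)) , p∣q
    where
    p∣q : p ∣ q
    p∣q = subst (p ∣_) (sym isFactorisation) (dividing ps p∈)
  distinct : ∀ ps → (∀ p → p * p ∣ product ps → p ≡ 1) → All Prime ps → Unique ps
  distinct []       sf _          = []
  distinct (p ∷ ps) sf (pp ∷ pr) = All.tabulate fresh ∷ distinct ps (λ r r² → sf r (∣ₚ.∣n⇒∣m*n p r²)) pr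
    where
    fresh : ∀ {r} → r ∈ ps → p ≢ r
    fresh r∈ refl = nonTrivial⇒≢1 {{prime⇒nonTrivial pp}} (sf p (∣ₚ.*-monoʳ-∣ p (dividing ps r∈)))

slice-nonzero : ∀ x y s r → y ≢ 0ℤ → ¬ (s ≡ 0ℤ × r ≡ 0ℤ) → NonZeroPt (slice (x , y) s r)
slice-nonzero x y s r y≢0 nontrivial (sy≡0 , _ , r≡0) with s ℤ.≟ 0ℤ
... | yes s≡0 = nontrivial (s≡0 , r≡0)
... | no s≢0  = y≢0 (integralᶻ s y sy≡0 s≢0)

module ShortVector (κ μ : ℕ) (μ≡ : μ ≡ 1 + 2 * κ) (7≤μ : 7 ≤ μ) where

  N : ℕ
  N = 2 * (5 * κ + 4)

  open Existence μ 7≤μ using (exists-square-value; Threshold; threshold)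
  open Parameters μ 7≤μ using (M)

  short-vector : ∀ q y Q → Odd q → SquareFree q → gcd ∣ det2M Q ∣ q ≡ 1 → q < suc y ^ M → proj₁ threshold ≤ y → 1 ≤ y →
                 Σ Pt (λ v → NonZeroPt v × ZeroMod Q q v × normSq v ≤ 3 * suc y ^ N)
  short-vector q y Q odd sf cop q< large 1≤y = slice l s r , nonzero , zero-mod , size
    where
    D : Form
    D = descent Q
    open GoodPrimes D (leading Q)
    open Global D using (modulus)
    factorisation = prime-factors q odd sf
    ps : List ℕ
    ps = proj₁ factorisation
    product≡ : product ps ≡ q
    product≡ = proj₁ (proj₂ factorisation)
    unique-ps : Unique ps
    unique-ps = proj₁ (proj₂ (proj₂ factorisation))
    facts : All (λ p → Prime p × Odd p × p ∣ q) ps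
    facts = proj₂ (proj₂ (proj₂ factorisation))
    admissible : All Admissible ps
    admissible = All.map (λ { {p} (pp , o , p∣q) → pp , o , descent-nondegenerate Q p pp o (λ p∣det → nonTrivial⇒≢1 {{prime⇒nonTrivial pp}} (∣ₚ.∣1⇒≡1 (subst (p ∣_) cop (gcd-greatest p∣det p∣q)))) }) facts
    gs : List (GoodPrime D)
    gs = good-primes admissible
    modulus≤q : modulus gs ≤ q
    modulus≤q = ≤-trans (good-primes-modulus admissible) (≡⇒≤ product≡)
    y-large : 16 * Threshold (length gs) ^ 4 ≤ y
    y-large = subst (λ n → 16 * Threshold n ^ 4 ≤ y) (Listₚ.length-map proj₁ gs) (proj₂ threshold y (map proj₁ gs) large (good-primes-distinct admissible unique-ps)
      (λ p p∈ → let pp , _ = All.lookup facts (good-primes⊆ admissible p∈) in >-nonZero⁻¹ p {{prime⇒nonZero pp}}) (≤-<-trans (≤-trans (≡⇒≤ (Classes.product-primes D gs)) modulus≤q) q<) 1≤y)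
    value = exists-square-value D gs (good-primes-distinct admissible unique-ps) q y modulus≤q q< y-large
    u : ℕ × ℕ
    u = proj₁ value
    l : Pair
    l = 𝟏𝟏 ⊕₂ natPair u
    open Pigeonhole (λ s r → eval Q (slice l s r))
    linear : All Linear ps
    linear = All.zipWith (λ { {p} ((pp , o , _) , sol) → prime⇒nonZero pp , linear-factor Q l p pp o sol }) (facts , solvable admissible l (proj₂ (proj₂ value)))
    Y S R L : ℕ
    Y = suc y
    -- M = 8 κ + 4 is split as 3 κ + (5 κ + 4), that is, q^(3/8) and q^(5/8). The extra 4 goes to R
    -- because L has exponent 3 + μ = 2 κ + 4, and S L must stay below R.
    S = Y ^ (3 * κ)
    R = Y ^ (5 * κ + 4)
    L = y ^ (3 + μ)
    SR≡ : S * R ≡ Y ^ M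
    SR≡ = trans (sym (^-distribˡ-+-* Y (3 * κ) (5 * κ + 4))) (cong (Y ^_) (trans (identity κ) (cong (4 *_) (sym μ≡))))
      where
      identity : ∀ κ → 3 * κ + (5 * κ + 4) ≡ 4 * (1 + 2 * κ)
      identity = ℕR.solve-∀
    solution = short-solution S R linear (≤-trans (s≤s (≡⇒≤ product≡)) (≤-trans q< (≡⇒≤ (sym SR≡))))
    s r : ℤ
    s = proj₁ solution
    r = proj₁ (proj₂ solution)
    nontrivial : ¬ (s ≡ 0ℤ × r ≡ 0ℤ)
    nontrivial = proj₁ (proj₂ (proj₂ solution))
    s≤ : ∣ s ∣ ≤ S
    s≤ = proj₁ (proj₂ (proj₂ (proj₂ solution)))
    r≤ : ∣ r ∣ ≤ R
    r≤ = proj₁ (proj₂ (proj₂ (proj₂ (proj₂ solution))))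
    divisible : All (λ p → p ∣ᶻ eval Q (slice l s r)) ps
    divisible = proj₂ (proj₂ (proj₂ (proj₂ (proj₂ solution))))
    zero-mod : ZeroMod Q q (slice l s r)
    zero-mod = subst (_∣ ∣ eval Q (slice l s r) ∣) product≡ (∣-prime-product ps unique-ps (All.map proj₁ facts) (λ p p∈ → All.lookup divisible p∈))
    nonzero : NonZeroPt (slice l s r)
    nonzero = slice-nonzero (+ suc (proj₁ u)) (+ suc (proj₂ u)) s r (λ ()) nontrivial
    coordinates : proj₁ u ∈ upTo L × proj₂ u ∈ upTo L
    coordinates = ∈ₚ.∈-cartesianProduct⁻ (upTo L) (upTo L) (proj₁ (proj₂ value))
    in-range : proj₁ u < L × proj₂ u < L
    in-range = ∈ₚ.∈-upTo⁻ (proj₁ coordinates) , ∈ₚ.∈-upTo⁻ (proj₂ coordinates)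
    SL≤R : S * L ≤ R
    SL≤R = ≤-trans (*-monoʳ-≤ S (^-monoˡ-≤ (3 + μ) (n≤1+n y))) (≡⇒≤ (trans (sym (^-distribˡ-+-* Y (3 * κ) (3 + μ))) (cong (Y ^_) (trans (cong (λ m → 3 * κ + (3 + m)) μ≡) (identity κ)))))
      where
      identity : ∀ κ → 3 * κ + (3 + (1 + 2 * κ)) ≡ 5 * κ + 4
      identity = ℕR.solve-∀
    scaled≤ : ∀ i → ∣ i ∣ ≤ L → ∣ s ℤ.* i ∣ ≤ R
    scaled≤ i i≤ = ≤-trans (∣i*j∣≤ s i s≤ i≤) SL≤R
    size : normSq (slice l s r) ≤ 3 * Y ^ N
    size = ≤-trans (+-mono-≤ (+-mono-≤ (square (scaled≤ (+ suc (proj₂ u)) (proj₂ in-range))) (square (≤-trans (≡⇒≤ (ℤₚ.∣-i∣≡∣i∣ (s ℤ.* + suc (proj₁ u)))) (scaled≤ (+ suc (proj₁ u)) (proj₁ in-range))))) (square r≤))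
      (≡⇒≤ (trans (three (R * R)) (cong (3 *_) (sym (^-double Y (5 * κ + 4))))))
      where
      square : ∀ {m} → m ≤ R → m * m ≤ R * R
      square le = *-mono-≤ le le
      three : ∀ x → x + x + x ≡ 3 * x
      three = ℕR.solve-∀

-- Small moduli and the final constants

trivial-bound : ∀ Q q C εn εd → 1 ≤ q → q ≤ C → MinBound Q q εn εd C
trivial-bound Q q C εn εd 1≤q q≤C = pt (+ q) 0ℤ 0ℤ , (λ { (q≡0 , _) → <⇒≢ 1≤q (sym (ℤₚ.+-injective q≡0)) }) , multiple Q , (begin
  (q * q + 0 + 0) ^ (4 * εd) ≡⟨ cong (_^ (4 * εd)) (trans (+-identityʳ _) (trans (+-identityʳ _) (cong (q *_) (sym (*-identityʳ q))))) ⟩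
  (q ^ 2) ^ (4 * εd) ≡⟨ trans (^-*-assoc q 2 (4 * εd)) (cong (q ^_) (eight εd)) ⟩
  q ^ (8 * εd) ≤⟨ ^-monoˡ-≤ (8 * εd) q≤C ⟩
  C ^ (8 * εd) ≤⟨ m≤m*n (C ^ (8 * εd)) (q ^ (5 * εd + 8 * εn)) {{>-nonZero (m^n>0 q {{>-nonZero 1≤q}} (5 * εd + 8 * εn))}} ⟩
  C ^ (8 * εd) * q ^ (5 * εd + 8 * εn) ∎)
  where
  open ≤-Reasoning
  eight : ∀ ε → 2 * (4 * ε) ≡ 8 * ε
  eight = ℕR.solve-∀
  multiple : ∀ Q → ZeroMod Q q (pt (+ q) 0ℤ 0ℤ)
  multiple (form a b c d e f) = ≡⇒∣ᶻ (eval (form a b c d e f) (pt (+ q) 0ℤ 0ℤ)) (a ℤ.* + q) (identity a b c d e f (+ q))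
    where
    identity : ∀ a b c d e f q → a ℤ.* q ℤ.* q ℤ.+ b ℤ.* 0ℤ ℤ.* 0ℤ ℤ.+ c ℤ.* 0ℤ ℤ.* 0ℤ ℤ.+ d ℤ.* q ℤ.* 0ℤ ℤ.+ e ℤ.* q ℤ.* 0ℤ ℤ.+ f ℤ.* 0ℤ ℤ.* 0ℤ ≡ a ℤ.* q ℤ.* q
    identity = ℤR.solve-∀

-- N · 4 εd exceeds M · 5 εd by exactly 12 εd; the term M · 8 εn, which is at least 64 κ εn, covers
-- this because εd ≤ κ and 1 ≤ εn.
norm-bound : ∀ κ M N C q y εn εd v → M ≡ 4 * (1 + 2 * κ) → N ≡ 2 * (5 * κ + 4) → 1 ≤ εn → εd ≤ κ → 1 ≤ y → 1 ≤ C → 3 * 2 ^ N ≤ C → y ^ M ≤ q → normSq v ≤ 3 * suc y ^ N → NormBound εn εd C q v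
norm-bound κ M N C q y εn εd v M≡ N≡ 1≤εn εd≤κ 1≤y 1≤C c≤C lo size = begin
  normSq v ^ (4 * εd) ≤⟨ ^-monoˡ-≤ (4 * εd) (≤-trans size (≤-trans (*-monoʳ-≤ 3 (^-monoˡ-≤ N doubled)) (≡⇒≤ (trans (cong (3 *_) (^-distrib-* N 2 y)) (sym (*-assoc 3 (2 ^ N) (y ^ N))))))) ⟩
  (3 * 2 ^ N * y ^ N) ^ (4 * εd) ≡⟨ trans (^-distrib-* (4 * εd) (3 * 2 ^ N) (y ^ N)) (cong ((3 * 2 ^ N) ^ (4 * εd) *_) (^-*-assoc y N (4 * εd))) ⟩
  (3 * 2 ^ N) ^ (4 * εd) * y ^ (N * (4 * εd)) ≤⟨ *-mono-≤ (≤-trans (^-monoˡ-≤ (4 * εd) c≤C) (^-monoʳ-≤ C {{>-nonZero 1≤C}} (*-monoˡ-≤ εd (m≤m+n 4 4)))) (^-monoʳ-≤ y {{>-nonZero 1≤y}} exponents) ⟩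
  C ^ (8 * εd) * y ^ (M * (5 * εd + 8 * εn)) ≡⟨ cong (C ^ (8 * εd) *_) (^-*-assoc y M (5 * εd + 8 * εn)) ⟨
  C ^ (8 * εd) * (y ^ M) ^ (5 * εd + 8 * εn) ≤⟨ *-monoʳ-≤ (C ^ (8 * εd)) (^-monoˡ-≤ (5 * εd + 8 * εn) lo) ⟩
  C ^ (8 * εd) * q ^ (5 * εd + 8 * εn) ∎
  where
  open ≤-Reasoning
  doubled : suc y ≤ 2 * y
  doubled = ≤-trans (+-monoˡ-≤ y 1≤y) (≡⇒≤ (cong (_+_ y) (sym (+-identityʳ y))))
  exponents : N * (4 * εd) ≤ M * (5 * εd + 8 * εn)
  exponents = ≤-trans (≡⇒≤ (trans (cong (_* (4 * εd)) N≡) (left κ εd))) (≤-trans (+-monoʳ-≤ (40 * (κ * εd) + 20 * εd) (≤-trans (*-mono-≤ (m≤m+n 12 52) (≤-trans εd≤κ (≤-trans (≡⇒≤ (sym (*-identityʳ κ))) (*-monoʳ-≤ κ 1≤εn)))) (m≤m+n _ (32 * εn))))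
    (≡⇒≤ (trans (right κ εd εn) (cong (_* (5 * εd + 8 * εn)) (sym M≡)))))
    where
    left : ∀ κ ε → 2 * (5 * κ + 4) * (4 * ε) ≡ 40 * (κ * ε) + 20 * ε + 12 * ε
    left = ℕR.solve-∀
    right : ∀ κ ε δ → 40 * (κ * ε) + 20 * ε + (64 * (κ * δ) + 32 * δ) ≡ 4 * (1 + 2 * κ) * (5 * ε + 8 * δ)
    right = ℕR.solve-∀

bound-from : ∀ κ M N y₀ εn εd → M ≡ 4 * (1 + 2 * κ) → N ≡ 2 * (5 * κ + 4) → 1 ≤ M → 1 ≤ εn → εd ≤ κ →
  (∀ q y Q → Odd q → SquareFree q → gcd ∣ det2M Q ∣ q ≡ 1 → q < suc y ^ M → y₀ ≤ y → 1 ≤ y → Σ Pt (λ v → NonZeroPt v × ZeroMod Q q v × normSq v ≤ 3 * suc y ^ N)) →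
  Σ ℕ (λ C → (q : ℕ) → Odd q → SquareFree q → (Q : TernaryForm) → gcd ∣ det2M Q ∣ q ≡ 1 → MinBound Q q εn εd C)
bound-from κ M N y₀ εn εd M≡ N≡ 1≤M 1≤εn εd≤κ short = C , λ q odd sf Q cop → by-root q odd sf Q cop (1≤odd q odd) (integer-root M q 1≤M)
  where
  C : ℕ
  -- The first term serves the moduli with integer root beyond y₀; the second exceeds every other q,
  -- for which (q , 0 , 0) is taken.
  C = 3 * 2 ^ N + suc y₀ ^ M
  1≤C : 1 ≤ C
  1≤C = ≤-trans (m^n>0 (suc y₀) M) (m≤n+m (suc y₀ ^ M) (3 * 2 ^ N))
  1≤odd : ∀ q → Odd q → 1 ≤ q
  1≤odd zero    odd = ⊥-elim (odd (2 ∣ₚ.∣0))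
  1≤odd (suc q) odd = s≤s z≤n
  by-root : ∀ q → Odd q → SquareFree q → (Q : TernaryForm) → gcd ∣ det2M Q ∣ q ≡ 1 → 1 ≤ q → Σ ℕ (λ y → y ^ M ≤ q × q < suc y ^ M) → MinBound Q q εn εd C
  by-root q odd sf Q cop 1≤q (y , lo , hi) = [ large , small ]′ (≤-<-connex (suc y₀) y)
    where
    small : y < suc y₀ → MinBound Q q εn εd C
    small y< = trivial-bound Q q C εn εd 1≤q (≤-trans (<⇒≤ hi) (≤-trans (^-monoˡ-≤ M y<) (m≤n+m (suc y₀ ^ M) (3 * 2 ^ N))))
    large : suc y₀ ≤ y → MinBound Q q εn εd C
    large y₀<y with short q y Q odd sf cop hi (<⇒≤ y₀<y) (≤-trans (s≤s z≤n) y₀<y)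
    ... | v , nonzero , zero-mod , size = v , nonzero , zero-mod , norm-bound κ M N C q y εn εd v M≡ N≡ 1≤εn εd≤κ (≤-trans (s≤s z≤n) y₀<y) 1≤C (m≤m+n (3 * 2 ^ N) (suc y₀ ^ M)) lo size

bound : ∀ κ μ → μ ≡ 1 + 2 * κ → 7 ≤ μ → (εn εd : ℕ) → 1 ≤ εn → εd ≤ κ →
        Σ ℕ (λ C → (q : ℕ) → Odd q → SquareFree q → (Q : TernaryForm) → gcd ∣ det2M Q ∣ q ≡ 1 → MinBound Q q εn εd C)
bound κ μ μ≡ 7≤μ εn εd 1≤εn εd≤κ = bound-from κ (4 * μ) (2 * (5 * κ + 4)) (proj₁ (Existence.threshold μ 7≤μ)) εn εd (cong (4 *_) μ≡) refl
  (≤-trans (s≤s z≤n) (*-mono-≤ {1} {4} (s≤s z≤n) 7≤μ)) 1≤εn εd≤κ (ShortVector.short-vector κ μ μ≡ 7≤μ)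

theorem1 : (εn εd : ℕ) → 1 ≤ εn → 1 ≤ εd →
    Σ ℕ (λ C → (q : ℕ) → Odd q → SquareFree q →
      (Q : TernaryForm) → gcd ∣ det2M Q ∣ q ≡ 1 →
      MinBound Q q εn εd C)
-- κ = 3 + εd yields both εd ≤ κ, needed for the exponents, and μ = 1 + 2 κ ≥ 7.
theorem1 εn εd 1≤εn 1≤εd = bound (3 + εd) (1 + 2 * (3 + εd)) refl (s≤s (*-monoʳ-≤ 2 (m≤m+n 3 εd))) εn εd 1≤εn (m≤n+m εd 3)
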